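{- For the online all-server spanner problem with uniform lengths, i.e. the online pairwise spanner problem with $\ell(e)=1$ for all $e\in E$ under the promise that for every arriving terminal pair $(s_i,t_i)$ the edge $s_i\to t_i$ belongs to $E$, there is a randomized polynomial-time online algorithm with competitive ratio $\tilde{O}(n^{2/3})$.
   Context: Online pairwise spanner problem: a directed simple graph $G=(V,E)$ with $n=|V|$ vertices and edge lengths $\ell:E\to\mathbb{R}_{\ge 0}$ is known in advance. Terminal pairs $(s_i,t_i)\in V\times V$ together with target distances $d_i$ (with $d_G(s_i,t_i)\le d_i$) arrive one at a time in rounds $i=1,2,\dots,k$, where $k$ is not known in advance. The algorithm maintains an edge set $E'\subseteq E$, initially empty; in round $i$ it must irrevocably add edges of $E$ to $E'$ so that in $H=(V,E')$ the length of a shortest $s_i\leadsto t_i$ path is at most $d_i$ (edges are never removed). The cost is $|E'|$. $\mathsf{OPT}$ denotes the minimum $|F|$ over $F\subseteq E$ such that $(V,F)$ satisfies the distance requirements of all arrived pairs. An algorithm has competitive ratio $c$ if at all times its cost is at most $c\cdot\mathsf{OPT}$ (for randomized algorithms: the maintained solution is feasible and has cost at most $c\cdot\mathsf{OPT}$ with high probability). $\tilde{O}(\cdot)$ hides factors polylogarithmic in $n$. Polynomial time means polynomial in the input size per round. -}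

module Defs where

open import Data.Bool.Base using (Bool; true; false; not; if_then_else_; _∧_)
open import Data.Fin.Base using (Fin; toℕ; fromℕ<; combine; remQuot)
open import Data.Fin.Subset using (Subset; _∈_; _∉_; _⊆_; _∩_; _∪_; ∣_∣; ⊥)
open import Data.Integer.Base using () renaming (∣_∣ to abs)
open import Data.List.Base using (List; []; _∷_; length; map; tails)
open import Data.List.Membership.Propositional using () renaming (_∉_ to _∉ᴸ_)
open import Data.List.Relation.Unary.All using (All)
open import Data.Nat.Base using (ℕ; zero; suc; _+_; _*_; _∸_; _^_; _≤_; _≡ᵇ_)
open import Data.Nat.ListAction using (sum)
open import Data.Nat.Logarithm using (⌈log₂_⌉)
open import Data.Nat.Properties using (_<?_)
open import Data.Product.Base using (Σ; ∃; ∃-syntax; _×_; _,_; proj₁; proj₂)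
open import Data.Rational.Base as ℚ using (ℚ; 0ℚ; 1ℚ; ↥_; ↧ₙ_)
open import Data.Vec.Base as Vec using (Vec; lookup)
open import Relation.Binary.Construct.Closure.ReflexiveTransitive using (Star; ε; _◅_)
open import Relation.Binary.PropositionalEquality using (_≡_; _≢_)
open import Relation.Nullary using (yes; no)

------------------------------------------------------------------------
-- Directed graphs and distances

-- The ordered pair (u , v) is the element combine u v of Fin (n * n).
EdgeSet : ℕ → Set
EdgeSet n = Subset (n * n)

_⟶_∈_ : ∀ {n} → Fin n → Fin n → EdgeSet n → Set
u ⟶ v ∈ F = combine u v ∈ F

record Digraph (n : ℕ) : Set where
  field
    edges    : EdgeSet n
    loopless : (v : Fin n) → combine v v ∉ edges

open Digraph public

Lengths : ℕ → Set
Lengths n = Fin n → Fin n → ℚ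

uniform : ∀ {n} → Lengths n
uniform _ _ = 1ℚ

Walk : ∀ {n} → EdgeSet n → Fin n → Fin n → Set
Walk F = Star (λ u v → u ⟶ v ∈ F)

walkLength : ∀ {n} (ℓ : Lengths n) {F : EdgeSet n} {s t : Fin n} → Walk F s t → ℚ
walkLength ℓ ε = 0ℚ
walkLength ℓ (_◅_ {i = u} {j = v} _ p) = ℓ u v ℚ.+ walkLength ℓ p

-- The distance from s to t in (V , F) is at most d.  For nonnegative lengths
-- it makes no difference whether walks or simple paths are used.
Dist≤ : ∀ {n} → Lengths n → EdgeSet n → Fin n → Fin n → ℚ → Set
Dist≤ ℓ F s t d = Σ (Walk F s t) λ p → walkLength ℓ p ℚ.≤ d

------------------------------------------------------------------------
-- Pairwise spanners

record Request (n : ℕ) : Set where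
  constructor request
  field
    source target : Fin n
    bound         : ℚ

open Request public

Satisfies : ∀ {n} → Lengths n → EdgeSet n → Request n → Set
Satisfies ℓ F r = Dist≤ ℓ F (source r) (target r) (bound r)

Feasible : ∀ {n} → Lengths n → EdgeSet n → List (Request n) → Set
Feasible ℓ F = All (Satisfies ℓ F)

record IsOPT {n} (ℓ : Lengths n) (G : Digraph n) (rs : List (Request n)) (opt : ℕ) : Set where
  field
    attained : ∃[ F ] F ⊆ edges G × Feasible ℓ F rs × ∣ F ∣ ≡ opt
    minimal  : ∀ F → F ⊆ edges G → Feasible ℓ F rs → opt ≤ ∣ F ∣

AllServer : ∀ {n} → Digraph n → Request n → Set
AllServer G r = source r ⟶ target r ∈ edges G

-- A request that may arrive in the all-server problem with uniform lengths.
Legal : ∀ {n} → Digraph n → Request n → Set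
Legal G r = Satisfies uniform (edges G) r × AllServer G r

------------------------------------------------------------------------
-- Randomized random access machines
--
-- Memory consists of two-dimensional arrays of natural numbers, named by
-- natural numbers and indirectly addressed.  Every command costs one step.
-- Since addition and truncated subtraction are the only arithmetic
-- operations (there is no multiplication), the bit length of the stored
-- numbers grows by O(1) per step of a fixed program: polynomial time agrees
-- with polynomial time on Turing machines.

Memory : Set
Memory = ℕ → ℕ → ℕ → ℕ

infixl 6 _⊕_ _⊖_
infix  9 _[_][_]

data Expr : Set where
  lit     : ℕ → Expr
  _[_][_]  : ℕ → Expr → Expr → Expr
  _⊕_ _⊖_ : Expr → Expr → Expr

eval : Memory → Expr → ℕ
eval m (lit k)       = k
eval m (a [ e ][ e′ ]) = m a (eval m e) (eval m e′)
eval m (e ⊕ e′)      = eval m e + eval m e′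
eval m (e ⊖ e′)      = eval m e ∸ eval m e′

infix  5 _[_][_]≔_ _[_][_]≔coin
infixr 4 _⨾_

data Cmd : Set where
  skip         : Cmd
  _[_][_]≔_     : ℕ → Expr → Expr → Expr → Cmd
  _[_][_]≔coin  : ℕ → Expr → Expr → Cmd
  _⨾_          : Cmd → Cmd → Cmd
  branch       : Expr → Cmd → Cmd → Cmd
  while        : Expr → Cmd → Cmd

write : Memory → ℕ → ℕ → ℕ → ℕ → Memory
write m a i j x a′ i′ j′ =
  if (a ≡ᵇ a′) ∧ (i ≡ᵇ i′) ∧ (j ≡ᵇ j′) then x else m a′ i′ j′

Coins : Set
Coins = ℕ → Bool

bit : Bool → ℕ
bit b = if b then 1 else 0

record State : Set where
  constructor state
  field
    memory : Memory
    tossed : ℕ         -- number of coins tossed so far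

open State public

-- ω ⊢ ⟨ c , S ⟩⇓[ t ] S′ : with coin outcomes ω, the command c started in S
-- halts in S′ after t steps.
infix 3 _⊢⟨_,_⟩⇓[_]_

data _⊢⟨_,_⟩⇓[_]_ (ω : Coins) : Cmd → State → ℕ → State → Set where

  ⇓skip : ∀ {S} → ω ⊢⟨ skip , S ⟩⇓[ 1 ] S

  ⇓assign : ∀ {m k a i j e} →
    ω ⊢⟨ a [ i ][ j ]≔ e , state m k ⟩⇓[ 1 ]
      state (write m a (eval m i) (eval m j) (eval m e)) k

  ⇓coin : ∀ {m k a i j} →
    ω ⊢⟨ a [ i ][ j ]≔coin , state m k ⟩⇓[ 1 ]
      state (write m a (eval m i) (eval m j) (bit (ω k))) (suc k)

  ⇓seq : ∀ {c c′ S S′ S″ t t′} →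
    ω ⊢⟨ c , S ⟩⇓[ t ] S′ → ω ⊢⟨ c′ , S′ ⟩⇓[ t′ ] S″ →
    ω ⊢⟨ c ⨾ c′ , S ⟩⇓[ t + t′ ] S″

  ⇓then : ∀ {e c c′ S S′ t} → eval (memory S) e ≢ 0 →
    ω ⊢⟨ c , S ⟩⇓[ t ] S′ → ω ⊢⟨ branch e c c′ , S ⟩⇓[ suc t ] S′

  ⇓else : ∀ {e c c′ S S′ t} → eval (memory S) e ≡ 0 →
    ω ⊢⟨ c′ , S ⟩⇓[ t ] S′ → ω ⊢⟨ branch e c c′ , S ⟩⇓[ suc t ] S′

  ⇓stop : ∀ {e c S} → eval (memory S) e ≡ 0 →
    ω ⊢⟨ while e c , S ⟩⇓[ 1 ] S

  ⇓loop : ∀ {e c S S′ S″ t t′} → eval (memory S) e ≢ 0 →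
    ω ⊢⟨ c , S ⟩⇓[ t ] S′ → ω ⊢⟨ while e c , S′ ⟩⇓[ t′ ] S″ →
    ω ⊢⟨ while e c , S ⟩⇓[ suc (t + t′) ] S″

------------------------------------------------------------------------
-- Online algorithms
--
-- An online algorithm is a single command, independent of n, that is run
-- once per round and keeps its memory from round to round.  Arrays 0 to 3
-- are its interface; all others are initially zero.

pattern orderArray    = 0
pattern graphArray    = 1
pattern requestArray  = 2
pattern solutionArray = 3

adjacency : ∀ {n} → Digraph n → ℕ → ℕ → ℕ
adjacency {n} G i j with i <? n | j <? n
... | yes i<n | yes j<n = bit (lookup (edges G) (combine (fromℕ< i<n) (fromℕ< j<n)))
... | _       | _       = 0

initialMemory : ∀ {n} → Digraph n → Memory
initialMemory {n} G orderArray 0 0 = n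
initialMemory     G graphArray i j = adjacency G i j
initialMemory     G _          _ _ = 0

requestCell : ∀ {n} → Request n → ℕ → ℕ → ℕ
requestCell r 0 0 = toℕ (source r)
requestCell r 0 1 = toℕ (target r)
requestCell r 0 2 = abs (↥ bound r)   -- bounds of legal requests are positive
requestCell r 0 3 = ↧ₙ bound r
requestCell r _ _ = 0

receive : ∀ {n} → Request n → State → State
receive {n} r (state m k) = state m′ k
  where
  m′ : Memory
  m′ requestArray i j = requestCell r i j
  m′ a            i j = m a i j

-- The edges of G whose entry in the solution array is nonzero.
marked : ∀ {n} → Digraph n → State → EdgeSet n
marked {n} G S = edges G ∩ Vec.tabulate λ e →
  let (u , v) = remQuot {n} n e in not (memory S solutionArray (toℕ u) (toℕ v) ≡ᵇ 0)

-- Execution P G ω rs S F : after the requests rs have arrived, most recent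
-- one first, the state is S and the maintained edge set is F.  Edges enter F
-- when they are marked at the end of a round and never leave it.
data Execution (P : Cmd) {n} (G : Digraph n) (ω : Coins) :
               List (Request n) → State → EdgeSet n → Set where

  start : Execution P G ω [] (state (initialMemory G) 0) ⊥

  round : ∀ {rs S F r t S′} →
    Execution P G ω rs S F →
    ω ⊢⟨ P , receive r S ⟩⇓[ t ] S′ →
    Execution P G ω (r ∷ rs) S′ (F ∪ marked G S′)

bits : ℕ → ℕ
bits k = ⌈log₂ suc k ⌉

inputSize : ℕ → ∀ {n} → List (Request n) → ℕ
inputSize n rs = n * n + sum (map requestSize rs)
  where
  requestSize : ∀ {n} → Request n → ℕ
  requestSize {n} r = 2 * bits n + bits (abs (↥ bound r)) + bits (↧ₙ bound r)

-- For all coin outcomes, each round halts within a number of steps polynomial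
-- in the size of the graph and of the requests that have arrived.
PolynomialTime : Cmd → Set
PolynomialTime P =
  ∃[ C ] ∃[ e ] ∀ {n} (G : Digraph n) (ω : Coins) (r : Request n) rs {S F} →
    All (Legal G) (r ∷ rs) → Execution P G ω rs S F →
    ∃[ t ] ∃[ S′ ] (ω ⊢⟨ P , receive r S ⟩⇓[ t ] S′) × t ≤ C * inputSize n (r ∷ rs) ^ e

------------------------------------------------------------------------
-- Competitive ratio

-- For independent fair coins, A fails with probability at most 1 / N: outcomes
-- at which it fails have their first R coins in a list of at most 2 ^ R / N
-- strings.
FailureProbability≤1/ : ℕ → (Coins → Set) → Set
FailureProbability≤1/ N A =
  ∃[ R ] Σ (List (Vec Bool R)) λ bad →
    length bad * N ≤ 2 ^ R ×
    (∀ ω → Vec.tabulate (λ i → ω (toℕ i)) ∉ᴸ bad → A ω)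

-- Executions are determined by P, G, ω and rs.
Competitive : Cmd → ∀ {n} → Digraph n → ℕ → Coins → List (Request n) → Set
Competitive P G c ω rs = ∀ {S F} → Execution P G ω rs S F →
  Feasible uniform F rs × (∀ opt → IsOPT uniform G rs opt → ∣ F ∣ ≤ c * opt)

-- The requests are chosen before the coins are tossed.  The tails of rs are
-- the request sequences that have arrived at the various times.
CompetitiveRatio : (κ : ℕ) → Cmd → (ℕ → ℕ) → Set
CompetitiveRatio κ P c = ∀ {n} (G : Digraph n) rs → All (Legal G) rs →
  FailureProbability≤1/ (n ^ κ) λ ω → All (Competitive P G (c n) ω) (tails rs)

-- f(n) = Õ(n^(p/q)), raised to the power q.
_∈Õ[n^_/_] : (ℕ → ℕ) → ℕ → ℕ → Set
f ∈Õ[n^ p / q ] =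
  ∃[ C ] ∃[ a ] ∃[ n₀ ] ∀ n → n₀ ≤ n → f n ^ q ≤ (C * ⌈log₂ n ⌉ ^ a) ^ q * n ^ p

{-# OPTIONS --safe #-}

-- A request that is not yet satisfied is served by its own edge, so that the
-- solution is always feasible and only its size is at stake; everything else
-- serves to make such purchases rare.  Let 8 ^ l be about n and β = 4 ^ l, about
-- n ^ (2/3).  Requests served by their own edges are distinct pairs of a tail
-- and a head of edges of the optimum, so k of them show that opt² ≥ k.  The
-- first β² purchases are therefore cheap, and after them opt ≥ β.  At that
-- moment about n ^ (1/3) log n random vertices become hubs, and their
-- shortest-path trees in both directions, of total size Õ(β²), are bought.
--
-- Suppose that a request (s , t) with bound d is not satisfied later on.  Its
-- jumps are the edges u → v of G such that dist(s,u) + dist(u,t) ≤ d, likewise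
-- for v, and the distance from s in the solution rises by at least 2 from u to
-- v.  Every feasible solution contains a jump.  Every edge has a weight,
-- initially 1.  If the jumps weigh less than M = Θ(n²) together, then
-- K = Õ(β) edges are bought, each drawn from the jumps with probability
-- weight / M, and the weights of the jumps are doubled.  As this doubles the
-- weight of an edge of the optimum, it happens at most opt · O(log n) times.
--
-- Otherwise the algorithm is stuck, which is improbable.  If β or more vertices
-- are local to the request, then all hubs missed them.  If not, then the jumps
-- are determined by the labels (distances from s) of fewer than β vertices, a
-- code, and the draws avoided them although their weight reached M.  While a
-- code is avoided, (1 + 1/M) ^ (K · weight) is a supermartingale, which
-- outweighs the number of codes.
module Submission where

open import Data.Bool.Base using (Bool; true; false; not; if_then_else_; _∧_; T)
open import Data.Bool.ListAction using (any)
open import Data.Bool.Properties using (∨-zeroʳ)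
open import Data.Fin.Base using (Fin; toℕ; fromℕ<; combine; remQuot)
open import Data.Fin.Properties using (pigeonhole; toℕ<n; toℕ-fromℕ<; toℕ-combine; toℕ-injective; fromℕ<-toℕ; remQuot-combine)
open import Data.Fin.Subset using (Subset; ∣_∣; _⊆_; _∪_)
open import Data.Fin.Subset.Properties using (x∈p∪q⁺; x∈p∪q⁻; x∈p∩q⁺; x∈p∩q⁻; ∉⊥)
open import Data.Integer.Base using () renaming (∣_∣ to abs)
import Data.Integer.Base as ℤ
import Data.Integer.Properties as ℤ
open import Data.List.Base using (List; []; _∷_; _++_; length; map; replicate; tails; cartesianProductWith; upTo)
open import Data.List.Membership.Propositional using () renaming (_∈_ to _∈ᴸ_; _∉_ to _∉ᴸ_)
open import Data.List.Membership.Propositional.Properties using (∈-cartesianProductWith⁺; ∈-upTo⁺; ∈-map⁺; ∈-++⁺ˡ; ∈-++⁺ʳ; ∈-++⁻)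
open import Data.List.Properties using (length-++; length-map; length-upTo; length-replicate)
open import Data.List.Relation.Unary.All using (All; []; _∷_)
open import Data.List.Relation.Unary.Any as Any using (Any)
open import Data.Maybe.Base using (Maybe; just; nothing)
open import Data.Nat.Base
open import Data.Nat.Logarithm using (⌈log₂_⌉; ⌊log₂_⌋; ⌊log₂⌋-mono-≤; ⌊log₂[2*b]⌋≡1+⌊log₂b⌋; ⌊log₂[2^n]⌋≡n; ⌈log₂⌉-mono-≤; ⌈log₂2^n⌉≡n)
open import Data.Nat.Properties
open import Data.Nat.Tactic.RingSolver using (solve-∀)
open import Data.Product.Base using (Σ; ∃-syntax; _×_; _,_; proj₁; proj₂)
open import Data.Rational.Base using (ℚ; mkℚ; toℚᵘ; 1ℚ; ↥_; ↧ₙ_)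
import Data.Rational.Base as ℚ
import Data.Rational.Properties as ℚ
import Data.Rational.Unnormalised.Base as ℚᵘ
import Data.Rational.Unnormalised.Properties as ℚᵘ
open import Data.Sum.Base using (_⊎_; inj₁; inj₂)
open import Data.Vec.Base using (Vec; tabulate; lookup) renaming (_++_ to _++ᵛ_)
open import Data.Vec.Properties using ([]=⇒lookup; lookup⇒[]=; lookup∘tabulate)
open import Defs
open import Function.Base using (_∘_; case_of_)
open import Relation.Binary.Construct.Closure.ReflexiveTransitive using (ε; _◅_; _◅◅_)
open import Relation.Binary.PropositionalEquality
open import Relation.Nullary using (¬_; Dec; yes; no; contradiction)

-- Loops whose length is read once from a cell of a read-only array: such
-- programs always halt, so they have a semantics by recursion.  A block does
-- not unfold by itself, which keeps the states in proofs about compositions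
-- of programs small.

-- A bought edge raises the distance from s in the solution by at most 1, so no bought edge is a
-- jump; a competitor's path of at most d edges has to climb from 0 to more than d, so it climbs by
-- 2 somewhere. The obstacle is that the jumps of a request depend on earlier draws through the
-- distances in the solution. Hence the analysis watches all conceivable codes from the start, of
-- which there are only 2 ^ Õ(β). As the distribution of the draws is adaptive too, a
-- supermartingale replaces a product of fixed probabilities. A code starts with weight at most n² ≤
-- M / 2; on reaching M its exponential has grown by a factor of at least 2 ^ (K / 2), which pays
-- for the number of codes and for the failure probability. One quantity, `risk`, joins both ways of
-- getting stuck. The stuck flag is never cleared, so one application of Markov's inequality at the
-- end covers all times, and no union bound over the unbounded number of rounds is taken.
-- Probabilities appear as integers: sums over coin vectors, with denominators cleared by powers of
-- 2 and M.

infixr 4 _⟫_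

data Prog : Set where
  nop  : Prog
  put  : (a : ℕ) (i j e : Expr) → Prog
  toss : (a : ℕ) → Prog
  _⟫_  : Prog → Prog → Prog
  test : Expr → Prog → Prog → Prog
  loop : (x a i : ℕ) → Prog → Prog
  block : Prog → Prog

cell : ℕ → Expr
cell a = a [ lit 0 ][ lit 0 ]

⟦_⟧ : Prog → Cmd
⟦ nop ⟧          = skip
⟦ put a i j e ⟧  = a [ i ][ j ]≔ e
⟦ toss a ⟧       = a [ lit 0 ][ lit 0 ]≔coin
⟦ p ⟫ q ⟧        = ⟦ p ⟧ ⨾ ⟦ q ⟧
⟦ test e p q ⟧   = branch e ⟦ p ⟧ ⟦ q ⟧
⟦ loop x a i p ⟧ =
  x [ lit 0 ][ lit 0 ]≔ a [ lit i ][ lit 0 ] ⨾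
  while (cell x) (x [ lit 0 ][ lit 0 ]≔ (cell x ⊖ lit 1) ⨾ ⟦ p ⟧)
⟦ block p ⟧      = ⟦ p ⟧

assign : ℕ → ℕ → ℕ → ℕ → State → State
assign a i j v S = state (write (memory S) a i j v) (tossed S)

iter : (State → State) → ℕ → ℕ → State → State
iter f x zero    S = S
iter f x (suc k) S = iter f x k (f (assign x 0 0 k S))

select : ∀ {A : Set} → ℕ → A → A → A
select zero    _ y = y
select (suc _) x _ = x

abstract
  sealed : (State → State) → State → State
  sealed f S = f S

  sealed-≡ : ∀ f S → sealed f S ≡ f S
  sealed-≡ f S = refl

-- Fixes the number of iterations when a loop is entered, whereas the compiled `while` tests the
-- counter cell each time. The two agree for `regular` programs, whose loop bodies leave the counter
-- alone.
run : Coins → Prog → State → State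
run ω nop            S = S
run ω (put a i j e)  S = assign a (eval (memory S) i) (eval (memory S) j) (eval (memory S) e) S
run ω (toss a)       S = state (write (memory S) a 0 0 (bit (ω (tossed S)))) (suc (tossed S))
run ω (p ⟫ q)        S = run ω q (run ω p S)
run ω (test e p q)   S = select (eval (memory S) e) (run ω p S) (run ω q S)
run ω (loop x a i p) S = iter (run ω p) x (memory S a i 0) (assign x 0 0 (memory S a i 0) S)
run ω (block p)      S = sealed (run ω p) S

block-spec : ∀ ω p S (P : State → Set) → P (run ω p S) → P (run ω (block p) S)
block-spec ω p S P = subst P (sym (sealed-≡ (run ω p) S))

-- Syntactic checks, the frame property and dependence on coins

untouched : ℕ → Prog → Bool
untouched a nop            = true
untouched a (put b _ _ _)  = not (b ≡ᵇ a)
untouched a (toss b)       = not (b ≡ᵇ a)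
untouched a (p ⟫ q)        = untouched a p ∧ untouched a q
untouched a (test _ p q)   = untouched a p ∧ untouched a q
untouched a (loop x _ _ p) = not (x ≡ᵇ a) ∧ untouched a p
untouched a (block p)      = untouched a p

-- All loop lengths come from the first `k` rows of an array that is never written, so one bound on
-- these cells limits every loop, however deeply nested, throughout the run.
regular : (a k : ℕ) → Prog → Bool
regular a k nop            = true
regular a k (put b _ _ _)  = not (b ≡ᵇ a)
regular a k (toss b)       = not (b ≡ᵇ a)
regular a k (p ⟫ q)        = regular a k p ∧ regular a k q
regular a k (test _ p q)   = regular a k p ∧ regular a k q
regular a k (loop x b i p) = (b ≡ᵇ a) ∧ (i <ᵇ k) ∧ not (x ≡ᵇ a) ∧ untouched x p ∧ regular a k p
regular a k (block p)      = regular a k p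

coinless : Prog → Bool
coinless (toss _)       = false
coinless (p ⟫ q)        = coinless p ∧ coinless q
coinless (test _ p q)   = coinless p ∧ coinless q
coinless (loop _ _ _ p) = coinless p
coinless (block p)      = coinless p
coinless _              = true

∧-split : ∀ {x y} → x ∧ y ≡ true → x ≡ true × y ≡ true
∧-split {true} {true} _ = refl , refl

T⇒≡ : ∀ {b} → T b → b ≡ true
T⇒≡ {true} _ = refl

≡⇒T : ∀ {b} → b ≡ true → T b
≡⇒T refl = _

not-≡ᵇ : ∀ {a b} → not (a ≡ᵇ b) ≡ true → (a ≡ᵇ b) ≡ false
not-≡ᵇ {a} {b} p with a ≡ᵇ b
... | false = refl

write-other : ∀ m a b i j v i′ j′ → not (a ≡ᵇ b) ≡ true → write m a i j v b i′ j′ ≡ m b i′ j′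
write-other m a b i j v i′ j′ p rewrite not-≡ᵇ {a} {b} p = refl

≡ᵇ-refl : ∀ n → (n ≡ᵇ n) ≡ true
≡ᵇ-refl n = T⇒≡ (≡⇒≡ᵇ n n refl)

≢⇒≡ᵇ : ∀ {m n} → m ≢ n → (m ≡ᵇ n) ≡ false
≢⇒≡ᵇ {m} {n} m≢n with m ≡ᵇ n in eq
... | true  = contradiction (≡ᵇ⇒≡ m n (≡⇒T eq)) m≢n
... | false = refl

write-same : ∀ m a i j v → write m a i j v a i j ≡ v
write-same m a i j v rewrite ≡ᵇ-refl a | ≡ᵇ-refl i | ≡ᵇ-refl j = refl

write-cell : ∀ m a i j v i′ j′ → i ≢ i′ ⊎ j ≢ j′ → write m a i j v a i′ j′ ≡ m a i′ j′
write-cell m a i j v i′ j′ (inj₁ p) rewrite ≡ᵇ-refl a | ≢⇒≡ᵇ p = refl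
write-cell m a i j v i′ j′ (inj₂ p) rewrite ≡ᵇ-refl a | ≢⇒≡ᵇ p with i ≡ᵇ i′
... | true  = refl
... | false = refl

select-elim : ∀ {A : Set} (P : A → Set) k {x y} → (k ≢ 0 → P x) → (k ≡ 0 → P y) → P (select k x y)
select-elim P zero    p q = q refl
select-elim P (suc k) p q = p λ ()

iter-invariant : ∀ (I : ℕ → State → Set) {f x} →
  (∀ k S → I (suc k) S → I k (f (assign x 0 0 k S))) → ∀ k S → I k S → I 0 (iter f x k S)
iter-invariant I step zero    S h = h
iter-invariant I step (suc k) S h = iter-invariant I step k _ (step k S h)

-- For a concrete program the hypothesis computes, so `refl` carries every unrelated array across a
-- run.
frame : ∀ ω a p → untouched a p ≡ true → ∀ S i j → memory (run ω p S) a i j ≡ memory S a i j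
frame ω a nop            h S i j = refl
frame ω a (put b k l _)  h S i j = write-other (memory S) b a (eval (memory S) k) (eval (memory S) l) _ i j h
frame ω a (toss b)       h S i j = write-other (memory S) b a 0 0 _ i j h
frame ω a (p ⟫ q)        h S i j =
  trans (frame ω a q (proj₂ (∧-split h)) (run ω p S) i j) (frame ω a p (proj₁ (∧-split h)) S i j)
frame ω a (test e p q)   h S i j =
  select-elim (λ S′ → memory S′ a i j ≡ memory S a i j) (eval (memory S) e)
    (λ _ → frame ω a p (proj₁ (∧-split h)) S i j) (λ _ → frame ω a q (proj₂ (∧-split h)) S i j)
frame ω a (loop x b l p) h S i j =
  iter-invariant (λ _ S′ → memory S′ a i j ≡ memory S a i j)
    (λ k S′ e → trans (frame ω a p (proj₂ (∧-split h)) _ i j)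
                      (trans (write-other (memory S′) x a 0 0 k i j (proj₁ (∧-split h))) e))
    (memory S b l 0) _ (write-other (memory S) x a 0 0 _ i j (proj₁ (∧-split h)))
frame ω a (block p)      h S i j =
  block-spec ω p S (λ S′ → memory S′ a i j ≡ memory S a i j) (frame ω a p h S i j)

coinless-tossed : ∀ ω p → coinless p ≡ true → ∀ S → tossed (run ω p S) ≡ tossed S
coinless-tossed ω nop            h S = refl
coinless-tossed ω (put _ _ _ _)  h S = refl
coinless-tossed ω (p ⟫ q)        h S =
  trans (coinless-tossed ω q (proj₂ (∧-split h)) _) (coinless-tossed ω p (proj₁ (∧-split h)) S)
coinless-tossed ω (test e p q)   h S =
  select-elim (λ S′ → tossed S′ ≡ tossed S) (eval (memory S) e)
    (λ _ → coinless-tossed ω p (proj₁ (∧-split h)) S) (λ _ → coinless-tossed ω q (proj₂ (∧-split h)) S)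
coinless-tossed ω (loop x a i p) h S =
  iter-invariant (λ _ S′ → tossed S′ ≡ tossed S)
    (λ k S′ e → trans (coinless-tossed ω p h _) e) (memory S a i 0) _ refl
coinless-tossed ω (block p)      h S = block-spec ω p S (λ S′ → tossed S′ ≡ tossed S) (coinless-tossed ω p h S)

tossed-mono : ∀ ω p S → tossed S ≤ tossed (run ω p S)
tossed-mono ω nop            S = ≤-refl
tossed-mono ω (put _ _ _ _)  S = ≤-refl
tossed-mono ω (toss a)       S = n≤1+n _
tossed-mono ω (p ⟫ q)        S = ≤-trans (tossed-mono ω p S) (tossed-mono ω q _)
tossed-mono ω (test e p q)   S =
  select-elim (λ S′ → tossed S ≤ tossed S′) (eval (memory S) e) (λ _ → tossed-mono ω p S) (λ _ → tossed-mono ω q S)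
tossed-mono ω (loop x a i p) S =
  iter-invariant (λ _ S′ → tossed S ≤ tossed S′)
    (λ k S′ h → ≤-trans h (tossed-mono ω p (assign x 0 0 k S′))) (memory S a i 0) (assign x 0 0 (memory S a i 0) S) ≤-refl
tossed-mono ω (block p)      S = block-spec ω p S (λ S′ → tossed S ≤ tossed S′) (tossed-mono ω p S)

iter-tossed-mono : ∀ ω p x k S → tossed S ≤ tossed (iter (run ω p) x k S)
iter-tossed-mono ω p x zero    S = ≤-refl
iter-tossed-mono ω p x (suc k) S =
  ≤-trans (tossed-mono ω p (assign x 0 0 k S)) (iter-tossed-mono ω p x k (run ω p (assign x 0 0 k S)))

module _ {ω ω′ : Coins} (N : ℕ) (agree : ∀ k → k < N → ω k ≡ ω′ k) where

  -- Coins that are not tossed have no influence. This is what allows infinite outcomes to be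
  -- replaced by finite vectors.
  run-cong  : ∀ p S → tossed (run ω p S) ≤ N → run ω p S ≡ run ω′ p S
  iter-cong : ∀ p x k S → tossed (iter (run ω p) x k S) ≤ N →
              iter (run ω p) x k S ≡ iter (run ω′ p) x k S

  run-cong nop            S h = refl
  run-cong (put a i j e)  S h = refl
  run-cong (toss a)       S h = cong (λ b → state (write (memory S) a 0 0 (bit b)) (suc (tossed S))) (agree _ h)
  run-cong (p ⟫ q)        S h =
    trans (run-cong q (run ω p S) h)
          (cong (run ω′ q) (run-cong p S (≤-trans (tossed-mono ω q (run ω p S)) h)))
  run-cong (test e p q)   S h with eval (memory S) e
  ... | zero  = run-cong q S h
  ... | suc _ = run-cong p S h
  run-cong (loop x a i p) S h = iter-cong p x (memory S a i 0) _ h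
  run-cong (block p)      S h =
    trans (sealed-≡ (run ω p) S)
      (trans (run-cong p S (subst (λ S′ → tossed S′ ≤ N) (sealed-≡ (run ω p) S) h)) (sym (sealed-≡ (run ω′ p) S)))

  iter-cong p x zero    S h = refl
  iter-cong p x (suc k) S h =
    trans (iter-cong p x k _ h)
          (cong (iter (run ω′ p) x k)
                (run-cong p (assign x 0 0 k S) (≤-trans (iter-tossed-mono ω p x k _) h)))

-- Termination and number of steps

size : Prog → ℕ → ℕ
size nop            B = 1
size (put _ _ _ _)  B = 1
size (toss _)       B = 1
size (p ⟫ q)        B = size p B + size q B
size (test _ p q)   B = suc (size p B + size q B)
size (loop _ _ _ p) B = 2 + B * (2 + size p B)
size (block p)      B = size p B

Bounded : ℕ → ℕ → ℕ → State → Set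
Bounded a k B S = ∀ i → i < k → memory S a i 0 ≤ B

regular⇒untouched : ∀ a k p → regular a k p ≡ true → untouched a p ≡ true
regular⇒untouched a k nop            h = refl
regular⇒untouched a k (put b _ _ _)  h = h
regular⇒untouched a k (toss b)       h = h
regular⇒untouched a k (p ⟫ q)        h =
  cong₂ _∧_ (regular⇒untouched a k p (proj₁ (∧-split h))) (regular⇒untouched a k q (proj₂ (∧-split h)))
regular⇒untouched a k (test _ p q)   h =
  cong₂ _∧_ (regular⇒untouched a k p (proj₁ (∧-split h))) (regular⇒untouched a k q (proj₂ (∧-split h)))
regular⇒untouched a k (loop x b i p) h with ∧-split {b ≡ᵇ a} h
... | _ , h₁ with ∧-split {i <ᵇ k} h₁
... | _ , h₂ with ∧-split {not (x ≡ᵇ a)} h₂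
... | h₃ , h₄ = cong₂ _∧_ h₃ (regular⇒untouched a k p (proj₂ (∧-split {untouched x p} h₄)))
regular⇒untouched a k (block p)      h = regular⇒untouched a k p h

Bounded-run : ∀ {ω a k B} p {S} → regular a k p ≡ true → Bounded a k B S → Bounded a k B (run ω p S)
Bounded-run {ω} {a} {k} p {S} h b i i<k = ≤-trans (≤-reflexive (frame ω a p (regular⇒untouched a k p h) S i 0)) (b i i<k)

Bounded-assign : ∀ {a k B S} x v → not (x ≡ᵇ a) ≡ true → Bounded a k B S → Bounded a k B (assign x 0 0 v S)
Bounded-assign {a} {S = S} x v h b i i<k = ≤-trans (≤-reflexive (write-other (memory S) x a 0 0 v i 0 h)) (b i i<k)

Halts : Coins → ℕ → ℕ → Cmd → State → State → (ℕ → ℕ) → Set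
Halts ω a k c S S′ f = ∃[ t ] (ω ⊢⟨ c , S ⟩⇓[ t ] S′) × (∀ B → Bounded a k B S → t ≤ f B)

-- No step changes the cells that hold the loop lengths, so a bound on them in the initial state is
-- still valid in every later state, in particular inside nested loops.
halts       : ∀ ω a k p → regular a k p ≡ true → ∀ S → Halts ω a k ⟦ p ⟧ S (run ω p S) (size p)
halts-while : ∀ ω a k p x → regular a k p ≡ true → untouched x p ≡ true → not (x ≡ᵇ a) ≡ true →
  ∀ j S → memory S x 0 0 ≡ j →
  Halts ω a k (while (cell x) (x [ lit 0 ][ lit 0 ]≔ (cell x ⊖ lit 1) ⨾ ⟦ p ⟧)) S
    (iter (run ω p) x j S) (λ B → suc (j * (2 + size p B)))

halts ω a k nop            h S = 1 , ⇓skip , λ _ _ → ≤-refl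
halts ω a k (put _ _ _ _)  h S = 1 , ⇓assign , λ _ _ → ≤-refl
halts ω a k (toss _)       h S = 1 , ⇓coin , λ _ _ → ≤-refl
halts ω a k (p ⟫ q)        h S
  with halts ω a k p (proj₁ (∧-split h)) S | halts ω a k q (proj₂ (∧-split h)) (run ω p S)
... | _ , d , b | _ , d′ , b′ =
  _ , ⇓seq d d′ , λ B bd → +-mono-≤ (b B bd) (b′ B (Bounded-run p (proj₁ (∧-split h)) bd))
halts ω a k (test e p q)   h S with eval (memory S) e in eq
... | zero with halts ω a k q (proj₂ (∧-split h)) S
...   | _ , d , b = _ , ⇓else eq d , λ B bd → s≤s (≤-trans (b B bd) (m≤n+m _ _))
halts ω a k (test e p q)   h S | suc _ with halts ω a k p (proj₁ (∧-split h)) S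
...   | _ , d , b = _ , ⇓then (λ z → contradiction (trans (sym eq) z) λ ()) d , λ B bd → s≤s (≤-trans (b B bd) (m≤m+n _ _))
halts ω a k (loop x b i p) h S with ∧-split {b ≡ᵇ a} h
... | h₀ , h₁ with ∧-split {i <ᵇ k} h₁
... | i<k , h₂ with ∧-split {not (x ≡ᵇ a)} h₂
... | h₃ , h₄ with ≡ᵇ⇒≡ b a (≡⇒T h₀) | ∧-split {untouched x p} h₄
... | refl | h₅ , h₆
  with halts-while ω a k p x h₆ h₅ h₃ (memory S a i 0) (assign x 0 0 (memory S a i 0) S)
         (write-same (memory S) x 0 0 _)
... | _ , d , bound = _ , ⇓seq ⇓assign d , λ B bd →
  s≤s (≤-trans (bound B (Bounded-assign {S = S} x _ h₃ bd))
       (s≤s (*-monoˡ-≤ (2 + size p B) (bd i (<ᵇ⇒< i k (≡⇒T i<k))))))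
halts ω a k (block p)      h S = block-spec ω p S (λ S′ → Halts ω a k ⟦ p ⟧ S S′ (size p)) (halts ω a k p h S)

halts-while ω a k p x r u h zero    S e = 1 , ⇓stop e , λ _ _ → ≤-refl
halts-while ω a k p x r u h (suc j) S e
  with halts ω a k p r (assign x 0 0 j S)
     | halts-while ω a k p x r u h j (run ω p (assign x 0 0 j S))
         (trans (frame ω x p u _ 0 0) (write-same (memory S) x 0 0 j))
... | t , d , b | t′ , d′ , b′ =
  _ , ⇓loop (λ z → contradiction (trans (sym e) z) λ ())
        -- The machine decrements the counter while `iter` assigns the next value; they agree
        -- because the counter holds `suc j`.
        (⇓seq (subst (λ v → ω ⊢⟨ _ , S ⟩⇓[ 1 ] assign x 0 0 v S) (cong (_∸ 1) e) ⇓assign) d) d′ ,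
  λ B bd → s≤s (≤-trans (+-mono-≤ (s≤s (b B (bd′ B bd))) (b′ B (Bounded-run p r (bd′ B bd))))
             (≤-reflexive (lem (size p B) (j * (2 + size p B)))))
  where
  bd′ : ∀ B → Bounded a k B S → Bounded a k B (assign x 0 0 j S)
  bd′ B bd = Bounded-assign {S = S} x j h bd
  lem : ∀ s r → suc s + suc r ≡ 2 + s + r
  lem s r = cong suc (+-suc s r)

deterministic : ∀ {ω c S t S′ t′ S″} → ω ⊢⟨ c , S ⟩⇓[ t ] S′ → ω ⊢⟨ c , S ⟩⇓[ t′ ] S″ → S′ ≡ S″
deterministic ⇓skip         ⇓skip          = refl
deterministic ⇓assign       ⇓assign        = refl
deterministic ⇓coin         ⇓coin          = refl
deterministic (⇓seq d e)    (⇓seq d′ e′)   with refl ← deterministic d d′ = deterministic e e′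
deterministic (⇓then _ d)   (⇓then _ d′)   = deterministic d d′
deterministic (⇓then p _)   (⇓else q _)    = contradiction q p
deterministic (⇓else p _)   (⇓then q _)    = contradiction p q
deterministic (⇓else _ d)   (⇓else _ d′)   = deterministic d d′
deterministic (⇓stop _)     (⇓stop _)      = refl
deterministic (⇓stop p)     (⇓loop q _ _)  = contradiction p q
deterministic (⇓loop p _ _) (⇓stop q)      = contradiction q p
deterministic (⇓loop _ d e) (⇓loop _ d′ e′) with refl ← deterministic d d′ = deterministic e e′

-- Polynomially bounded functions

-- The base `suc n` is positive, so enlarging the exponent only weakens the bound.
Poly : (ℕ → ℕ) → Set
Poly f = ∃[ C ] ∃[ e ] ∀ n → f n ≤ C * suc n ^ e

poly-const : ∀ k → Poly (λ _ → k)
poly-const k = k , 0 , λ n → ≤-reflexive (sym (*-identityʳ k))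

poly-id : Poly (λ n → n)
poly-id = 1 , 1 , λ n → ≤-trans (n≤1+n n) (≤-reflexive (sym (trans (*-identityˡ _) (*-identityʳ (suc n)))))

poly-weaken : ∀ C {e e′} n → e ≤ e′ → C * suc n ^ e ≤ C * suc n ^ e′
poly-weaken C n h = *-monoʳ-≤ C (^-monoʳ-≤ (suc n) h)

poly-+ : ∀ {f g} → Poly f → Poly g → Poly (λ n → f n + g n)
poly-+ (C , e , p) (C′ , e′ , q) = C + C′ , e + e′ , λ n →
  ≤-trans (+-mono-≤ (≤-trans (p n) (poly-weaken C n (m≤m+n e e′))) (≤-trans (q n) (poly-weaken C′ n (m≤n+m e′ e))))
          (≤-reflexive (sym (*-distribʳ-+ (suc n ^ (e + e′)) C C′)))

poly-* : ∀ {f g} → Poly f → Poly g → Poly (λ n → f n * g n)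
poly-* (C , e , p) (C′ , e′ , q) = C * C′ , e + e′ , λ n →
  ≤-trans (*-mono-≤ (p n) (q n))
    (≤-reflexive (trans ([m*n]*[o*p]≡[m*o]*[n*p] C (suc n ^ e) C′ (suc n ^ e′))
                        (cong (C * C′ *_) (sym (^-distribˡ-+-* (suc n) e e′)))))

poly-^ : ∀ {f} k → Poly f → Poly (λ n → f n ^ k)
poly-^ zero    p = poly-const 1
poly-^ (suc k) p = poly-* p (poly-^ k p)

poly-mono : ∀ {f g} → (∀ n → f n ≤ g n) → Poly g → Poly f
poly-mono h (C , e , p) = C , e , λ n → ≤-trans (h n) (p n)

poly-∘ : ∀ {f g} → Poly f → Poly g → Poly (λ n → f (g n))
poly-∘ {f} {g} (C , e , p) q with poly-* (poly-const C) (poly-^ e (poly-+ (poly-const 1) q))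
... | C′ , e′ , r = C′ , e′ , λ n → ≤-trans (p (g n)) (r n)

poly-size : ∀ p → Poly (size p)
poly-size nop            = poly-const 1
poly-size (put _ _ _ _)  = poly-const 1
poly-size (toss _)       = poly-const 1
poly-size (p ⟫ q)        = poly-+ (poly-size p) (poly-size q)
poly-size (test _ p q)   = poly-+ (poly-const 1) (poly-+ (poly-size p) (poly-size q))
poly-size (loop _ _ _ p) = poly-+ (poly-const 2) (poly-* poly-id (poly-+ (poly-const 2) (poly-size p)))
poly-size (block p)      = poly-size p

-- Sums and matrices

Matrix : Set
Matrix = ℕ → ℕ → ℕ

-- Peels off the largest index, in step with loops that count down.
sum< : ℕ → (ℕ → ℕ) → ℕ
sum< zero    f = 0
sum< (suc n) f = f n + sum< n f

sum² : ℕ → Matrix → ℕ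
sum² n X = sum< n λ i → sum< n (X i)

sum-mono : ∀ n {f g} → (∀ i → i < n → f i ≤ g i) → sum< n f ≤ sum< n g
sum-mono zero    h = z≤n
sum-mono (suc n) h = +-mono-≤ (h n ≤-refl) (sum-mono n λ i i<n → h i (m<n⇒m<1+n i<n))

sum-cong : ∀ n {f g} → (∀ i → i < n → f i ≡ g i) → sum< n f ≡ sum< n g
sum-cong zero    h = refl
sum-cong (suc n) h = cong₂ _+_ (h n ≤-refl) (sum-cong n λ i i<n → h i (m<n⇒m<1+n i<n))

+-interchange : ∀ a b c d → (a + b) + (c + d) ≡ (a + c) + (b + d)
+-interchange = solve-∀

sum-+ : ∀ n f g → sum< n (λ i → f i + g i) ≡ sum< n f + sum< n g
sum-+ zero    f g = refl
sum-+ (suc n) f g = trans (cong (f n + g n +_) (sum-+ n f g)) (+-interchange (f n) (g n) _ _)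

sum-const : ∀ n c → sum< n (λ _ → c) ≡ n * c
sum-const zero    c = refl
sum-const (suc n) c = cong (c +_) (sum-const n c)

sum-* : ∀ n c f → sum< n (λ i → c * f i) ≡ c * sum< n f
sum-* zero    c f = sym (*-zeroʳ c)
sum-* (suc n) c f = trans (cong (c * f n +_) (sum-* n c f)) (sym (*-distribˡ-+ c (f n) _))

sum-term : ∀ {n i} f → i < n → f i ≤ sum< n f
sum-term {suc n} {i} f i<1+n with m≤n⇒m<n∨m≡n (≤-pred i<1+n)
... | inj₁ i<n  = ≤-trans (sum-term f i<n) (m≤n+m _ _)
... | inj₂ refl = m≤m+n _ _

sum-split : ∀ m n f → sum< (m + n) f ≡ sum< m (λ i → f (n + i)) + sum< n f
sum-split zero    n f = refl
sum-split (suc m) n f = trans (cong₂ _+_ (cong f (+-comm m n)) (sum-split m n f)) (sym (+-assoc (f (n + m)) _ _))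

sum²-mono : ∀ n {X Y} → (∀ i j → i < n → j < n → X i j ≤ Y i j) → sum² n X ≤ sum² n Y
sum²-mono n h = sum-mono n λ i i<n → sum-mono n λ j → h i j i<n

sum²-cong : ∀ n {X Y} → (∀ i j → i < n → j < n → X i j ≡ Y i j) → sum² n X ≡ sum² n Y
sum²-cong n h = sum-cong n λ i i<n → sum-cong n λ j → h i j i<n

sum²-+ : ∀ n X Y → sum² n (λ i j → X i j + Y i j) ≡ sum² n X + sum² n Y
sum²-+ n X Y = trans (sum-cong n λ i _ → sum-+ n (X i) (Y i)) (sum-+ n _ _)

sum²-const : ∀ n c → sum² n (λ _ _ → c) ≡ n * n * c
sum²-const n c = trans (sum-cong n λ _ _ → sum-const n c) (trans (sum-const n (n * c)) (sym (*-assoc n n c)))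

sum²-term : ∀ {n i j} X → i < n → j < n → X i j ≤ sum² n X
sum²-term {n} {i} X i<n j<n = ≤-trans (sum-term (X i) j<n) (sum-term (λ i → sum< n (X i)) i<n)

sum²-outer : ∀ n f g → sum² n (λ i j → f i * g j) ≡ sum< n f * sum< n g
sum²-outer n f g =
  trans (sum-cong n λ i _ → sum-* n (f i) g)
        (trans (sum-cong n λ i _ → *-comm (f i) (sum< n g))
               (trans (sum-* n (sum< n g) f) (*-comm (sum< n g) (sum< n f))))

δ : ℕ → ℕ → ℕ
δ i j = bit (i ≡ᵇ j)

sum-δ-out : ∀ n i → n ≤ i → sum< n (λ k → δ k i) ≡ 0
sum-δ-out zero    i h = refl
sum-δ-out (suc n) i h rewrite ≢⇒≡ᵇ (<⇒≢ h) = sum-δ-out n i (<⇒≤ h)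

sum-δ : ∀ n i → sum< n (λ k → δ k i) ≤ 1
sum-δ zero    i = z≤n
sum-δ (suc n) i with n ≟ i
... | yes refl rewrite ≡ᵇ-refl n = ≤-reflexive (cong suc (sum-δ-out n n ≤-refl))
... | no n≢i   rewrite ≢⇒≡ᵇ n≢i = sum-δ n i

sum-product-δ : ∀ n (f : ℕ → ℕ) c → (∀ i → i < n → f i ≡ c) → sum< n f ≡ n * c
sum-product-δ n f c h = trans (sum-cong n h) (sum-const n c)

nz : ℕ → ℕ
nz zero    = 0
nz (suc _) = 1

nz-≢0 : ∀ {n} → n ≢ 0 → nz n ≡ 1
nz-≢0 {zero}  h = contradiction refl h
nz-≢0 {suc n} h = refl

bit≤1 : ∀ b → bit b ≤ 1
bit≤1 false = z≤n
bit≤1 true  = ≤-refl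

count : ℕ → Matrix → ℕ
count n X = sum² n λ i j → nz (X i j)

count-mono : ∀ n {X Y} → (∀ i j → X i j ≢ 0 → Y i j ≢ 0) → count n X ≤ count n Y
count-mono n {X} {Y} h = sum²-mono n λ i j _ _ → lem i j
  where
  lem : ∀ i j → nz (X i j) ≤ nz (Y i j)
  lem i j with X i j in eq
  ... | zero  = z≤n
  ... | suc k = ≤-reflexive (sym (nz-≢0 (h i j λ z → contradiction (trans (sym eq) z) λ ())))

count-insert : ∀ n {X Y} u v → (∀ i j → Y i j ≢ 0 → (i ≡ u × j ≡ v) ⊎ X i j ≢ 0) → count n Y ≤ suc (count n X)
count-insert n {X} {Y} u v h = ≤-trans
  (sum²-mono n {Y = λ i j → δ i u * δ j v + nz (X i j)} λ i j _ _ → lem i j)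
  (≤-trans (≤-reflexive (sum²-+ n (λ i j → δ i u * δ j v) (λ i j → nz (X i j))))
    (+-monoˡ-≤ (count n X) (≤-trans (≤-reflexive (sum²-outer n (λ i → δ i u) (λ j → δ j v))) (*-mono-≤ (sum-δ n u) (sum-δ n v)))))
  where
  lem : ∀ i j → nz (Y i j) ≤ δ i u * δ j v + nz (X i j)
  lem i j with Y i j in eq
  ... | zero = z≤n
  ... | suc k with h i j (λ z → contradiction (trans (sym eq) z) λ ())
  ...   | inj₁ (refl , refl) rewrite ≡ᵇ-refl i | ≡ᵇ-refl j = s≤s z≤n
  ...   | inj₂ x = ≤-trans (≤-reflexive (sym (nz-≢0 x))) (m≤n+m _ (δ i u * δ j v))

-- Walks

data Path (X : Matrix) : ℕ → ℕ → ℕ → Set where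
  here : ∀ {u} → Path X 0 u u
  _▹_  : ∀ {k u v w} → Path X k u v → X v w ≢ 0 → Path X (suc k) u w

_⧺_ : ∀ {X k l u v w} → Path X k u v → Path X l v w → Path X (l + k) u w
p ⧺ here    = p
p ⧺ (q ▹ e) = (p ⧺ q) ▹ e

path-map : ∀ {X Y k u v} → (∀ i j → X i j ≢ 0 → Y i j ≢ 0) → Path X k u v → Path Y k u v
path-map h here    = here
path-map h (p ▹ e) = path-map h p ▹ h _ _ e

first-edge : ∀ {X k u v} → Path X (suc k) u v → ∃[ w ] X u w ≢ 0
first-edge (here ▹ e)      = _ , e
first-edge (p@(_ ▹ _) ▹ _) = first-edge p

last-edge : ∀ {X k u v} → Path X (suc k) u v → ∃[ w ] X w v ≢ 0
last-edge (_ ▹ e) = _ , e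

Supported : ℕ → Matrix → Set
Supported n X = ∀ i j → X i j ≢ 0 → i < n × j < n

path-end : ∀ {n X k u v} → Supported n X → u < n → Path X k u v → v < n
path-end s u<n here    = u<n
path-end s u<n (p ▹ e) = proj₂ (s _ _ e)

module _ {X : Matrix} where

  -- Positions are counted from the end of the path, where `Path` is extended.
  vertex : ∀ {k u v} → Path X k u v → ℕ → ℕ
  vertex {v = v} _       zero    = v
  vertex {v = v} here    (suc _) = v
  vertex         (p ▹ _) (suc i) = vertex p i

  prefix : ∀ {k u v} (p : Path X k u v) i → i ≤ k → Path X (k ∸ i) u (vertex p i)
  prefix p       zero    h       = p
  prefix (p ▹ _) (suc i) (s≤s h) = prefix p i h

  suffix : ∀ {k u v} (p : Path X k u v) i → i ≤ k → Path X i (vertex p i) v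
  suffix p       zero    h       = here
  suffix (p ▹ e) (suc i) (s≤s h) = suffix p i h ▹ e

  -- Among the last n + 1 positions of a walk with at least n edges two carry the same vertex, and
  -- the closed part between them is cut out. `f` is fuel for the repetition.
  shorten : ∀ {n u v} → Supported n X → u < n → ∀ f k → k < f → Path X k u v →
            ∃[ l ] l < n × l ≤ k × Path X l u v
  shorten {n} {u} {v} s u<n (suc f) k k<f p with k <? n
  ... | yes k<n = k , k<n , ≤-refl , p
  ... | no  k≮n = shortcut
    where
    n≤k = ≮⇒≥ k≮n
    vertex< : ∀ i → i ≤ k → vertex p i < n
    vertex< i h = path-end s u<n (prefix p i h)
    ≤k : (i : Fin (suc n)) → toℕ i ≤ k
    ≤k i = ≤-trans (≤-pred (toℕ<n i)) n≤k
    shortcut : ∃[ l ] l < n × l ≤ k × Path X l u v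
    shortcut with pigeonhole ≤-refl (λ i → fromℕ< (vertex< (toℕ i) (≤k i)))
    ... | i , j , i<j , eq with shorten s u<n f (toℕ i + (k ∸ toℕ j)) (<-≤-trans shorter (≤-pred k<f))
            (subst (λ x → Path X _ u x)
               (sym (trans (sym (toℕ-fromℕ< _)) (trans (cong toℕ eq) (toℕ-fromℕ< _))))
               (prefix p (toℕ j) (≤k j)) ⧺ suffix p (toℕ i) (≤k i))
      where
      shorter : toℕ i + (k ∸ toℕ j) < k
      shorter = ≤-trans (+-monoˡ-< (k ∸ toℕ j) i<j) (≤-reflexive (m+[n∸m]≡n (≤k j)))
    ... | l , l<n , l≤ , q = l , l<n , ≤-trans l≤ (<⇒≤ (≤-trans (+-monoˡ-< (k ∸ toℕ j) i<j) (≤-reflexive (m+[n∸m]≡n (≤k j))))) , q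

  -- If every edge raised `h` by at most 1, then k edges would raise it by at most k. The parts of
  -- the path before and after the edge are returned because they bound the distances of its ends
  -- from s and to t.
  jump-edge : ∀ {k s t} (h : ℕ → ℕ) → Path X k s t → h s + k < h t →
    ∃[ i ] ∃[ j ] ∃[ u ] ∃[ w ] Path X i s u × X u w ≢ 0 × Path X j w t × suc (i + j) ≡ k × 2 + h u ≤ h w
  jump-edge h here lt = contradiction lt (≤⇒≯ (m≤m+n _ 0))
  jump-edge {suc k} {s} {t} h (_▹_ {v = v} p e) lt with 2 + h v ≤? h t
  ... | yes jump = k , 0 , v , t , p , e , here , cong suc (+-identityʳ k) , jump
  ... | no ¬jump with jump-edge h p (≤-pred (≤-trans (≤-reflexive (cong suc (sym (+-suc (h s) k)))) (≤-trans lt (≤-pred (≰⇒> ¬jump)))))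
  ...   | i , j , u , w , a , x , b , eq , jump =
          i , suc j , u , w , a , x , b ▹ e , cong suc (trans (+-suc i j) eq) , jump

-- The value n stands for an infinite distance.
record IsDist (n : ℕ) (X D : Matrix) : Set where
  field
    bounded  : ∀ i j → i < n → j < n → D i j ≤ n
    sound    : ∀ i j → i < n → j < n → D i j < n → Path X (D i j) i j
    complete : ∀ i j k → i < n → j < n → k ≤ n → Path X k i j → D i j ≤ k

  -- Survives the cap: if `D i u` is infinite it is at least n, and no entry exceeds n.
  relaxed : ∀ i u v → i < n → u < n → v < n → X u v ≢ 0 → D i v ≤ suc (D i u)
  relaxed i u v i<n u<n v<n e with D i u <? n
  ... | yes lt = complete i v (suc (D i u)) i<n v<n lt (sound i u i<n u<n lt ▹ e)
  ... | no ¬lt = ≤-trans (bounded i v i<n v<n) (≤-trans (≮⇒≥ ¬lt) (n≤1+n _))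

-- Random choice of a cell

-- Descending, which is the order in which `forEach` visits the cells.
cellsOfRow : ℕ → ℕ → List (ℕ × ℕ)
cellsOfRow u zero    = []
cellsOfRow u (suc v) = (u , v) ∷ cellsOfRow u v

cells : ℕ → ℕ → List (ℕ × ℕ)
cells n zero    = []
cells n (suc u) = cellsOfRow u n ++ cells n u

-- Inverts the cumulative weights: for `r` uniform below some M that is at least the total weight, a
-- cell is chosen with probability weight / M, and `nothing` is the remaining case.
pick : Matrix → List (ℕ × ℕ) → ℕ → Maybe (ℕ × ℕ)
pick Y []             r = nothing
pick Y ((u , v) ∷ es) r = if r <ᵇ Y u v then just (u , v) else pick Y es (r ∸ Y u v)

weight : Matrix → List (ℕ × ℕ) → ℕ
weight Y []             = 0
weight Y ((u , v) ∷ es) = Y u v + weight Y es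

weight-++ : ∀ Y es fs → weight Y (es ++ fs) ≡ weight Y es + weight Y fs
weight-++ Y []       fs = refl
weight-++ Y (e ∷ es) fs = trans (cong (Y (proj₁ e) (proj₂ e) +_) (weight-++ Y es fs)) (sym (+-assoc (Y (proj₁ e) (proj₂ e)) _ _))

weight-row : ∀ Y u n → weight Y (cellsOfRow u n) ≡ sum< n (Y u)
weight-row Y u zero    = refl
weight-row Y u (suc n) = cong (Y u n +_) (weight-row Y u n)

weight-rows : ∀ Y n m → weight Y (cells n m) ≡ sum< m (λ u → sum< n (Y u))
weight-rows Y n zero    = refl
weight-rows Y n (suc m) = trans (weight-++ Y (cellsOfRow m n) (cells n m)) (cong₂ _+_ (weight-row Y m n) (weight-rows Y n m))

restrict : (ℕ → ℕ → Bool) → Matrix → Matrix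
restrict A Y u v = bit (A u v) * Y u v

avoids : (ℕ → ℕ → Bool) → Maybe (ℕ × ℕ) → ℕ
avoids A nothing        = 1
avoids A (just (u , v)) = bit (not (A u v))

pick-hit : ∀ Y u v es {r} → r < Y u v → pick Y ((u , v) ∷ es) r ≡ just (u , v)
pick-hit Y u v es h rewrite T⇒≡ (<⇒<ᵇ h) = refl

pick-skip : ∀ Y u v es i → pick Y ((u , v) ∷ es) (Y u v + i) ≡ pick Y es i
pick-skip Y u v es i with (Y u v + i) <ᵇ Y u v in eq
... | true  = contradiction (<ᵇ⇒< (Y u v + i) (Y u v) (≡⇒T eq)) (≤⇒≯ (m≤m+n (Y u v) i))
... | false = cong (pick Y es) (m+n∸m≡n (Y u v) i)

-- Each cell is chosen by as many values of `r` as its weight says. The surplus `x` counts the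
-- values beyond the total weight, which choose nothing and so avoid A.
count-avoiding : ∀ A Y es x →
  sum< (x + weight Y es) (λ r → avoids A (pick Y es r)) + weight (restrict A Y) es ≡ x + weight Y es
count-avoiding A Y []             x = trans (+-identityʳ _) (trans (sum-const (x + 0) 1) (*-identityʳ (x + 0)))
count-avoiding A Y ((u , v) ∷ es) x = begin
  sum< (x + (y + w)) f + (b * y + w′)
    ≡⟨ cong (λ z → sum< z f + (b * y + w′)) (lem₁ x y w) ⟩
  sum< ((x + w) + y) f + (b * y + w′)
    ≡⟨ cong (_+ (b * y + w′)) (sum-split (x + w) y f) ⟩
  sum< (x + w) (λ i → f (y + i)) + sum< y f + (b * y + w′)
    ≡⟨ cong₂ (λ p q → p + q + (b * y + w′))
         (sum-cong (x + w) λ i _ → cong (avoids A) (pick-skip Y u v es i))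
         (sum-product-δ y f (bit (not (A u v))) λ i i<y → cong (avoids A) (pick-hit Y u v es i<y)) ⟩
  sum< (x + w) (λ i → avoids A (pick Y es i)) + y * b′ + (b * y + w′)
    ≡⟨ lem₂ (sum< (x + w) (λ i → avoids A (pick Y es i))) (y * b′) (b * y) w′ ⟩
  (sum< (x + w) (λ i → avoids A (pick Y es i)) + w′) + (y * b′ + b * y)
    ≡⟨ cong₂ _+_ (count-avoiding A Y es x) (lem₃ (A u v)) ⟩
  (x + w) + y
    ≡⟨ sym (lem₁ x y w) ⟩
  x + (y + w) ∎
  where
  open ≡-Reasoning
  y = Y u v
  w = weight Y es
  w′ = weight (restrict A Y) es
  b = bit (A u v)
  b′ = bit (not (A u v))
  f = λ r → avoids A (pick Y ((u , v) ∷ es) r)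
  lem₁ : ∀ x y w → x + (y + w) ≡ (x + w) + y
  lem₁ = solve-∀
  lem₂ : ∀ a b c d → a + b + (c + d) ≡ (a + d) + (b + c)
  lem₂ = solve-∀
  lem₃ : ∀ c → y * bit (not c) + bit c * y ≡ y
  lem₃ true  = trans (cong (_+ (y + 0)) (*-zeroʳ y)) (+-identityʳ y)
  lem₃ false = trans (+-identityʳ _) (*-identityʳ y)

avoiding-draws : ∀ n M A Y → sum² n Y ≤ M →
  sum< M (λ r → avoids A (pick Y (cells n n) r)) ≤ M ∸ sum² n (restrict A Y)
avoiding-draws n M A Y h = begin
  sum< M f                  ≡⟨ sym (m+n∸n≡m (sum< M f) δ′) ⟩
  sum< M f + δ′ ∸ δ′        ≡⟨ cong (λ z → sum< z f + δ′ ∸ δ′) (sym eq) ⟩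
  sum< (x + weight Y es) f + δ′ ∸ δ′
    ≡⟨ cong (λ z → sum< (x + weight Y es) f + z ∸ δ′) (sym (weight-rows (restrict A Y) n n)) ⟩
  sum< (x + weight Y es) f + weight (restrict A Y) es ∸ δ′
    ≡⟨ cong (_∸ δ′) (count-avoiding A Y es x) ⟩
  x + weight Y es ∸ δ′      ≡⟨ cong (_∸ δ′) eq ⟩
  M ∸ δ′                    ∎
  where
  open ≤-Reasoning
  es = cells n n
  δ′ = sum² n (restrict A Y)
  f = λ r → avoids A (pick Y es r)
  x = M ∸ sum² n Y
  eq : x + weight Y es ≡ M
  eq = trans (cong (x +_) (weight-rows Y n n)) (m∸n+n≡m h)

-- Exponential weights

-- Two terms of the binomial expansion. They yield (1 + 1/M) ^ M ≥ 2 and (1 - 1/g) ^ g ≤ 1/2, the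
-- only estimates of exponentials that the proof uses.
bernoulli : ∀ M k → M ^ suc k + suc k * M ^ k ≤ suc M ^ suc k
bernoulli M zero    = ≤-reflexive (lem M)
  where
  lem : ∀ M → M * 1 + 1 * 1 ≡ suc M * 1
  lem = solve-∀
bernoulli M (suc k) = begin
  M * (M * m) + suc (suc k) * (M * m)            ≤⟨ m≤m+n _ (suc k * m) ⟩
  M * (M * m) + suc (suc k) * (M * m) + suc k * m ≡⟨ lem M m k ⟩
  suc M * (M * m + suc k * m)                    ≤⟨ *-monoʳ-≤ (suc M) (bernoulli M k) ⟩
  suc M * suc M ^ suc k                          ∎
  where
  open ≤-Reasoning
  m = M ^ k
  lem : ∀ M m k → M * (M * m) + suc (suc k) * (M * m) + suc k * m ≡ suc M * (M * m + suc k * m)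
  lem = solve-∀

double-power : ∀ M → 1 ≤ M → 2 * M ^ M ≤ suc M ^ M
double-power (suc k) _ = ≤-trans (≤-reflexive (lem (suc k) (suc k ^ k))) (bernoulli (suc k) k)
  where
  lem : ∀ M m → 2 * (M * m) ≡ M * m + M * m
  lem = solve-∀

halve-power : ∀ g → 1 ≤ g → 2 * (g ∸ 1) ^ g ≤ g ^ g
halve-power (suc M) _ = ≤-trans (≤-trans (≤-reflexive (lem M (M ^ M))) (+-monoʳ-≤ (M * M ^ M) (m≤n+m (M * M ^ M) (M ^ M)))) (bernoulli M M)
  where
  lem : ∀ M m → 2 * (M * m) ≡ M * m + M * m
  lem = solve-∀

power-product : ∀ a b k → (a * b) ^ k ≡ a ^ k * b ^ k
power-product a b zero    = refl
power-product a b (suc k) = trans (cong (a * b *_) (power-product a b k)) ([m*n]*[o*p]≡[m*o]*[n*p] a b (a ^ k) (b ^ k))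

-- That is, 1 - y/M ≤ (1 + 1/M) ^ -y. It follows one unit at a time from (M - y - 1) (M + 1) ≤ M (M
-- - y).
draw-loss : ∀ M y → y ≤ M → (M ∸ y) * suc M ^ y ≤ M * M ^ y
draw-loss M zero    h = ≤-refl
draw-loss M (suc y) h = begin
  (M ∸ suc y) * (suc M * s)    ≡⟨ sym (*-assoc (M ∸ suc y) (suc M) s) ⟩
  (M ∸ suc y) * suc M * s      ≤⟨ *-monoˡ-≤ s step ⟩
  M * (M ∸ y) * s              ≡⟨ *-assoc M (M ∸ y) s ⟩
  M * ((M ∸ y) * s)            ≤⟨ *-monoʳ-≤ M (draw-loss M y (<⇒≤ h)) ⟩
  M * (M * M ^ y)              ∎
  where
  open ≤-Reasoning
  s = suc M ^ y
  z = M ∸ suc y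
  z≤M : z ≤ M
  z≤M = m∸n≤m M (suc y)
  step : z * suc M ≤ M * (M ∸ y)
  step = begin
    z * suc M   ≡⟨ *-suc z M ⟩
    z + z * M   ≤⟨ +-monoˡ-≤ (z * M) z≤M ⟩
    M + z * M   ≡⟨ *-comm (suc z) M ⟩
    M * suc z   ≡⟨ cong (M *_) (sym (+-∸-assoc 1 h)) ⟩
    M * (M ∸ y) ∎

-- The weight (1 + 1/M) ^ (K y), scaled by M ^ (K T).
module Exponential (M K T : ℕ) where

  base : ℕ → ℕ
  base y = suc M ^ y * M ^ (T ∸ y)

  wt : ℕ → ℕ
  wt y = base y ^ K

  base-step : ∀ y z → y ≤ M → z + y ≤ T → (M ∸ y) * base (z + y) ≤ M * base z
  base-step y z h h′ = begin
    (M ∸ y) * (suc M ^ (z + y) * M ^ (T ∸ (z + y)))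
      ≡⟨ cong (λ p → (M ∸ y) * (p * R)) (^-distribˡ-+-* (suc M) z y) ⟩
    (M ∸ y) * (suc M ^ z * suc M ^ y * R)       ≡⟨ lem₁ (M ∸ y) (suc M ^ z) (suc M ^ y) R ⟩
    (M ∸ y) * suc M ^ y * (suc M ^ z * R)       ≤⟨ *-monoˡ-≤ (suc M ^ z * R) (draw-loss M y h) ⟩
    M * M ^ y * (suc M ^ z * R)                 ≡⟨ lem₂ M (M ^ y) (suc M ^ z) R ⟩
    M * (suc M ^ z * (M ^ y * R))               ≡⟨ cong (λ p → M * (suc M ^ z * p)) (sym (^-distribˡ-+-* M y _)) ⟩
    M * (suc M ^ z * M ^ (y + (T ∸ (z + y))))   ≡⟨ cong (λ p → M * (suc M ^ z * M ^ p)) expo ⟩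
    M * (suc M ^ z * M ^ (T ∸ z))               ∎
    where
    open ≤-Reasoning
    R = M ^ (T ∸ (z + y))
    lem₁ : ∀ a b c d → a * (b * c * d) ≡ a * c * (b * d)
    lem₁ = solve-∀
    lem₂ : ∀ a b c d → a * b * (c * d) ≡ a * (c * (b * d))
    lem₂ = solve-∀
    expo : y + (T ∸ (z + y)) ≡ T ∸ z
    expo = trans (cong (y +_) (sym (∸-+-assoc T z y))) (m+[n∸m]≡n (m+n≤o⇒m≤o∸n y (≤-trans (≤-reflexive (+-comm y z)) h′)))

  -- The supermartingale step for one code: the chance (1 - y/M) ^ K of missing weight y in K draws
  -- makes up for the factor (1 + 1/M) ^ (K y) by which `wt` grows when y is added.
  wt-step : ∀ y z → y ≤ M → z + y ≤ T → (M ∸ y) ^ K * wt (z + y) ≤ M ^ K * wt z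
  wt-step y z h h′ = ≤-trans (≤-reflexive (sym (power-product (M ∸ y) (base (z + y)) K)))
    (≤-trans (^-monoˡ-≤ K (base-step y z h h′)) (≤-reflexive (power-product M (base z) K)))

  base-mono : ∀ y d → y + d ≤ T → base y ≤ base (y + d)
  base-mono y d h = begin
    suc M ^ y * M ^ (T ∸ y)                ≡⟨ cong (λ p → suc M ^ y * M ^ p) (sym expo) ⟩
    suc M ^ y * M ^ (d + (T ∸ (y + d)))    ≡⟨ cong (suc M ^ y *_) (^-distribˡ-+-* M d _) ⟩
    suc M ^ y * (M ^ d * R)                ≤⟨ *-monoʳ-≤ (suc M ^ y) (*-monoˡ-≤ R (^-monoˡ-≤ d (n≤1+n M))) ⟩
    suc M ^ y * (suc M ^ d * R)            ≡⟨ sym (*-assoc (suc M ^ y) _ _) ⟩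
    suc M ^ y * suc M ^ d * R              ≡⟨ cong (_* R) (sym (^-distribˡ-+-* (suc M) y d)) ⟩
    suc M ^ (y + d) * R                    ∎
    where
    open ≤-Reasoning
    R = M ^ (T ∸ (y + d))
    expo : d + (T ∸ (y + d)) ≡ T ∸ y
    expo = trans (cong (d +_) (sym (∸-+-assoc T y d)))
      (m+[n∸m]≡n (≤-trans (≤-reflexive (sym (m+n∸m≡n y d))) (∸-monoˡ-≤ y h)))

  wt-mono : ∀ {y z} → y ≤ z → z ≤ T → wt y ≤ wt z
  wt-mono {y} {z} p h with m+[n∸m]≡n p
  ... | eq = ^-monoˡ-≤ K (≤-trans (base-mono y (z ∸ y) (≤-trans (≤-reflexive eq) h)) (≤-reflexive (cong base eq)))

-- With K = 2 L and M - H = M / 2 the quotient of the two weights is (1 + 1/M) ^ (L M), and (1 +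
-- 1/M) ^ M ≥ 2.
wt-gain : ∀ M H L T → 1 ≤ M → H + H ≡ M → M ≤ T →
  2 ^ L * Exponential.wt M (2 * L) T H ≤ Exponential.wt M (2 * L) T M
wt-gain M H L T 1≤M 2H≡M M≤T = begin
  2 ^ L * (suc M ^ H * M ^ (T ∸ H)) ^ (2 * L)
    ≡⟨ cong (2 ^ L *_) (sym (^-*-assoc (suc M ^ H * M ^ (T ∸ H)) 2 L)) ⟩
  2 ^ L * ((suc M ^ H * M ^ (T ∸ H)) ^ 2) ^ L
    ≡⟨ sym (power-product 2 _ L) ⟩
  (2 * (suc M ^ H * M ^ (T ∸ H)) ^ 2) ^ L
    ≤⟨ ^-monoˡ-≤ L core ⟩
  ((suc M ^ M * M ^ (T ∸ M)) ^ 2) ^ L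
    ≡⟨ ^-*-assoc _ 2 L ⟩
  (suc M ^ M * M ^ (T ∸ M)) ^ (2 * L) ∎
  where
  open ≤-Reasoning
  a = suc M ^ H
  R = M ^ (T ∸ M)
  b = M ^ H
  expo : T ∸ H ≡ H + (T ∸ M)
  expo = trans (sym (m+[n∸m]≡n (m+n≤o⇒m≤o∸n H (≤-trans (≤-reflexive 2H≡M) M≤T))))
               (cong (H +_) (trans (∸-+-assoc T H H) (cong (T ∸_) 2H≡M)))
  lem₁ : ∀ a b R → 2 * ((a * (b * R)) * ((a * (b * R)) * 1)) ≡ (a * a) * (2 * (b * b)) * (R * R)
  lem₁ = solve-∀
  lem₂ : ∀ x R → (x * x) * (R * R) ≡ (x * R) * ((x * R) * 1)
  lem₂ = solve-∀
  aa : a * a ≡ suc M ^ M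
  aa = trans (sym (^-distribˡ-+-* (suc M) H H)) (cong (suc M ^_) 2H≡M)
  bb : b * b ≡ M ^ M
  bb = trans (sym (^-distribˡ-+-* M H H)) (cong (M ^_) 2H≡M)
  core : 2 * (suc M ^ H * M ^ (T ∸ H)) ^ 2 ≤ (suc M ^ M * R) ^ 2
  core = begin
    2 * (a * M ^ (T ∸ H)) ^ 2        ≡⟨ cong (λ p → 2 * (a * p) ^ 2) (trans (cong (M ^_) expo) (^-distribˡ-+-* M H _)) ⟩
    2 * (a * (b * R)) ^ 2            ≡⟨ lem₁ a b R ⟩
    (a * a) * (2 * (b * b)) * (R * R) ≡⟨ cong₂ (λ p q → p * (2 * q) * (R * R)) aa bb ⟩
    suc M ^ M * (2 * M ^ M) * (R * R) ≤⟨ *-monoˡ-≤ (R * R) (*-monoʳ-≤ (suc M ^ M) (double-power M 1≤M)) ⟩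
    suc M ^ M * suc M ^ M * (R * R)  ≡⟨ lem₂ (suc M ^ M) R ⟩
    (suc M ^ M * R) ^ 2              ∎

-- Families of labelled sets

module _ {A : Set} where

  sumL : (A → ℕ) → List A → ℕ
  sumL f []       = 0
  sumL f (x ∷ xs) = f x + sumL f xs

  sumL-mono : ∀ {f g} xs → (∀ x → f x ≤ g x) → sumL f xs ≤ sumL g xs
  sumL-mono []       h = z≤n
  sumL-mono (x ∷ xs) h = +-mono-≤ (h x) (sumL-mono xs h)

  sumL-* : ∀ c f xs → sumL (λ x → c * f x) xs ≡ c * sumL f xs
  sumL-* c f []       = sym (*-zeroʳ c)
  sumL-* c f (x ∷ xs) = trans (cong (c * f x +_) (sumL-* c f xs)) (sym (*-distribˡ-+ c (f x) _))

  sumL-bound : ∀ {f} c xs → (∀ x → f x ≤ c) → sumL f xs ≤ length xs * c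
  sumL-bound c []       h = z≤n
  sumL-bound c (x ∷ xs) h = +-mono-≤ (h x) (sumL-bound c xs h)

  sumL-∈ : ∀ {x} f xs → x ∈ᴸ xs → f x ≤ sumL f xs
  sumL-∈ f (x ∷ xs) (Any.here refl) = m≤m+n _ _
  sumL-∈ f (x ∷ xs) (Any.there p)   = ≤-trans (sumL-∈ f xs p) (m≤n+m _ _)

  words : List A → ℕ → List (List A)
  words as zero    = [] ∷ []
  words as (suc k) = cartesianProductWith _∷_ as (words as k)

  words-∈ : ∀ as w → (∀ {x} → x ∈ᴸ w → x ∈ᴸ as) → w ∈ᴸ words as (length w)
  words-∈ as []      h = Any.here refl
  words-∈ as (x ∷ w) h = ∈-cartesianProductWith⁺ _∷_ (h (Any.here refl)) (words-∈ as w (h ∘ Any.there))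

length-productWith : ∀ {A B C : Set} (f : A → B → C) xs ys →
  length (cartesianProductWith f xs ys) ≡ length xs * length ys
length-productWith f []       ys = refl
length-productWith f (x ∷ xs) ys =
  trans (length-++ (map (f x) ys)) (cong₂ _+_ (length-map (f x) ys) (length-productWith f xs ys))

length-words : ∀ {A : Set} (as : List A) k → length (words as k) ≡ length as ^ k
length-words as zero    = refl
length-words as (suc k) = trans (length-productWith _∷_ as (words as k)) (cong (length as *_) (length-words as k))

Code : Set
Code = List (ℕ × ℕ)

has : ℕ → (ℕ → Bool) → ℕ × ℕ → Bool
has u f (x , a) = (x ≡ᵇ u) ∧ f a

-- A code is read as a partial labelling of vertices. Labels that differ by at least 2 are what a
-- jump shows when the labels are distances from s in the solution.
jump : Code → ℕ → ℕ → Bool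
jump c u v = any (has u λ a → any (has v λ b → suc a <ᵇ b) c) c

any-sound : ∀ {u} f (c : Code) → any (has u f) c ≡ true → ∃[ a ] (u , a) ∈ᴸ c × f a ≡ true
any-sound {u} f ((x , a) ∷ c) h with x ≡ᵇ u in eq | f a in fa
... | true  | true  with refl ← ≡ᵇ⇒≡ x u (≡⇒T eq) = a , Any.here refl , fa
... | true  | false with any-sound f c h
...   | b , p , q = b , Any.there p , q
any-sound {u} f ((x , a) ∷ c) h | false | _ with any-sound f c h
...   | b , p , q = b , Any.there p , q

any-complete : ∀ {u a} f (c : Code) → (u , a) ∈ᴸ c → f a ≡ true → any (has u f) c ≡ true
any-complete {u} f (_ ∷ c) (Any.here refl) fa rewrite ≡ᵇ-refl u | fa = refl
any-complete {u} f (e ∷ c) (Any.there p)   fa rewrite any-complete f c p fa = ∨-zeroʳ (has u f e)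

-- Labels go up to n inclusive, since n stands for an infinite distance.
alphabet : ℕ → List (ℕ × ℕ)
alphabet n = cartesianProductWith _,_ (upTo n) (upTo (suc n))

length-alphabet : ∀ n → length (alphabet n) ≡ n * suc n
length-alphabet n = trans (length-productWith _,_ (upTo n) (upTo (suc n))) (cong₂ _*_ (length-upTo n) (length-upTo (suc n)))

module _ (L : ℕ → Bool) (h : ℕ → ℕ) where

  graphOn : ℕ → Code
  graphOn zero    = []
  graphOn (suc v) = if L v then (v , h v) ∷ graphOn v else graphOn v

  length-graphOn : ∀ n → length (graphOn n) ≡ sum< n (bit ∘ L)
  length-graphOn zero    = refl
  length-graphOn (suc n) with L n
  ... | true  = cong suc (length-graphOn n)
  ... | false = length-graphOn n

  OnGraph : ℕ → ℕ × ℕ → Set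
  OnGraph n (v , a) = v < n × L v ≡ true × a ≡ h v

  graphOn-sound : ∀ n {e} → e ∈ᴸ graphOn n → OnGraph n e
  graphOn-sound (suc n) p with L n in eq
  graphOn-sound (suc n) (Any.here refl) | true = ≤-refl , eq , refl
  graphOn-sound (suc n) (Any.there p)   | true with graphOn-sound n p
  ... | a , b , c = m<n⇒m<1+n a , b , c
  graphOn-sound (suc n) p | false with graphOn-sound n p
  ... | a , b , c = m<n⇒m<1+n a , b , c

  graphOn-complete : ∀ n {v} → v < n → L v ≡ true → (v , h v) ∈ᴸ graphOn n
  graphOn-complete (suc n) {v} v<1+n Lv with m≤n⇒m<n∨m≡n (≤-pred v<1+n)
  ... | inj₂ refl rewrite Lv = Any.here refl
  ... | inj₁ v<n with L n
  ...   | true  = Any.there (graphOn-complete n v<n Lv)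
  ...   | false = graphOn-complete n v<n Lv

  -- Padding with copies of (s , h s) gives all codes the same length.
  encode : ∀ n k s → s < n → L s ≡ true → (∀ v → v < n → h v ≤ n) → sum< n (bit ∘ L) ≤ k →
    ∃[ c ] c ∈ᴸ words (alphabet n) k ×
           (∀ u v → u < n → v < n → jump c u v ≡ (L u ∧ L v ∧ (suc (h u) <ᵇ h v)))
  encode n k s s<n Ls h≤n size≤k =
    c , subst (λ l → c ∈ᴸ words (alphabet n) l) length-c (words-∈ (alphabet n) c letters) , spec
    where
    pad = k ∸ sum< n (bit ∘ L)
    c = replicate pad (s , h s) ++ graphOn n
    length-c : length c ≡ k
    length-c = trans (length-++ (replicate pad (s , h s)))
      (trans (cong₂ _+_ (length-replicate pad) (length-graphOn n)) (m∸n+n≡m size≤k))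
    sound : ∀ j {e} → e ∈ᴸ replicate j (s , h s) ++ graphOn n → OnGraph n e
    sound zero    p               = graphOn-sound n p
    sound (suc j) (Any.here refl) = s<n , Ls , refl
    sound (suc j) (Any.there p)   = sound j p
    complete : ∀ j {e} → e ∈ᴸ graphOn n → e ∈ᴸ replicate j (s , h s) ++ graphOn n
    complete zero    p = p
    complete (suc j) p = Any.there (complete j p)
    letters : ∀ {e} → e ∈ᴸ c → e ∈ᴸ alphabet n
    letters p with sound pad p
    ... | v<n , _ , refl = ∈-cartesianProductWith⁺ _,_ (∈-upTo⁺ v<n) (∈-upTo⁺ (s≤s (h≤n _ v<n)))
    bool-≡ : ∀ {x y} → (x ≡ true → y ≡ true) → (y ≡ true → x ≡ true) → x ≡ y
    bool-≡ {true}  {true}  f g = refl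
    bool-≡ {true}  {false} f g = sym (f refl)
    bool-≡ {false} {true}  f g = g refl
    bool-≡ {false} {false} f g = refl
    ∧-intro : ∀ {x y} → x ≡ true → y ≡ true → x ∧ y ≡ true
    ∧-intro refl refl = refl
    spec : ∀ u v → u < n → v < n → jump c u v ≡ (L u ∧ L v ∧ (suc (h u) <ᵇ h v))
    spec u v u<n v<n = bool-≡ to from
      where
      to : jump c u v ≡ true → (L u ∧ L v ∧ (suc (h u) <ᵇ h v)) ≡ true
      to j with any-sound (λ a → any (has v λ b → suc a <ᵇ b) c) c j
      ... | a , p , q with any-sound (λ b → suc a <ᵇ b) c q | sound pad p
      ...   | b , r , lt | _ , Lu , refl with sound pad r
      ...     | _ , Lv , refl = ∧-intro Lu (∧-intro Lv lt)
      from : (L u ∧ L v ∧ (suc (h u) <ᵇ h v)) ≡ true → jump c u v ≡ true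
      from eq with ∧-split {L u} eq
      ... | Lu , eq′ with ∧-split {L v} eq′
      ...   | Lv , lt = any-complete (λ a → any (has v λ b → suc a <ᵇ b) c) c (complete pad (graphOn-complete n u<n Lu))
                          (any-complete (λ b → suc (h u) <ᵇ b) c (complete pad (graphOn-complete n v<n Lv)) lt)

-- Sums over coin outcomes

sumV : ∀ R → (Vec Bool R → ℕ) → ℕ
sumV zero    f = f Vec.[]
sumV (suc R) f = sumV R (f ∘ (true Vec.∷_)) + sumV R (f ∘ (false Vec.∷_))

sumV-mono : ∀ R {f g} → (∀ v → f v ≤ g v) → sumV R f ≤ sumV R g
sumV-mono zero    h = h Vec.[]
sumV-mono (suc R) h = +-mono-≤ (sumV-mono R (h ∘ (true Vec.∷_))) (sumV-mono R (h ∘ (false Vec.∷_)))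

sumV-cong : ∀ R {f g} → (∀ v → f v ≡ g v) → sumV R f ≡ sumV R g
sumV-cong zero    h = h Vec.[]
sumV-cong (suc R) h = cong₂ _+_ (sumV-cong R (h ∘ (true Vec.∷_))) (sumV-cong R (h ∘ (false Vec.∷_)))

sumV-const : ∀ R c → sumV R (λ _ → c) ≡ 2 ^ R * c
sumV-const zero    c = sym (+-identityʳ c)
sumV-const (suc R) c = trans (cong₂ _+_ (sumV-const R c) (sumV-const R c)) (lem (2 ^ R) c)
  where
  lem : ∀ p c → p * c + p * c ≡ (2 * p) * c
  lem = solve-∀

sumV-+ : ∀ R f g → sumV R (λ v → f v + g v) ≡ sumV R f + sumV R g
sumV-+ zero    f g = refl
sumV-+ (suc R) f g = trans (cong₂ _+_ (sumV-+ R _ _) (sumV-+ R _ _)) (+-interchange (sumV R (f ∘ (true Vec.∷_))) _ _ _)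

sumV-* : ∀ R c f → sumV R (λ v → c * f v) ≡ c * sumV R f
sumV-* zero    c f = refl
sumV-* (suc R) c f = trans (cong₂ _+_ (sumV-* R c _) (sumV-* R c _)) (sym (*-distribˡ-+ c (sumV R (f ∘ (true Vec.∷_))) _))

sumV-sumL : ∀ {A : Set} R (f : Vec Bool R → A → ℕ) xs →
  sumV R (λ v → sumL (f v) xs) ≡ sumL (λ x → sumV R (λ v → f v x)) xs
sumV-sumL R f []       = trans (sumV-const R 0) (*-zeroʳ (2 ^ R))
sumV-sumL R f (x ∷ xs) = trans (sumV-+ R (λ v → f v x) _) (cong (sumV R (λ v → f v x) +_) (sumV-sumL R f xs))

sumV-++ : ∀ m n f → sumV (m + n) f ≡ sumV m (λ v → sumV n (λ w → f (v ++ᵛ w)))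
sumV-++ zero    n f = refl
sumV-++ (suc m) n f = cong₂ _+_ (sumV-++ m n _) (sumV-++ m n _)

sumV-product : ∀ m n f g → sumV m (λ v → sumV n (λ w → f v * g w)) ≡ sumV m f * sumV n g
sumV-product m n f g =
  trans (sumV-cong m λ v → trans (sumV-* n (f v) g) (*-comm (f v) (sumV n g)))
        (trans (sumV-* m (sumV n g) f) (*-comm (sumV n g) (sumV m f)))

select-outcomes : ∀ R → (Vec Bool R → Bool) → List (Vec Bool R)
select-outcomes zero    p = if p Vec.[] then Vec.[] ∷ [] else []
select-outcomes (suc R) p =
  map (true Vec.∷_) (select-outcomes R (p ∘ (true Vec.∷_))) ++ map (false Vec.∷_) (select-outcomes R (p ∘ (false Vec.∷_)))

length-select : ∀ R p → length (select-outcomes R p) ≡ sumV R (bit ∘ p)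
length-select zero    p with p Vec.[]
... | true  = refl
... | false = refl
length-select (suc R) p =
  trans (length-++ (map (true Vec.∷_) (select-outcomes R (p ∘ (true Vec.∷_)))))
        (cong₂ _+_ (half true) (half false))
  where
  half : ∀ x → length (map (x Vec.∷_) (select-outcomes R (p ∘ (x Vec.∷_)))) ≡ sumV R (bit ∘ p ∘ (x Vec.∷_))
  half x = trans (length-map (x Vec.∷_) (select-outcomes R (p ∘ (x Vec.∷_)))) (length-select R (p ∘ (x Vec.∷_)))

select-∈ : ∀ R p v → p v ≡ true → v ∈ᴸ select-outcomes R p
select-∈ zero    p Vec.[]           h rewrite h = Any.here refl
select-∈ (suc R) p (true Vec.∷ v)  h = ∈-++⁺ˡ (∈-map⁺ (true Vec.∷_) (select-∈ R _ v h))
select-∈ (suc R) p (false Vec.∷ v) h =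
  ∈-++⁺ʳ (map (true Vec.∷_) (select-outcomes R (p ∘ (true Vec.∷_)))) (∈-map⁺ (false Vec.∷_) (select-∈ R _ v h))

-- The padding is arbitrary: by `run-cong` only coins that are actually tossed matter.
ext : ∀ {R} → Vec Bool R → Coins
ext Vec.[]      _       = false
ext (x Vec.∷ v) zero    = x
ext (x Vec.∷ v) (suc k) = ext v k

ext-++ˡ : ∀ {R R′} (v : Vec Bool R) (w : Vec Bool R′) k → k < R → ext (v ++ᵛ w) k ≡ ext v k
ext-++ˡ (x Vec.∷ v) w zero    h       = refl
ext-++ˡ (x Vec.∷ v) w (suc k) (s≤s h) = ext-++ˡ v w k h

ext-++ʳ : ∀ {R R′} (v : Vec Bool R) (w : Vec Bool R′) k → ext (v ++ᵛ w) (R + k) ≡ ext w k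
ext-++ʳ Vec.[]      w k = refl
ext-++ʳ (x Vec.∷ v) w k = ext-++ʳ v w k

ext-tabulate : ∀ R (ω : Coins) k → k < R → ext (tabulate {n = R} (λ i → ω (toℕ i))) k ≡ ω k
ext-tabulate (suc R) ω zero    h       = refl
ext-tabulate (suc R) ω (suc k) (s≤s h) = ext-tabulate R (ω ∘ suc) k h

-- Binary notation with the most significant bit first, as the tossing loop accumulates it.
val : Coins → ℕ → ℕ → ℕ → ℕ
val ω o zero    acc = acc
val ω o (suc b) acc = val ω (suc o) b (acc + acc + bit (ω o))

-- The draw with the highest index is tossed first, as loops count down.
drawn : Coins → (o b K : ℕ) → ℕ → ℕ
drawn ω o b zero    i = 0
drawn ω o b (suc K) i = if i ≡ᵇ K then val ω o b 0 else drawn ω (b + o) b K i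

val-shift : ∀ {ω ω′ o o′} b acc → (∀ k → ω (o + k) ≡ ω′ (o′ + k)) → val ω o b acc ≡ val ω′ o′ b acc
val-shift zero    acc h = refl
val-shift {ω} {ω′} {o} {o′} (suc b) acc h =
  trans (val-shift {ω} {ω′} b _ λ k → trans (cong ω (sym (+-suc o k))) (trans (h (suc k)) (cong ω′ (+-suc o′ k))))
        (cong (λ x → val ω′ (suc o′) b (acc + acc + bit x))
              (trans (cong ω (sym (+-identityʳ o))) (trans (h 0) (cong ω′ (+-identityʳ o′)))))

drawn-shift : ∀ {ω ω′ o o′} b K i → (∀ k → ω (o + k) ≡ ω′ (o′ + k)) → drawn ω o b K i ≡ drawn ω′ o′ b K i
drawn-shift b zero    i h = refl
drawn-shift {ω} {ω′} {o} {o′} b (suc K) i h with i ≡ᵇ K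
... | true  = val-shift {ω} {ω′} b 0 h
... | false = drawn-shift {ω} {ω′} b K i λ k →
  trans (cong ω (lem b o k)) (trans (h (b + k)) (cong ω′ (sym (lem b o′ k))))
  where
  lem : ∀ b o k → b + o + k ≡ o + (b + k)
  lem = solve-∀

-- The first coin decides between the upper and the lower half of the interval, and the induction
-- hypothesis covers each half.
val-uniform : ∀ b (f : ℕ → ℕ) acc → sumV b (λ w → f (val (ext w) 0 b acc)) ≡ sum< (2 ^ b) (λ r → f (acc * 2 ^ b + r))
val-uniform zero    f acc = trans (cong f (sym (trans (+-identityʳ _) (*-identityʳ acc)))) (sym (+-identityʳ (f (acc * 1 + 0))))
val-uniform (suc b) f acc = begin
  sumV b (λ w → f (val (ext (true Vec.∷ w)) 1 b (acc + acc + 1))) +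
  sumV b (λ w → f (val (ext (false Vec.∷ w)) 1 b (acc + acc + 0)))
    ≡⟨ cong₂ _+_ (half true 1) (half false 0) ⟩
  sum< p (λ r → f ((acc + acc + 1) * p + r)) + sum< p (λ r → f ((acc + acc + 0) * p + r))
    ≡⟨ cong₂ _+_ (sum-cong p λ r _ → cong f (lem₁ acc p r))
                 (trans (sum-cong p λ r _ → cong f (lem₀ acc p r)) (cong (λ q → sum< q g) (sym (+-identityʳ p)))) ⟩
  sum< p (λ r → g (p + 0 + r)) + sum< (p + 0) g
    ≡⟨ sym (sum-split p (p + 0) g) ⟩
  sum< (2 ^ suc b) g ∎
  where
  open ≡-Reasoning
  p = 2 ^ b
  g = λ r → f (acc * 2 ^ suc b + r)
  half : ∀ x e → sumV b (λ w → f (val (ext (x Vec.∷ w)) 1 b (acc + acc + e))) ≡ sum< p (λ r → f ((acc + acc + e) * p + r))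
  half x e = trans (sumV-cong b λ w → cong f (val-shift {ext (x Vec.∷ w)} {ext w} {1} {0} b (acc + acc + e) λ k → refl)) (val-uniform b f (acc + acc + e))
  lem₁ : ∀ a p r → (a + a + 1) * p + r ≡ a * (p + (p + 0)) + (p + 0 + r)
  lem₁ = solve-∀
  lem₀ : ∀ a p r → (a + a + 0) * p + r ≡ a * (p + (p + 0)) + r
  lem₀ = solve-∀

prod< : ℕ → (ℕ → ℕ) → ℕ
prod< zero    f = 1
prod< (suc n) f = f n * prod< n f

prod-mono : ∀ n {f g} → (∀ i → i < n → f i ≤ g i) → prod< n f ≤ prod< n g
prod-mono zero    h = ≤-refl
prod-mono (suc n) h = *-mono-≤ (h n ≤-refl) (prod-mono n λ i i<n → h i (m<n⇒m<1+n i<n))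

prod-cong : ∀ n {f g} → (∀ i → i < n → f i ≡ g i) → prod< n f ≡ prod< n g
prod-cong zero    h = refl
prod-cong (suc n) h = cong₂ _*_ (h n ≤-refl) (prod-cong n λ i i<n → h i (m<n⇒m<1+n i<n))

prod-const : ∀ n c → prod< n (λ _ → c) ≡ c ^ n
prod-const zero    c = refl
prod-const (suc n) c = cong (c *_) (prod-const n c)

-- Different draws read disjoint blocks of b coins, so the sum of a product over all coins is the
-- product of the sums.
draws-independent : ∀ b K (g : ℕ → ℕ → ℕ) →
  sumV (K * b) (λ w → prod< K (λ i → g i (drawn (ext w) 0 b K i))) ≡ prod< K (λ i → sum< (2 ^ b) (g i))
draws-independent b zero    g = refl
draws-independent b (suc K) g = begin
  sumV (b + K * b) f
    ≡⟨ sumV-++ b (K * b) f ⟩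
  sumV b (λ v → sumV (K * b) (λ w → f (v ++ᵛ w)))
    ≡⟨ sumV-cong b (λ v → sumV-cong (K * b) (λ w → cong₂ _*_ (first v w) (prod-cong K λ i i<K → rest v w i i<K))) ⟩
  sumV b (λ v → sumV (K * b) (λ w → g K (val (ext v) 0 b 0) * prod< K (λ i → g i (drawn (ext w) 0 b K i))))
    ≡⟨ sumV-product b (K * b) (λ v → g K (val (ext v) 0 b 0)) (λ w → prod< K (λ i → g i (drawn (ext w) 0 b K i))) ⟩
  sumV b (λ v → g K (val (ext v) 0 b 0)) * sumV (K * b) (λ w → prod< K (λ i → g i (drawn (ext w) 0 b K i)))
    ≡⟨ cong₂ _*_ (val-uniform b (g K) 0) (draws-independent b K g) ⟩
  sum< (2 ^ b) (g K) * prod< K (λ i → sum< (2 ^ b) (g i)) ∎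
  where
  open ≡-Reasoning
  f = λ w → prod< (suc K) (λ i → g i (drawn (ext w) 0 b (suc K) i))
  val-prefix : ∀ {R R′} (v : Vec Bool R) (w : Vec Bool R′) acc → val (ext (v ++ᵛ w)) 0 R acc ≡ val (ext v) 0 R acc
  val-prefix Vec.[]      w acc = refl
  val-prefix {suc R} (x Vec.∷ v) w acc =
    trans (val-shift {ext (x Vec.∷ (v ++ᵛ w))} {ext (v ++ᵛ w)} {1} {0} R (acc + acc + bit x) λ k → refl)
      (trans (val-prefix v w (acc + acc + bit x))
             (sym (val-shift {ext (x Vec.∷ v)} {ext v} {1} {0} R (acc + acc + bit x) λ k → refl)))
  first : ∀ v w → g K (drawn (ext (v ++ᵛ w)) 0 b (suc K) K) ≡ g K (val (ext v) 0 b 0)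
  first v w rewrite ≡ᵇ-refl K = cong (g K) (val-prefix v w 0)
  rest : ∀ v w i → i < K → g i (drawn (ext (v ++ᵛ w)) 0 b (suc K) i) ≡ g i (drawn (ext w) 0 b K i)
  rest v w i i<K rewrite ≢⇒≡ᵇ (<⇒≢ i<K) = cong (g i) (drawn-shift {ext (v ++ᵛ w)} {ext w} {b + 0} {0} b K i λ k →
    trans (cong (λ z → ext (v ++ᵛ w) (z + k)) (+-identityʳ b)) (ext-++ʳ v w k))

-- Rules for loops

∸-step : ∀ {k n} → k < n → n ∸ k ≡ suc (n ∸ suc k)
∸-step {zero}  (s≤s _) = refl
∸-step {suc k} (s≤s h) = ∸-step h

Keeps : Prog → State → State → Set
Keeps p S₀ S = ∀ a → untouched a p ≡ true → ∀ i j → memory S a i j ≡ memory S₀ a i j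

-- `I k` is the invariant with k iterations to come. `Keeps` supplies the frame property from the
-- start of the loop, so that invariants need only mention what the loop writes.
loop-rule : ∀ ω x b l p S₀ (I : ℕ → State → Set) →
  (∀ k S → k < memory S₀ b l 0 → Keeps (loop x b l p) S₀ S → I (suc k) S → I k (run ω p (assign x 0 0 k S))) →
  I (memory S₀ b l 0) (assign x 0 0 (memory S₀ b l 0) S₀) → I 0 (run ω (loop x b l p) S₀)
loop-rule ω x b l p S₀ I step h = proj₂ (proj₂ (iter-invariant
  (λ k S → k ≤ memory S₀ b l 0 × Keeps (loop x b l p) S₀ S × I k S)
  (λ k S (k<n , keep , i) → <⇒≤ k<n , keeps k S keep , step k S k<n keep i)
  (memory S₀ b l 0) _
  (≤-refl , (λ a u i j → write-other (memory S₀) x a 0 0 _ i j (proj₁ (∧-split {not (x ≡ᵇ a)} u))) , h)))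
  where
  keeps : ∀ k S → Keeps (loop x b l p) S₀ S → Keeps (loop x b l p) S₀ (run ω p (assign x 0 0 k S))
  keeps k S keep a u i j with ∧-split {not (x ≡ᵇ a)} u
  ... | v , w = trans (frame ω a p w _ i j) (trans (write-other (memory S) x a 0 0 k i j v) (keep a u i j))

run-select : ∀ ω e p q S (P : State → Set) → (eval (memory S) e ≢ 0 → P (run ω p S)) →
             (eval (memory S) e ≡ 0 → P (run ω q S)) → P (run ω (test e p q) S)
run-select ω e p q S P f g = select-elim P (eval (memory S) e) f g

record Overwritten (P : ℕ → ℕ → Set) (new old cur : Matrix) : Set where
  field
    inside  : ∀ i j → P i j → cur i j ≡ new i j
    outside : ∀ i j → ¬ P i j → cur i j ≡ old i j

open Overwritten

Inside : ℕ → ℕ → ℕ → Set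
Inside n i j = i < n × j < n

forEach : Prog → Prog
forEach p = loop 20 9 0 (loop 21 9 0 p)

module _ (ω : Coins) (A : ℕ) (p : Prog) (g : Matrix) (S₀ : State)
  (20≢A : not (20 ≡ᵇ A) ≡ true) (21≢A : not (21 ≡ᵇ A) ≡ true)
  (keeps20 : untouched 20 p ≡ true) (keeps9 : untouched 9 p ≡ true) where

  private
    n = memory S₀ 9 0 0

  -- Every cell is visited once, so at its turn it still holds its old value. This is what makes
  -- updates in place, such as raising the weights, fit the rule.
  forEach-rule :
    (∀ u v S → u < n → v < n → Keeps (forEach p) S₀ S →
       memory S 20 0 0 ≡ u → memory S 21 0 0 ≡ v → memory S A u v ≡ memory S₀ A u v →
       memory (run ω p S) A u v ≡ g u v ×
       (∀ i j → i ≢ u ⊎ j ≢ v → memory (run ω p S) A i j ≡ memory S A i j)) →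
    Overwritten (Inside n) g (memory S₀ A) (memory (run ω (forEach p) S₀) A)
  forEach-rule body = final (loop-rule ω 20 9 0 (loop 21 9 0 p) S₀ outer outer-step initial)
    where
    Row : ℕ → ℕ → ℕ → Set
    Row k i j = k ≤ i × Inside n i j
    outer : ℕ → State → Set
    outer k S = Overwritten (Row k) g (memory S₀ A) (memory S A)
    -- The finished cells are those with larger indices, both loops running downwards.
    Part : ℕ → ℕ → ℕ → ℕ → Set
    Part u k i j = (u < i ⊎ (i ≡ u × k ≤ j)) × Inside n i j

    final : outer 0 (run ω (forEach p) S₀) →
            Overwritten (Inside n) g (memory S₀ A) (memory (run ω (forEach p) S₀) A)
    final o .inside i j q  = inside o i j (z≤n , q)
    final o .outside i j q = outside o i j (q ∘ proj₂)

    initial : outer n (assign 20 0 0 n S₀)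
    initial .inside i j (n≤i , i<n , _) = contradiction i<n (≤⇒≯ n≤i)
    initial .outside i j _ = write-other (memory S₀) 20 A 0 0 n i j 20≢A

    outer-step : ∀ u S → u < n → Keeps (forEach p) S₀ S → outer (suc u) S →
                 outer u (run ω (loop 21 9 0 p) (assign 20 0 0 u S))
    outer-step u S u<n keep o = finish (loop-rule ω 21 9 0 p S₁ inner inner-step initial′)
      where
      S₁ = assign 20 0 0 u S
      n₁≡n : memory S₁ 9 0 0 ≡ n
      n₁≡n = keep 9 keeps9 0 0
      inner : ℕ → State → Set
      inner k S′ = Overwritten (Part u k) g (memory S₀ A) (memory S′ A)

      initial′ : inner (memory S₁ 9 0 0) (assign 21 0 0 (memory S₁ 9 0 0) S₁)
      initial′ .inside i j (inj₁ u<i , q) =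
        trans (write-other (memory S₁) 21 A 0 0 _ i j 21≢A)
          (trans (write-other (memory S) 20 A 0 0 u i j 20≢A) (inside o i j (u<i , q)))
      initial′ .inside i j (inj₂ (refl , n≤j) , _ , j<n) =
        contradiction j<n (≤⇒≯ (≤-trans (≤-reflexive (sym n₁≡n)) n≤j))
      initial′ .outside i j ¬q =
        trans (write-other (memory S₁) 21 A 0 0 _ i j 21≢A)
          (trans (write-other (memory S) 20 A 0 0 u i j 20≢A) (outside o i j λ (u<i , q) → ¬q (inj₁ u<i , q)))

      inner-step : ∀ v S′ → v < memory S₁ 9 0 0 → Keeps (loop 21 9 0 p) S₁ S′ → inner (suc v) S′ →
                   inner v (run ω p (assign 21 0 0 v S′))
      inner-step v S′ v<n keep′ o′ = result
        where
        S₂ = assign 21 0 0 v S′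
        keep₂ : Keeps (forEach p) S₀ S₂
        keep₂ a q i j with ∧-split {not (20 ≡ᵇ a)} q
        ... | q₁ , q₂ = trans (write-other (memory S′) 21 a 0 0 v i j (proj₁ (∧-split {not (21 ≡ᵇ a)} q₂)))
                          (trans (keep′ a q₂ i j) (trans (write-other (memory S) 20 a 0 0 u i j q₁) (keep a q i j)))
        fresh : memory S₂ A u v ≡ memory S₀ A u v
        fresh = trans (write-other (memory S′) 21 A 0 0 v u v 21≢A) (outside o′ u v λ
          { (inj₁ u<u , _) → <-irrefl refl u<u ; (inj₂ (_ , v<v) , _) → <-irrefl refl v<v })
        b = body u v S₂ u<n (≤-trans v<n (≤-reflexive n₁≡n)) keep₂ (keep′ 20 keeps20 0 0) refl fresh
        unchanged : ∀ i j → i ≢ u ⊎ j ≢ v → memory (run ω p S₂) A i j ≡ memory S′ A i j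
        unchanged i j ne = trans (proj₂ b i j ne) (write-other (memory S′) 21 A 0 0 v i j 21≢A)
        result : inner v (run ω p S₂)
        result .inside i j (q , ins) with i ≟ u | j ≟ v
        ... | yes refl | yes refl = proj₁ b
        ... | no i≢u   | _ = trans (unchanged i j (inj₁ i≢u)) (inside o′ i j (lem q , ins))
          where
          lem : (u < i ⊎ (i ≡ u × v ≤ j)) → (u < i ⊎ (i ≡ u × suc v ≤ j))
          lem (inj₁ x) = inj₁ x
          lem (inj₂ (e , _)) = contradiction e i≢u
        ... | yes refl | no j≢v = trans (unchanged i j (inj₂ j≢v)) (inside o′ i j (lem q , ins))
          where
          lem : (i < i ⊎ (i ≡ i × v ≤ j)) → (i < i ⊎ (i ≡ i × suc v ≤ j))
          lem (inj₁ x) = inj₁ x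
          lem (inj₂ (e , h)) = inj₂ (e , ≤∧≢⇒< h (j≢v ∘ sym))
        result .outside i j ¬q = trans (unchanged i j ne) (outside o′ i j λ
          { (inj₁ x , ins) → ¬q (inj₁ x , ins) ; (inj₂ (e , h) , ins) → ¬q (inj₂ (e , <⇒≤ h) , ins) })
          where
          ne : i ≢ u ⊎ j ≢ v
          ne with i ≟ u | j ≟ v
          ... | yes refl | yes refl = contradiction (inj₂ (refl , ≤-refl) , u<n , ≤-trans v<n (≤-reflexive n₁≡n)) ¬q
          ... | no i≢u   | _        = inj₁ i≢u
          ... | yes _    | no j≢v   = inj₂ j≢v

      finish : inner 0 (run ω (loop 21 9 0 p) S₁) → outer u (run ω (loop 21 9 0 p) S₁)
      finish o′ .inside i j (u≤i , ins) = inside o′ i j (split (m≤n⇒m<n∨m≡n u≤i) , ins)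
        where
        split : u < i ⊎ u ≡ i → u < i ⊎ (i ≡ u × 0 ≤ j)
        split (inj₁ x)    = inj₁ x
        split (inj₂ refl) = inj₂ (refl , z≤n)
      finish o′ .outside i j ¬q = outside o′ i j λ
        { (inj₁ x , ins) → ¬q (<⇒≤ x , ins) ; (inj₂ (refl , _) , ins) → ¬q (≤-refl , ins) }

-- The algorithm

pattern weightArray = 4
pattern hubArray    = 5
pattern phaseCell   = 6
pattern boughtCell  = 7
pattern stuckCell   = 8
pattern parArray    = 9
pattern drawArray   = 10
pattern boundCell   = 11
pattern distG       = 12
pattern distH       = 13
pattern candidates  = 14
pattern modeCell    = 15
pattern limitCell   = 16
pattern scratch     = 17
pattern foundCell   = 18
pattern xCell       = 22
pattern yCell       = 23
pattern rowCell     = 24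
pattern colCell     = 25
pattern parentCell  = 26

put₀ : ℕ → Expr → Prog
put₀ a e = put a (lit 0) (lit 0) e

par : ℕ → Expr
par i = parArray [ lit i ][ lit 0 ]

setPar : ℕ → Expr → Prog
setPar i e = put parArray (lit i) (lit 0) e

abstract
  -- The machine cannot multiply, so a constant factor is unrolled into additions. Abstract, lest
  -- sums of 64 terms unfold inside states.
  times : ℕ → Expr → Expr
  times zero    e = lit 0
  times (suc k) e = e ⊕ times k e

  eval-times : ∀ m k e → eval m (times k e) ≡ k * eval m e
  eval-times m zero    e = refl
  eval-times m (suc k) e = cong (eval m e +_) (eval-times m k e)

rows cols : Expr
rows = cell 20
cols = cell 21

src tgt : Expr
src = requestArray [ lit 0 ][ lit 0 ]
tgt = requestArray [ lit 0 ][ lit 1 ]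

-- With l least such that n ≤ 8 ^ l, parameter i holds: 0: n, 1: n - 1,
-- 2: the number 2 c (l + 1) 4 ^ l of draws per round, 3: the number 6 l + 1 of
-- coins per draw, 4: the number c (l + 1) 2 ^ l of hubs, 5: 2 * 64 ^ l,
-- 6: 16 ^ l, 7: 2 * 8 ^ l, 8: 2 ^ l, 9: 4 ^ l, 10: 8 ^ l.
module _ (c : ℕ) where

  growth : Prog
  growth =
    -- Uses 2 c (l + 2) 4 ^ (l + 1) = 4 · 2 c (l + 1) 4 ^ l + 8 c 4 ^ l. The old powers are read
    -- here and in parameter 4, so both precede the updates of parameters 9 and 8.
    setPar 2 (times 4 (par 2) ⊕ times (8 * c) (par 9)) ⟫
    setPar 3 (par 3 ⊕ lit 6) ⟫
    setPar 4 (times 2 (par 4) ⊕ times (2 * c) (par 8)) ⟫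
    setPar 5 (times 64 (par 5)) ⟫
    setPar 6 (times 16 (par 6)) ⟫
    setPar 7 (times 8 (par 7)) ⟫
    setPar 8 (times 2 (par 8)) ⟫
    setPar 9 (times 4 (par 9)) ⟫
    setPar 10 (times 8 (par 10))

  abstract
    smallest : Prog
    smallest =
      setPar 0 (cell orderArray) ⟫
      setPar 1 (cell orderArray ⊖ lit 1) ⟫
      setPar 2 (lit (2 * c)) ⟫
      setPar 3 (lit 1) ⟫
      setPar 4 (lit c) ⟫
      setPar 5 (lit 2) ⟫
      setPar 6 (lit 1) ⟫
      setPar 7 (lit 2) ⟫
      setPar 8 (lit 1) ⟫
      setPar 9 (lit 1) ⟫
      setPar 10 (lit 1)

    smallest-spec : ∀ ω S → let m = memory (run ω smallest S) parArray ; n = memory S orderArray 0 0 in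
      m 0 0 ≡ n × m 1 0 ≡ n ∸ 1 × m 2 0 ≡ 2 * c × m 3 0 ≡ 1 × m 4 0 ≡ c × m 5 0 ≡ 2 × m 6 0 ≡ 1 ×
      m 7 0 ≡ 2 × m 8 0 ≡ 1 × m 9 0 ≡ 1 × m 10 0 ≡ 1
    smallest-spec ω S = refl , refl , refl , refl , refl , refl , refl , refl , refl , refl , refl

    smallest-untouched : ∀ a → not (parArray ≡ᵇ a) ≡ true → untouched a smallest ≡ true
    smallest-untouched a h rewrite h = refl

    smallest-regular : regular orderArray 1 smallest ≡ true
    smallest-regular = refl

    smallest-coinless : coinless smallest ≡ true
    smallest-coinless = refl

  growIfSmall : Prog
  growIfSmall = test (cell orderArray ⊖ par 10) growth nop

  -- n passes are enough because n ≤ 8 ^ n. The test in each pass halts the growth at the least l;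
  -- otherwise the parameters would be exponential in n.
  parameters : Prog
  parameters = smallest ⟫ loop 20 orderArray 0 growIfSmall

-- Rounds the rational bound down by adding its denominator repeatedly. The result is capped at n -
-- 1, which loses nothing because a shortest path has fewer than n edges. `scratch` stays one
-- denominator ahead of the accepted multiple.
findBound : Prog
findBound =
  (put₀ boundCell (lit 0) ⟫
   put₀ scratch (requestArray [ lit 0 ][ lit 3 ])) ⟫
  loop 20 parArray 1
    (test ((lit 1 ⊕ requestArray [ lit 0 ][ lit 2 ]) ⊖ cell scratch)
      (put₀ boundCell (cell boundCell ⊕ lit 1) ⟫
       put₀ scratch (cell scratch ⊕ requestArray [ lit 0 ][ lit 3 ]))
      nop)

relaxation : ℕ → Prog
relaxation X = loop xCell parArray 0
  (test (X [ cell xCell ][ cols ])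
    (test (distH [ rows ][ cols ] ⊖ (distH [ rows ][ cell xCell ] ⊕ lit 1))
      (put distH rows cols (distH [ rows ][ cell xCell ] ⊕ lit 1))
      nop)
    nop)

-- Bellman-Ford from all sources at once, in place, with n passes; the initial value n means that no
-- path is known.
distances : ℕ → Prog
distances X =
  forEach (put distH rows cols (par 0)) ⟫
  loop 20 parArray 0 (put distH rows rows (lit 0)) ⟫
  loop yCell parArray 0 (forEach (relaxation X))

noCandidates : Prog
noCandidates = forEach (put candidates rows cols (lit 0))

local : Expr → Expr
local e = (lit 1 ⊕ cell boundCell) ⊖ (distG [ src ][ e ] ⊕ distG [ e ][ tgt ])

-- `weightArray` holds weights less one, so that the zeroed initial memory gives every edge weight
-- 1; hence the added `lit 1`.
jumpCandidates : Prog
jumpCandidates = forEach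
  (put candidates rows cols (lit 0) ⟫
   test (graphArray [ rows ][ cols ])
    (test (local rows)
      (test (local cols)
        (test (distH [ src ][ cols ] ⊖ (distH [ src ][ rows ] ⊕ lit 1))
          (put candidates rows cols (lit 1 ⊕ weightArray [ rows ][ cols ]))
          nop) nop) nop) nop)

-- A hub is drawn as a diagonal cell, so that the same draws serve for edges and for vertices.
-- Weight 2 * 8 ^ l out of M = 2 * 64 ^ l gives each vertex probability 1 / 8 ^ l.
hubCandidates : Prog
hubCandidates = loop 20 parArray 0 (put candidates rows rows (par 7))

totalWeight : Prog
totalWeight = put₀ scratch (lit 0) ⟫ forEach (put₀ scratch (cell scratch ⊕ candidates [ rows ][ cols ]))

-- The candidate is 1 + W, and adding it to W doubles 1 + W.
raiseWeights : Prog
raiseWeights = forEach (put weightArray rows cols (weightArray [ rows ][ cols ] ⊕ candidates [ rows ][ cols ]))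

-- Being stuck is only recorded. The request has been served by its own edge before, so feasibility
-- is not in danger.
tryUpdate : Prog
tryUpdate =
  block jumpCandidates ⟫ block totalWeight ⟫
  test (par 5 ⊖ cell scratch) (block raiseWeights ⟫ put₀ limitCell (par 2)) (put₀ stuckCell (lit 1))

openHubs : Prog
openHubs =
  put₀ phaseCell (lit 1) ⟫ put₀ modeCell (lit 1) ⟫ put₀ limitCell (par 4) ⟫ block noCandidates ⟫ block hubCandidates

buyDirect : Prog
buyDirect =
  put solutionArray src tgt (lit 1) ⟫
  test (cell phaseCell) (block tryUpdate)
    (test (par 6 ⊖ cell boughtCell) (put₀ boughtCell (cell boughtCell ⊕ lit 1)) (block openHubs))

respond : Prog
respond = test ((lit 1 ⊕ cell boundCell) ⊖ distH [ src ][ tgt ]) nop buyDirect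

copyDistances : Prog
copyDistances = forEach (put distG rows cols (distH [ rows ][ cols ]))

prepare : Prog
prepare =
  block findBound ⟫ block (distances graphArray) ⟫ block copyDistances ⟫ block (distances solutionArray) ⟫
  put₀ modeCell (lit 0) ⟫ put₀ limitCell (lit 0)

decide : Prog
decide = block prepare ⟫ block respond

-- Run in every round, whether or not anything is to be bought, so that the number of coins consumed
-- depends on the number of rounds alone.
draws : Prog
draws = loop 20 parArray 2
  (put₀ scratch (lit 0) ⟫
   loop 21 parArray 3 (toss xCell ⟫ put₀ scratch (cell scratch ⊕ cell scratch ⊕ cell xCell)) ⟫
   put drawArray rows (lit 0) (cell scratch))

scan : Prog
scan = forEach
  (test (cell foundCell) nop
    (test (candidates [ rows ][ cols ] ⊖ cell scratch)
      (put₀ foundCell (lit 1) ⟫ put₀ rowCell rows ⟫ put₀ colCell cols)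
      (put₀ scratch (cell scratch ⊖ candidates [ rows ][ cols ]))))

-- Distances grow by at most 1 along an edge, so any in-neighbour strictly closer to the hub
-- precedes the vertex on a shortest path. The parent is stored plus one; 0 means that there is
-- none, as for the hub itself.
buyOut : Prog
buyOut =
  (put₀ parentCell (lit 0) ⟫
   loop 21 parArray 0
    (test (graphArray [ cols ][ rows ])
      (test (distG [ cell rowCell ][ rows ] ⊖ distG [ cell rowCell ][ cols ]) (put₀ parentCell (cols ⊕ lit 1)) nop)
      nop)) ⟫
  test (cell parentCell) (put solutionArray (cell parentCell ⊖ lit 1) rows (lit 1)) nop

buyIn : Prog
buyIn =
  (put₀ parentCell (lit 0) ⟫
   loop 21 parArray 0
    (test (graphArray [ rows ][ cols ])
      (test (distG [ rows ][ cell rowCell ] ⊖ distG [ cols ][ cell rowCell ]) (put₀ parentCell (cols ⊕ lit 1)) nop)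
      nop)) ⟫
  test (cell parentCell) (put solutionArray rows (cell parentCell ⊖ lit 1) (lit 1)) nop

buyTrees : Prog
buyTrees = loop 20 parArray 0 (block buyOut ⟫ block buyIn)

buyHub : Prog
buyHub = put hubArray (cell rowCell) (cell rowCell) (lit 1) ⟫ block buyTrees

buyEdge : Prog
buyEdge = put solutionArray (cell rowCell) (cell colCell) (lit 1)

buyPick : Prog
buyPick =
  (put₀ scratch (drawArray [ cell yCell ][ lit 0 ]) ⟫ put₀ foundCell (lit 0)) ⟫ block scan ⟫
  test (cell foundCell) (test (cell modeCell) buyHub buyEdge) nop

-- The limit selects the draws that count: all K in an update, Q when the hubs open, none otherwise.
purchases : Prog
purchases = loop yCell parArray 2 (test (cell limitCell ⊖ cell yCell) (block buyPick) nop)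

-- Correctness of the parameters

module Parameters (c : ℕ) where

  value : (n l : ℕ) → ℕ → ℕ
  value n l 0  = n
  value n l 1  = n ∸ 1
  value n l 2  = 2 * (c * suc l * 4 ^ l)
  value n l 3  = suc (6 * l)
  value n l 4  = c * suc l * 2 ^ l
  value n l 5  = 2 * 64 ^ l
  value n l 6  = 16 ^ l
  value n l 7  = 2 * 8 ^ l
  value n l 8  = 2 ^ l
  value n l 9  = 4 ^ l
  value n l 10 = 8 ^ l
  value n l _  = 0

  HasParameters : (n l : ℕ) → State → Set
  HasParameters n l S = ∀ i → (i <ᵇ 11) ≡ true → memory S parArray i 0 ≡ value n l i

  levelIn : (n k : ℕ) → ℕ
  levelIn n zero    = 0
  levelIn n (suc k) = if 8 ^ levelIn n k <ᵇ n then suc (levelIn n k) else levelIn n k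

  level : ℕ → ℕ
  level n = levelIn n n

  *-exchange : ∀ a b p → a * (b * p) ≡ b * (a * p)
  *-exchange = solve-∀

  growth-spec : ∀ ω n l S → HasParameters n l S → HasParameters n (suc l) (run ω (growth c) S)
  growth-spec ω n l S h 0  _ = h 0 refl
  growth-spec ω n l S h 1  _ = h 1 refl
  growth-spec ω n l S h 2  _ =
    trans (cong₂ _+_ (eval-times _ 4 (par 2)) (eval-times _ (8 * c) (par 9)))
      (trans (cong₂ (λ x y → 4 * x + 8 * c * y) (h 2 refl) (h 9 refl)) (lem c l (4 ^ l)))
    where
    lem : ∀ c l p → 4 * (2 * (c * suc l * p)) + 8 * c * p ≡ 2 * (c * suc (suc l) * (4 * p))
    lem = solve-∀
  growth-spec ω n l S h 3  _ = trans (cong (_+ 6) (h 3 refl)) (lem l)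
    where
    lem : ∀ l → suc (6 * l) + 6 ≡ suc (6 * suc l)
    lem = solve-∀
  growth-spec ω n l S h 4  _ =
    trans (cong₂ _+_ (eval-times _ 2 (par 4)) (eval-times _ (2 * c) (par 8)))
      (trans (cong₂ (λ x y → 2 * x + 2 * c * y) (h 4 refl) (h 8 refl)) (lem c l (2 ^ l)))
    where
    lem : ∀ c l p → 2 * (c * suc l * p) + 2 * c * p ≡ c * suc (suc l) * (2 * p)
    lem = solve-∀
  growth-spec ω n l S h 5  _ = trans (eval-times _ 64 (par 5)) (trans (cong (64 *_) (h 5 refl)) (*-exchange 64 2 (64 ^ l)))
  growth-spec ω n l S h 6  _ = trans (eval-times _ 16 (par 6)) (cong (16 *_) (h 6 refl))
  growth-spec ω n l S h 7  _ = trans (eval-times _ 8 (par 7)) (trans (cong (8 *_) (h 7 refl)) (*-exchange 8 2 (8 ^ l)))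
  growth-spec ω n l S h 8  _ = trans (eval-times _ 2 (par 8)) (cong (2 *_) (h 8 refl))
  growth-spec ω n l S h 9  _ = trans (eval-times _ 4 (par 9)) (cong (4 *_) (h 9 refl))
  growth-spec ω n l S h 10 _ = trans (eval-times _ 8 (par 10)) (cong (8 *_) (h 10 refl))

  smallest-parameters : ∀ ω S → HasParameters (memory S orderArray 0 0) 0 (run ω (smallest c) S)
  smallest-parameters ω S with smallest-spec c ω S
  ... | p₀ , p₁ , p₂ , p₃ , p₄ , p₅ , p₆ , p₇ , p₈ , p₉ , p₁₀ = λ
    { 0  _ → p₀ ; 1 _ → p₁ ; 2 _ → trans p₂ (lem₂ c) ; 3 _ → p₃ ; 4 _ → trans p₄ (lem₄ c) ; 5 _ → p₅
    ; 6  _ → p₆ ; 7 _ → p₇ ; 8 _ → p₈ ; 9 _ → p₉ ; 10 _ → p₁₀ ; (suc (suc (suc (suc (suc (suc (suc (suc (suc (suc (suc _))))))))))) () }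
    where
    lem₂ : ∀ c → 2 * c ≡ 2 * (c * 1 * 1)
    lem₂ = solve-∀
    lem₄ : ∀ c → c ≡ c * 1 * 1
    lem₄ = solve-∀

  growIfSmall-spec : ∀ ω n k S → memory S orderArray 0 0 ≡ n → HasParameters n (levelIn n k) S →
    HasParameters n (levelIn n (suc k)) (run ω (growIfSmall c) S)
  growIfSmall-spec ω n k S n≡ h =
    run-select ω (cell orderArray ⊖ par 10) (growth c) nop S (HasParameters n (levelIn n (suc k))) grow stay
    where
    l = levelIn n k
    guard : memory S orderArray 0 0 ∸ memory S parArray 10 0 ≡ n ∸ 8 ^ l
    guard = cong₂ _∸_ n≡ (h 10 refl)
    grow : memory S orderArray 0 0 ∸ memory S parArray 10 0 ≢ 0 → HasParameters n (levelIn n (suc k)) (run ω (growth c) S)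
    grow ne rewrite T⇒≡ (<⇒<ᵇ (m∸n≢0⇒n<m {n} {8 ^ l} λ z → ne (trans guard z))) = growth-spec ω n l S h
    stay : memory S orderArray 0 0 ∸ memory S parArray 10 0 ≡ 0 → HasParameters n (levelIn n (suc k)) S
    stay e with 8 ^ l <ᵇ n in eq
    ... | true  = contradiction (<ᵇ⇒< (8 ^ l) n (≡⇒T eq)) (≤⇒≯ (m∸n≡0⇒m≤n (trans (sym guard) e)))
    ... | false = h

  growing : ∀ ω n S → memory S orderArray 0 0 ≡ n → HasParameters n 0 S →
    HasParameters n (level n) (run ω (loop 20 orderArray 0 (growIfSmall c)) S)
  growing ω n S refl h = loop-rule ω 20 orderArray 0 (growIfSmall c) S I step
      (λ i q → trans (h i q) (cong (λ k → value n (levelIn n k) i) (sym (n∸n≡0 n))))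
    where
    I : ℕ → State → Set
    I k S′ = HasParameters n (levelIn n (n ∸ k)) S′
    step : ∀ k S′ → k < n → Keeps (loop 20 orderArray 0 (growIfSmall c)) S S′ → I (suc k) S′ → I k (run ω (growIfSmall c) (assign 20 0 0 k S′))
    step k S′ k<n keep h′ =
      subst (λ j → HasParameters n (levelIn n j) (run ω (growIfSmall c) (assign 20 0 0 k S′))) (sym (∸-step k<n))
        (growIfSmall-spec ω n (n ∸ suc k) (assign 20 0 0 k S′) (keep orderArray refl 0 0) h′)

  parameters-spec : ∀ ω n S → memory S orderArray 0 0 ≡ n → HasParameters n (level n) (run ω (parameters c) S)
  parameters-spec ω n S refl = growing ω n (run ω (smallest c) S)
    (frame ω orderArray (smallest c) (smallest-untouched c orderArray refl) S 0 0) (smallest-parameters ω S)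

  levelIn-small : ∀ n k → levelIn n k ≡ 0 ⊎ 8 ^ (levelIn n k ∸ 1) < n
  levelIn-small n zero    = inj₁ refl
  levelIn-small n (suc k) with 8 ^ levelIn n k <ᵇ n in eq
  ... | true  = inj₂ (<ᵇ⇒< (8 ^ levelIn n k) n (≡⇒T eq))
  ... | false = levelIn-small n k

  -- Either the growth has stopped, or every pass so far has raised the level.
  levelIn-large : ∀ n k → n ≤ 8 ^ levelIn n k ⊎ levelIn n k ≡ k
  levelIn-large n zero    = inj₂ refl
  levelIn-large n (suc k) with 8 ^ levelIn n k <ᵇ n in eq
  ... | false = inj₁ (≮⇒≥ λ lt → case trans (sym eq) (T⇒≡ (<⇒<ᵇ lt)) of λ ())
  ... | true with levelIn-large n k
  ...   | inj₁ le = contradiction (<ᵇ⇒< (8 ^ levelIn n k) n (≡⇒T eq)) (≤⇒≯ le)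
  ...   | inj₂ e  = inj₂ (cong suc e)

  n≤8^level : ∀ n → n ≤ 8 ^ level n
  n≤8^level n with levelIn-large n n
  ... | inj₁ le = le
  ... | inj₂ e  = subst (λ k → n ≤ 8 ^ k) (sym e) (n≤8^n n)
    where
    n≤8^n : ∀ n → n ≤ 8 ^ n
    n≤8^n zero    = z≤n
    n≤8^n (suc n) = ≤-trans (s≤s (n≤8^n n)) (≤-trans (+-monoˡ-≤ (8 ^ n) (m^n>0 8 n)) (+-monoʳ-≤ (8 ^ n) (m≤m+n (8 ^ n) _)))

-- Correctness of the deterministic steps

findBound-spec : ∀ ω S N → memory S parArray 1 0 ≡ N →
  let d   = memory (run ω findBound S) boundCell 0 0
      num = memory S requestArray 0 2
      den = memory S requestArray 0 3
  in d ≤ N × d * den ≤ num × (∀ k → k ≤ N → k * den ≤ num → k ≤ d)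
findBound-spec ω S N refl = finish (loop-rule ω 20 parArray 1 body S₁ I step initial)
  where
  num = memory S requestArray 0 2
  den = memory S requestArray 0 3
  advance = put₀ boundCell (cell boundCell ⊕ lit 1) ⟫
            put₀ scratch (cell scratch ⊕ requestArray [ lit 0 ][ lit 3 ])
  body = test ((lit 1 ⊕ requestArray [ lit 0 ][ lit 2 ]) ⊖ cell scratch) advance nop
  S₁ = run ω (put₀ boundCell (lit 0) ⟫ put₀ scratch (requestArray [ lit 0 ][ lit 3 ])) S
  -- The closing alternative: the search has failed once and d is maximal, or every pass so far has
  -- succeeded and d + k is still N.
  I : ℕ → State → Set
  I k S′ = memory S′ scratch 0 0 ≡ suc d * den × d + k ≤ N × d * den ≤ num × (num < suc d * den ⊎ d + k ≡ N)
    where d = memory S′ boundCell 0 0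
  initial : I N (assign 20 0 0 N S₁)
  initial = sym (+-identityʳ den) , ≤-refl , z≤n , inj₂ refl
  step : ∀ k S′ → k < N → Keeps (loop 20 parArray 1 body) S₁ S′ → I (suc k) S′ → I k (run ω body (assign 20 0 0 k S′))
  step k S′ k<N keep (acc , le , fit , stop) = run-select ω ((lit 1 ⊕ requestArray [ lit 0 ][ lit 2 ]) ⊖ cell scratch) advance nop S₂ (I k) more halt
    where
    S₂ = assign 20 0 0 k S′
    d = memory S′ boundCell 0 0
    num≡ : memory S′ requestArray 0 2 ≡ num
    num≡ = keep requestArray refl 0 2
    den≡ : memory S′ requestArray 0 3 ≡ den
    den≡ = keep requestArray refl 0 3
    guard : suc (memory S′ requestArray 0 2) ∸ memory S′ scratch 0 0 ≡ suc num ∸ suc d * den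
    guard = cong₂ (λ x y → suc x ∸ y) num≡ acc
    more : suc (memory S′ requestArray 0 2) ∸ memory S′ scratch 0 0 ≢ 0 → I k (run ω advance S₂)
    more ne = trans (cong₂ _+_ acc den≡) (lem₁ d den) , ≤-trans (≤-reflexive (lem₂ d k)) le ,
              ≤-trans (≤-reflexive (lem₃ d den)) fits , again stop
      where
      lem₁ : ∀ d e → suc d * e + e ≡ suc (d + 1) * e
      lem₁ = solve-∀
      lem₂ : ∀ d k → d + 1 + k ≡ d + suc k
      lem₂ = solve-∀
      lem₃ : ∀ d e → (d + 1) * e ≡ suc d * e
      lem₃ = solve-∀
      fits : suc d * den ≤ num
      fits = ≤-pred (m∸n≢0⇒n<m {suc num} {suc d * den} λ z → ne (trans guard z))
      again : num < suc d * den ⊎ d + suc k ≡ N → num < suc (d + 1) * den ⊎ d + 1 + k ≡ N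
      again (inj₁ lt) = contradiction fits (<⇒≱ lt)
      again (inj₂ e)  = inj₂ (trans (lem₂ d k) e)
    halt : suc (memory S′ requestArray 0 2) ∸ memory S′ scratch 0 0 ≡ 0 → I k S₂
    halt e = acc , ≤-trans (+-monoʳ-≤ d (n≤1+n k)) le , fit , inj₁ (m∸n≡0⇒m≤n {suc num} (trans (sym guard) e))
  finish : I 0 (run ω findBound S) → _
  finish (_ , le , fit , stop) = ≤-trans (≤-reflexive (sym (+-identityʳ _))) le , fit , maximal stop
    where
    d = memory (run ω findBound S) boundCell 0 0
    maximal : num < suc d * den ⊎ d + 0 ≡ N → ∀ k → k ≤ N → k * den ≤ num → k ≤ d
    maximal (inj₁ lt) k _ h with k ≤? d
    ... | yes k≤d = k≤d
    ... | no k≰d  = contradiction (≤-trans (*-monoˡ-≤ den (≰⇒> k≰d)) h) (<⇒≱ lt)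
    maximal (inj₂ e)  k h _ = ≤-trans h (≤-reflexive (trans (sym e) (+-identityʳ d)))

module Distances (ω : Coins) (X : ℕ) (ok : untouched X (distances X) ≡ true) (S : State) (n : ℕ)
  (n≡ : memory S parArray 0 0 ≡ n) (supported : Supported n (memory S X)) where

  private
    E = memory S X

  Sound : Matrix → Set
  Sound D = ∀ i j → i < n → j < n → D i j ≤ n × (D i j < n → Path E (D i j) i j)

  sound-write : ∀ m i j x → i < n → x ≤ n → Path E x i j → Sound (m distH) → Sound (write m distH i j x distH)
  sound-write m i j x i<n x≤n p s i′ j′ i′<n j′<n with i ≡ᵇ i′ in e | j ≡ᵇ j′ in e′
  ... | false | _     = s i′ j′ i′<n j′<n
  ... | true  | false = s i′ j′ i′<n j′<n
  ... | true  | true with ≡ᵇ⇒≡ i i′ (≡⇒T e) | ≡ᵇ⇒≡ j j′ (≡⇒T e′)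
  ...   | refl | refl = x≤n , λ _ → p

  private
    X-fill : untouched X (forEach (put distH rows cols (par 0))) ≡ true
    X-fill = proj₁ (∧-split {untouched X (forEach (put distH rows cols (par 0)))} ok)
    X-rest : untouched X (loop 20 parArray 0 (put distH rows rows (lit 0))) ∧ untouched X (loop yCell parArray 0 (forEach (relaxation X))) ≡ true
    X-rest = proj₂ (∧-split {untouched X (forEach (put distH rows cols (par 0)))} ok)
    X-diag = proj₁ (∧-split {untouched X (loop 20 parArray 0 (put distH rows rows (lit 0)))} X-rest)
    X-relax = proj₂ (∧-split {untouched X (loop 20 parArray 0 (put distH rows rows (lit 0)))} X-rest)
    X-each = proj₂ (∧-split {not (yCell ≡ᵇ X)} X-relax)
    X-row = proj₂ (∧-split {not (20 ≡ᵇ X)} X-each)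
    X-inner : untouched X (relaxation X) ≡ true
    X-inner = proj₂ (∧-split {not (21 ≡ᵇ X)} X-row)

  Context : State → Set
  Context S′ = memory S′ parArray 0 0 ≡ n × (∀ i j → memory S′ X i j ≡ E i j)

  Improves : State → State → Set
  Improves S₁ S₂ = ∀ i j → memory S₂ distH i j ≤ memory S₁ distH i j

  relaxation-spec : ∀ S₁ i v → i < n → v < n → Context S₁ → memory S₁ 20 0 0 ≡ i → memory S₁ 21 0 0 ≡ v →
    Sound (memory S₁ distH) → let S₂ = run ω (relaxation X) S₁ in
    Improves S₁ S₂ × Sound (memory S₂ distH) ×
    (∀ u → u < n → E u v ≢ 0 → memory S₂ distH i v ≤ suc (memory S₁ distH i u))
  relaxation-spec S₁ i v i<n v<n (n₁ , x₁) refl refl s =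
    finish (loop-rule ω xCell parArray 0 body S₁ I step initial)
    where
    lower = put distH rows cols (distH [ rows ][ cell xCell ] ⊕ lit 1)
    compare′ = test (distH [ rows ][ cols ] ⊖ (distH [ rows ][ cell xCell ] ⊕ lit 1)) lower nop
    body = test (X [ cell xCell ][ cols ]) compare′ nop
    D₁ = memory S₁ distH
    I : ℕ → State → Set
    I w S′ = Improves S₁ S′ × Sound (memory S′ distH) ×
             (∀ u → w ≤ u → u < n → E u v ≢ 0 → memory S′ distH i v ≤ suc (D₁ i u))
    initial : I (memory S₁ parArray 0 0) (assign xCell 0 0 (memory S₁ parArray 0 0) S₁)
    initial = (λ _ _ → ≤-refl) , s , λ u n≤u u<n → contradiction u<n (≤⇒≯ (≤-trans (≤-reflexive (sym n₁)) n≤u))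
    finish : I 0 (run ω (relaxation X) S₁) → _
    finish (a , b , c) = a , b , λ u → c u z≤n
    step : ∀ w S′ → w < memory S₁ parArray 0 0 → Keeps (relaxation X) S₁ S′ → I (suc w) S′ → I w (run ω body (assign xCell 0 0 w S′))
    step w S′ w<n keep (mono , snd , done) =
      run-select ω (X [ cell xCell ][ cols ]) compare′ nop S₂ (I w)
        (λ e → run-select ω (distH [ rows ][ cols ] ⊖ (distH [ rows ][ cell xCell ] ⊕ lit 1)) lower nop S₂ (I w) (better (edge e)) (worse (edge e)))
        none
      where
      S₂ = assign xCell 0 0 w S′
      D = memory S′ distH
      i≡ : memory S₂ 20 0 0 ≡ i
      i≡ = keep 20 refl 0 0
      v≡ : memory S₂ 21 0 0 ≡ v
      v≡ = keep 21 refl 0 0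
      w<n′ : w < n
      w<n′ = ≤-trans w<n (≤-reflexive n₁)
      X≡ : memory S₂ X w (memory S₂ 21 0 0) ≡ E w v
      X≡ = trans (write-other (memory S′) xCell X 0 0 w w _ (proj₁ (∧-split {not (xCell ≡ᵇ X)} X-inner)))
            (trans (cong (memory S′ X w) v≡) (trans (keep X X-inner w v) (x₁ w v)))
      edge : memory S₂ X w (memory S₂ 21 0 0) ≢ 0 → E w v ≢ 0
      edge ne z = ne (trans X≡ z)
      extend : ∀ {S″} → Improves S′ S″ → (E w v ≢ 0 → memory S″ distH i v ≤ suc (D i w)) →
               ∀ u → w ≤ u → u < n → E u v ≢ 0 → memory S″ distH i v ≤ suc (D₁ i u)
      extend imp new u w≤u u<n e with m≤n⇒m<n∨m≡n w≤u
      ... | inj₁ w<u  = ≤-trans (imp i v) (done u w<u u<n e)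
      ... | inj₂ refl = ≤-trans (new e) (s≤s (mono i w))
      none : memory S₂ X w (memory S₂ 21 0 0) ≡ 0 → I w S₂
      none z = mono , snd , extend {S₂} (λ _ _ → ≤-refl) λ e → contradiction (trans (sym X≡) z) e
      worse : E w v ≢ 0 → D (memory S₂ 20 0 0) (memory S₂ 21 0 0) ∸ (D (memory S₂ 20 0 0) w + 1) ≡ 0 → I w S₂
      worse e z = mono , snd , extend {S₂} (λ _ _ → ≤-refl) λ _ →
        ≤-trans (≤-reflexive (cong₂ D (sym i≡) (sym v≡)))
          (≤-trans (m∸n≡0⇒m≤n {D (memory S₂ 20 0 0) (memory S₂ 21 0 0)} z) (≤-reflexive (trans (+-comm _ 1) (cong (λ q → suc (D q w)) i≡))))
      better : E w v ≢ 0 → D (memory S₂ 20 0 0) (memory S₂ 21 0 0) ∸ (D (memory S₂ 20 0 0) w + 1) ≢ 0 →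
               I w (run ω lower S₂)
      better e ne = (λ a b → ≤-trans (imp a b) (mono a b)) , sound′ , extend {S₃} imp λ _ → ≤-reflexive at
        where
        x = D (memory S₂ 20 0 0) w + 1
        S₃ = assign distH (memory S₂ 20 0 0) (memory S₂ 21 0 0) x S₂
        x≡ : x ≡ suc (D i w)
        x≡ = trans (+-comm _ 1) (cong (λ q → suc (D q w)) i≡)
        x< : x < D i v
        x< = ≤-trans (m∸n≢0⇒n<m ne) (≤-reflexive (cong₂ D i≡ v≡))
        at : memory S₃ distH i v ≡ suc (D i w)
        at = trans (cong₂ (λ a b → memory S₃ distH a b) (sym i≡) (sym v≡)) (trans (write-same (memory S₂) distH _ _ x) x≡)
        imp : Improves S′ S₃
        imp a b with memory S₂ 20 0 0 ≡ᵇ a in ea | memory S₂ 21 0 0 ≡ᵇ b in eb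
        ... | false | _     = ≤-refl
        ... | true  | false = ≤-refl
        ... | true  | true with ≡ᵇ⇒≡ (memory S₂ 20 0 0) a (≡⇒T ea) | ≡ᵇ⇒≡ (memory S₂ 21 0 0) b (≡⇒T eb)
        ...   | refl | refl = ≤-trans (<⇒≤ x<) (≤-reflexive (cong₂ D (sym i≡) (sym v≡)))
        D<n : D i w < n
        D<n = ≤-trans (≤-reflexive (sym x≡)) (≤-trans (<⇒≤ x<) (proj₁ (snd i v i<n v<n)))
        sound′ : Sound (memory S₃ distH)
        sound′ = sound-write (memory S₂) (memory S₂ 20 0 0) (memory S₂ 21 0 0) x
          (subst (_< n) (sym i≡) i<n) (≤-trans (≤-reflexive x≡) D<n)
          (subst₂ (Path E x) (sym i≡) (sym v≡) (subst (λ k → Path E k i v) (sym x≡) (proj₂ (snd i w i<n w<n′) D<n ▹ e))) snd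

  -- Compares with the entries before the pass. Working in place only improves on this, since
  -- entries never increase.
  round-spec : ∀ S₁ → Context S₁ → Sound (memory S₁ distH) → let S₂ = run ω (forEach (relaxation X)) S₁ in
    Improves S₁ S₂ × Sound (memory S₂ distH) ×
    (∀ i v u → i < n → v < n → u < n → E u v ≢ 0 → memory S₂ distH i v ≤ suc (memory S₁ distH i u))
  round-spec S₁ (n₁ , x₁) s = finish (loop-rule ω 20 parArray 0 (loop 21 parArray 0 (relaxation X)) S₁ I step initial)
    where
    D₁ = memory S₁ distH
    Done : ℕ → ℕ → State → Set
    Done i v S′ = ∀ u → u < n → E u v ≢ 0 → memory S′ distH i v ≤ suc (D₁ i u)
    I : ℕ → State → Set
    I k S′ = Improves S₁ S′ × Sound (memory S′ distH) × (∀ i v → k ≤ i → i < n → v < n → Done i v S′)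
    initial : I (memory S₁ parArray 0 0) (assign 20 0 0 (memory S₁ parArray 0 0) S₁)
    initial = (λ _ _ → ≤-refl) , s , λ i v n≤i i<n → contradiction i<n (≤⇒≯ (≤-trans (≤-reflexive (sym n₁)) n≤i))
    finish : I 0 (run ω (forEach (relaxation X)) S₁) → _
    finish (a , b , c) = a , b , λ i v u i<n v<n → c i v z≤n i<n v<n u
    step : ∀ i S′ → i < memory S₁ parArray 0 0 → Keeps (forEach (relaxation X)) S₁ S′ → I (suc i) S′ →
           I i (run ω (loop 21 parArray 0 (relaxation X)) (assign 20 0 0 i S′))
    step i S′ i<n₁ keep (mono , snd , done) = finish′ (loop-rule ω 21 parArray 0 (relaxation X) S₂ I′ step′ initial′)
      where
      S₂ = assign 20 0 0 i S′
      i<n : i < n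
      i<n = ≤-trans i<n₁ (≤-reflexive n₁)
      n₂ : memory S₂ parArray 0 0 ≡ n
      n₂ = trans (keep parArray refl 0 0) n₁
      I′ : ℕ → State → Set
      I′ k S″ = Improves S₁ S″ × Sound (memory S″ distH) ×
               (∀ i′ v → i < i′ → i′ < n → v < n → Done i′ v S″) × (∀ v → k ≤ v → v < n → Done i v S″)
      initial′ : I′ (memory S₂ parArray 0 0) (assign 21 0 0 (memory S₂ parArray 0 0) S₂)
      initial′ = mono , snd , done , λ v n≤v v<n → contradiction v<n (≤⇒≯ (≤-trans (≤-reflexive (sym n₂)) n≤v))
      finish′ : I′ 0 (run ω (loop 21 parArray 0 (relaxation X)) S₂) → I i (run ω (loop 21 parArray 0 (relaxation X)) S₂)
      finish′ (a , b , c , d) = a , b , λ i′ v i≤i′ → split (m≤n⇒m<n∨m≡n i≤i′) v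
        where
        split : ∀ {i′} → i < i′ ⊎ i ≡ i′ → ∀ v → i′ < n → v < n →
                Done i′ v (run ω (loop 21 parArray 0 (relaxation X)) S₂)
        split (inj₁ lt)   v i′<n v<n = c _ v lt i′<n v<n
        split (inj₂ refl) v _    v<n = d v z≤n v<n
      step′ : ∀ v S″ → v < memory S₂ parArray 0 0 → Keeps (loop 21 parArray 0 (relaxation X)) S₂ S″ → I′ (suc v) S″ →
              I′ v (run ω (relaxation X) (assign 21 0 0 v S″))
      step′ v S″ v<n₂ keep′ (mono′ , snd′ , done₁ , done₂)
        with relaxation-spec (assign 21 0 0 v S″) i v i<n (≤-trans v<n₂ (≤-reflexive n₂))
               ( trans (keep′ parArray refl 0 0) n₂
               , λ a b → trans (write-other (memory S″) 21 X 0 0 v a b (proj₁ (∧-split {not (21 ≡ᵇ X)} X-row)))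
                  (trans (keep′ X X-row a b) (trans (write-other (memory S′) 20 X 0 0 i a b (proj₁ (∧-split {not (20 ≡ᵇ X)} X-each)))
                    (trans (keep X X-each a b) (x₁ a b)))))
               (keep′ 20 refl 0 0) refl snd′
      ... | imp , snd″ , new =
        (λ a b → ≤-trans (imp a b) (mono′ a b)) , snd″ ,
        (λ i′ v′ lt i′<n v′<n u u<n e → ≤-trans (imp i′ v′) (done₁ i′ v′ lt i′<n v′<n u u<n e)) ,
        λ v′ v≤v′ v′<n u u<n e → extend v′ (m≤n⇒m<n∨m≡n v≤v′) v′<n u u<n e
        where
        S‴ = run ω (relaxation X) (assign 21 0 0 v S″)
        extend : ∀ v′ → v < v′ ⊎ v ≡ v′ → v′ < n → Done i v′ S‴
        extend v′ (inj₁ lt)   v′<n u u<n e = ≤-trans (imp i v′) (done₂ v′ lt v′<n u u<n e)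
        extend v′ (inj₂ refl) v′<n u u<n e = ≤-trans (new u u<n e) (s≤s (mono′ i u))

  distances-spec : IsDist n E (memory (run ω (distances X) S) distH)
  distances-spec = finish (loop-rule ω yCell parArray 0 (forEach (relaxation X)) S₂ I step initial)
    where
    S₁ = run ω (forEach (put distH rows cols (par 0))) S
    S₂ = run ω (loop 20 parArray 0 (put distH rows rows (lit 0))) S₁
    par₁ : memory S₁ parArray 0 0 ≡ n
    par₁ = trans (frame ω parArray (forEach (put distH rows cols (par 0))) refl S 0 0) n≡
    par₂ : memory S₂ parArray 0 0 ≡ n
    par₂ = trans (frame ω parArray (loop 20 parArray 0 (put distH rows rows (lit 0))) refl S₁ 0 0) par₁
    X₂ : ∀ i j → memory S₂ X i j ≡ E i j
    X₂ i j = trans (frame ω X (loop 20 parArray 0 (put distH rows rows (lit 0))) X-diag S₁ i j)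
                   (frame ω X (forEach (put distH rows cols (par 0))) X-fill S i j)
    filled = forEach-rule ω distH (put distH rows cols (par 0)) (λ _ _ → n) S refl refl refl refl
      λ { u v S′ _ _ keep refl refl _ →
          trans (write-same (memory S′) distH u v _) (trans (keep parArray refl 0 0) n≡) ,
          λ i j ne → write-cell (memory S′) distH u v _ i j (swap ne) }
      where
      swap : ∀ {a b c d : ℕ} → a ≢ b ⊎ c ≢ d → b ≢ a ⊎ d ≢ c
      swap (inj₁ x) = inj₁ (x ∘ sym)
      swap (inj₂ x) = inj₂ (x ∘ sym)
    sound₁ : Sound (memory S₁ distH)
    sound₁ i j i<n j<n = ≤-reflexive e , λ lt → contradiction lt (≤⇒≯ (≤-reflexive (sym e)))
      where
      e : memory S₁ distH i j ≡ n
      e = inside filled i j (subst (i <_) (sym n≡) i<n , subst (j <_) (sym n≡) j<n)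
    Diag : ℕ → State → Set
    Diag k S′ = Sound (memory S′ distH) × (∀ i → k ≤ i → i < n → memory S′ distH i i ≡ 0)
    diag : Diag 0 S₂
    diag = loop-rule ω 20 parArray 0 (put distH rows rows (lit 0)) S₁ Diag
      (λ k S′ k<n keep (s , z) →
        sound-write (memory S′) k k 0 (≤-trans k<n (≤-reflexive par₁)) z≤n here s ,
        λ i k≤i i<n → zeroes k S′ z i k≤i i<n)
      (sound₁ , λ i n≤i i<n → contradiction i<n (≤⇒≯ (≤-trans (≤-reflexive (sym par₁)) n≤i)))
      where
      zeroes : ∀ k S′ → (∀ i → suc k ≤ i → i < n → memory S′ distH i i ≡ 0) →
               ∀ i → k ≤ i → i < n → write (memory S′) distH k k 0 distH i i ≡ 0
      zeroes k S′ z i k≤i i<n with k ≟ i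
      ... | yes refl = write-same (memory S′) distH k k 0
      ... | no k≢i   = trans (write-cell (memory S′) distH k k 0 i i (inj₁ k≢i)) (z i (≤∧≢⇒< k≤i k≢i) i<n)
    -- With k passes to come, all walks of at most n - k edges are accounted for.
    I : ℕ → State → Set
    I k S′ = Sound (memory S′ distH) ×
             (∀ i j l → i < n → j < n → l + k ≤ n → Path E l i j → memory S′ distH i j ≤ l)
    initial : I (memory S₂ parArray 0 0) (assign yCell 0 0 (memory S₂ parArray 0 0) S₂)
    initial = proj₁ diag , zero-walk
      where
      zero-walk : ∀ i j l → i < n → j < n → l + memory S₂ parArray 0 0 ≤ n → Path E l i j → memory S₂ distH i j ≤ l
      zero-walk i j zero    i<n j<n h here = ≤-reflexive (proj₂ diag i z≤n i<n)
      zero-walk i j (suc l) i<n j<n h p =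
        contradiction (≤-trans (s≤s (m≤n+m _ l)) (≤-trans h (≤-reflexive (sym par₂)))) 1+n≰n
    step : ∀ k S′ → k < memory S₂ parArray 0 0 → Keeps (loop yCell parArray 0 (forEach (relaxation X))) S₂ S′ → I (suc k) S′ →
           I k (run ω (forEach (relaxation X)) (assign yCell 0 0 k S′))
    step k S′ k<n keep (s , compl)
      with round-spec (assign yCell 0 0 k S′)
             ( trans (keep parArray refl 0 0) par₂
             , λ i j → trans (write-other (memory S′) yCell X 0 0 k i j (proj₁ (∧-split {not (yCell ≡ᵇ X)} X-relax)))
                         (trans (keep X X-relax i j) (X₂ i j)) ) s
    ... | imp , s′ , new = s′ , longer
      where
      longer : ∀ i j l → i < n → j < n → l + k ≤ n → Path E l i j →
               memory (run ω (forEach (relaxation X)) (assign yCell 0 0 k S′)) distH i j ≤ l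
      longer i j zero    i<n j<n h here = ≤-trans (imp i i) (compl i i 0 i<n i<n (≤-trans k<n (≤-reflexive par₂)) here)
      longer i j (suc l) i<n j<n h (_▹_ {v = u} p e) with proj₁ (supported u j e)
      ... | u<n = ≤-trans (new i j u i<n j<n u<n e) (s≤s (compl i u l i<n u<n (≤-trans (≤-reflexive (+-suc l k)) h) p))
    finish : I 0 (run ω (distances X) S) → IsDist n E (memory (run ω (distances X) S) distH)
    finish (s , compl) = record
      { bounded  = λ i j i<n j<n → proj₁ (s i j i<n j<n)
      ; sound    = λ i j i<n j<n → proj₂ (s i j i<n j<n)
      ; complete = λ i j l i<n j<n h → compl i j l i<n j<n (≤-trans (≤-reflexive (+-identityʳ l)) h)
      }

select-≢0 : ∀ {A : Set} {k} {x y : A} → k ≢ 0 → select k x y ≡ x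
select-≢0 {k = zero}  h = contradiction refl h
select-≢0 {k = suc _} h = refl

select-≡0 : ∀ {A : Set} {k} {x y : A} → k ≡ 0 → select k x y ≡ y
select-≡0 refl = refl

swap-≢ : ∀ {a b c d : ℕ} → a ≢ b ⊎ c ≢ d → b ≢ a ⊎ d ≢ c
swap-≢ (inj₁ x) = inj₁ (x ∘ sym)
swap-≢ (inj₂ x) = inj₂ (x ∘ sym)

fill-rule : ∀ ω A e g S n → memory S parArray 0 0 ≡ n →
  not (20 ≡ᵇ A) ≡ true → not (21 ≡ᵇ A) ≡ true → not (A ≡ᵇ 20) ≡ true → not (A ≡ᵇ parArray) ≡ true →
  (∀ u v S′ → u < n → v < n → Keeps (forEach (put A rows cols e)) S S′ → memory S′ 20 0 0 ≡ u → memory S′ 21 0 0 ≡ v →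
     memory S′ A u v ≡ memory S A u v → eval (memory S′) e ≡ g u v) →
  ∀ i j → i < n → j < n → memory (run ω (forEach (put A rows cols e)) S) A i j ≡ g i j
fill-rule ω A e g S n refl h₁ h₂ h₃ h₄ body i j i<n j<n =
  inside (forEach-rule ω A (put A rows cols e) g S h₁ h₂ h₃ h₄ step) i j (i<n , j<n)
  where
  step : ∀ u v S′ → u < n → v < n → Keeps (forEach (put A rows cols e)) S S′ → memory S′ 20 0 0 ≡ u → memory S′ 21 0 0 ≡ v →
     memory S′ A u v ≡ memory S A u v → memory (run ω (put A rows cols e) S′) A u v ≡ g u v ×
     (∀ i j → i ≢ u ⊎ j ≢ v → memory (run ω (put A rows cols e) S′) A i j ≡ memory S′ A i j)
  step u v S′ u<n v<n keep refl refl old =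
    trans (write-same (memory S′) A u v _) (body u v S′ u<n v<n keep refl refl old) ,
    λ i j ne → write-cell (memory S′) A u v _ i j (swap-≢ ne)

noCandidates-spec : ∀ ω S n → memory S parArray 0 0 ≡ n → ∀ i j → i < n → j < n →
  memory (run ω noCandidates S) candidates i j ≡ 0
noCandidates-spec ω S n h = fill-rule ω candidates (lit 0) (λ _ _ → 0) S n h refl refl refl refl λ _ _ _ _ _ _ _ _ _ → refl

copy-spec : ∀ ω S n → memory S parArray 0 0 ≡ n → ∀ i j → i < n → j < n →
  memory (run ω copyDistances S) distG i j ≡ memory S distH i j
copy-spec ω S n h = fill-rule ω distG (distH [ rows ][ cols ]) (memory S distH) S n h refl refl refl refl
  λ { u v S′ _ _ keep refl refl _ → keep distH refl u v }

raiseWeights-spec : ∀ ω S n → memory S parArray 0 0 ≡ n → ∀ i j → i < n → j < n →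
  memory (run ω raiseWeights S) weightArray i j ≡ memory S weightArray i j + memory S candidates i j
raiseWeights-spec ω S n h =
  fill-rule ω weightArray (weightArray [ rows ][ cols ] ⊕ candidates [ rows ][ cols ])
    (λ i j → memory S weightArray i j + memory S candidates i j) S n h refl refl refl refl
    λ { u v S′ _ _ keep refl refl old → cong₂ _+_ old (keep candidates refl u v) }

raiseWeights-outside : ∀ ω S n → memory S parArray 0 0 ≡ n → ∀ i j → ¬ (i < n × j < n) →
  memory (run ω raiseWeights S) weightArray i j ≡ memory S weightArray i j
raiseWeights-outside ω S n refl = outside (forEach-rule ω weightArray (put weightArray rows cols (weightArray [ rows ][ cols ] ⊕ candidates [ rows ][ cols ]))
    (λ i j → memory S weightArray i j + memory S candidates i j) S refl refl refl refl
    λ { u v S′ _ _ keep refl refl old →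
        trans (write-same (memory S′) weightArray u v _) (cong₂ _+_ old (keep candidates refl u v)) ,
        λ i j ne → write-cell (memory S′) weightArray u v _ i j (swap-≢ ne) })

hubCandidates-spec : ∀ ω S n → memory S parArray 0 0 ≡ n → let Y = memory (run ω hubCandidates S) candidates in
  (∀ i → i < n → Y i i ≡ memory S parArray 7 0) × (∀ i j → i ≢ j → Y i j ≡ memory S candidates i j)
hubCandidates-spec ω S n refl = finish (loop-rule ω 20 parArray 0 (put candidates rows rows (par 7)) S I step
    ((λ i n≤i i<n → contradiction i<n (≤⇒≯ n≤i)) , λ _ _ _ → refl))
  where
  I : ℕ → State → Set
  I k S′ = (∀ i → k ≤ i → i < n → memory S′ candidates i i ≡ memory S parArray 7 0) ×
           (∀ i j → i ≢ j → memory S′ candidates i j ≡ memory S candidates i j)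
  finish : I 0 (run ω hubCandidates S) → _
  finish (a , b) = (λ i → a i z≤n) , b
  step : ∀ k S′ → k < n → Keeps hubCandidates S S′ → I (suc k) S′ → I k (run ω (put candidates rows rows (par 7)) (assign 20 0 0 k S′))
  step k S′ k<n keep (a , b) = diagonal , λ i j ne → trans (write-cell (memory S′) candidates k k _ i j (off i j ne)) (b i j ne)
    where
    x = memory S′ parArray 7 0
    off : ∀ i j → i ≢ j → k ≢ i ⊎ k ≢ j
    off i j ne with k ≟ i
    ... | yes refl = inj₂ ne
    ... | no k≢i   = inj₁ k≢i
    diagonal : ∀ i → k ≤ i → i < n → write (memory S′) candidates k k x candidates i i ≡ memory S parArray 7 0
    diagonal i k≤i i<n with k ≟ i
    ... | yes refl = trans (write-same (memory S′) candidates k k x) (keep parArray refl 7 0)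
    ... | no k≢i   = trans (write-cell (memory S′) candidates k k x i i (inj₁ k≢i)) (a i (≤∧≢⇒< k≤i k≢i) i<n)

jumpWeight : (E DG DH W : Matrix) (d s t u v : ℕ) → ℕ
jumpWeight E DG DH W d s t u v =
  select (E u v)
    (select (suc d ∸ (DG s u + DG u t))
      (select (suc d ∸ (DG s v + DG v t))
        (select (DH s v ∸ (DH s u + 1)) (suc (W u v)) 0) 0) 0) 0

jumpCandidates-spec : ∀ ω S n → memory S parArray 0 0 ≡ n → ∀ i j → i < n → j < n →
  memory (run ω jumpCandidates S) candidates i j ≡
  jumpWeight (memory S graphArray) (memory S distG) (memory S distH) (memory S weightArray)
    (memory S boundCell 0 0) (memory S requestArray 0 0) (memory S requestArray 0 1) i j
jumpCandidates-spec ω S n refl i j i<n j<n =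
  inside (forEach-rule ω candidates (put candidates rows cols (lit 0) ⟫ test₁) w S refl refl refl refl step) i j (i<n , j<n)
  where
  store = put candidates rows cols (lit 1 ⊕ weightArray [ rows ][ cols ])
  test₄ = test (distH [ src ][ cols ] ⊖ (distH [ src ][ rows ] ⊕ lit 1)) store nop
  test₃ = test (local cols) test₄ nop
  test₂ = test (local rows) test₃ nop
  test₁ = test (graphArray [ rows ][ cols ]) test₂ nop
  w = jumpWeight (memory S graphArray) (memory S distG) (memory S distH) (memory S weightArray)
        (memory S boundCell 0 0) (memory S requestArray 0 0) (memory S requestArray 0 1)
  step : ∀ u v S′ → u < n → v < n → Keeps jumpCandidates S S′ → memory S′ 20 0 0 ≡ u → memory S′ 21 0 0 ≡ v →
     memory S′ candidates u v ≡ memory S candidates u v →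
     memory (run ω (put candidates rows cols (lit 0) ⟫ test₁) S′) candidates u v ≡ w u v ×
     (∀ i j → i ≢ u ⊎ j ≢ v → memory (run ω (put candidates rows cols (lit 0) ⟫ test₁) S′) candidates i j ≡ memory S′ candidates i j)
  step u v S′ u<n v<n keep refl refl old =
    run-select ω (graphArray [ rows ][ cols ]) test₂ nop S₁ P
      (λ h₁ → run-select ω (local rows) test₃ nop S₁ P
        (λ h₂ → run-select ω (local cols) test₄ nop S₁ P
          (λ h₃ → run-select ω (distH [ src ][ cols ] ⊖ (distH [ src ][ rows ] ⊕ lit 1)) store nop S₁ P
            (λ h₄ → trans (write-same (memory S₁) candidates u v _)
                      (trans (cong suc (keep weightArray refl u v))
                        (sym (trans (select-≢0 (h₁ ∘ trans e₁)) (trans (select-≢0 (h₂ ∘ trans e₂)) (trans (select-≢0 (h₃ ∘ trans e₃)) (select-≢0 (h₄ ∘ trans e₄))))))) ,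
                    λ i j ne → trans (write-cell (memory S₁) candidates u v _ i j (swap-≢ ne)) (unchanged i j ne))
            (λ z → zero′ (sym (trans (select-≢0 (h₁ ∘ trans e₁)) (trans (select-≢0 (h₂ ∘ trans e₂)) (trans (select-≢0 (h₃ ∘ trans e₃)) (select-≡0 (trans (sym e₄) z))))))))
          (λ z → zero′ (sym (trans (select-≢0 (h₁ ∘ trans e₁)) (trans (select-≢0 (h₂ ∘ trans e₂)) (select-≡0 (trans (sym e₃) z)))))))
        (λ z → zero′ (sym (trans (select-≢0 (h₁ ∘ trans e₁)) (select-≡0 (trans (sym e₂) z))))))
      (λ z → zero′ (sym (select-≡0 (trans (sym e₁) z))))
    where
    S₁ = assign candidates u v 0 S′
    P : State → Set
    P S″ = memory S″ candidates u v ≡ w u v × (∀ i j → i ≢ u ⊎ j ≢ v → memory S″ candidates i j ≡ memory S′ candidates i j)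
    unchanged : ∀ i j → i ≢ u ⊎ j ≢ v → memory S₁ candidates i j ≡ memory S′ candidates i j
    unchanged i j ne = write-cell (memory S′) candidates u v 0 i j (swap-≢ ne)
    zero′ : 0 ≡ w u v → P S₁
    zero′ z = trans (write-same (memory S′) candidates u v 0) z , unchanged
    s≡ = keep requestArray refl 0 0
    t≡ = keep requestArray refl 0 1
    e₁ : memory S′ graphArray u v ≡ memory S graphArray u v
    e₁ = keep graphArray refl u v
    loc : ∀ x → suc (memory S′ boundCell 0 0) ∸ (memory S′ distG (memory S′ requestArray 0 0) x + memory S′ distG x (memory S′ requestArray 0 1))
              ≡ suc (memory S boundCell 0 0) ∸ (memory S distG (memory S requestArray 0 0) x + memory S distG x (memory S requestArray 0 1))
    loc x = cong₂ (λ a b → suc a ∸ b) (keep boundCell refl 0 0)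
      (cong₂ _+_ (trans (cong (λ a → memory S′ distG a x) s≡) (keep distG refl _ x))
                 (trans (cong (λ a → memory S′ distG x a) t≡) (keep distG refl x _)))
    e₂ = loc u
    e₃ = loc v
    e₄ : memory S′ distH (memory S′ requestArray 0 0) v ∸ (memory S′ distH (memory S′ requestArray 0 0) u + 1) ≡
         memory S distH (memory S requestArray 0 0) v ∸ (memory S distH (memory S requestArray 0 0) u + 1)
    e₄ = cong₂ (λ a b → a ∸ (b + 1)) (trans (cong (λ a → memory S′ distH a v) s≡) (keep distH refl _ v))
                                     (trans (cong (λ a → memory S′ distH a u) s≡) (keep distH refl _ u))

totalWeight-spec : ∀ ω S n → memory S parArray 0 0 ≡ n → memory (run ω totalWeight S) scratch 0 0 ≡ sum² n (memory S candidates)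
totalWeight-spec ω S n refl = trans (sym (+-identityʳ _)) (loop-rule ω 20 parArray 0 inner S₁ I step refl)
  where
  Y = memory S candidates
  add = put₀ scratch (cell scratch ⊕ candidates [ rows ][ cols ])
  inner = loop 21 parArray 0 add
  S₁ = assign scratch 0 0 0 S
  row = λ i → sum< n (Y i)
  I : ℕ → State → Set
  I k S′ = memory S′ scratch 0 0 + sum< k row ≡ sum² n Y
  step : ∀ u S′ → u < n → Keeps (forEach add) S₁ S′ → I (suc u) S′ → I u (run ω inner (assign 20 0 0 u S′))
  step u S′ u<n keep h = loop-rule ω 21 parArray 0 add S₂ I₂ step₂ initial
    where
    S₂ = assign 20 0 0 u S′
    n₂ : memory S₂ parArray 0 0 ≡ n
    n₂ = keep parArray refl 0 0
    I₂ : ℕ → State → Set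
    I₂ k S″ = memory S″ scratch 0 0 + (sum< k (Y u) + sum< u row) ≡ sum² n Y
    initial : I₂ (memory S₂ parArray 0 0) (assign 21 0 0 (memory S₂ parArray 0 0) S₂)
    initial = trans (cong (λ k → memory S′ scratch 0 0 + (sum< k (Y u) + sum< u row)) n₂) h
    step₂ : ∀ v S″ → v < memory S₂ parArray 0 0 → Keeps inner S₂ S″ → I₂ (suc v) S″ → I₂ v (run ω add (assign 21 0 0 v S″))
    step₂ v S″ _ keep′ h′ = trans (cong (λ y → memory S″ scratch 0 0 + y + (sum< v (Y u) + sum< u row))
        (trans (cong (λ a → memory S″ candidates a v) (keep′ 20 refl 0 0)) (trans (keep′ candidates refl u v) (keep candidates refl u v))))
      (trans (lem (memory S″ scratch 0 0) (Y u v) _ _) h′)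
      where
      lem : ∀ a b c d → a + b + (c + d) ≡ a + (b + c + d)
      lem = solve-∀

draws-spec : ∀ ω S K b → memory S parArray 2 0 ≡ K → memory S parArray 3 0 ≡ b → let S′ = run ω draws S in
  tossed S′ ≡ tossed S + K * b × (∀ i → i < K → memory S′ drawArray i 0 ≡ drawn ω (tossed S) b K i)
draws-spec ω S K b refl refl = finish (loop-rule ω 20 parArray 2 body S I step (refl , (λ i K≤i i<K → contradiction i<K (≤⇒≯ K≤i)) , λ _ _ → refl))
  where
  o = tossed S
  tossOnce = toss xCell ⟫ put₀ scratch (cell scratch ⊕ cell scratch ⊕ cell xCell)
  inner = loop 21 parArray 3 tossOnce
  body = put₀ scratch (lit 0) ⟫ inner ⟫ put drawArray rows (lit 0) (cell scratch)
  -- The last clause says that the draws still to be made, read from the current coin on, are those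
  -- prescribed at the outset.
  I : ℕ → State → Set
  I k S′ = tossed S′ + k * b ≡ o + K * b ×
           (∀ i → k ≤ i → i < K → memory S′ drawArray i 0 ≡ drawn ω o b K i) ×
           (∀ i → i < k → drawn ω (tossed S′) b k i ≡ drawn ω o b K i)
  finish : I 0 (run ω draws S) → tossed (run ω draws S) ≡ o + K * b × (∀ i → i < K → memory (run ω draws S) drawArray i 0 ≡ drawn ω o b K i)
  finish (t , h , _) = trans (sym (+-identityʳ _)) t , λ i → h i z≤n
  step : ∀ k S′ → k < K → Keeps draws S S′ → I (suc k) S′ → I k (run ω body (assign 20 0 0 k S′))
  step k S′ k<K keep (t , done , rest) = tossed′ , done′ , rest′
    where
    S₁ = assign scratch 0 0 0 (assign 20 0 0 k S′)
    S₂ = run ω inner S₁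
    b₁ : memory S₁ parArray 3 0 ≡ b
    b₁ = keep parArray refl 3 0
    I₂ : ℕ → State → Set
    I₂ j S″ = tossed S″ + j ≡ tossed S′ + b × val ω (tossed S″) j (memory S″ scratch 0 0) ≡ val ω (tossed S′) b 0
    i₂ : I₂ 0 S₂
    i₂ = loop-rule ω 21 parArray 3 tossOnce S₁ I₂ (λ j S″ _ _ (p , q) → trans (sym (+-suc (tossed S″) j)) p , q)
           (cong (tossed S′ +_) b₁ , cong (λ z → val ω (tossed S′) z 0) b₁)
    t₂ : tossed S₂ ≡ tossed S′ + b
    t₂ = trans (sym (+-identityʳ _)) (proj₁ i₂)
    row₂ : memory S₂ 20 0 0 ≡ k
    row₂ = frame ω 20 inner refl S₁ 0 0
    S₃ = assign drawArray (memory S₂ 20 0 0) 0 (memory S₂ scratch 0 0) S₂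
    tossed′ : tossed S₂ + k * b ≡ o + K * b
    tossed′ = trans (cong (_+ k * b) t₂) (trans (+-assoc (tossed S′) b (k * b)) t)
    done′ : ∀ i → k ≤ i → i < K → memory S₃ drawArray i 0 ≡ drawn ω o b K i
    done′ i k≤i i<K with k ≟ i
    ... | yes refl = trans (cong (λ z → write (memory S₂) drawArray z 0 (memory S₂ scratch 0 0) drawArray k 0) row₂)
      (trans (write-same (memory S₂) drawArray k 0 _) (trans (proj₂ i₂)
        (trans (sym (cong (λ z → if z then val ω (tossed S′) b 0 else drawn ω (b + tossed S′) b k k) (≡ᵇ-refl k))) (rest k ≤-refl))))
    ... | no k≢i = trans (write-cell (memory S₂) drawArray (memory S₂ 20 0 0) 0 _ i 0 (inj₁ λ e → k≢i (trans (sym row₂) e)))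
      (trans (frame ω drawArray inner refl S₁ i 0) (done i (≤∧≢⇒< k≤i k≢i) i<K))
    rest′ : ∀ i → i < k → drawn ω (tossed S₂) b k i ≡ drawn ω o b K i
    rest′ i i<k = trans (cong (λ z → drawn ω z b k i) (trans t₂ (+-comm (tossed S′) b)))
      (trans (sym (cong (λ z → if z then val ω (tossed S′) b 0 else drawn ω (b + tossed S′) b k i) (≢⇒≡ᵇ (<⇒≢ i<k)))) (rest i (m<n⇒m<1+n i<k)))

-- Finding the cell that a draw selects

pick-member : ∀ Y es r {e} → pick Y es r ≡ just e → e ∈ᴸ es × Y (proj₁ e) (proj₂ e) ≢ 0
pick-member Y ((u , v) ∷ es) r h with r <ᵇ Y u v in eq
pick-member Y ((u , v) ∷ es) r refl | true =
  Any.here refl , λ z → contradiction (≤-trans (<ᵇ⇒< r (Y u v) (≡⇒T eq)) (≤-reflexive z)) λ ()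
pick-member Y ((u , v) ∷ es) r h    | false with pick-member Y es (r ∸ Y u v) h
... | p , q = Any.there p , q

row-∈ : ∀ u n {e} → e ∈ᴸ cellsOfRow u n → proj₁ e ≡ u × proj₂ e < n
row-∈ u (suc n) (Any.here refl) = refl , ≤-refl
row-∈ u (suc n) (Any.there p) with row-∈ u n p
... | a , b = a , m<n⇒m<1+n b

cells-∈ : ∀ n m {e} → e ∈ᴸ cells n m → proj₁ e < m × proj₂ e < n
cells-∈ n (suc m) p with ∈-++⁻ (cellsOfRow m n) p
... | inj₁ q with row-∈ m n q
...   | refl , b = ≤-refl , b
cells-∈ n (suc m) p | inj₂ q with cells-∈ n m q
...   | a , b = m<n⇒m<1+n a , b

pick-cell : ∀ Y n r {u v} → pick Y (cells n n) r ≡ just (u , v) → u < n × v < n × Y u v ≢ 0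
pick-cell Y n r h with pick-member Y (cells n n) r h
... | p , q with cells-∈ n n p
...   | a , b = a , b , q

Found : State → Maybe (ℕ × ℕ) → Set
Found S nothing        = memory S foundCell 0 0 ≡ 0
Found S (just (u , v)) = memory S foundCell 0 0 ≢ 0 × memory S rowCell 0 0 ≡ u × memory S colCell 0 0 ≡ v

scan-spec : ∀ ω S n → memory S parArray 0 0 ≡ n → memory S foundCell 0 0 ≡ 0 →
  Found (run ω scan S) (pick (memory S candidates) (cells n n) (memory S scratch 0 0))
scan-spec ω S n refl empty = finish (loop-rule ω 20 parArray 0 inner S I step initial)
  where
  Y = memory S candidates
  goal = pick Y (cells n n) (memory S scratch 0 0)
  -- The answer predicted from the current state and the cells not yet visited. Every step of the
  -- scan preserves it.
  outcome : State → List (ℕ × ℕ) → Maybe (ℕ × ℕ)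
  outcome S′ es = select (memory S′ foundCell 0 0) (just (memory S′ rowCell 0 0 , memory S′ colCell 0 0)) (pick Y es (memory S′ scratch 0 0))
  found = put₀ foundCell (lit 1) ⟫ put₀ rowCell rows ⟫ put₀ colCell cols
  skipped = put₀ scratch (cell scratch ⊖ candidates [ rows ][ cols ])
  compare′ = test (candidates [ rows ][ cols ] ⊖ cell scratch) found skipped
  body = test (cell foundCell) nop compare′
  inner = loop 21 parArray 0 body
  I : ℕ → State → Set
  I k S′ = outcome S′ (cells n k) ≡ goal
  initial : I n (assign 20 0 0 n S)
  initial = select-≡0 empty
  finish : I 0 (run ω scan S) → Found (run ω scan S) goal
  finish h with memory (run ω scan S) foundCell 0 0 in eq
  ... | zero  = subst (Found (run ω scan S)) h eq
  ... | suc _ = subst (Found (run ω scan S)) h ((λ z → contradiction (trans (sym eq) z) λ ()) , refl , refl)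
  step : ∀ u S′ → u < n → Keeps scan S S′ → I (suc u) S′ → I u (run ω inner (assign 20 0 0 u S′))
  step u S′ u<n keep h = loop-rule ω 21 parArray 0 body S₁ I₂ step₂
      (trans (cong (λ k → outcome S′ (cellsOfRow u k ++ cells n u)) n₁) h)
    where
    S₁ = assign 20 0 0 u S′
    n₁ : memory S₁ parArray 0 0 ≡ n
    n₁ = keep parArray refl 0 0
    I₂ : ℕ → State → Set
    I₂ k S″ = outcome S″ (cellsOfRow u k ++ cells n u) ≡ goal
    step₂ : ∀ v S″ → v < memory S₁ parArray 0 0 → Keeps inner S₁ S″ → I₂ (suc v) S″ → I₂ v (run ω body (assign 21 0 0 v S″))
    step₂ v S″ _ keep′ h′ = run-select ω (cell foundCell) nop compare′ S₂ (I₂ v)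
      (λ ne → trans (select-≢0 ne) (trans (sym (select-≢0 ne)) h′))
      (λ z → run-select ω (candidates [ rows ][ cols ] ⊖ cell scratch) found skipped S₂ (I₂ v) (hit z) (miss z))
      where
      S₂ = assign 21 0 0 v S″
      es = cellsOfRow u v ++ cells n u
      r = memory S″ scratch 0 0
      row≡ : memory S″ 20 0 0 ≡ u
      row≡ = keep′ 20 refl 0 0
      Y≡ : memory S″ candidates (memory S″ 20 0 0) v ≡ Y u v
      Y≡ = trans (cong (λ a → memory S″ candidates a v) row≡) (trans (keep′ candidates refl u v) (keep candidates refl u v))
      rest : memory S″ foundCell 0 0 ≡ 0 → pick Y ((u , v) ∷ es) r ≡ goal
      rest z = trans (sym (select-≡0 z)) h′
      hit : memory S″ foundCell 0 0 ≡ 0 → memory S″ candidates (memory S″ 20 0 0) v ∸ r ≢ 0 → I₂ v (run ω found S₂)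
      hit z ne = trans (cong (λ a → just (a , v)) row≡)
        (trans (sym (pick-hit Y u v es (≤-trans (m∸n≢0⇒n<m ne) (≤-reflexive Y≡)))) (rest z))
      miss : memory S″ foundCell 0 0 ≡ 0 → memory S″ candidates (memory S″ 20 0 0) v ∸ r ≡ 0 → I₂ v (run ω skipped S₂)
      miss z e = trans (select-≡0 z) (trans (cong (λ y → pick Y es (r ∸ y)) Y≡)
        (trans (trans (sym (pick-skip Y u v es (r ∸ Y u v)))
                      (cong (pick Y ((u , v) ∷ es)) (m+[n∸m]≡n (≤-trans (≤-reflexive (sym Y≡)) (m∸n≡0⇒m≤n e)))))
               (rest z)))

-- The effect of purchases on the solution

record Buys (E : Matrix) (n k : ℕ) (S S′ : State) : Set where
  field
    grows : ∀ i j → memory S solutionArray i j ≢ 0 → memory S′ solutionArray i j ≢ 0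
    edges : ∀ i j → memory S′ solutionArray i j ≢ 0 → memory S solutionArray i j ≢ 0 ⊎ E i j ≢ 0
    cost  : count n (memory S′ solutionArray) ≤ k + count n (memory S solutionArray)

open Buys

buys-none : ∀ {E n S S′} → (∀ i j → memory S′ solutionArray i j ≡ memory S solutionArray i j) → Buys E n 0 S S′
buys-none h .grows i j x = x ∘ trans (sym (h i j))
buys-none h .edges i j x = inj₁ (x ∘ trans (h i j))
buys-none {n = n} h .cost = ≤-reflexive (sum²-cong n λ i j _ _ → cong nz (h i j))

buys-one : ∀ {E n S} u v → E u v ≢ 0 → Buys E n 1 S (assign solutionArray u v 1 S)
buys-one {S = S} u v e .grows i j x with u ≡ᵇ i | v ≡ᵇ j
... | true  | true  = λ ()
... | true  | false = x
... | false | _     = x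
buys-one {S = S} u v e .edges i j x with u ≡ᵇ i in eq | v ≡ᵇ j in eq′
... | true  | false = inj₁ x
... | false | _     = inj₁ x
... | true  | true with ≡ᵇ⇒≡ u i (≡⇒T eq) | ≡ᵇ⇒≡ v j (≡⇒T eq′)
...   | refl | refl = inj₂ e
buys-one {n = n} {S = S} u v e .cost = count-insert n u v lem
  where
  lem : ∀ i j → write (memory S) solutionArray u v 1 solutionArray i j ≢ 0 → (i ≡ u × j ≡ v) ⊎ memory S solutionArray i j ≢ 0
  lem i j x with u ≡ᵇ i in eq | v ≡ᵇ j in eq′
  ... | true  | false = inj₂ x
  ... | false | _     = inj₂ x
  ... | true  | true  = inj₁ (sym (≡ᵇ⇒≡ u i (≡⇒T eq)) , sym (≡ᵇ⇒≡ v j (≡⇒T eq′)))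

buys-trans : ∀ {E n k l S S′ S″} → Buys E n k S S′ → Buys E n l S′ S″ → Buys E n (l + k) S S″
buys-trans a b .grows i j x = b .grows i j (a .grows i j x)
buys-trans a b .edges i j x with b .edges i j x
... | inj₁ y = a .edges i j y
... | inj₂ y = inj₂ y
buys-trans {n = n} {k} {l} {S} a b .cost =
  ≤-trans (b .cost) (≤-trans (+-monoʳ-≤ l (a .cost)) (≤-reflexive (sym (+-assoc l k _))))

buys-weaken : ∀ {E n k l S S′} → k ≤ l → Buys E n k S S′ → Buys E n l S S′
buys-weaken h a .grows = a .grows
buys-weaken h a .edges = a .edges
buys-weaken {n = n} {S = S} h a .cost = ≤-trans (a .cost) (+-monoˡ-≤ (count n (memory S solutionArray)) h)

buys-cong : ∀ {E E′ n k S S′} → (∀ i j → E i j ≡ E′ i j) → Buys E n k S S′ → Buys E′ n k S S′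
buys-cong h a .grows = a .grows
buys-cong h a .edges i j x with a .edges i j x
... | inj₁ y = inj₁ y
... | inj₂ y = inj₂ (y ∘ trans (h i j))
buys-cong h a .cost = a .cost

-- Hubs and their shortest-path trees

module Parent (ω : Coins) (e₁ e₂ : Expr) where

  record-parent : Prog
  record-parent = put₀ parentCell (cols ⊕ lit 1)
  further : Prog
  further = test e₂ record-parent nop
  findParent : Prog
  findParent = put₀ parentCell (lit 0) ⟫ loop 21 parArray 0 (test e₁ further nop)

  -- `C` abstracts from the two tests, so that one proof serves trees in both directions. It has to
  -- be equivalent to them, because a search without result must prove that no parent exists.
  findParent-spec : ∀ S n → memory S parArray 0 0 ≡ n → (C : ℕ → Set) →
    (∀ u S′ → u < n → Keeps findParent S S′ → memory S′ 21 0 0 ≡ u →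
       (eval (memory S′) e₁ ≢ 0 → eval (memory S′) e₂ ≢ 0 → C u) ×
       (C u → eval (memory S′) e₁ ≢ 0 × eval (memory S′) e₂ ≢ 0)) →
    let p = memory (run ω findParent S) parentCell 0 0 in
    (p ≡ 0 × ∀ u → u < n → ¬ C u) ⊎ ∃[ u ] p ≡ suc u × u < n × C u
  findParent-spec S n refl C body = finish (loop-rule ω 21 parArray 0 (test e₁ further nop) S₁ I step
      (inj₁ (refl , λ u n≤u u<n → contradiction u<n (≤⇒≯ n≤u))))
    where
    S₁ = assign parentCell 0 0 0 S
    I : ℕ → State → Set
    I k S′ = let p = memory S′ parentCell 0 0 in
      (p ≡ 0 × ∀ u → k ≤ u → u < n → ¬ C u) ⊎ ∃[ u ] p ≡ suc u × u < n × C u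
    finish : I 0 (run ω findParent S) → _
    finish (inj₁ (z , h)) = inj₁ (z , λ u → h u z≤n)
    finish (inj₂ x)       = inj₂ x
    step : ∀ k S′ → k < n → Keeps (loop 21 parArray 0 (test e₁ further nop)) S₁ S′ → I (suc k) S′ → I k (run ω (test e₁ further nop) (assign 21 0 0 k S′))
    step k S′ k<n keep h = run-select ω e₁ further nop S₂ (I k)
      (λ x → run-select ω e₂ record-parent nop S₂ (I k)
        (λ y → inj₂ (k , +-comm k 1 , k<n , proj₁ b x y))
        (λ z → keepOld h λ c → proj₂ (proj₂ b c) z))
      (λ z → keepOld h λ c → proj₁ (proj₂ b c) z)
      where
      S₂ = assign 21 0 0 k S′
      keep₂ : Keeps findParent S S₂
      keep₂ a q i j with ∧-split {not (parentCell ≡ᵇ a)} q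
      ... | q₁ , q₂ = trans (write-other (memory S′) 21 a 0 0 k i j (proj₁ (∧-split {not (21 ≡ᵇ a)} q₂)))
        (trans (keep a q₂ i j) (write-other (memory S) parentCell a 0 0 0 i j q₁))
      b = body k S₂ k<n keep₂ refl
      keepOld : I (suc k) S′ → ¬ C k → I k S₂
      keepOld (inj₂ x) _ = inj₂ x
      keepOld (inj₁ (z , none)) ¬c = inj₁ (z , λ u k≤u u<n → extend u (m≤n⇒m<n∨m≡n k≤u) u<n)
        where
        extend : ∀ u → k < u ⊎ k ≡ u → u < n → ¬ C u
        extend u (inj₁ lt)   u<n = none u lt u<n
        extend u (inj₂ refl) _   = ¬c

OutParent InParent : (E D : Matrix) (w v u : ℕ) → Set
OutParent E D w v u = E u v ≢ 0 × D w u < D w v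
InParent  E D w v u = E v u ≢ 0 × D u w < D v w

-- A condition on single vertices: it can be established one loop iteration at a time and survives
-- further purchases. Whole shortest paths are recovered from it afterwards.
record HubAt (n : ℕ) (E D Z : Matrix) (w v : ℕ) : Set where
  field
    out : ∀ u → u < n → OutParent E D w v u → ∃[ p ] p < n × OutParent E D w v p × Z p v ≢ 0
    inn : ∀ u → u < n → InParent  E D w v u → ∃[ p ] p < n × InParent  E D w v p × Z v p ≢ 0

open HubAt

HubTrees : (n : ℕ) (E D Z : Matrix) (w : ℕ) → Set
HubTrees n E D Z w = ∀ v → v < n → HubAt n E D Z w v

hubAt-mono : ∀ {n E D Z Z′ w v} → (∀ i j → Z i j ≢ 0 → Z′ i j ≢ 0) → HubAt n E D Z w v → HubAt n E D Z′ w v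
hubAt-mono h t .out u u<n o with t .out u u<n o
... | p , p<n , q , z = p , p<n , q , h _ _ z
hubAt-mono h t .inn u u<n o with t .inn u u<n o
... | p , p<n , q , z = p , p<n , q , h _ _ z

-- The last edge of a shortest path shows that a parent exists. The one bought is strictly closer
-- and, by `relaxed`, closer by exactly 1, so the induction on the distance goes through.
hub-out : ∀ {n E D Z w} → IsDist n E D → Supported n E → HubTrees n E D Z w → w < n →
  ∀ k v → v < n → D w v ≡ k → k < n → Path Z k w v
hub-out {n} {E} {D} {Z} {w} dist supp trees w<n zero v v<n eq k<n
  with subst (λ k → Path E k w v) eq (IsDist.sound dist w v w<n v<n (subst (_< n) (sym eq) k<n))
... | here = here
hub-out {n} {E} {D} {Z} {w} dist supp trees w<n (suc k) v v<n eq k<n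
  with subst (λ k → Path E k w v) eq (IsDist.sound dist w v w<n v<n (subst (_< n) (sym eq) k<n))
... | _▹_ {v = u} q e with proj₁ (supp u v e)
... | u<n with trees v v<n .out u u<n (e , ≤-trans (s≤s (IsDist.complete dist w u k w<n u<n (≤-trans (n≤1+n k) (<⇒≤ k<n)) q)) (≤-reflexive (sym eq)))
... | p , p<n , (e′ , lt) , z = hub-out dist supp trees w<n k p p<n Dp (≤-trans (n≤1+n _) k<n) ▹ z
  where
  Dp : D w p ≡ k
  Dp = ≤-antisym (≤-pred (≤-trans lt (≤-reflexive eq)))
         (≤-pred (≤-trans (≤-reflexive (sym eq)) (IsDist.relaxed dist w p v w<n p<n v<n e′)))

uncons : ∀ {X k u v} → Path X (suc k) u v → ∃[ w ] X u w ≢ 0 × Path X k w v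
uncons (here ▹ e) = _ , e , here
uncons (p@(_ ▹ _) ▹ e) with uncons p
... | w , x , q = w , x , q ▹ e

cons : ∀ {X k u w v} → X u w ≢ 0 → Path X k w v → Path X (suc k) u v
cons e here    = here ▹ e
cons e (p ▹ f) = cons e p ▹ f

hub-in : ∀ {n E D Z w} → IsDist n E D → Supported n E → HubTrees n E D Z w → w < n →
  ∀ k v → v < n → D v w ≡ k → k < n → Path Z k v w
hub-in {n} {E} {D} {Z} {w} dist supp trees w<n zero v v<n eq k<n
  with subst (λ k → Path E k v w) eq (IsDist.sound dist v w v<n w<n (subst (_< n) (sym eq) k<n))
... | here = here
hub-in {n} {E} {D} {Z} {w} dist supp trees w<n (suc k) v v<n eq k<n
  with uncons (subst (λ k → Path E k v w) eq (IsDist.sound dist v w v<n w<n (subst (_< n) (sym eq) k<n)))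
... | u , e , q with proj₂ (supp v u e)
... | u<n with trees v v<n .inn u u<n (e , ≤-trans (s≤s (IsDist.complete dist u w k u<n w<n (≤-trans (n≤1+n k) (<⇒≤ k<n)) q)) (≤-reflexive (sym eq)))
... | p , p<n , (e′ , lt) , z = cons z (hub-in dist supp trees w<n k p p<n Dp (≤-trans (n≤1+n _) k<n))
  where
  -- `relaxed` speaks of distances from a fixed source, so here the edge is put in front of a
  -- shortest path from `p` instead.
  Dp : D p w ≡ k
  Dp with D p w <? n
  ... | yes D<n = ≤-antisym (≤-pred (≤-trans lt (≤-reflexive eq))) (≤-pred (≤-trans (≤-reflexive (sym eq))
          (IsDist.complete dist v w (suc (D p w)) v<n w<n D<n (cons e′ (IsDist.sound dist p w p<n w<n D<n)))))
  ... | no ¬D<n = contradiction (≤-trans (≤-trans lt (≤-reflexive eq)) (<⇒≤ k<n)) (λ h → ¬D<n h)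

module _ (ω : Coins) (n : ℕ) where

  private
    E D : State → Matrix
    E S = memory S graphArray
    D S = memory S distG

  buyOut-spec : ∀ S v w → memory S parArray 0 0 ≡ n → memory S 20 0 0 ≡ v → memory S rowCell 0 0 ≡ w → let S′ = run ω buyOut S in
    Buys (E S) n 1 S S′ × (∀ u → u < n → OutParent (E S) (D S) w v u → ∃[ p ] p < n × OutParent (E S) (D S) w v p × memory S′ solutionArray p v ≢ 0)
  buyOut-spec S v w n≡ refl refl = run-select ω (cell parentCell) buy nop S₁ P bought none
    where
    open Parent ω (graphArray [ cols ][ rows ]) (distG [ cell rowCell ][ rows ] ⊖ distG [ cell rowCell ][ cols ])
    buy = put solutionArray (cell parentCell ⊖ lit 1) rows (lit 1)
    S₁ = run ω findParent S
    C = OutParent (E S) (D S) w v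
    P : State → Set
    P S′ = Buys (E S) n 1 S S′ × (∀ u → u < n → C u → ∃[ p ] p < n × C p × memory S′ solutionArray p v ≢ 0)
    r = findParent-spec S n n≡ C λ { u S′ u<n keep refl →
      let g : memory S′ graphArray u (memory S′ 20 0 0) ≡ E S u v
          g = trans (cong (memory S′ graphArray u) (keep 20 refl 0 0)) (keep graphArray refl u v)
          d : ∀ x → memory S′ distG (memory S′ rowCell 0 0) x ≡ D S w x
          d x = trans (cong (λ a → memory S′ distG a x) (keep rowCell refl 0 0)) (keep distG refl w x)
          e : memory S′ distG (memory S′ rowCell 0 0) (memory S′ 20 0 0) ∸ memory S′ distG (memory S′ rowCell 0 0) u ≡ D S w v ∸ D S w u
          e = cong₂ _∸_ (trans (d _) (cong (D S w) (keep 20 refl 0 0))) (d u)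
      in (λ x y → (x ∘ trans g) , m∸n≢0⇒n<m (y ∘ trans e)) ,
         (λ (x , lt) → (x ∘ trans (sym g)) , λ z → contradiction lt (≤⇒≯ (m∸n≡0⇒m≤n (trans (sym e) z)))) }
    same : ∀ i j → memory S₁ solutionArray i j ≡ memory S solutionArray i j
    same = frame ω solutionArray findParent refl S
    none : memory S₁ parentCell 0 0 ≡ 0 → P S₁
    none z with r
    ... | inj₁ (_ , no-parent) = buys-weaken z≤n (buys-none same) , λ u u<n c → contradiction c (no-parent u u<n)
    ... | inj₂ (u , e , _) = contradiction (trans (sym e) z) λ ()
    bought : memory S₁ parentCell 0 0 ≢ 0 → P (run ω buy S₁)
    bought ne with r
    ... | inj₁ (z , _) = contradiction z ne
    ... | inj₂ (u , e , u<n , c) = subst₂ (λ a b → P (assign solutionArray a b 1 S₁)) (sym (cong (_∸ 1) e)) (sym row≡)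
        ( buys-trans (buys-none same) (buys-one u v (proj₁ c))
        , λ _ _ _ → u , u<n , c , λ z → contradiction (trans (sym (write-same (memory S₁) solutionArray u v 1)) z) λ ())
      where
      row≡ : memory S₁ 20 0 0 ≡ v
      row≡ = frame ω 20 findParent refl S 0 0

  buyIn-spec : ∀ S v w → memory S parArray 0 0 ≡ n → memory S 20 0 0 ≡ v → memory S rowCell 0 0 ≡ w → let S′ = run ω buyIn S in
    Buys (E S) n 1 S S′ × (∀ u → u < n → InParent (E S) (D S) w v u → ∃[ p ] p < n × InParent (E S) (D S) w v p × memory S′ solutionArray v p ≢ 0)
  buyIn-spec S v w n≡ refl refl = run-select ω (cell parentCell) buy nop S₁ P bought none
    where
    open Parent ω (graphArray [ rows ][ cols ]) (distG [ rows ][ cell rowCell ] ⊖ distG [ cols ][ cell rowCell ])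
    buy = put solutionArray rows (cell parentCell ⊖ lit 1) (lit 1)
    S₁ = run ω findParent S
    C = InParent (E S) (D S) w v
    P : State → Set
    P S′ = Buys (E S) n 1 S S′ × (∀ u → u < n → C u → ∃[ p ] p < n × C p × memory S′ solutionArray v p ≢ 0)
    r = findParent-spec S n n≡ C λ { u S′ u<n keep refl →
      let g : memory S′ graphArray (memory S′ 20 0 0) u ≡ E S v u
          g = trans (cong (λ a → memory S′ graphArray a u) (keep 20 refl 0 0)) (keep graphArray refl v u)
          d : ∀ x → memory S′ distG x (memory S′ rowCell 0 0) ≡ D S x w
          d x = trans (cong (memory S′ distG x) (keep rowCell refl 0 0)) (keep distG refl x w)
          e : memory S′ distG (memory S′ 20 0 0) (memory S′ rowCell 0 0) ∸ memory S′ distG u (memory S′ rowCell 0 0) ≡ D S v w ∸ D S u w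
          e = cong₂ _∸_ (trans (d _) (cong (λ a → D S a w) (keep 20 refl 0 0))) (d u)
      in (λ x y → (x ∘ trans g) , m∸n≢0⇒n<m (y ∘ trans e)) ,
         (λ (x , lt) → (x ∘ trans (sym g)) , λ z → contradiction lt (≤⇒≯ (m∸n≡0⇒m≤n (trans (sym e) z)))) }
    same : ∀ i j → memory S₁ solutionArray i j ≡ memory S solutionArray i j
    same = frame ω solutionArray findParent refl S
    none : memory S₁ parentCell 0 0 ≡ 0 → P S₁
    none z with r
    ... | inj₁ (_ , no-parent) = buys-weaken z≤n (buys-none same) , λ u u<n c → contradiction c (no-parent u u<n)
    ... | inj₂ (u , e , _) = contradiction (trans (sym e) z) λ ()
    bought : memory S₁ parentCell 0 0 ≢ 0 → P (run ω buy S₁)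
    bought ne with r
    ... | inj₁ (z , _) = contradiction z ne
    ... | inj₂ (u , e , u<n , c) = subst₂ (λ a b → P (assign solutionArray a b 1 S₁)) (sym row≡) (sym (cong (_∸ 1) e))
        ( buys-trans (buys-none same) (buys-one v u (proj₁ c))
        , λ _ _ _ → u , u<n , c , λ z → contradiction (trans (sym (write-same (memory S₁) solutionArray v u 1)) z) λ ())
      where
      row≡ : memory S₁ 20 0 0 ≡ v
      row≡ = frame ω 20 findParent refl S 0 0

outParent-cong : ∀ {E E′ D D′ w v u} → (∀ i j → E i j ≡ E′ i j) → (∀ i j → D i j ≡ D′ i j) →
  OutParent E D w v u → OutParent E′ D′ w v u
outParent-cong {w = w} {v} {u} e d (x , y) = (x ∘ trans (e u v)) , subst₂ _<_ (d w u) (d w v) y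

inParent-cong : ∀ {E E′ D D′ w v u} → (∀ i j → E i j ≡ E′ i j) → (∀ i j → D i j ≡ D′ i j) →
  InParent E D w v u → InParent E′ D′ w v u
inParent-cong {w = w} {v} {u} e d (x , y) = (x ∘ trans (e v u)) , subst₂ _<_ (d u w) (d v w) y

pick-cong : ∀ {Y Y′} es r → (∀ i j → Y i j ≡ Y′ i j) → pick Y es r ≡ pick Y′ es r
pick-cong []             r h = refl
pick-cong {Y} {Y′} ((u , v) ∷ es) r h rewrite h u v =
  cong (if r <ᵇ Y′ u v then just (u , v) else_) (pick-cong es (r ∸ Y′ u v) h)

module _ (ω : Coins) (n : ℕ) (E D : Matrix) where

  buyBoth-spec : ∀ S v w → memory S parArray 0 0 ≡ n → memory S 20 0 0 ≡ v → memory S rowCell 0 0 ≡ w →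
    (∀ i j → memory S graphArray i j ≡ E i j) → (∀ i j → memory S distG i j ≡ D i j) →
    let S′ = run ω (block buyOut ⟫ block buyIn) S in Buys E n 2 S S′ × HubAt n E D (memory S′ solutionArray) w v
  buyBoth-spec S v w n≡ v≡ w≡ e d =
    buys-trans (buys-cong e (proj₁ o)) (buys-cong e₁ (proj₁ i)) , record
      { out = λ u u<n c → case proj₂ o u u<n (outParent-cong (λ i j → sym (e i j)) (λ i j → sym (d i j)) c) of
          λ (p , p<n , c′ , z) → p , p<n , outParent-cong e d c′ , proj₁ i .grows p v z
      ; inn = λ u u<n c → case proj₂ i u u<n (inParent-cong (λ i j → sym (e₁ i j)) (λ i j → sym (d₁ i j)) c) of
          λ (p , p<n , c′ , z) → p , p<n , inParent-cong e₁ d₁ c′ , z }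
    where
    S₁ = run ω (block buyOut) S
    e₁ : ∀ i j → memory S₁ graphArray i j ≡ E i j
    e₁ i j = trans (frame ω graphArray (block buyOut) refl S i j) (e i j)
    d₁ : ∀ i j → memory S₁ distG i j ≡ D i j
    d₁ i j = trans (frame ω distG (block buyOut) refl S i j) (d i j)
    o = block-spec ω buyOut S (λ S′ → Buys (memory S graphArray) n 1 S S′ × (∀ u → u < n → OutParent (memory S graphArray) (memory S distG) w v u →
          ∃[ p ] p < n × OutParent (memory S graphArray) (memory S distG) w v p × memory S′ solutionArray p v ≢ 0))
          (buyOut-spec ω n S v w n≡ v≡ w≡)
    i = block-spec ω buyIn S₁ (λ S′ → Buys (memory S₁ graphArray) n 1 S₁ S′ × (∀ u → u < n → InParent (memory S₁ graphArray) (memory S₁ distG) w v u →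
          ∃[ p ] p < n × InParent (memory S₁ graphArray) (memory S₁ distG) w v p × memory S′ solutionArray v p ≢ 0))
          (buyIn-spec ω n S₁ v w (trans (frame ω parArray (block buyOut) refl S 0 0) n≡)
          (trans (frame ω 20 (block buyOut) refl S 0 0) v≡) (trans (frame ω rowCell (block buyOut) refl S 0 0) w≡))

  buyTrees-spec : ∀ S w → memory S parArray 0 0 ≡ n → memory S rowCell 0 0 ≡ w →
    (∀ i j → memory S graphArray i j ≡ E i j) → (∀ i j → memory S distG i j ≡ D i j) →
    let S′ = run ω buyTrees S in
    Buys E n (n * 2) S S′ × HubTrees n E D (memory S′ solutionArray) w
  buyTrees-spec S w refl w≡ e d = finish (loop-rule ω 20 parArray 0 both S I step initial)
    where
    both = block buyOut ⟫ block buyIn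
    I : ℕ → State → Set
    I k S′ = Buys E n ((n ∸ k) * 2) S S′ × (∀ v → k ≤ v → v < n → HubAt n E D (memory S′ solutionArray) w v)
    initial : I n (assign 20 0 0 n S)
    initial = buys-weaken z≤n (buys-none λ _ _ → refl) , λ v n≤v v<n → contradiction v<n (≤⇒≯ n≤v)
    finish : I 0 (run ω buyTrees S) → _
    finish (a , b) = a , λ v → b v z≤n
    step : ∀ k S′ → k < n → Keeps buyTrees S S′ → I (suc k) S′ → I k (run ω both (assign 20 0 0 k S′))
    step k S′ k<n keep (b , t) = assemble
      (buyBoth-spec S₂ k w (keep parArray refl 0 0) refl (trans (keep rowCell refl 0 0) w≡)
        (λ i j → trans (keep graphArray refl i j) (e i j)) (λ i j → trans (keep distG refl i j) (d i j)))
      where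
      S₂ = assign 20 0 0 k S′
      assemble : Buys E n 2 S₂ (run ω both S₂) × HubAt n E D (memory (run ω both S₂) solutionArray) w k → I k (run ω both S₂)
      assemble (b′ , t′) =
        buys-weaken (≤-reflexive (cong (_* 2) (sym (∸-step k<n)))) (buys-trans (buys-trans {S′ = S′} {S″ = S₂} b (buys-none λ _ _ → refl)) b′) ,
        λ v k≤v → extend v (m≤n⇒m<n∨m≡n k≤v)
        where
        extend : ∀ v → k < v ⊎ k ≡ v → v < n → HubAt n E D (memory (run ω both S₂) solutionArray) w v
        extend v (inj₁ lt)   v<n = hubAt-mono (b′ .grows) (t v lt v<n)
        extend v (inj₂ refl) _   = t′

  -- Edges that one draw may buy: a single jump, or the two trees of a hub.
  unit : ℕ → ℕ
  unit zero    = 1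
  unit (suc _) = n * 2

  record Outcome (Y : Matrix) (mode k : ℕ) (S S′ : State) : Set where
    field
      buys    : Buys E n k S S′
      hubGrow : ∀ w → memory S hubArray w w ≢ 0 → memory S′ hubArray w w ≢ 0
      newHub  : ∀ w → memory S′ hubArray w w ≢ 0 →
                memory S hubArray w w ≢ 0 ⊎ (w < n × HubTrees n E D (memory S′ solutionArray) w)

  open Outcome public

  Marked : (mode u v : ℕ) → State → Set
  Marked zero    u v S = memory S solutionArray u v ≢ 0
  Marked (suc _) u v S = memory S hubArray u u ≢ 0

  module _ (Y : Matrix) (mode : ℕ) (allowed : mode ≡ 0 → ∀ u v → u < n → v < n → Y u v ≢ 0 → E u v ≢ 0) where

    buyPick-spec : ∀ S i r → memory S yCell 0 0 ≡ i → memory S drawArray i 0 ≡ r → memory S parArray 0 0 ≡ n →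
      (∀ i j → memory S graphArray i j ≡ E i j) → (∀ i j → memory S distG i j ≡ D i j) →
      (∀ i j → memory S candidates i j ≡ Y i j) → memory S modeCell 0 0 ≡ mode →
      let S′ = run ω buyPick S in
      Outcome Y mode (unit mode) S S′ × (∀ u v → pick Y (cells n n) r ≡ just (u , v) → Marked mode u v S′)
    buyPick-spec S i r refl refl n≡ e d y m = by-pick (pick Y (cells n n) r) refl
        (subst (Found S₂) (pick-cong (cells n n) r y)
          (block-spec ω scan S₁ (λ S′ → Found S′ (pick (memory S candidates) (cells n n) r)) (scan-spec ω S₁ n n≡ refl)))
      where
      S₁ = assign foundCell 0 0 0 (assign scratch 0 0 r S)
      S₂ = run ω (block scan) S₁
      S₃ = run ω buyPick S
      buy = test (cell modeCell) buyHub buyEdge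
      sol≡ : ∀ i j → memory S₂ solutionArray i j ≡ memory S solutionArray i j
      sol≡ = frame ω solutionArray (block scan) refl S₁
      hub≡ : ∀ i j → memory S₂ hubArray i j ≡ memory S hubArray i j
      hub≡ = frame ω hubArray (block scan) refl S₁
      P : Maybe (ℕ × ℕ) → State → Set
      P x S′ = Outcome Y mode (unit mode) S S′ × (∀ u v → x ≡ just (u , v) → Marked mode u v S′)
      by-pick : ∀ x → pick Y (cells n n) r ≡ x → Found S₂ x → P x S₃
      by-pick nothing eq f = subst (P nothing) (sym (select-≡0 f))
        ( record { buys = buys-weaken z≤n (buys-none sol≡)
                 ; hubGrow = λ w h → h ∘ trans (sym (hub≡ w w))
                 ; newHub = λ w h → inj₁ (h ∘ trans (hub≡ w w)) }
        , λ _ _ () )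
      by-pick (just (u , v)) eq (f , u≡ , v≡) with pick-cell Y n r eq
      ... | u<n , v<n , Yuv = subst (P (just (u , v))) (sym (select-≢0 f)) (by-mode mode refl)
        where
        mode≡ : memory S₂ modeCell 0 0 ≡ mode
        mode≡ = trans (frame ω modeCell (block scan) refl S₁ 0 0) m
        by-mode : ∀ k → mode ≡ k → P (just (u , v)) (run ω buy S₂)
        by-mode zero refl = subst (P (just (u , v))) (sym (select-≡0 mode≡))
          (subst₂ (λ a b → P (just (u , v)) (assign solutionArray a b 1 S₂)) (sym u≡) (sym v≡)
            ( record { buys = buys-trans (buys-none sol≡) (buys-one u v (allowed refl u v u<n v<n Yuv))
                     ; hubGrow = λ w h → h ∘ trans (sym (hub≡ w w))
                     ; newHub = λ w h → inj₁ (h ∘ trans (hub≡ w w)) }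
            , λ { _ _ refl z → contradiction (trans (sym (write-same (memory S₂) solutionArray u v 1)) z) λ () }))
        by-mode (suc k) refl = subst (P (just (u , v))) (sym (select-≢0 (λ z → contradiction (trans (sym mode≡) z) λ ())))
          (subst (λ a → P (just (u , v)) (run ω trees (assign hubArray a a 1 S₂))) (sym u≡)
            (hub-bought (block-spec ω buyTrees S₄ (λ S′ → Buys E n (n * 2) S₄ S′ × HubTrees n E D (memory S′ solutionArray) u) (buyTrees-spec S₄ u (trans (frame ω parArray (block scan) refl S₁ 0 0) n≡) u≡
              (λ i j → trans (frame ω graphArray (block scan) refl S₁ i j) (e i j))
              (λ i j → trans (frame ω distG (block scan) refl S₁ i j) (d i j))))))
          where
          trees = block buyTrees
          S₄ = assign hubArray u u 1 S₂
          hub₅ : ∀ i j → memory (run ω trees S₄) hubArray i j ≡ memory S₄ hubArray i j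
          hub₅ = frame ω hubArray trees refl S₄
          hub-bought : Buys E n (n * 2) S₄ (run ω trees S₄) × HubTrees n E D (memory (run ω trees S₄) solutionArray) u →
                       P (just (u , v)) (run ω trees S₄)
          hub-bought (b , t) =
            ( record { buys = buys-weaken (≤-reflexive (+-identityʳ (n * 2))) (buys-trans (buys-none {S = S} {S′ = S₄} sol≡) b)
                     ; hubGrow = grow
                     ; newHub = new }
            , λ { _ _ refl z → contradiction (trans (sym (trans (hub₅ u u) (write-same (memory S₂) hubArray u u 1))) z) λ () } )
            where
            grow : ∀ w → memory S hubArray w w ≢ 0 → memory (run ω trees S₄) hubArray w w ≢ 0
            grow w h z with u ≟ w
            ... | yes refl = contradiction (trans (sym (trans (hub₅ u u) (write-same (memory S₂) hubArray u u 1))) z) λ ()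
            ... | no u≢w   = h (trans (sym (trans (hub₅ w w) (trans (write-cell (memory S₂) hubArray u u 1 w w (inj₁ u≢w)) (hub≡ w w)))) z)
            new : ∀ w → memory (run ω trees S₄) hubArray w w ≢ 0 →
                  memory S hubArray w w ≢ 0 ⊎ (w < n × HubTrees n E D (memory (run ω trees S₄) solutionArray) w)
            new w h with u ≟ w
            ... | yes refl = inj₂ (u<n , t)
            ... | no u≢w   = inj₁ λ z → h (trans (hub₅ w w) (trans (write-cell (memory S₂) hubArray u u 1 w w (inj₁ u≢w)) (trans (hub≡ w w) z)))

    -- The outcome bounds the cost; the second component feeds the probability argument, which needs
    -- that whatever a counted draw selects is marked in the end.
    purchases-spec : ∀ S K lim → memory S parArray 2 0 ≡ K → memory S parArray 0 0 ≡ n →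
      (∀ i j → memory S graphArray i j ≡ E i j) → (∀ i j → memory S distG i j ≡ D i j) →
      (∀ i j → memory S candidates i j ≡ Y i j) → memory S modeCell 0 0 ≡ mode → memory S limitCell 0 0 ≡ lim →
      let S′ = run ω purchases S in
      Outcome Y mode (lim * unit mode) S S′ ×
      (∀ i → i < K → i < lim → ∀ u v → pick Y (cells n n) (memory S drawArray i 0) ≡ just (u , v) → Marked mode u v S′)
    purchases-spec S K lim refl n≡ e d y m refl = finish (loop-rule ω yCell parArray 2 body S I step initial)
      where
      body = test (cell limitCell ⊖ cell yCell) (block buyPick) nop
      ds = λ i → memory S drawArray i 0
      I : ℕ → State → Set
      I k S′ = Outcome Y mode ((lim ∸ k) * unit mode) S S′ ×
        (∀ i → k ≤ i → i < K → i < lim → ∀ u v → pick Y (cells n n) (ds i) ≡ just (u , v) → Marked mode u v S′)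
      initial : I K (assign yCell 0 0 K S)
      initial = record { buys = buys-weaken z≤n (buys-none λ _ _ → refl) ; hubGrow = λ _ h → h ; newHub = λ _ h → inj₁ h } ,
                (λ i K≤i i<K → contradiction i<K (≤⇒≯ K≤i))
      finish : I 0 (run ω purchases S) → _
      finish (a , b) = a , (λ i → b i z≤n)
      step : ∀ k S′ → k < K → Keeps purchases S S′ → I (suc k) S′ → I k (run ω body (assign yCell 0 0 k S′))
      step k S′ k<K keep (o , hit) = run-select ω (cell limitCell ⊖ cell yCell) (block buyPick) nop S₁ (I k) active inactive
        where
        S₁ = assign yCell 0 0 k S′
        lim≡ : memory S′ limitCell 0 0 ≡ lim
        lim≡ = keep limitCell refl 0 0
        marked-mono : ∀ mode′ {u v S₂} → (∀ i j → memory S′ solutionArray i j ≢ 0 → memory S₂ solutionArray i j ≢ 0) →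
          (∀ w → memory S′ hubArray w w ≢ 0 → memory S₂ hubArray w w ≢ 0) → Marked mode′ u v S′ → Marked mode′ u v S₂
        marked-mono zero    f g = f _ _
        marked-mono (suc _) f g = g _
        inactive : memory S′ limitCell 0 0 ∸ k ≡ 0 → I k S₁
        inactive z =
          record { buys = buys-weaken (*-monoˡ-≤ (unit mode) (∸-monoʳ-≤ lim (n≤1+n k))) (buys-trans (o .buys) (buys-none λ _ _ → refl)) ; hubGrow = o .hubGrow ; newHub = o .newHub } ,
          (λ i k≤i → extend i (m≤n⇒m<n∨m≡n k≤i))
          where
          extend : ∀ i → k < i ⊎ k ≡ i → i < K → i < lim → ∀ u v → pick Y (cells n n) (ds i) ≡ just (u , v) → Marked mode u v S₁
          extend i (inj₁ lt)   i<K i<lim u v q = marked-mono mode {u} {v} {S₁} (λ _ _ h → h) (λ _ h → h) (hit i lt i<K i<lim u v q)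
          extend i (inj₂ refl) i<K i<lim = contradiction i<lim (≤⇒≯ (≤-trans (≤-reflexive (sym lim≡)) (m∸n≡0⇒m≤n z)))
        active : memory S′ limitCell 0 0 ∸ k ≢ 0 → I k (run ω (block buyPick) S₁)
        active ne with block-spec ω buyPick S₁ (λ S′ → Outcome Y mode (unit mode) S₁ S′ × (∀ u v → pick Y (cells n n) (ds k) ≡ just (u , v) → Marked mode u v S′)) (buyPick-spec S₁ k (ds k) refl (keep drawArray refl k 0) (trans (keep parArray refl 0 0) n≡)
                         (λ i j → trans (keep graphArray refl i j) (e i j)) (λ i j → trans (keep distG refl i j) (d i j))
                         (λ i j → trans (keep candidates refl i j) (y i j)) (trans (keep modeCell refl 0 0) m))
        ... | o′ , hit′ =
          record { buys = buys-weaken (≤-reflexive (cong (_* unit mode) (sym (∸-step k<lim)))) (buys-trans (buys-trans {S′ = S′} {S″ = S₁} (o .buys) (buys-none λ _ _ → refl)) (o′ .buys))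
                 ; hubGrow = λ w h → o′ .hubGrow w (o .hubGrow w h) ; newHub = new } ,
          (λ i k≤i → extend i (m≤n⇒m<n∨m≡n k≤i))
          where
          S₂ = run ω (block buyPick) S₁
          k<lim : k < lim
          k<lim = ≤-trans (m∸n≢0⇒n<m ne) (≤-reflexive lim≡)
          new : ∀ w → memory S₂ hubArray w w ≢ 0 → memory S hubArray w w ≢ 0 ⊎ (w < n × HubTrees n E D (memory S₂ solutionArray) w)
          new w h with o′ .newHub w h
          ... | inj₂ x = inj₂ x
          ... | inj₁ h′ with o .newHub w h′
          ...   | inj₁ x       = inj₁ x
          ...   | inj₂ (l , t) = inj₂ (l , λ v v<n → hubAt-mono (o′ .buys .grows) (t v v<n))
          extend : ∀ i → k < i ⊎ k ≡ i → i < K → i < lim → ∀ u v → pick Y (cells n n) (ds i) ≡ just (u , v) → Marked mode u v S₂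
          extend i (inj₁ lt)   i<K i<lim u v q = marked-mono mode {u} {v} {S₂} (o′ .buys .grows) (o′ .hubGrow) (hit i lt i<K i<lim u v q)
          extend i (inj₂ refl) i<K i<lim = hit′

purchases-idle : ∀ ω S → memory S limitCell 0 0 ≡ 0 → let S′ = run ω purchases S in
  (∀ i j → memory S′ solutionArray i j ≡ memory S solutionArray i j) × (∀ i j → memory S′ hubArray i j ≡ memory S hubArray i j)
purchases-idle ω S z = loop-rule ω yCell parArray 2 (test (cell limitCell ⊖ cell yCell) (block buyPick) nop) S
  (λ _ S′ → (∀ i j → memory S′ solutionArray i j ≡ memory S solutionArray i j) × (∀ i j → memory S′ hubArray i j ≡ memory S hubArray i j))
  (λ k S′ _ keep h → run-select ω (cell limitCell ⊖ cell yCell) (block buyPick) nop (assign yCell 0 0 k S′)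
     (λ S″ → (∀ i j → memory S″ solutionArray i j ≡ memory S solutionArray i j) × (∀ i j → memory S″ hubArray i j ≡ memory S hubArray i j))
     (λ ne → contradiction (trans (cong (_∸ k) (trans (keep limitCell refl 0 0) z)) (0∸n≡0 k)) ne) (λ _ → h))
  ((λ _ _ → refl) , λ _ _ → refl)

-- The response to a request

Same : ℕ → State → State → Set
Same a S S′ = ∀ i j → memory S′ a i j ≡ memory S a i j

source′ target′ bound′ : State → ℕ
source′ S = memory S requestArray 0 0
target′ S = memory S requestArray 0 1
bound′  S = memory S boundCell 0 0

newWeights : State → Matrix
newWeights S = jumpWeight (memory S graphArray) (memory S distG) (memory S distH) (memory S weightArray)
  (bound′ S) (source′ S) (target′ S)

-- The five courses that a round can take. They are settled before the coins of the round are
-- tossed, which is why the later analysis can fix the case and then average over the coins.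
data Response (n : ℕ) (S S′ : State) : Set where

  satisfied : memory S distH (source′ S) (target′ S) ≤ bound′ S → Same solutionArray S S′ →
    Same weightArray S S′ → Same phaseCell S S′ → Same boughtCell S S′ → Same stuckCell S S′ →
    memory S′ limitCell 0 0 ≡ 0 → Response n S S′

  direct : bound′ S < memory S distH (source′ S) (target′ S) →
    Same solutionArray (assign solutionArray (source′ S) (target′ S) 1 S) S′ →
    memory S phaseCell 0 0 ≡ 0 → memory S boughtCell 0 0 < memory S parArray 6 0 →
    Same weightArray S S′ → Same phaseCell S S′ → memory S′ boughtCell 0 0 ≡ suc (memory S boughtCell 0 0) →
    Same stuckCell S S′ → memory S′ limitCell 0 0 ≡ 0 → Response n S S′

  hubs : bound′ S < memory S distH (source′ S) (target′ S) →
    Same solutionArray (assign solutionArray (source′ S) (target′ S) 1 S) S′ →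
    memory S phaseCell 0 0 ≡ 0 → memory S parArray 6 0 ≤ memory S boughtCell 0 0 →
    Same weightArray S S′ → memory S′ phaseCell 0 0 ≡ 1 → Same stuckCell S S′ →
    memory S′ modeCell 0 0 ≡ 1 → memory S′ limitCell 0 0 ≡ memory S parArray 4 0 →
    (∀ i → i < n → memory S′ candidates i i ≡ memory S parArray 7 0) →
    (∀ i j → i < n → j < n → i ≢ j → memory S′ candidates i j ≡ 0) → Response n S S′

  update : bound′ S < memory S distH (source′ S) (target′ S) →
    Same solutionArray (assign solutionArray (source′ S) (target′ S) 1 S) S′ →
    memory S phaseCell 0 0 ≢ 0 → sum² n (memory S′ candidates) < memory S parArray 5 0 →
    (∀ i j → i < n → j < n → memory S′ candidates i j ≡ newWeights S i j) →
    (∀ i j → i < n → j < n → memory S′ weightArray i j ≡ memory S weightArray i j + memory S′ candidates i j) →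
    (∀ i j → ¬ (i < n × j < n) → memory S′ weightArray i j ≡ memory S weightArray i j) →
    Same phaseCell S S′ → Same stuckCell S S′ →
    memory S′ modeCell 0 0 ≡ 0 → memory S′ limitCell 0 0 ≡ memory S parArray 2 0 → Response n S S′

  stuck : bound′ S < memory S distH (source′ S) (target′ S) →
    Same solutionArray (assign solutionArray (source′ S) (target′ S) 1 S) S′ →
    memory S phaseCell 0 0 ≢ 0 → memory S parArray 5 0 ≤ sum² n (newWeights S) →
    Same weightArray S S′ → Same phaseCell S S′ → memory S′ stuckCell 0 0 ≡ 1 →
    memory S′ limitCell 0 0 ≡ 0 → Response n S S′

respond-spec : ∀ ω n S → memory S parArray 0 0 ≡ n → memory S modeCell 0 0 ≡ 0 → memory S limitCell 0 0 ≡ 0 →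
  Response n S (run ω respond S)
respond-spec ω n S n≡ mode≡ lim≡ = run-select ω ((lit 1 ⊕ cell boundCell) ⊖ distH [ src ][ tgt ]) nop buyDirect S (Response n S)
  (λ ne → satisfied (≤-pred (m∸n≢0⇒n<m ne)) (λ _ _ → refl) (λ _ _ → refl) (λ _ _ → refl) (λ _ _ → refl) (λ _ _ → refl) lim≡)
  (λ z → unsatisfied (m∸n≡0⇒m≤n z))
  where
  S₁ = assign solutionArray (source′ S) (target′ S) 1 S
  early = test (par 6 ⊖ cell boughtCell) (put₀ boughtCell (cell boughtCell ⊕ lit 1)) (block openHubs)
  unsatisfied : bound′ S < memory S distH (source′ S) (target′ S) → Response n S (run ω buyDirect S)
  unsatisfied far = run-select ω (cell phaseCell) (block tryUpdate) early S₁ (Response n S)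
    (λ φ → block-spec ω tryUpdate S₁ (Response n S) (late φ))
    (λ φ → run-select ω (par 6 ⊖ cell boughtCell) (put₀ boughtCell (cell boughtCell ⊕ lit 1)) (block openHubs) S₁ (Response n S)
      (λ ne → direct far (λ _ _ → refl) φ (m∸n≢0⇒n<m ne) (λ _ _ → refl) (λ _ _ → refl) (+-comm _ 1) (λ _ _ → refl) lim≡)
      (λ z → block-spec ω openHubs S₁ (Response n S) (opening φ (m∸n≡0⇒m≤n z))))
    where
    opening : memory S phaseCell 0 0 ≡ 0 → memory S parArray 6 0 ≤ memory S boughtCell 0 0 → Response n S (run ω openHubs S₁)
    opening φ big = hubs far (frame ω solutionArray openHubs refl S₁) φ big (frame ω weightArray openHubs refl S₁)
      (frame ω phaseCell (block noCandidates ⟫ block hubCandidates) refl S₂ 0 0) (frame ω stuckCell openHubs refl S₁)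
      (frame ω modeCell (block noCandidates ⟫ block hubCandidates) refl S₂ 0 0) (frame ω limitCell (block noCandidates ⟫ block hubCandidates) refl S₂ 0 0)
      (λ i i<n → trans (proj₁ spec i i<n) (frame ω parArray (block noCandidates) refl S₂ 7 0))
      (λ i j i<n j<n ne → trans (proj₂ spec i j ne) (cleared i j i<n j<n))
      where
      S₂ = run ω (put₀ phaseCell (lit 1) ⟫ put₀ modeCell (lit 1) ⟫ put₀ limitCell (par 4)) S₁
      S₃ = run ω (block noCandidates) S₂
      cleared : ∀ i j → i < n → j < n → memory S₃ candidates i j ≡ 0
      cleared = block-spec ω noCandidates S₂ (λ S′ → ∀ i j → i < n → j < n → memory S′ candidates i j ≡ 0) (noCandidates-spec ω S₂ n n≡)
      Diagonal : State → Set
      Diagonal S′ = (∀ i → i < n → memory S′ candidates i i ≡ memory S₃ parArray 7 0) ×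
                    (∀ i j → i ≢ j → memory S′ candidates i j ≡ memory S₃ candidates i j)
      spec : Diagonal (run ω (block hubCandidates) S₃)
      spec = block-spec ω hubCandidates S₃ Diagonal (hubCandidates-spec ω S₃ n (trans (frame ω parArray (block noCandidates) refl S₂ 0 0) n≡))
    late : memory S phaseCell 0 0 ≢ 0 → Response n S (run ω tryUpdate S₁)
    late φ = run-select ω (par 5 ⊖ cell scratch) (block raiseWeights ⟫ put₀ limitCell (par 2)) (put₀ stuckCell (lit 1)) S₃ (Response n S) raised blocked
      where
      S₂ = run ω (block jumpCandidates) S₁
      S₃ = run ω (block totalWeight) S₂
      S₄ = run ω (block raiseWeights) S₃
      n₂ : memory S₂ parArray 0 0 ≡ n
      n₂ = trans (frame ω parArray (block jumpCandidates) refl S₁ 0 0) n≡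
      n₃ : memory S₃ parArray 0 0 ≡ n
      n₃ = trans (frame ω parArray (block totalWeight) refl S₂ 0 0) n₂
      Y₂ = memory S₂ candidates
      Y₃ : ∀ i j → memory S₃ candidates i j ≡ Y₂ i j
      Y₃ = frame ω candidates (block totalWeight) refl S₂
      total : memory S₃ scratch 0 0 ≡ sum² n Y₂
      total = block-spec ω totalWeight S₂ (λ S′ → memory S′ scratch 0 0 ≡ sum² n Y₂) (totalWeight-spec ω S₂ n n₂)
      M≡ : memory S₃ parArray 5 0 ≡ memory S parArray 5 0
      M≡ = trans (frame ω parArray (block totalWeight) refl S₂ 5 0) (frame ω parArray (block jumpCandidates) refl S₁ 5 0)
      Y≡ : ∀ i j → i < n → j < n → Y₂ i j ≡ newWeights S i j
      Y≡ = block-spec ω jumpCandidates S₁ (λ S′ → ∀ i j → i < n → j < n → memory S′ candidates i j ≡ newWeights S i j) (jumpCandidates-spec ω S₁ n n≡)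
      W₃ : ∀ i j → memory S₃ weightArray i j ≡ memory S weightArray i j
      W₃ i j = trans (frame ω weightArray (block totalWeight) refl S₂ i j) (frame ω weightArray (block jumpCandidates) refl S₁ i j)
      raised : memory S₃ parArray 5 0 ∸ memory S₃ scratch 0 0 ≢ 0 → Response n S (run ω (block raiseWeights ⟫ put₀ limitCell (par 2)) S₃)
      raised ne = update far
        (λ i j → trans (frame ω solutionArray (block raiseWeights) refl S₃ i j) (trans (frame ω solutionArray (block totalWeight) refl S₂ i j) (frame ω solutionArray (block jumpCandidates) refl S₁ i j)))
        φ
        (subst₂ _<_ (trans total (sum²-cong n λ i j _ _ → sym (Y₄ i j))) M≡ (m∸n≢0⇒n<m ne))
        (λ i j i<n j<n → trans (Y₄ i j) (Y≡ i j i<n j<n))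
        (λ i j i<n j<n → trans (raised-in i j i<n j<n) (cong₂ _+_ (W₃ i j) (sym (frame ω candidates (block raiseWeights) refl S₃ i j))))
        (λ i j o → trans (raised-out i j o) (W₃ i j))
        (λ i j → trans (frame ω phaseCell (block raiseWeights) refl S₃ i j) (trans (frame ω phaseCell (block totalWeight) refl S₂ i j) (frame ω phaseCell (block jumpCandidates) refl S₁ i j)))
        (λ i j → trans (frame ω stuckCell (block raiseWeights) refl S₃ i j) (trans (frame ω stuckCell (block totalWeight) refl S₂ i j) (frame ω stuckCell (block jumpCandidates) refl S₁ i j)))
        (trans (trans (frame ω modeCell (block raiseWeights) refl S₃ 0 0) (trans (frame ω modeCell (block totalWeight) refl S₂ 0 0) (frame ω modeCell (block jumpCandidates) refl S₁ 0 0))) mode≡)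
        (trans (frame ω parArray (block raiseWeights) refl S₃ 2 0) (trans (frame ω parArray (block totalWeight) refl S₂ 2 0) (frame ω parArray (block jumpCandidates) refl S₁ 2 0)))
        where
        raised-in : ∀ i j → i < n → j < n → memory S₄ weightArray i j ≡ memory S₃ weightArray i j + memory S₃ candidates i j
        raised-in = block-spec ω raiseWeights S₃ (λ S′ → ∀ i j → i < n → j < n → memory S′ weightArray i j ≡ memory S₃ weightArray i j + memory S₃ candidates i j)
          (raiseWeights-spec ω S₃ n n₃)
        raised-out : ∀ i j → ¬ (i < n × j < n) → memory S₄ weightArray i j ≡ memory S₃ weightArray i j
        raised-out = block-spec ω raiseWeights S₃ (λ S′ → ∀ i j → ¬ (i < n × j < n) → memory S′ weightArray i j ≡ memory S₃ weightArray i j)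
          (raiseWeights-outside ω S₃ n n₃)
        Y₄ : ∀ i j → memory S₄ candidates i j ≡ Y₂ i j
        Y₄ i j = trans (frame ω candidates (block raiseWeights) refl S₃ i j) (Y₃ i j)
      blocked : memory S₃ parArray 5 0 ∸ memory S₃ scratch 0 0 ≡ 0 → Response n S (assign stuckCell 0 0 1 S₃)
      blocked z = stuck far
        (λ i j → trans (frame ω solutionArray (block totalWeight) refl S₂ i j) (frame ω solutionArray (block jumpCandidates) refl S₁ i j)) φ
        (subst₂ _≤_ M≡ (trans total (sum²-cong n Y≡)) (m∸n≡0⇒m≤n z)) W₃
        (λ i j → trans (frame ω phaseCell (block totalWeight) refl S₂ i j) (frame ω phaseCell (block jumpCandidates) refl S₁ i j)) refl
        (trans (frame ω limitCell (block totalWeight) refl S₂ 0 0) (trans (frame ω limitCell (block jumpCandidates) refl S₁ 0 0) lim≡))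

isDist-cong : ∀ {n X X′ D D′} → (∀ i j → X i j ≡ X′ i j) → (∀ i j → i < n → j < n → D′ i j ≡ D i j) → IsDist n X D → IsDist n X′ D′
isDist-cong {n} {X} {X′} x d h = record
  { bounded  = λ i j i<n j<n → ≤-trans (≤-reflexive (d i j i<n j<n)) (bounded i j i<n j<n)
  ; sound    = λ i j i<n j<n lt → subst (λ k → Path X′ k i j) (sym (d i j i<n j<n))
                 (path-map (λ a b e → e ∘ trans (x a b)) (sound i j i<n j<n (subst (_< n) (d i j i<n j<n) lt)))
  ; complete = λ i j k i<n j<n k≤n p → ≤-trans (≤-reflexive (d i j i<n j<n))
                 (complete i j k i<n j<n k≤n (path-map (λ a b e → e ∘ trans (sym (x a b))) p))
  }
  where open IsDist h

-- `S` lies between `prepare` and `respond`: there the distances and the rounded bound are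
-- available, while the solution is still the old one.
record Decided (n : ℕ) (S₀ S S′ : State) : Set where
  field
    response   : Response n S S′
    distances-G : IsDist n (memory S₀ graphArray) (memory S distG)
    distances-H : IsDist n (memory S₀ solutionArray) (memory S distH)
    bound≤     : bound′ S ≤ n ∸ 1
    bound-fits : bound′ S * memory S₀ requestArray 0 3 ≤ memory S₀ requestArray 0 2
    bound-max  : ∀ k → k ≤ n ∸ 1 → k * memory S₀ requestArray 0 3 ≤ memory S₀ requestArray 0 2 → k ≤ bound′ S
    keepsPre   : ∀ a → untouched a decide ≡ true → Same a S₀ S
    keepsPost  : ∀ a → untouched a decide ≡ true → Same a S S′
    persistent : Same solutionArray S₀ S × Same weightArray S₀ S × Same phaseCell S₀ S × Same boughtCell S₀ S × Same stuckCell S₀ S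
    distG-kept : Same distG S S′

decide-spec : ∀ ω n S → memory S parArray 0 0 ≡ n → memory S parArray 1 0 ≡ n ∸ 1 →
  Supported n (memory S graphArray) → Supported n (memory S solutionArray) →
  Decided n S (run ω (block prepare) S) (run ω decide S)
decide-spec ω n S n≡ n∸1≡ supG supH = block-spec ω prepare S (λ S′ → Decided n S S′ (run ω (block respond) S′)) record
  { response = block-spec ω respond S₅ (Response n S₅) (respond-spec ω n S₅ (par₅ 0 n≡) refl refl)
  ; distances-G = isDist-cong (frame ω graphArray (block findBound) refl S) dG
      (block-spec ω (distances graphArray) S₁ (λ S′ → IsDist n (memory S₁ graphArray) (memory S′ distH))
        (Distances.distances-spec ω graphArray refl S₁ n n₁ (supported′ graphArray {S₁} (frame ω graphArray (block findBound) refl S) supG)))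
  ; distances-H = isDist-cong sol₃ (λ _ _ _ _ → refl)
      (block-spec ω (distances solutionArray) S₃ (λ S′ → IsDist n (memory S₃ solutionArray) (memory S′ distH))
        (Distances.distances-spec ω solutionArray refl S₃ n n₃ (supported′ solutionArray {S₃} sol₃ supH)))
  ; bound≤ = ≤-trans (≤-reflexive b≡) (proj₁ fb)
  ; bound-fits = ≤-trans (≤-reflexive (cong (_* memory S requestArray 0 3) b≡)) (proj₁ (proj₂ fb))
  ; bound-max = λ k k≤ h → ≤-trans (proj₂ (proj₂ fb) k k≤ h) (≤-reflexive (sym b≡))
  ; keepsPre = λ a q → frame ω a prepare (proj₁ (∧-split {untouched a prepare} q)) S
  ; keepsPost = λ a q → frame ω a (block respond) (proj₂ (∧-split {untouched a prepare} q)) S₅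
  ; persistent = frame ω solutionArray prepare refl S , frame ω weightArray prepare refl S , frame ω phaseCell prepare refl S ,
                 frame ω boughtCell prepare refl S , frame ω stuckCell prepare refl S
  ; distG-kept = frame ω distG (block respond) refl S₅
  }
  where
  S₁ = run ω (block findBound) S
  S₂ = run ω (block (distances graphArray)) S₁
  S₃ = run ω (block copyDistances) S₂
  S₅ = run ω prepare S
  Found′ : State → Set
  Found′ S′ = memory S′ boundCell 0 0 ≤ n ∸ 1 × memory S′ boundCell 0 0 * memory S requestArray 0 3 ≤ memory S requestArray 0 2 ×
    (∀ k → k ≤ n ∸ 1 → k * memory S requestArray 0 3 ≤ memory S requestArray 0 2 → k ≤ memory S′ boundCell 0 0)
  fb : Found′ S₁
  fb = block-spec ω findBound S Found′ (findBound-spec ω S (n ∸ 1) n∸1≡)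
  n₁ : memory S₁ parArray 0 0 ≡ n
  n₁ = trans (frame ω parArray (block findBound) refl S 0 0) n≡
  n₂ : memory S₂ parArray 0 0 ≡ n
  n₂ = trans (frame ω parArray (block (distances graphArray)) refl S₁ 0 0) n₁
  n₃ : memory S₃ parArray 0 0 ≡ n
  n₃ = trans (frame ω parArray (block copyDistances) refl S₂ 0 0) n₂
  par₅ : ∀ i {x} → memory S parArray i 0 ≡ x → memory S₅ parArray i 0 ≡ x
  par₅ i e = trans (frame ω parArray prepare refl S i 0) e
  sol₃ : ∀ i j → memory S₃ solutionArray i j ≡ memory S solutionArray i j
  sol₃ = frame ω solutionArray (block findBound ⟫ block (distances graphArray) ⟫ block copyDistances) refl S
  copied : ∀ i j → i < n → j < n → memory S₃ distG i j ≡ memory S₂ distH i j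
  copied = block-spec ω copyDistances S₂ (λ S′ → ∀ i j → i < n → j < n → memory S′ distG i j ≡ memory S₂ distH i j) (copy-spec ω S₂ n n₂)
  dG : ∀ i j → i < n → j < n → memory S₅ distG i j ≡ memory S₂ distH i j
  dG i j i<n j<n = trans (frame ω distG (block (distances solutionArray)) refl S₃ i j) (copied i j i<n j<n)
  b≡ : memory S₅ boundCell 0 0 ≡ memory S₁ boundCell 0 0
  b≡ = frame ω boundCell (block (distances graphArray) ⟫ block copyDistances ⟫ block (distances solutionArray)) refl S₁ 0 0
  supported′ : ∀ a {S′} → Same a S S′ → Supported n (memory S a) → Supported n (memory S′ a)
  supported′ a h s i j e = s i j (e ∘ trans (h i j))

-- One round of the program

main : Prog
main = block decide ⟫ block draws ⟫ block purchases

num den : ∀ {n} → Request n → ℕ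
num r = abs (↥ bound r)
den r = ↧ₙ bound r

module Rounds (c : ℕ) {n : ℕ} (G : Digraph n) where

  open Parameters c public

  l : ℕ
  l = level n

  E : Matrix
  E = adjacency G

  K b Q M β : ℕ
  K = value n l 2
  b = value n l 3
  Q = value n l 4
  M = value n l 5
  β = value n l 9

  -- The interface between program and analysis. `T` is the state in which distances are known, `S₁`
  -- the one in which the response is decided, and `S′` the one after the random purchases.
  record Round (ω : Coins) (r : Request n) (S T S₁ S′ : State) : Set where
    field
      T-source   : source′ T ≡ toℕ (source r)
      T-target   : target′ T ≡ toℕ (target r)
      T-graph    : ∀ i j → memory T graphArray i j ≡ E i j
      T-par      : HasParameters n l T
      T-same     : ∀ a → (2 <ᵇ a) ∧ (a <ᵇ 9) ≡ true → Same a S T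
      response   : Response n T S₁
      isDistG    : IsDist n E (memory T distG)
      isDistH    : IsDist n (memory T solutionArray) (memory T distH)
      bound≤     : bound′ T ≤ n ∸ 1
      bound-fits : bound′ T * den r ≤ num r
      bound-max  : ∀ k → k ≤ n ∸ 1 → k * den r ≤ num r → k ≤ bound′ T
      hub₁       : Same hubArray T S₁
      tossed₁    : tossed S₁ ≡ tossed S
      tossed′    : tossed S′ ≡ tossed S + K * b
      order′     : memory S′ orderArray 0 0 ≡ n
      graph′     : ∀ i j → memory S′ graphArray i j ≡ E i j
      after      : Same weightArray S₁ S′ × Same phaseCell S₁ S′ × Same boughtCell S₁ S′ × Same stuckCell S₁ S′
      idle       : memory S₁ limitCell 0 0 ≡ 0 → Same solutionArray S₁ S′ × Same hubArray S₁ S′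
      active     : ∀ mode → memory S₁ modeCell 0 0 ≡ mode → let Y = memory S₁ candidates ; lim = memory S₁ limitCell 0 0 ; D = memory T distG in
        (mode ≡ 0 → ∀ u v → u < n → v < n → Y u v ≢ 0 → E u v ≢ 0) →
        Outcome ω n E D Y mode (lim * unit ω n E D mode) S₁ S′ ×
        (∀ i → i < K → i < lim → ∀ u v → pick Y (cells n n) (drawn ω (tossed S) b K i) ≡ just (u , v) → Marked ω n E D mode u v S′)

  parameters-untouched : ∀ a → not (parArray ≡ᵇ a) ≡ true → not (20 ≡ᵇ a) ≡ true → untouched a (parameters c) ≡ true
  parameters-untouched a h h′ = cong₂ _∧_ (smallest-untouched c a h) (cong₂ _∧_ h′ grows-untouched)
    where
    grows-untouched : untouched a (growIfSmall c) ≡ true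
    grows-untouched rewrite h = refl

  parameters-coinless : coinless (parameters c) ≡ true
  parameters-coinless = cong₂ _∧_ (smallest-coinless c) (growIfSmall-coinless)
    where
    growIfSmall-coinless : coinless (growIfSmall c) ≡ true
    growIfSmall-coinless = refl

  adjacency-supported : Supported n E
  adjacency-supported i j e with i <? n | j <? n
  ... | yes i<n | yes j<n = i<n , j<n
  ... | yes _   | no _    = contradiction refl e
  ... | no _    | _       = contradiction refl e

  start′ decided afterRound : Coins → Request n → State → State
  start′ ω r S = run ω (block (parameters c)) (receive r S)
  decided ω r S = run ω (block decide) (start′ ω r S)
  afterRound ω r S = run ω main (start′ ω r S)

  round-spec : ∀ ω r S → memory S orderArray 0 0 ≡ n → (∀ i j → memory S graphArray i j ≡ E i j) →
    (∀ i j → memory S solutionArray i j ≢ 0 → E i j ≢ 0) →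
    Round ω r S (run ω (block prepare) (start′ ω r S)) (decided ω r S) (afterRound ω r S)
  round-spec ω r S order graph inE = record
    { T-source = trans (keepsPre requestArray refl 0 0) (kept₀ requestArray refl refl 0 0)
    ; T-target = trans (keepsPre requestArray refl 0 1) (kept₀ requestArray refl refl 0 1)
    ; T-graph = λ i j → trans (keepsPre graphArray refl i j) (graph₀ i j)
    ; T-par = λ i q → trans (keepsPre parArray refl i 0) (par₀ i q)
    ; T-same = same
    ; response = response
    ; isDistG = isDist-cong graph₀ (λ _ _ _ _ → refl) distances-G
    ; isDistH = isDist-cong (λ i j → sym (proj₁ persistent i j)) (λ _ _ _ _ → refl) distances-H
    ; bound≤ = bound≤
    ; bound-fits = subst₂ (λ x y → bound′ T₀ * x ≤ y) (kept₀ requestArray refl refl 0 3) (kept₀ requestArray refl refl 0 2) bound-fits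
    ; bound-max = λ k k≤ h → bound-max k k≤ (subst₂ (λ x y → k * x ≤ y) (sym (kept₀ requestArray refl refl 0 3)) (sym (kept₀ requestArray refl refl 0 2)) h)
    ; hub₁ = keepsPost hubArray refl
    ; tossed₁ = toss₁
    ; tossed′ = trans (coinless-tossed ω (block purchases) refl S₂) (trans (proj₁ drawSpec) (cong (_+ K * b) toss₁))
    ; order′ = trans (frame ω orderArray main refl S₀ 0 0) (trans (kept₀ orderArray refl refl 0 0) order)
    ; graph′ = λ i j → trans (frame ω graphArray main refl S₀ i j) (graph₀ i j)
    ; after = frame ω weightArray rest refl S₁ , frame ω phaseCell rest refl S₁ , frame ω boughtCell rest refl S₁ , frame ω stuckCell rest refl S₁
    ; idle = λ z → case idleSpec (trans (frame ω limitCell (block draws) refl S₁ 0 0) z) of λ (p , q) →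
        (λ i j → trans (p i j) (frame ω solutionArray (block draws) refl S₁ i j)) , (λ i j → trans (q i j) (frame ω hubArray (block draws) refl S₁ i j))
    ; active = act
    }
    where
    S₀ = start′ ω r S
    T₀ = run ω (block prepare) S₀
    S₁ = run ω (block decide) S₀
    S₂ = run ω (block draws) S₁
    S₃ = run ω (block purchases) S₂
    rest = block draws ⟫ block purchases
    kept₀ : ∀ a → not (parArray ≡ᵇ a) ≡ true → not (20 ≡ᵇ a) ≡ true → ∀ i j → memory S₀ a i j ≡ memory (receive r S) a i j
    kept₀ a h h′ = frame ω a (block (parameters c)) (parameters-untouched a h h′) (receive r S)
    graph₀ : ∀ i j → memory S₀ graphArray i j ≡ E i j
    graph₀ i j = trans (kept₀ graphArray refl refl i j) (graph i j)
    sol₀ : ∀ i j → memory S₀ solutionArray i j ≡ memory S solutionArray i j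
    sol₀ = kept₀ solutionArray refl refl
    par₀ : HasParameters n l S₀
    par₀ = block-spec ω (parameters c) (receive r S) (HasParameters n l) (parameters-spec ω n (receive r S) order)
    decideSpec : Decided n S₀ T₀ S₁
    decideSpec = block-spec ω decide S₀ (Decided n S₀ T₀) (decide-spec ω n S₀ (par₀ 0 refl) (par₀ 1 refl)
      (λ i j e → adjacency-supported i j (e ∘ trans (graph₀ i j)))
      (λ i j e → adjacency-supported i j (inE i j (e ∘ trans (sol₀ i j)))))
    open Decided decideSpec
    same : ∀ a → (2 <ᵇ a) ∧ (a <ᵇ 9) ≡ true → Same a S T₀
    same 3 _ i j = trans (proj₁ persistent i j) (sol₀ i j)
    same 4 _ i j = trans (proj₁ (proj₂ persistent) i j) (kept₀ 4 refl refl i j)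
    same 5 _ i j = trans (keepsPre 5 refl i j) (kept₀ 5 refl refl i j)
    same 6 _ i j = trans (proj₁ (proj₂ (proj₂ persistent)) i j) (kept₀ 6 refl refl i j)
    same 7 _ i j = trans (proj₁ (proj₂ (proj₂ (proj₂ persistent))) i j) (kept₀ 7 refl refl i j)
    same 8 _ i j = trans (proj₂ (proj₂ (proj₂ (proj₂ persistent))) i j) (kept₀ 8 refl refl i j)
    par₁ : ∀ i → (i <ᵇ 11) ≡ true → memory S₁ parArray i 0 ≡ value n l i
    par₁ i q = trans (frame ω parArray (block decide) refl S₀ i 0) (par₀ i q)
    par₂ : ∀ i → (i <ᵇ 11) ≡ true → memory S₂ parArray i 0 ≡ value n l i
    par₂ i q = trans (frame ω parArray (block draws) refl S₁ i 0) (par₁ i q)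
    toss₁ : tossed S₁ ≡ tossed S
    toss₁ = trans (coinless-tossed ω (block decide) refl S₀)
      (coinless-tossed ω (block (parameters c)) parameters-coinless (receive r S))
    Drawn : State → Set
    Drawn S′ = tossed S′ ≡ tossed S₁ + K * b × (∀ i → i < K → memory S′ drawArray i 0 ≡ drawn ω (tossed S₁) b K i)
    drawSpec : Drawn S₂
    drawSpec = block-spec ω draws S₁ Drawn (draws-spec ω S₁ K b (par₁ 2 refl) (par₁ 3 refl))
    idleSpec : memory S₂ limitCell 0 0 ≡ 0 → Same solutionArray S₂ S₃ × Same hubArray S₂ S₃
    idleSpec z = block-spec ω purchases S₂ (λ S′ → Same solutionArray S₂ S′ × Same hubArray S₂ S′) (purchases-idle ω S₂ z)
    act : ∀ mode → memory S₁ modeCell 0 0 ≡ mode → let Y = memory S₁ candidates ; lim = memory S₁ limitCell 0 0 ; D = memory T₀ distG in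
        (mode ≡ 0 → ∀ u v → u < n → v < n → Y u v ≢ 0 → E u v ≢ 0) →
        Outcome ω n E D Y mode (lim * unit ω n E D mode) S₁ S₃ ×
        (∀ i → i < K → i < lim → ∀ u v → pick Y (cells n n) (drawn ω (tossed S) b K i) ≡ just (u , v) → Marked ω n E D mode u v S₃)
    act mode m allowed = assemble (block-spec ω purchases S₂ Bought (purchases-spec ω n E D Y mode allowed S₂ K lim
        (par₂ 2 refl) (par₂ 0 refl)
        (λ i j → trans (frame ω graphArray (block decide ⟫ block draws) refl S₀ i j) (graph₀ i j))
        (λ i j → trans (frame ω distG (block draws) refl S₁ i j) (distG-kept i j))
        (frame ω candidates (block draws) refl S₁)
        (trans (frame ω modeCell (block draws) refl S₁ 0 0) m)
        (frame ω limitCell (block draws) refl S₁ 0 0)))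
      where
      Y = memory S₁ candidates
      lim = memory S₁ limitCell 0 0
      D = memory T₀ distG
      Bought : State → Set
      Bought S′ = Outcome ω n E D Y mode (lim * unit ω n E D mode) S₂ S′ ×
        (∀ i → i < K → i < lim → ∀ u v → pick Y (cells n n) (memory S₂ drawArray i 0) ≡ just (u , v) → Marked ω n E D mode u v S′)
      assemble : Bought S₃ → Outcome ω n E D Y mode (lim * unit ω n E D mode) S₁ S₃ ×
        (∀ i → i < K → i < lim → ∀ u v → pick Y (cells n n) (drawn ω (tossed S) b K i) ≡ just (u , v) → Marked ω n E D mode u v S₃)
      assemble (o , hit) =
        record { buys = buys-weaken (≤-reflexive (+-identityʳ _)) (buys-trans (buys-none (frame ω solutionArray (block draws) refl S₁)) (o .buys))
               ; hubGrow = λ w h → o .hubGrow w (h ∘ trans (sym (frame ω hubArray (block draws) refl S₁ w w)))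
               ; newHub = λ w h → case o .newHub w h of λ { (inj₁ x) → inj₁ (x ∘ trans (frame ω hubArray (block draws) refl S₁ w w)) ; (inj₂ y) → inj₂ y } } ,
        λ i i<K i<lim u v q → hit i i<K i<lim u v
          (trans (cong (pick Y (cells n n)) (trans (proj₂ drawSpec i i<K) (cong (λ o → drawn ω o b K i) toss₁))) q)

-- Counting edges and pairs of endpoints

sum-δ-in : ∀ n i → i < n → sum< n (λ k → δ k i) ≡ 1
sum-δ-in (suc n) i i<1+n with n ≟ i
... | yes refl rewrite ≡ᵇ-refl n = cong suc (sum-δ-out n n ≤-refl)
... | no n≢i   rewrite ≢⇒≡ᵇ n≢i = sum-δ-in n i (≤∧≢⇒< (≤-pred i<1+n) (n≢i ∘ sym))

count-new : ∀ n {X Y} u v → u < n → v < n → X u v ≡ 0 → Y u v ≢ 0 → (∀ i j → i ≢ u ⊎ j ≢ v → Y i j ≡ X i j) →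
  count n Y ≡ suc (count n X)
count-new n {X} {Y} u v u<n v<n x y h =
  trans (sum²-cong n {X = λ i j → nz (Y i j)} {Y = λ i j → δ i u * δ j v + nz (X i j)} λ i j _ _ → pointwise i j)
    (trans (sum²-+ n (λ i j → δ i u * δ j v) (λ i j → nz (X i j)))
      (cong (_+ count n X) (trans (sum²-outer n (λ i → δ i u) (λ j → δ j v)) (cong₂ _*_ (sum-δ-in n u u<n) (sum-δ-in n v v<n)))))
  where
  pointwise : ∀ i j → nz (Y i j) ≡ δ i u * δ j v + nz (X i j)
  pointwise i j with i ≟ u | j ≟ v
  ... | yes refl | yes refl rewrite ≡ᵇ-refl i | ≡ᵇ-refl j | x = nz-≢0 y
  ... | no i≢u   | _ rewrite ≢⇒≡ᵇ i≢u = cong nz (h i j (inj₁ i≢u))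
  ... | yes refl | no j≢v rewrite ≡ᵇ-refl i | ≢⇒≡ᵇ j≢v = cong nz (h i j (inj₂ j≢v))

sum-swap : ∀ m n (X : Matrix) → sum< m (λ i → sum< n (X i)) ≡ sum< n (λ j → sum< m (λ i → X i j))
sum-swap zero    n X = sym (trans (sum-const n 0) (*-zeroʳ n))
sum-swap (suc m) n X = trans (cong (sum< n (X m) +_) (sum-swap m n X)) (sym (sum-+ n (X m) _))

-- A pair in Z contributes at least 1 to the sum of outdegree of u times indegree of v, and that sum
-- factors into the square of the number of edges.
count-pairs : ∀ n {X Z} → Supported n X → (∀ u v → Z u v ≢ 0 → (∃[ x ] X u x ≢ 0) × (∃[ x ] X x v ≢ 0)) →
  count n Z ≤ count n X * count n X
count-pairs n {X} {Z} supp h = ≤-trans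
  (sum²-mono n {Y = λ u v → outs u * ins v} λ u v _ _ → pointwise u v)
  (≤-reflexive (trans (sum²-outer n outs ins) (cong (count n X *_) (sym (sum-swap n n (λ i j → nz (X i j)))))))
  where
  outs ins : ℕ → ℕ
  outs u = sum< n λ x → nz (X u x)
  ins v = sum< n λ x → nz (X x v)
  pointwise : ∀ u v → nz (Z u v) ≤ outs u * ins v
  pointwise u v with Z u v in eq
  ... | zero  = z≤n
  ... | suc k with h u v (λ z → contradiction (trans (sym eq) z) λ ())
  ...   | (x , ux) , (y , yv) = *-mono-≤
    (≤-trans (≤-reflexive (sym (nz-≢0 ux))) (sum-term (λ x → nz (X u x)) (proj₂ (supp u x ux))))
    (≤-trans (≤-reflexive (sym (nz-≢0 yv))) (sum-term (λ x → nz (X x v)) (proj₁ (supp y v yv))))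

-- Jumps and the doubling of weights

module _ (E DG DH W : Matrix) (d s t u v : ℕ) where

  record Jump : Set where
    field
      edge  : E u v ≢ 0
      local₁ : DG s u + DG u t ≤ d
      local₂ : DG s v + DG v t ≤ d
      rise  : 2 + DH s u ≤ DH s v

  jump-weight : Jump → jumpWeight E DG DH W d s t u v ≡ suc (W u v)
  jump-weight h = trans (select-≢0 edge) (trans (select-≢0 (m<n⇒n∸m≢0 (s≤s local₁)))
    (trans (select-≢0 (m<n⇒n∸m≢0 (s≤s local₂))) (select-≢0 (m<n⇒n∸m≢0 (≤-trans (≤-reflexive (cong suc (+-comm (DH s u) 1))) rise)))))
    where
    open Jump h
    m<n⇒n∸m≢0 : ∀ {m n} → m < n → n ∸ m ≢ 0
    m<n⇒n∸m≢0 lt z = <⇒≱ lt (m∸n≡0⇒m≤n z)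

  jump-cases : jumpWeight E DG DH W d s t u v ≡ 0 ⊎ Jump
  jump-cases with E u v in e
  ... | zero = inj₁ refl
  ... | suc _ with suc d ∸ (DG s u + DG u t) in a
  ...   | zero = inj₁ refl
  ...   | suc _ with suc d ∸ (DG s v + DG v t) in a′
  ...     | zero = inj₁ refl
  ...     | suc _ with DH s v ∸ (DH s u + 1) in j
  ...       | zero = inj₁ refl
  ...       | suc _ = inj₂ record
    { edge = λ z → contradiction (trans (sym e) z) λ ()
    ; local₁ = ≤-pred (m∸n≢0⇒n<m {suc d} λ z → contradiction (trans (sym a) z) λ ())
    ; local₂ = ≤-pred (m∸n≢0⇒n<m {suc d} λ z → contradiction (trans (sym a′) z) λ ())
    ; rise = ≤-trans (≤-reflexive (cong suc (+-comm 1 (DH s u)))) (m∸n≢0⇒n<m {DH s v} λ z → contradiction (trans (sym j) z) λ ())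
    }

log-double : ∀ w → ⌊log₂ suc (w + suc w) ⌋ ≡ suc ⌊log₂ suc w ⌋
log-double w = trans (cong ⌊log₂_⌋ (lem w)) (⌊log₂[2*b]⌋≡1+⌊log₂b⌋ (suc w))
  where
  lem : ∀ w → suc (w + suc w) ≡ 2 * suc w
  lem = solve-∀

-- The invariant that bounds the cost

module Invariants (c : ℕ) {n : ℕ} (G : Digraph n) where

  open Rounds c G public

  T16 base : ℕ
  T16 = value n l 6
  -- The purchases of the first phase, the own edge of the request that opens the hubs, and two
  -- trees for each of at most Q hubs.
  base = T16 + suc (Q * (n * 2))

  NumSat : Matrix → Request n → Set
  NumSat X r = ∃[ k ] Path X k (toℕ (source r)) (toℕ (target r)) × k * den r ≤ num r

  -- The optimum changes with every request. Quantifying over all feasible solutions instead lets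
  -- the invariant pass from round to round, since a competitor for more requests is one for fewer.
  Competitor : List (Request n) → Matrix → Set
  Competitor rs X = (∀ u v → X u v ≢ 0 → E u v ≢ 0) × All (NumSat X) rs

  -- Legality in terms of natural numbers; the last clause says that the bound is at least 1, the
  -- length of the request's own edge.
  Admissible : Request n → Set
  Admissible r = E (toℕ (source r)) (toℕ (target r)) ≢ 0 × toℕ (source r) ≢ toℕ (target r) × den r ≤ num r

  -- Counts the doublings of the competitor's edges. Every update adds at least 1, as the competitor
  -- contains a jump, and each edge contributes O(log n).
  potential : Matrix → Matrix → ℕ
  potential X W = sum² n λ u v → nz (X u v) * ⌊log₂ suc (W u v) ⌋

  -- Formulated with paths in G rather than with a distance matrix, because each round computes a
  -- distance matrix of its own.
  Serves : Matrix → ℕ → Set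
  Serves Z w = w < n × (∀ v k → v < n → Path E k w v → ∃[ j ] j ≤ k × Path Z j w v)
                     × (∀ v k → v < n → Path E k v w → ∃[ j ] j ≤ k × Path Z j v w)

  record Inv (rs : List (Request n)) (S : State) : Set where
    Z = memory S solutionArray
    W = memory S weightArray
    field
      order  : memory S orderArray 0 0 ≡ n
      graph  : ∀ i j → memory S graphArray i j ≡ E i j
      inE    : ∀ u v → Z u v ≢ 0 → E u v ≢ 0
      -- Weights are raised only if the candidates weigh less than M in total, and each of them at
      -- most doubles.
      weights : ∀ u v → W u v < M + M
      serving : ∀ w → memory S hubArray w w ≢ 0 → Serves Z w
      solved : All (NumSat Z) rs
      early  : memory S phaseCell 0 0 ≡ 0 → (∀ u v → W u v ≡ 0) × memory S stuckCell 0 0 ≡ 0 ×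
        count n Z ≡ memory S boughtCell 0 0 × memory S boughtCell 0 0 ≤ T16 ×
        (∀ X → Competitor rs X → ∀ u v → Z u v ≢ 0 → (∃[ x ] X u x ≢ 0) × (∃[ x ] X x v ≢ 0))
      -- Each unit of potential pays for K draws and one own edge. Getting stuck forfeits the bound
      -- on the cost, but neither feasibility nor the lower bound on the competitor.
      late   : memory S phaseCell 0 0 ≢ 0 → ∀ X → Competitor rs X → β ≤ count n X ×
        (memory S stuckCell 0 0 ≡ 0 → count n Z ≤ base + suc K * potential X W)

  sat-mono : ∀ {X Y} r → (∀ i j → X i j ≢ 0 → Y i j ≢ 0) → NumSat X r → NumSat Y r
  sat-mono r h (k , p , q) = k , path-map h p , q

  all-sat-mono : ∀ {X Y rs} → (∀ i j → X i j ≢ 0 → Y i j ≢ 0) → All (NumSat X) rs → All (NumSat Y) rs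
  all-sat-mono h []       = []
  all-sat-mono {rs = r ∷ _} h (p ∷ ps) = sat-mono r h p ∷ all-sat-mono h ps

  serves-mono : ∀ {Z Z′ w} → (∀ i j → Z i j ≢ 0 → Z′ i j ≢ 0) → Serves Z w → Serves Z′ w
  serves-mono h (w<n , o , i) = w<n ,
    (λ v k v<n p → case o v k v<n p of λ (j , le , q) → j , le , path-map h q) ,
    (λ v k v<n p → case i v k v<n p of λ (j , le , q) → j , le , path-map h q)

  trees-serve : ∀ {D Z w} → IsDist n E D → w < n → HubTrees n E D Z w → Serves Z w
  trees-serve {D} {Z} {w} dist w<n trees = w<n , out′ , in′
    where
    out′ : ∀ v k → v < n → Path E k w v → ∃[ j ] j ≤ k × Path Z j w v
    out′ v k v<n p with shorten adjacency-supported w<n (suc k) k ≤-refl p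
    ... | j , j<n , j≤k , q = D w v , ≤-trans D≤j j≤k , hub-out dist adjacency-supported trees w<n (D w v) v v<n refl (≤-trans (s≤s D≤j) j<n)
      where
      D≤j = IsDist.complete dist w v j w<n v<n (<⇒≤ j<n) q
    in′ : ∀ v k → v < n → Path E k v w → ∃[ j ] j ≤ k × Path Z j v w
    in′ v k v<n p with shorten adjacency-supported v<n (suc k) k ≤-refl p
    ... | j , j<n , j≤k , q = D v w , ≤-trans D≤j j≤k , hub-in dist adjacency-supported trees w<n (D v w) v v<n refl (≤-trans (s≤s D≤j) j<n)
      where
      D≤j = IsDist.complete dist v w j v<n w<n (<⇒≤ j<n) q

  potential-mono : ∀ X {W W′} → (∀ u v → u < n → v < n → W u v ≤ W′ u v) → potential X W ≤ potential X W′
  potential-mono X h = sum²-mono n λ u v u<n v<n → *-monoʳ-≤ (nz (X u v)) (⌊log₂⌋-mono-≤ (s≤s (h u v u<n v<n)))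

  potential-gain : ∀ X {W W′} u v → u < n → v < n → X u v ≢ 0 → (∀ i j → i < n → j < n → W i j ≤ W′ i j) →
    W′ u v ≡ W u v + suc (W u v) → suc (potential X W) ≤ potential X W′
  potential-gain X {W} {W′} u v u<n v<n x mono eq = begin
    suc (potential X W)
      ≡⟨ cong (_+ potential X W) (sym (trans (sum²-outer n (λ i → δ i u) (λ j → δ j v)) (cong₂ _*_ (sum-δ-in n u u<n) (sum-δ-in n v v<n)))) ⟩
    sum² n (λ i j → δ i u * δ j v) + potential X W
      ≡⟨ sym (sum²-+ n (λ i j → δ i u * δ j v) _) ⟩
    sum² n (λ i j → δ i u * δ j v + nz (X i j) * ⌊log₂ suc (W i j) ⌋)
      ≤⟨ sum²-mono n pointwise ⟩
    potential X W′ ∎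
    where
    open ≤-Reasoning
    pointwise : ∀ i j → i < n → j < n → δ i u * δ j v + nz (X i j) * ⌊log₂ suc (W i j) ⌋ ≤ nz (X i j) * ⌊log₂ suc (W′ i j) ⌋
    pointwise i j i<n j<n with i ≟ u | j ≟ v
    ... | yes refl | yes refl rewrite ≡ᵇ-refl i | ≡ᵇ-refl j | nz-≢0 x | eq | log-double (W i j) = ≤-refl
    ... | no i≢u   | _ rewrite ≢⇒≡ᵇ i≢u = *-monoʳ-≤ (nz (X i j)) (⌊log₂⌋-mono-≤ (s≤s (mono i j i<n j<n)))
    ... | yes refl | no j≢v rewrite ≡ᵇ-refl i | ≢⇒≡ᵇ j≢v = *-monoʳ-≤ (nz (X i j)) (⌊log₂⌋-mono-≤ (s≤s (mono i j i<n j<n)))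

  module OneRound {ω r S T S₁ S′} (R : Round ω r S T S₁ S′) (admissible : Admissible r)
    (inE : ∀ u v → memory S solutionArray u v ≢ 0 → E u v ≢ 0) where

    open Round R public

    s t d : ℕ
    s = toℕ (source r)
    t = toℕ (target r)
    d = bound′ T
    Z Z₁ Z′ W W₁ DG DH Y : Matrix
    Z  = memory T solutionArray
    Z₁ = memory S₁ solutionArray
    Z′ = memory S′ solutionArray
    W  = memory T weightArray
    W₁ = memory S₁ weightArray
    DG = memory T distG
    DH = memory T distH
    Y  = memory S₁ candidates

    s<n : s < n
    s<n = toℕ<n (source r)
    t<n : t < n
    t<n = toℕ<n (target r)

    1<n : 1 < n
    1<n = two s<n t<n (proj₁ (proj₂ admissible))
      where
      two : ∀ {x y m} → x < m → y < m → x ≢ y → 1 < m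
      two {zero}  {zero}  _ _ ne = contradiction refl ne
      two {zero}  {suc y} _ h _ = ≤-trans (s≤s (s≤s z≤n)) h
      two {suc x}         h _ _ = ≤-trans (s≤s (s≤s z≤n)) h

    d<n : d < n
    d<n = ≤-trans (s≤s bound≤) (≤-reflexive (m+[n∸m]≡n (<⇒≤ 1<n)))

    1≤d : 1 ≤ d
    1≤d = bound-max 1 (∸-monoˡ-≤ 1 1<n) (≤-trans (≤-reflexive (*-identityˡ (den r))) (proj₂ (proj₂ admissible)))

    ZE : ∀ u v → Z u v ≢ 0 → E u v ≢ 0
    ZE u v h = inE u v (h ∘ trans (T-same solutionArray refl u v))

    endpoints : ∀ (X : Matrix) → X (source′ T) (target′ T) ≡ X s t
    endpoints X = cong₂ X T-source T-target

    near⇒sat : DH s t ≤ d → NumSat Z r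
    near⇒sat h = DH s t , IsDist.sound isDistH s t s<n t<n (≤-trans (s≤s h) d<n) , ≤-trans (*-monoˡ-≤ (den r) h) bound-fits

    direct-sat : ∀ {X} → X s t ≢ 0 → NumSat X r
    direct-sat x = 1 , here ▹ x , ≤-trans (≤-reflexive (*-identityˡ (den r))) (proj₂ (proj₂ admissible))

    module Far (far′ : bound′ T < DH (source′ T) (target′ T))
      (bought : Same solutionArray (assign solutionArray (source′ T) (target′ T) 1 T) S₁) where

      far : d < DH s t
      far = subst (d <_) (endpoints DH) far′

      Z₁≡ : ∀ i j → Z₁ i j ≡ write (memory T) solutionArray s t 1 solutionArray i j
      Z₁≡ i j = trans (bought i j) (cong₂ (λ a b → write (memory T) solutionArray a b 1 solutionArray i j) T-source T-target)

      Z₁-st : Z₁ s t ≢ 0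
      Z₁-st z = contradiction (trans (sym (trans (Z₁≡ s t) (write-same (memory T) solutionArray s t 1))) z) λ ()

      Z₁-other : ∀ i j → i ≢ s ⊎ j ≢ t → Z₁ i j ≡ Z i j
      Z₁-other i j ne = trans (Z₁≡ i j) (write-cell (memory T) solutionArray s t 1 i j (swap-≢ ne))

      Z₁-cases : ∀ i j → Z₁ i j ≢ 0 → (i ≡ s × j ≡ t) ⊎ Z i j ≢ 0
      Z₁-cases i j h with i ≟ s | j ≟ t
      ... | yes p | yes q = inj₁ (p , q)
      ... | no p  | _     = inj₂ (h ∘ trans (Z₁-other i j (inj₁ p)))
      ... | yes _ | no q  = inj₂ (h ∘ trans (Z₁-other i j (inj₂ q)))

      grows₁ : ∀ i j → Z i j ≢ 0 → Z₁ i j ≢ 0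
      grows₁ i j h with i ≟ s | j ≟ t
      ... | yes refl | yes refl = Z₁-st
      ... | no p     | _        = h ∘ trans (sym (Z₁-other i j (inj₁ p)))
      ... | yes _    | no q     = h ∘ trans (sym (Z₁-other i j (inj₂ q)))

      Z₁E : ∀ u v → Z₁ u v ≢ 0 → E u v ≢ 0
      Z₁E u v h with Z₁-cases u v h
      ... | inj₁ (refl , refl) = proj₁ admissible
      ... | inj₂ z = ZE u v z

      -- An own edge that is already present would satisfy the request. Purchases of own edges are
      -- therefore distinct, and in the first phase their number is the size of the solution.
      Z-st : Z s t ≡ 0
      Z-st with Z s t ≟ 0
      ... | yes z = z
      ... | no z  = contradiction (IsDist.complete isDistH s t 1 s<n t<n (<⇒≤ 1<n) (here ▹ z)) (<⇒≱ (≤-trans (s≤s 1≤d) far))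

      count₁ : count n Z₁ ≡ suc (count n Z)
      count₁ = count-new n s t s<n t<n Z-st Z₁-st Z₁-other

      -- The competitor's walk is shortened to fewer than n edges, so the rounded bound d applies to
      -- it. `jump-edge` is used with the distance from s in the solution, which is 0 at s and
      -- exceeds d at t; the two remaining parts of the walk show that both ends are local.
      competitor-jump : ∀ {rs X} → Competitor (r ∷ rs) X →
        ∃[ u ] ∃[ v ] u < n × v < n × X u v ≢ 0 × Jump (memory T graphArray) DG DH W d s t u v
      competitor-jump {X = X} (sub , (k , p , fits) ∷ _) with shorten (λ i j e → adjacency-supported i j (sub i j e)) s<n (suc k) k ≤-refl p
      ... | j , j<n , j≤k , q with jump-edge (DH s) q (≤-trans (≤-reflexive (cong (λ z → suc (z + j)) DHss)) (≤-trans (s≤s j≤d) far))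
        where
        DHss : DH s s ≡ 0
        DHss = n≤0⇒n≡0 (IsDist.complete isDistH s s 0 s<n s<n z≤n here)
        j≤d : j ≤ d
        j≤d = bound-max j (≤-pred (≤-trans j<n (≤-reflexive (sym (m+[n∸m]≡n (<⇒≤ 1<n)))))) (≤-trans (*-monoˡ-≤ (den r) j≤k) fits)
      ... | a , b′ , u , v , p₁ , e , p₂ , sum≡ , rise = u , v , u<n , v<n , e , record
        { edge = λ z → sub u v e (trans (sym (T-graph u v)) z)
        ; local₁ = ≤-trans (+-mono-≤ (IsDist.complete isDistG s u a s<n u<n (≤-trans (m≤m+n a (suc b′)) walk≤n) (path-map sub p₁))
                              (IsDist.complete isDistG u t (suc b′) u<n t<n (≤-trans (m≤n+m (suc b′) a) walk≤n) (cons (sub u v e) (path-map sub p₂))))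
                    (≤-trans (≤-reflexive (trans (+-suc a b′) sum≡)) j≤d)
        ; local₂ = ≤-trans (+-mono-≤ (IsDist.complete isDistG s v (suc a) s<n v<n (≤-trans (≤-trans (m≤m+n (suc a) b′) (≤-reflexive sum≡)) (<⇒≤ j<n)) (path-map sub p₁ ▹ sub u v e))
                              (IsDist.complete isDistG v t b′ v<n t<n (≤-trans (≤-trans (m≤n+m b′ (suc a)) (≤-reflexive sum≡)) (<⇒≤ j<n)) (path-map sub p₂)))
                    (≤-trans (≤-reflexive sum≡) j≤d)
        ; rise = rise }
        where
        j≤d : j ≤ d
        j≤d = bound-max j (≤-pred (≤-trans j<n (≤-reflexive (sym (m+[n∸m]≡n (<⇒≤ 1<n)))))) (≤-trans (*-monoˡ-≤ (den r) j≤k) fits)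
        u<n = proj₁ (adjacency-supported u v (sub u v e))
        v<n = proj₂ (adjacency-supported u v (sub u v e))
        walk≤n : a + suc b′ ≤ n
        walk≤n = ≤-trans (≤-reflexive (trans (+-suc a b′) sum≡)) (<⇒≤ j<n)

-- Preservation of the invariant

module Preservation (c : ℕ) {n : ℕ} (G : Digraph n) where

  open Invariants c G public

  nonempty : ∀ {X k u v} → u ≢ v → Path X k u v → (∃[ x ] X u x ≢ 0) × (∃[ x ] X x v ≢ 0)
  nonempty ne here        = contradiction refl ne
  nonempty ne p@(_ ▹ _)   = first-edge p , last-edge p

  T16≡ : T16 ≡ β * β
  T16≡ = power-product 4 4 l

  step : ∀ {ω r rs S T S₁ S′} → Admissible r → Inv rs S → Round ω r S T S₁ S′ → Inv (r ∷ rs) S′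
  step {ω} {r} {rs} {S} {T} {S₁} {S′} admissible I R = by-response response
    where
    open Inv I using (order; graph; inE; weights; serving; solved; early; late)
    open OneRound R admissible inE
    W₀ Z₀ : Matrix
    W₀ = memory S weightArray
    Z₀ = memory S solutionArray
    φ₀ k₀ st₀ : ℕ
    φ₀ = memory S phaseCell 0 0
    k₀ = memory S boughtCell 0 0
    st₀ = memory S stuckCell 0 0
    Z≡ : ∀ i j → Z i j ≡ Z₀ i j
    Z≡ = T-same solutionArray refl
    W≡ : ∀ i j → W i j ≡ W₀ i j
    W≡ = T-same weightArray refl
    φ≡ : memory T phaseCell 0 0 ≡ φ₀
    φ≡ = T-same phaseCell refl 0 0
    k≡ : memory T boughtCell 0 0 ≡ k₀
    k≡ = T-same boughtCell refl 0 0
    st≡ : memory T stuckCell 0 0 ≡ st₀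
    st≡ = T-same stuckCell refl 0 0
    hub≡ : ∀ i j → memory S₁ hubArray i j ≡ memory S hubArray i j
    hub≡ i j = trans (hub₁ i j) (T-same hubArray refl i j)
    W′≡ : ∀ i j → memory S′ weightArray i j ≡ W₁ i j
    W′≡ = proj₁ after
    φ′≡ : memory S′ phaseCell 0 0 ≡ memory S₁ phaseCell 0 0
    φ′≡ = proj₁ (proj₂ after) 0 0
    k′≡ : memory S′ boughtCell 0 0 ≡ memory S₁ boughtCell 0 0
    k′≡ = proj₁ (proj₂ (proj₂ after)) 0 0
    st′≡ : memory S′ stuckCell 0 0 ≡ memory S₁ stuckCell 0 0
    st′≡ = proj₂ (proj₂ (proj₂ after)) 0 0

    countZ : count n Z ≡ count n Z₀
    countZ = sum²-cong n λ i j _ _ → cong nz (Z≡ i j)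

    weights-same : Same weightArray T S₁ → ∀ u v → memory S′ weightArray u v ≡ W₀ u v
    weights-same w u v = trans (W′≡ u v) (trans (w u v) (W≡ u v))

    older : ∀ {X} → Competitor (r ∷ rs) X → Competitor rs X
    older (sub , _ ∷ ss) = sub , ss

    module Idle (idle′ : memory S₁ limitCell 0 0 ≡ 0) where
      Z′≡ : ∀ i j → Z′ i j ≡ Z₁ i j
      Z′≡ = proj₁ (idle idle′)
      hub′ : ∀ w → memory S′ hubArray w w ≢ 0 → memory S hubArray w w ≢ 0
      hub′ w h = h ∘ trans (trans (proj₂ (idle idle′) w w) (hub≡ w w))
      count′ : count n Z′ ≡ count n Z₁
      count′ = sum²-cong n λ i j _ _ → cong nz (Z′≡ i j)

    by-response : Response n T S₁ → Inv (r ∷ rs) S′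
    by-response (satisfied near sol wt ph bo st lim) = record
      { order = order′ ; graph = graph′
      ; inE = λ u v h → inE u v (h ∘ trans (same u v))
      ; weights = λ u v → subst (_< M + M) (sym (weights-same wt u v)) (weights u v)
      ; serving = λ w h → serves-mono (λ i j x → x ∘ trans (sym (same i j))) (serving w (hub′ w h))
      ; solved = sat-mono r (λ i j x → x ∘ trans (sym (trans (same i j) (sym (Z≡ i j))))) (near⇒sat (subst (_≤ d) (endpoints DH) near)) ∷
                 all-sat-mono (λ i j x → x ∘ trans (sym (same i j))) solved
      ; early = λ z → case early (trans (sym φ″) z) of λ (w , st0 , cnt , le , req) →
          (λ u v → trans (weights-same wt u v) (w u v)) , trans st″ st0 , trans count″ (trans cnt (sym k″)) , ≤-trans (≤-reflexive k″) le ,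
          λ X comp u v h → req X (older comp) u v (h ∘ trans (same u v))
      ; late = λ z X comp → case late (z ∘ trans φ″) X (older comp) of λ (b≤ , cost≤) →
          b≤ , λ st0 → ≤-trans (≤-reflexive count″) (≤-trans (cost≤ (trans (sym st″) st0))
            (+-monoʳ-≤ base (*-monoʳ-≤ (suc K) (potential-mono X λ u v _ _ → ≤-reflexive (sym (weights-same wt u v))))))
      }
      where
      open Idle lim
      same : ∀ i j → Z′ i j ≡ Z₀ i j
      same i j = trans (Z′≡ i j) (trans (sol i j) (Z≡ i j))
      count″ : count n Z′ ≡ count n Z₀
      count″ = sum²-cong n λ i j _ _ → cong nz (same i j)
      φ″ : memory S′ phaseCell 0 0 ≡ φ₀
      φ″ = trans φ′≡ (trans (ph 0 0) φ≡)
      k″ : memory S′ boughtCell 0 0 ≡ k₀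
      k″ = trans k′≡ (trans (bo 0 0) k≡)
      st″ : memory S′ stuckCell 0 0 ≡ st₀
      st″ = trans st′≡ (trans (st 0 0) st≡)

    by-response (direct far′ bought φ0 small wt ph bo st lim) = record
      { order = order′ ; graph = graph′
      ; inE = λ u v h → Z₁E u v (h ∘ trans (Z′≡ u v))
      ; weights = λ u v → subst (_< M + M) (sym (weights-same wt u v)) (weights u v)
      ; serving = λ w h → serves-mono grows′ (serving w (hub′ w h))
      ; solved = direct-sat (Z₁-st ∘ trans (sym (Z′≡ s t))) ∷ all-sat-mono grows′ solved
      ; early = λ z → case early (trans (sym φ″) z) of λ (w , st0 , cnt , le , req) →
          (λ u v → trans (weights-same wt u v) (w u v)) , trans st″ st0 ,
          trans count′ (trans count₁ (trans (cong suc (trans countZ (trans cnt (sym k≡)))) (sym (trans k′≡ bo)))) ,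
          ≤-trans (≤-reflexive (trans k′≡ bo)) (≤-trans small (≤-reflexive (T-par 6 refl))) ,
          λ X comp u v h → requested X comp req u v (Z₁-cases u v (h ∘ trans (Z′≡ u v)))
      ; late = λ z → contradiction (trans φ′≡ (trans (ph 0 0) φ0)) z
      }
      where
      open Idle lim
      open Far far′ bought
      φ″ : memory S′ phaseCell 0 0 ≡ φ₀
      φ″ = trans φ′≡ (trans (ph 0 0) φ≡)
      st″ : memory S′ stuckCell 0 0 ≡ st₀
      st″ = trans st′≡ (trans (st 0 0) st≡)
      grows′ : ∀ i j → Z₀ i j ≢ 0 → Z′ i j ≢ 0
      grows′ i j h = grows₁ i j (h ∘ trans (sym (Z≡ i j))) ∘ trans (sym (Z′≡ i j))
      requested : ∀ X → Competitor (r ∷ rs) X →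
        (∀ X → Competitor rs X → ∀ u v → Z₀ u v ≢ 0 → (∃[ x ] X u x ≢ 0) × (∃[ x ] X x v ≢ 0)) →
        ∀ u v → (u ≡ s × v ≡ t) ⊎ Z u v ≢ 0 → (∃[ x ] X u x ≢ 0) × (∃[ x ] X x v ≢ 0)
      requested X (_ , (_ , p , _) ∷ _) req u v (inj₁ (refl , refl)) = nonempty (proj₁ (proj₂ admissible)) p
      requested X comp req u v (inj₂ z) = req X (older comp) u v (z ∘ trans (Z≡ u v))

    by-response (hubs far′ bought φ0 large wt φ1 st mode lim diag off) = record
      { order = order′ ; graph = graph′
      ; inE = λ u v h → case o .buys .edges u v h of λ { (inj₁ x) → Z₁E u v x ; (inj₂ e) → e }
      ; weights = λ u v → subst (_< M + M) (sym (weights-same wt u v)) (weights u v)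
      ; serving = λ w h → case o .newHub w h of λ
          { (inj₁ x) → serves-mono grows′ (serving w (x ∘ trans (hub≡ w w)))
          ; (inj₂ (w<n , trees)) → trees-serve isDistG w<n trees }
      ; solved = direct-sat (o .buys .grows s t Z₁-st) ∷ all-sat-mono grows′ solved
      ; early = λ z → contradiction (trans (sym φ1) (trans (sym φ′≡) z)) λ ()
      ; late = λ _ X comp → case early (trans (sym φ≡) φ0) of λ (w , st0 , cnt , le , req) →
          β≤ X (older comp) (req X (older comp)) cnt , λ _ → ≤-trans (cost≤ cnt le) (m≤m+n base _)
      }
      where
      open Far far′ bought
      o : Outcome ω n E DG Y 1 (memory S₁ limitCell 0 0 * (n * 2)) S₁ S′
      o = proj₁ (active 1 mode λ ())
      grows′ : ∀ i j → Z₀ i j ≢ 0 → Z′ i j ≢ 0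
      grows′ i j h = o .buys .grows i j (grows₁ i j (h ∘ trans (sym (Z≡ i j))))
      T16≤ : T16 ≤ k₀
      T16≤ = subst₂ _≤_ (T-par 6 refl) k≡ large
      -- With fewer than β edges, X would provide fewer than β² pairs of a tail and a head, too few
      -- for the purchases made so far.
      β≤ : ∀ X → Competitor rs X → (∀ u v → Z₀ u v ≢ 0 → (∃[ x ] X u x ≢ 0) × (∃[ x ] X x v ≢ 0)) → count n Z₀ ≡ k₀ → β ≤ count n X
      β≤ X (sub , _) req cnt = ≮⇒≥ λ lt → <⇒≱ (*-mono-< lt lt)
        (≤-trans (≤-reflexive (sym T16≡)) (≤-trans T16≤ (≤-trans (≤-reflexive (sym cnt))
          (count-pairs n (λ i j e → adjacency-supported i j (sub i j e)) req))))
      cost≤ : count n Z₀ ≡ k₀ → k₀ ≤ T16 → count n Z′ ≤ base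
      cost≤ cnt le = begin
        count n Z′                                           ≤⟨ o .buys .cost ⟩
        memory S₁ limitCell 0 0 * (n * 2) + count n Z₁       ≡⟨ cong₂ (λ x y → x * (n * 2) + y) (trans lim (T-par 4 refl)) (trans count₁ (cong suc (trans countZ cnt))) ⟩
        Q * (n * 2) + suc k₀                                 ≤⟨ +-monoʳ-≤ (Q * (n * 2)) (s≤s le) ⟩
        Q * (n * 2) + suc T16                                ≡⟨ lem (Q * (n * 2)) T16 ⟩
        T16 + suc (Q * (n * 2))                              ∎
        where
        open ≤-Reasoning
        lem : ∀ a b → a + suc b ≡ b + suc a
        lem = solve-∀

    by-response (update far′ bought φ1 small Y≡ raised out-same ph st mode lim) = record
      { order = order′ ; graph = graph′
      ; inE = λ u v h → case o .buys .edges u v h of λ { (inj₁ x) → Z₁E u v x ; (inj₂ e) → e }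
      ; weights = λ u v → subst (_< M + M) (sym (W′≡ u v)) (weight-bound u v)
      ; serving = λ w h → case o .newHub w h of λ
          { (inj₁ x) → serves-mono grows′ (serving w (x ∘ trans (hub≡ w w)))
          ; (inj₂ (w<n , trees)) → trees-serve isDistG w<n trees }
      ; solved = direct-sat (o .buys .grows s t Z₁-st) ∷ all-sat-mono grows′ solved
      ; early = λ z → contradiction (trans (sym (trans φ′≡ (ph 0 0))) z) φ1
      ; late = λ _ X comp → case late (φ1 ∘ trans φ≡) X (older comp) of λ (b≤ , cost≤) →
          b≤ , λ st0 → cost′ X comp (cost≤ (trans (sym st≡) (trans (sym (st 0 0)) (trans (sym st′≡) st0))))
      }
      where
      open Far far′ bought
      jump-or-zero : ∀ u v → u < n → v < n → Y u v ≡ 0 ⊎ Jump (memory T graphArray) DG DH W d (source′ T) (target′ T) u v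
      jump-or-zero u v u<n v<n with jump-cases (memory T graphArray) DG DH W d (source′ T) (target′ T) u v
      ... | inj₁ z = inj₁ (trans (Y≡ u v u<n v<n) z)
      ... | inj₂ h = inj₂ h
      Y-jump : ∀ u v → u < n → v < n → Jump (memory T graphArray) DG DH W d (source′ T) (target′ T) u v → Y u v ≡ suc (W u v)
      Y-jump u v u<n v<n h = trans (Y≡ u v u<n v<n) (jump-weight _ _ _ _ _ _ _ u v h)
      allowed : 0 ≡ 0 → ∀ u v → u < n → v < n → Y u v ≢ 0 → E u v ≢ 0
      allowed _ u v u<n v<n y with jump-or-zero u v u<n v<n
      ... | inj₁ z = contradiction z y
      ... | inj₂ h = Jump.edge h ∘ trans (T-graph u v)
      o : Outcome ω n E DG Y 0 (memory S₁ limitCell 0 0 * 1) S₁ S′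
      o = proj₁ (active 0 mode allowed)
      grows′ : ∀ i j → Z₀ i j ≢ 0 → Z′ i j ≢ 0
      grows′ i j h = o .buys .grows i j (grows₁ i j (h ∘ trans (sym (Z≡ i j))))
      old-bound : ∀ u v → W u v < M + M
      old-bound u v = subst (_< M + M) (sym (W≡ u v)) (weights u v)
      weight-bound : ∀ u v → W₁ u v < M + M
      weight-bound u v with u <? n | v <? n
      ... | no u≮n  | _       = subst (_< M + M) (sym (out-same u v (u≮n ∘ proj₁))) (old-bound u v)
      ... | yes _   | no v≮n  = subst (_< M + M) (sym (out-same u v (v≮n ∘ proj₂))) (old-bound u v)
      ... | yes u<n | yes v<n with jump-or-zero u v u<n v<n
      ...   | inj₁ z = subst (_< M + M) (sym (trans (raised u v u<n v<n) (trans (cong (W u v +_) z) (+-identityʳ _)))) (old-bound u v)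
      ...   | inj₂ h = subst (_< M + M) (sym (raised u v u<n v<n))
        (+-mono-≤ (≤-trans (≤-reflexive (sym (Y-jump u v u<n v<n h))) (<⇒≤ Y<M)) (<⇒≤ Y<M))
        where
        Y<M : Y u v < M
        Y<M = ≤-trans (s≤s (sum²-term Y u<n v<n)) (≤-trans small (≤-reflexive (T-par 5 refl)))
      gain : ∀ X → Competitor (r ∷ rs) X → suc (potential X W₀) ≤ potential X (memory S′ weightArray)
      gain X comp with competitor-jump comp
      ... | u , v , u<n , v<n , x , h = ≤-trans (s≤s (potential-mono X λ i j _ _ → ≤-reflexive (sym (W≡ i j))))
        (potential-gain X {W} {memory S′ weightArray} u v u<n v<n x
          (λ i j i<n j<n → ≤-trans (m≤m+n (W i j) (Y i j)) (≤-reflexive (sym (trans (W′≡ i j) (raised i j i<n j<n)))))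
          (trans (W′≡ u v) (trans (raised u v u<n v<n) (cong (W u v +_) (Y-jump u v u<n v<n h′)))))
        where
        h′ : Jump (memory T graphArray) DG DH W d (source′ T) (target′ T) u v
        h′ = subst₂ (λ a b → Jump (memory T graphArray) DG DH W d a b u v) (sym T-source) (sym T-target) h
      cost′ : ∀ X → Competitor (r ∷ rs) X → count n Z₀ ≤ base + suc K * potential X W₀ →
        count n Z′ ≤ base + suc K * potential X (memory S′ weightArray)
      cost′ X comp old = begin
        count n Z′                                        ≤⟨ o .buys .cost ⟩
        memory S₁ limitCell 0 0 * 1 + count n Z₁          ≡⟨ cong₂ _+_ (trans (*-identityʳ _) (trans lim (T-par 2 refl))) (trans count₁ (cong suc countZ)) ⟩
        K + suc (count n Z₀)                              ≤⟨ +-monoʳ-≤ K (s≤s old) ⟩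
        K + suc (base + suc K * potential X W₀)           ≡⟨ lem K base (potential X W₀) ⟩
        base + suc K * suc (potential X W₀)               ≤⟨ +-monoʳ-≤ base (*-monoʳ-≤ (suc K) (gain X comp)) ⟩
        base + suc K * potential X (memory S′ weightArray) ∎
        where
        open ≤-Reasoning
        lem : ∀ K a p → K + suc (a + suc K * p) ≡ a + suc K * suc p
        lem = solve-∀

    by-response (stuck far′ bought φ1 large wt ph st1 lim) = record
      { order = order′ ; graph = graph′
      ; inE = λ u v h → Z₁E u v (h ∘ trans (Z′≡ u v))
      ; weights = λ u v → subst (_< M + M) (sym (weights-same wt u v)) (weights u v)
      ; serving = λ w h → serves-mono grows′ (serving w (hub′ w h))
      ; solved = direct-sat (Z₁-st ∘ trans (sym (Z′≡ s t))) ∷ all-sat-mono grows′ solved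
      ; early = λ z → contradiction (trans (sym (trans φ′≡ (ph 0 0))) z) φ1
      ; late = λ _ X comp → proj₁ (late (φ1 ∘ trans φ≡) X (older comp)) ,
          λ st0 → contradiction (trans (sym st1) (trans (sym st′≡) st0)) λ ()
      }
      where
      open Idle lim
      open Far far′ bought
      grows′ : ∀ i j → Z₀ i j ≢ 0 → Z′ i j ≢ 0
      grows′ i j h = grows₁ i j (h ∘ trans (sym (Z≡ i j))) ∘ trans (sym (Z′≡ i j))

  -- The maintained edge set accumulates the marks of all rounds. As marks are never cleared, it
  -- coincides with the current marks, so counting these gives the cost.
  grows-in-round : ∀ {ω r rs S T S₁ S′} → Round ω r S T S₁ S′ → Admissible r → Inv rs S → ∀ i j →
    memory S solutionArray i j ≢ 0 → memory S′ solutionArray i j ≢ 0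
  grows-in-round {ω} {r} {rs} {S} {T} {S₁} {S′} R admissible I i j h = by-response response
    where
    open OneRound R admissible (Inv.inE I)
    h′ : Z i j ≢ 0
    h′ = h ∘ trans (sym (T-same solutionArray refl i j))
    by-response : Response n T S₁ → Z′ i j ≢ 0
    by-response (satisfied _ sol _ _ _ _ lim) = h′ ∘ trans (sym (trans (proj₁ (idle lim) i j) (sol i j)))
    by-response (direct far bought _ _ _ _ _ _ lim) = Far.grows₁ far bought i j h′ ∘ trans (sym (proj₁ (idle lim) i j))
    by-response (stuck far bought _ _ _ _ _ lim) = Far.grows₁ far bought i j h′ ∘ trans (sym (proj₁ (idle lim) i j))
    by-response (hubs far bought _ _ _ _ _ mode _ _ _) = proj₁ (active 1 mode λ ()) .buys .grows i j (Far.grows₁ far bought i j h′)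
    by-response (update far bought _ _ Y≡ _ _ _ _ mode _) = proj₁ (active 0 mode allowed) .buys .grows i j (Far.grows₁ far bought i j h′)
      where
      allowed : 0 ≡ 0 → ∀ u v → u < n → v < n → Y u v ≢ 0 → E u v ≢ 0
      allowed _ u v u<n v<n y = by-jump (jump-cases (memory T graphArray) DG DH W d (source′ T) (target′ T) u v)
        where
        by-jump : newWeights T u v ≡ 0 ⊎ Jump (memory T graphArray) DG DH W d (source′ T) (target′ T) u v → E u v ≢ 0
        by-jump (inj₁ z) = contradiction (trans (Y≡ u v u<n v<n) z) y
        by-jump (inj₂ x) = Jump.edge x ∘ trans (T-graph u v)

  stuck-stays : ∀ {S S₁} → Response n S S₁ → memory S stuckCell 0 0 ≢ 0 → memory S₁ stuckCell 0 0 ≢ 0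
  stuck-stays (satisfied _ _ _ _ _ st _)            h = h ∘ trans (sym (st 0 0))
  stuck-stays (direct _ _ _ _ _ _ _ st _)           h = h ∘ trans (sym (st 0 0))
  stuck-stays (hubs _ _ _ _ _ _ st _ _ _ _)         h = h ∘ trans (sym (st 0 0))
  stuck-stays (update _ _ _ _ _ _ _ _ st _ _)       h = h ∘ trans (sym (st 0 0))
  stuck-stays (stuck _ _ _ _ _ _ st _)              h z = contradiction (trans (sym st) z) λ ()

-- The probability of getting stuck

isz : ℕ → ℕ
isz zero    = 1
isz (suc _) = 0

isz-anti : ∀ {x y} → (x ≢ 0 → y ≢ 0) → isz y ≤ isz x
isz-anti {zero}  {zero}  h = ≤-refl
isz-anti {zero}  {suc y} h = z≤n
isz-anti {suc x} {zero}  h = contradiction refl (h λ ())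
isz-anti {suc x} {suc y} h = z≤n

isz≤1 : ∀ x → isz x ≤ 1
isz≤1 zero    = ≤-refl
isz≤1 (suc _) = z≤n

sum-≢0 : ∀ n f → sum< n f ≢ 0 → ∃[ i ] i < n × f i ≢ 0
sum-≢0 zero    f h = contradiction refl h
sum-≢0 (suc n) f h with f n ≟ 0
... | no ne = n , ≤-refl , ne
... | yes z with sum-≢0 n f (h ∘ λ e → cong₂ _+_ z e)
...   | i , i<n , ne = i , m<n⇒m<1+n i<n , ne

sum-term-≢0 : ∀ {n i} f → i < n → f i ≢ 0 → sum< n f ≢ 0
sum-term-≢0 {n} {i} f i<n h z = h (n≤0⇒n≡0 (≤-trans (sum-term f i<n) (≤-reflexive z)))

hits : ℕ → (ℕ → ℕ → Bool) → Matrix → ℕ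
hits n A Z = sum² n λ u v → bit (A u v) * nz (Z u v)

hits-intro : ∀ {n A Z u v} → u < n → v < n → A u v ≡ true → Z u v ≢ 0 → hits n A Z ≢ 0
hits-intro {n} {A} {Z} {u} {v} u<n v<n a z = sum-term-≢0 (λ u → sum< n λ v → bit (A u v) * nz (Z u v)) u<n
  (sum-term-≢0 (λ v → bit (A u v) * nz (Z u v)) v<n λ e → contradiction (trans (sym (cong₂ (λ x y → bit x * y) a (nz-≢0 z))) e) λ ())

hits-elim : ∀ {n A Z} → hits n A Z ≢ 0 → ∃[ u ] ∃[ v ] u < n × v < n × A u v ≡ true × Z u v ≢ 0
hits-elim {n} {A} {Z} h with sum-≢0 n _ h
... | u , u<n , h′ with sum-≢0 n _ h′
...   | v , v<n , ne with A u v in a | Z u v in z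
...     | true  | suc k = u , v , u<n , v<n , a , λ e → contradiction (trans (sym z) e) λ ()
...     | true  | zero  = contradiction refl ne
...     | false | _     = contradiction refl ne

hits-mono : ∀ {n A Z Z′} → (∀ i j → Z i j ≢ 0 → Z′ i j ≢ 0) → hits n A Z ≢ 0 → hits n A Z′ ≢ 0
hits-mono {n} {A} {Z} {Z′} h x with hits-elim {n} {A} {Z} x
... | u , v , u<n , v<n , a , z = hits-intro {n} {A} {Z′} u<n v<n a (h u v z)

prod-01 : ∀ n f → (∀ i → f i ≡ 0 ⊎ f i ≡ 1) → prod< n f ≡ 1 ⊎ ∃[ i ] i < n × f i ≡ 0
prod-01 zero    f h = inj₁ refl
prod-01 (suc n) f h with h n
... | inj₁ z = inj₂ (n , ≤-refl , z)
... | inj₂ o with prod-01 n f h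
...   | inj₁ p = inj₁ (cong₂ _*_ o p)
...   | inj₂ (i , i<n , z) = inj₂ (i , m<n⇒m<1+n i<n , z)

avoids-01 : ∀ A x → avoids A x ≡ 0 ⊎ avoids A x ≡ 1
avoids-01 A nothing = inj₂ refl
avoids-01 A (just (u , v)) with A u v
... | true  = inj₁ refl
... | false = inj₂ refl

avoids-hit : ∀ A x → avoids A x ≡ 0 → ∃[ u ] ∃[ v ] x ≡ just (u , v) × A u v ≡ true
avoids-hit A (just (u , v)) h with A u v in a
... | true  = u , v , refl , a

-- K draws are tossed in any case; those with index Q or more buy nothing and contribute the factor
-- 1.
early-avoids : (Q : ℕ) → (ℕ → ℕ → Bool) → Matrix → ℕ → ℕ → ℕ → ℕ
early-avoids Q A Y n i r = if i <ᵇ Q then avoids A (pick Y (cells n n) r) else 1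

early-avoids-01 : ∀ Q A Y n i r → early-avoids Q A Y n i r ≡ 0 ⊎ early-avoids Q A Y n i r ≡ 1
early-avoids-01 Q A Y n i r with i <ᵇ Q
... | true  = avoids-01 A (pick Y (cells n n) r)
... | false = inj₂ refl

early-avoids-hit : ∀ Q A Y n i r → early-avoids Q A Y n i r ≡ 0 →
  i < Q × ∃[ u ] ∃[ v ] pick Y (cells n n) r ≡ just (u , v) × A u v ≡ true
early-avoids-hit Q A Y n i r h with i <ᵇ Q in eq
... | true = <ᵇ⇒< i Q (≡⇒T eq) , avoids-hit A (pick Y (cells n n) r) h

prod-early : ∀ Q J x y → prod< (J + Q) (λ i → if i <ᵇ Q then x else y) ≡ y ^ J * x ^ Q
prod-early Q zero    x y = trans (trans (prod-cong Q λ i i<Q → cong (λ z → if z then x else y) (T⇒≡ (<⇒<ᵇ i<Q))) (prod-const Q x)) (sym (+-identityʳ _))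
prod-early Q (suc J) x y with J + Q <ᵇ Q in eq
... | true  = contradiction (<ᵇ⇒< (J + Q) Q (≡⇒T eq)) (≤⇒≯ (m≤n+m Q J))
... | false = trans (cong (y *_) (prod-early Q J x y)) (sym (*-assoc y (y ^ J) (x ^ Q)))

-- Whatever the earlier coins `v`, the fresh draws are independent and uniform below 2 ^ b, so the
-- sum factors into one factor for each draw.
draws-avoid : ∀ {R} (v : Vec Bool R) n b K Q A Y → Q ≤ K → sum² n Y ≤ 2 ^ b →
  sumV (K * b) (λ w → prod< K (λ i → early-avoids Q A Y n i (drawn (ext (v ++ᵛ w)) R b K i))) ≤
  (2 ^ b) ^ (K ∸ Q) * (2 ^ b ∸ sum² n (restrict A Y)) ^ Q
draws-avoid {R} v n b K Q A Y Q≤K small = begin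
  sumV (K * b) (λ w → prod< K (λ i → f i (drawn (ext (v ++ᵛ w)) R b K i)))
    ≡⟨ sumV-cong (K * b) (λ w → prod-cong K λ i _ → cong (f i) (drawn-shift {ext (v ++ᵛ w)} {ext w} {R} {0} b K i (ext-++ʳ v w))) ⟩
  sumV (K * b) (λ w → prod< K (λ i → f i (drawn (ext w) 0 b K i)))
    ≡⟨ draws-independent b K f ⟩
  prod< K (λ i → sum< M (f i))
    ≤⟨ prod-mono K (λ i _ → each i) ⟩
  prod< K (λ i → if i <ᵇ Q then x else M)
    ≡⟨ cong (λ k → prod< k (λ i → if i <ᵇ Q then x else M)) (sym (m∸n+n≡m Q≤K)) ⟩
  prod< (K ∸ Q + Q) (λ i → if i <ᵇ Q then x else M)
    ≡⟨ prod-early Q (K ∸ Q) x M ⟩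
  M ^ (K ∸ Q) * x ^ Q ∎
  where
  open ≤-Reasoning
  M = 2 ^ b
  x = M ∸ sum² n (restrict A Y)
  f = early-avoids Q A Y n
  each : ∀ i → sum< M (f i) ≤ (if i <ᵇ Q then x else M)
  each i with i <ᵇ Q
  ... | true  = avoiding-draws n M A Y small
  ... | false = ≤-reflexive (trans (sum-const M 1) (*-identityʳ M))

-- The choice of constants

module Numbers (κ : ℕ) {n : ℕ} (1≤n : 1 ≤ n) where

  -- Large enough for both estimates: `few-codes` requires (6 l + 1) β + 3 l κ + 1 ≤ c (l + 1) β,
  -- and `few-misses` requires 9 l + 3 l κ + 1 ≤ c (l + 1).
  c : ℕ
  c = 10 + 3 * κ

  open Parameters c

  private
    l K b Q M β g q : ℕ
    l = level n
    K = value n l 2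
    b = value n l 3
    Q = value n l 4
    M = value n l 5
    g = value n l 8
    β = value n l 9
    q = value n l 10

  -- The factor 2 in `N₁` shares the failure probability between the two ways of getting stuck. `H`
  -- bounds the weight of any code at the beginning, `L` is half the number of draws, and `T∞`
  -- bounds the weight that a code can ever have, entries being below 2 M.
  N₁ H L T∞ : ℕ
  N₁ = 2 * n ^ κ
  H = 64 ^ l
  L = c * suc l * β
  T∞ = n * n * (M + M)

  2H≡M : H + H ≡ M
  2H≡M = cong (H +_) (sym (+-identityʳ H))

  1≤M : 1 ≤ M
  1≤M = ≤-trans (m^n>0 64 l) (≤-trans (m≤m+n H H) (≤-reflexive 2H≡M))

  M≤T∞ : M ≤ T∞
  M≤T∞ = ≤-trans (m≤m+n M M) (≤-trans (≤-reflexive (sym (*-identityˡ (M + M)))) (*-monoˡ-≤ (M + M) (*-mono-≤ 1≤n 1≤n)))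

  2^b≡M : 2 ^ b ≡ M
  2^b≡M = cong (2 *_) (sym (^-*-assoc 2 6 l))

  1≤β : 1 ≤ β
  1≤β = m^n>0 4 l

  n≤q : n ≤ q
  n≤q = n≤8^level n

  q≡ : q ≡ 2 ^ (3 * l)
  q≡ = ^-*-assoc 2 3 l

  qq≡H : q * q ≡ H
  qq≡H = sym (power-product 8 8 l)

  n*n≤H : n * n ≤ H
  n*n≤H = ≤-trans (*-mono-≤ n≤q n≤q) (≤-reflexive qq≡H)

  n^≤ : ∀ k → n ^ k ≤ 2 ^ (3 * l * k)
  n^≤ k = ≤-trans (^-monoˡ-≤ k (≤-trans n≤q (≤-reflexive q≡))) (≤-reflexive (^-*-assoc 2 (3 * l) k))

  N₁≤ : N₁ ≤ 2 ^ suc (3 * l * κ)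
  N₁≤ = *-monoʳ-≤ 2 (n^≤ κ)

  -- Codes are words of length β over n (n + 1) ≤ 2 ^ (6 l + 1) letters.
  few-codes : length (words (alphabet n) β) * N₁ ≤ 2 ^ L
  few-codes = begin
    length (words (alphabet n) β) * N₁
      ≡⟨ cong (_* N₁) (trans (length-words (alphabet n) β) (cong (_^ β) (length-alphabet n))) ⟩
    (n * suc n) ^ β * N₁                            ≤⟨ *-mono-≤ (^-monoˡ-≤ β letters) N₁≤ ⟩
    (2 ^ suc (6 * l)) ^ β * 2 ^ suc (3 * l * κ)     ≡⟨ cong (_* 2 ^ suc (3 * l * κ)) (^-*-assoc 2 (suc (6 * l)) β) ⟩
    2 ^ (suc (6 * l) * β) * 2 ^ suc (3 * l * κ)     ≡⟨ sym (^-distribˡ-+-* 2 (suc (6 * l) * β) _) ⟩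
    2 ^ (suc (6 * l) * β + suc (3 * l * κ))         ≤⟨ ^-monoʳ-≤ 2 exponent ⟩
    2 ^ L                                           ∎
    where
    open ≤-Reasoning
    letters : n * suc n ≤ 2 ^ suc (6 * l)
    letters = ≤-trans (*-monoʳ-≤ n (+-monoˡ-≤ n 1≤n)) (≤-trans (≤-reflexive (*-distribˡ-+ n n n))
      (≤-trans (+-mono-≤ n*n≤H n*n≤H) (≤-reflexive (trans 2H≡M (sym 2^b≡M)))))
    exponent : suc (6 * l) * β + suc (3 * l * κ) ≤ L
    exponent = begin
      suc (6 * l) * β + suc (3 * l * κ)     ≤⟨ +-monoʳ-≤ (suc (6 * l) * β) (≤-trans (≤-reflexive (sym (*-identityʳ _))) (*-monoʳ-≤ (suc (3 * l * κ)) 1≤β)) ⟩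
      suc (6 * l) * β + suc (3 * l * κ) * β ≤⟨ m≤m+n _ ((8 + 4 * l + 3 * κ) * β) ⟩
      suc (6 * l) * β + suc (3 * l * κ) * β + (8 + 4 * l + 3 * κ) * β ≡⟨ lem l κ β ⟩
      (10 + 3 * κ) * suc l * β ∎
      where
      lem : ∀ l κ β → suc (6 * l) * β + suc (3 * l * κ) * β + (8 + 4 * l + 3 * κ) * β ≡ (10 + 3 * κ) * suc l * β
      lem = solve-∀

  -- 64 = 2 · 8 · 4, raised to the power l.
  M≡gy : M ≡ g * (2 * q * β)
  M≡gy = trans (cong (2 *_) (trans (cong (_^ l) {x = 64} {y = 2 * 32} refl) (trans (power-product 2 32 l) (cong (g *_) (power-product 8 4 l))))) (lem g q β)
    where
    lem : ∀ g q β → 2 * (g * (q * β)) ≡ g * (2 * q * β)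
    lem = solve-∀

  -- The cube counts triples s, t, d. One draw misses β vertices of weight 2 q with probability 1 -
  -- 1/g for g = 2 ^ l, and Q is g times c (l + 1), so the probability is halved at least c (l + 1)
  -- times.
  few-misses : (n * n * n * N₁) * (M ∸ 2 * q * β) ^ Q ≤ M ^ Q
  few-misses = begin
    (n * n * n * N₁) * (M ∸ y) ^ Q           ≡⟨ cong (λ z → (n * n * n * N₁) * z ^ Q) M∸y ⟩
    (n * n * n * N₁) * ((g ∸ 1) * y) ^ Q     ≤⟨ *-monoˡ-≤ (((g ∸ 1) * y) ^ Q) size≤ ⟩
    2 ^ j * ((g ∸ 1) * y) ^ Q                ≡⟨ cong (2 ^ j *_) (power-product (g ∸ 1) y Q) ⟩
    2 ^ j * ((g ∸ 1) ^ Q * y ^ Q)            ≡⟨ sym (*-assoc (2 ^ j) _ _) ⟩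
    2 ^ j * (g ∸ 1) ^ Q * y ^ Q              ≤⟨ *-monoˡ-≤ (y ^ Q) halved ⟩
    g ^ Q * y ^ Q                            ≡⟨ sym (power-product g y Q) ⟩
    (g * y) ^ Q                              ≡⟨ cong (_^ Q) (sym M≡gy) ⟩
    M ^ Q                                    ∎
    where
    open ≤-Reasoning
    y = 2 * q * β
    j = c * suc l
    M∸y : M ∸ y ≡ (g ∸ 1) * y
    M∸y = trans (cong (_∸ y) M≡gy) (trans (cong (g * y ∸_) (sym (*-identityˡ y))) (sym (*-distribʳ-∸ y g 1)))
    Q≡ : Q ≡ g * j
    Q≡ = *-comm j g
    halved : 2 ^ j * (g ∸ 1) ^ Q ≤ g ^ Q
    halved = begin
      2 ^ j * (g ∸ 1) ^ Q        ≡⟨ cong (λ z → 2 ^ j * (g ∸ 1) ^ z) Q≡ ⟩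
      2 ^ j * (g ∸ 1) ^ (g * j)  ≡⟨ cong (2 ^ j *_) (sym (^-*-assoc (g ∸ 1) g j)) ⟩
      2 ^ j * ((g ∸ 1) ^ g) ^ j  ≡⟨ sym (power-product 2 ((g ∸ 1) ^ g) j) ⟩
      (2 * (g ∸ 1) ^ g) ^ j      ≤⟨ ^-monoˡ-≤ j (halve-power g (m^n>0 2 l)) ⟩
      (g ^ g) ^ j                ≡⟨ ^-*-assoc g g j ⟩
      g ^ (g * j)                ≡⟨ cong (g ^_) (sym Q≡) ⟩
      g ^ Q                      ∎
    size≤ : n * n * n * N₁ ≤ 2 ^ j
    size≤ = begin
      n * n * n * N₁                              ≡⟨ cong (_* N₁) (lem₁ n) ⟩
      n ^ 3 * N₁                                  ≤⟨ *-mono-≤ (n^≤ 3) N₁≤ ⟩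
      2 ^ (3 * l * 3) * 2 ^ suc (3 * l * κ)       ≡⟨ sym (^-distribˡ-+-* 2 (3 * l * 3) _) ⟩
      2 ^ (3 * l * 3 + suc (3 * l * κ))           ≤⟨ ^-monoʳ-≤ 2 (≤-trans (m≤m+n _ (9 + l + 3 * κ)) (≤-reflexive (lem₂ l κ))) ⟩
      2 ^ j                                       ∎
      where
      lem₁ : ∀ n → n * n * n ≡ n * (n * (n * 1))
      lem₁ = solve-∀
      lem₂ : ∀ l κ → 3 * l * 3 + suc (3 * l * κ) + (9 + l + 3 * κ) ≡ (10 + 3 * κ) * suc l
      lem₂ = solve-∀

  Q≤K : Q ≤ K
  Q≤K = ≤-trans (*-monoʳ-≤ (c * suc l) (^-monoˡ-≤ l (s≤s (s≤s (z≤n {2}))))) (m≤m+n (c * suc l * β) _)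

isDist-unique : ∀ {n X D D′} → IsDist n X D → IsDist n X D′ → ∀ i j → i < n → j < n → D i j ≤ D′ i j
isDist-unique {n} {D′ = D′} h h′ i j i<n j<n with D′ i j <? n
... | yes lt = IsDist.complete h i j (D′ i j) i<n j<n (<⇒≤ lt) (IsDist.sound h′ i j i<n j<n lt)
... | no ¬lt = ≤-trans (IsDist.bounded h i j i<n j<n) (≮⇒≥ ¬lt)

≤ᵇ-true : ∀ {m n} → m ≤ n → (m ≤ᵇ n) ≡ true
≤ᵇ-true h = T⇒≡ (≤⇒≤ᵇ h)

true-≤ᵇ : ∀ {m n} → (m ≤ᵇ n) ≡ true → m ≤ n
true-≤ᵇ {m} {n} h = ≤ᵇ⇒≤ m n (≡⇒T h)

restrict-+ : ∀ n A X Y Z → (∀ i j → i < n → j < n → Z i j ≡ X i j + Y i j) →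
  sum² n (restrict A Z) ≡ sum² n (restrict A X) + sum² n (restrict A Y)
restrict-+ n A X Y Z h = trans (sum²-cong n λ i j i<n j<n → trans (cong (bit (A i j) *_) (h i j i<n j<n)) (*-distribˡ-+ (bit (A i j)) (X i j) (Y i j)))
  (sum²-+ n (restrict A X) (restrict A Y))

restrict-≤ : ∀ n A X → sum² n (restrict A X) ≤ sum² n X
restrict-≤ n A X = sum²-mono n λ i j _ _ → ≤-trans (*-monoˡ-≤ (X i j) (bit≤1 (A i j))) (≤-reflexive (*-identityˡ (X i j)))

sum³ : ℕ → (ℕ → ℕ → ℕ → ℕ) → ℕ
sum³ n f = sum< n λ i → sum² n (f i)

sum³-mono : ∀ n {f g} → (∀ i j k → i < n → j < n → k < n → f i j k ≤ g i j k) → sum³ n f ≤ sum³ n g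
sum³-mono n h = sum-mono n λ i i<n → sum²-mono n λ j k → h i j k i<n

sum³-term : ∀ {n i j k} f → i < n → j < n → k < n → f i j k ≤ sum³ n f
sum³-term {n} {i} f i<n j<n k<n = ≤-trans (sum²-term (f i) j<n k<n) (sum-term (λ i → sum² n (f i)) i<n)

sum³-const : ∀ n x → sum³ n (λ _ _ _ → x) ≡ n * n * n * x
sum³-const n x = trans (sum-cong n λ _ _ → sum²-const n x) (trans (sum-const n (n * n * x)) (lem n x))
  where
  lem : ∀ n x → n * (n * n * x) ≡ n * n * n * x
  lem = solve-∀

sumV-sum< : ∀ R n (f : Vec Bool R → ℕ → ℕ) → sumV R (λ v → sum< n (f v)) ≡ sum< n (λ i → sumV R (λ v → f v i))
sumV-sum< R zero    f = trans (sumV-const R 0) (*-zeroʳ (2 ^ R))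
sumV-sum< R (suc n) f = trans (sumV-+ R (λ v → f v n) _) (cong (sumV R (λ v → f v n) +_) (sumV-sum< R n f))

sumV-sum³ : ∀ R n (f : Vec Bool R → ℕ → ℕ → ℕ → ℕ) → sumV R (λ v → sum³ n (f v)) ≡ sum³ n (λ i j k → sumV R (λ v → f v i j k))
sumV-sum³ R n f = trans (sumV-sum< R n _) (sum-cong n λ i _ → trans (sumV-sum< R n _) (sum-cong n λ j _ → sumV-sum< R n _))

-- The risk and its behaviour under random draws

module Potential (κ : ℕ) {n : ℕ} (G : Digraph n) (1≤n : 1 ≤ n) where

  open Numbers κ 1≤n public
  open Preservation c G public
  open Exponential M K T∞ using (wt; wt-step; wt-mono) public

  -- Every state has its own matrix of distances in G; the risk needs one that
  -- does not depend on the state.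
  graphState : State
  graphState = state (λ a i j → if a ≡ᵇ graphArray then E i j else n) 0

  abstract
    D₀ : Matrix
    D₀ = memory (run (λ _ → false) (distances graphArray) graphState) distH

    isDist₀ : IsDist n E D₀
    isDist₀ = Distances.distances-spec (λ _ → false) graphArray refl graphState n refl adjacency-supported

  near : ℕ → ℕ → ℕ → ℕ → Bool
  near s t d v = D₀ s v + D₀ v t ≤ᵇ d

  near-size : ℕ → ℕ → ℕ → ℕ
  near-size s t d = sum< n (bit ∘ near s t d)

  onDiagonal : (ℕ → Bool) → ℕ → ℕ → Bool
  onDiagonal A u v = (u ≡ᵇ v) ∧ A u

  missed : Matrix → ℕ → ℕ → ℕ → ℕ
  missed Hub s t d = bit (β ≤ᵇ near-size s t d) * isz (hits n (onDiagonal (near s t d)) Hub)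

  -- A union bound over triples that are fixed in advance. They include every request, because
  -- rounded bounds are below n.
  hubRisk : Matrix → ℕ
  hubRisk Hub = sum³ n (missed Hub)

  family : List Code
  family = words (alphabet n) β

  -- Taken over all pairs of vertices, edges of G or not. It thus dominates the candidates of any
  -- request with this code, and is at most n² as long as all weights are 1.
  mass : Matrix → Code → ℕ
  mass W x = sum² n (restrict (jump x) λ u v → suc (W u v))

  -- Codes that have been hit drop out for good: the code of a request that gets stuck contains no
  -- bought jump.
  codeRisk : Matrix → Matrix → ℕ
  codeRisk Z W = sumL (λ x → isz (hits n (jump x) Z) * wt (mass W x)) family

  -- `Θ` is the risk of a stuck state and `Φ₀` that of the first phase. The terms of `Φ₀` bound the
  -- code risk and the expected hub risk when the hubs open; each is at most `wt M`, so `Θ` is at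
  -- least n ^ κ times `Φ₀`.
  Θ Φ₀ : ℕ
  Θ = N₁ * wt M
  Φ₀ = length family * N₁ * wt H + wt M

  lateRisk : Matrix → Matrix → Matrix → ℕ
  lateRisk Z W Hub = N₁ * codeRisk Z W + wt M * (N₁ * hubRisk Hub)

  -- Constant in the first phase, when coins do not affect the purchases yet, and constant again
  -- once stuck.
  risk : State → ℕ
  risk S = select (memory S stuckCell 0 0) Θ
    (select (memory S phaseCell 0 0) (lateRisk (memory S solutionArray) (memory S weightArray) (memory S hubArray)) Φ₀)

  gain-H : length family * N₁ * wt H ≤ wt M
  gain-H = ≤-trans (*-monoˡ-≤ (wt H) few-codes) (wt-gain M H L T∞ 1≤M 2H≡M M≤T∞)

  hubRisk-mono : ∀ {X X′} → (∀ w → X w w ≢ 0 → X′ w w ≢ 0) → hubRisk X′ ≤ hubRisk X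
  hubRisk-mono {X} {X′} h = sum³-mono n λ s t d _ _ _ → *-monoʳ-≤ (bit (β ≤ᵇ near-size s t d)) (isz-anti (grow s t d))
    where
    grow : ∀ s t d → hits n (onDiagonal (near s t d)) X ≢ 0 → hits n (onDiagonal (near s t d)) X′ ≢ 0
    grow s t d x with hits-elim {n} {onDiagonal (near s t d)} {X} x
    ... | u , v , u<n , v<n , a , z with ≡ᵇ⇒≡ u v (≡⇒T (proj₁ (∧-split {u ≡ᵇ v} a)))
    ...   | refl = hits-intro {n} {onDiagonal (near s t d)} {X′} u<n v<n a (h u z)

  codeRisk-mono : ∀ {Z Z′ W W′} → (∀ i j → Z i j ≢ 0 → Z′ i j ≢ 0) → (∀ i j → W′ i j ≡ W i j) → codeRisk Z′ W′ ≤ codeRisk Z W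
  codeRisk-mono {Z} {Z′} h w = sumL-mono family λ x → *-mono-≤
    (isz-anti (hits-mono {n} {jump x} {Z} {Z′} h))
    (≤-reflexive (cong wt (sum²-cong n λ i j _ _ → cong (λ z → bit (jump x i j) * suc z) (w i j))))

  mass-small : ∀ {W} x → (∀ u v → W u v < M + M) → mass W x ≤ T∞
  mass-small {W} x h = ≤-trans (restrict-≤ n (jump x) (λ u v → suc (W u v)))
    (≤-trans (sum²-mono n λ u v _ _ → h u v) (≤-reflexive (sum²-const n (M + M))))

  module Batch {R : ℕ} (v : Vec Bool R) (Y : Matrix) (m : ℕ) (m≤K : m ≤ K) (small : sum² n Y ≤ M) where

    draw : Vec Bool (K * b) → ℕ → ℕ
    draw w = drawn (ext (v ++ᵛ w)) R b K

    batch : ∀ A → sumV (K * b) (λ w → prod< K (λ i → early-avoids m A Y n i (draw w i))) ≤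
            M ^ (K ∸ m) * (M ∸ sum² n (restrict A Y)) ^ m
    batch A = ≤-trans (draws-avoid v n b K m A Y m≤K (≤-trans small (≤-reflexive (sym 2^b≡M))))
      (≤-reflexive (cong (λ z → z ^ (K ∸ m) * (z ∸ sum² n (restrict A Y)) ^ m) 2^b≡M))

    -- A set can remain unhit only if it was unhit before and every counted draw avoids it. The
    -- product of 0-1 factors is the indicator of the latter and will factor under the sum over
    -- coins.
    still-missed : ∀ A Z Z′ w → (∀ i j → Z i j ≢ 0 → A i j ≡ true → Z′ i j ≢ 0) →
      (∀ i → i < K → i < m → ∀ a b → pick Y (cells n n) (draw w i) ≡ just (a , b) → A a b ≡ true → Z′ a b ≢ 0) →
      isz (hits n A Z′) ≤ isz (hits n A Z) * prod< K (λ i → early-avoids m A Y n i (draw w i))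
    still-missed A Z Z′ w grow hit with prod-01 K (λ i → early-avoids m A Y n i (draw w i)) (λ i → early-avoids-01 m A Y n i (draw w i))
    ... | inj₁ one = ≤-trans (isz-anti mono) (≤-reflexive (trans (sym (*-identityʳ _)) (cong (isz (hits n A Z) *_) (sym one))))
      where
      mono : hits n A Z ≢ 0 → hits n A Z′ ≢ 0
      mono x with hits-elim {n} {A} {Z} x
      ... | u , v , u<n , v<n , a , z = hits-intro {n} {A} {Z′} u<n v<n a (grow u v z a)
    ... | inj₂ (i , i<K , e) with early-avoids-hit m A Y n i (draw w i) e
    ...   | i<m , a , b , p , t with pick-cell Y n (draw w i) p
    ...     | a<n , b<n , _ = ≤-trans (≤-reflexive (isz-≢0 (hits-intro {n} {A} {Z′} a<n b<n t (hit i i<K i<m a b p t)))) z≤n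
      where
      isz-≢0 : ∀ {x} → x ≢ 0 → isz x ≡ 0
      isz-≢0 {zero}  h = contradiction refl h
      isz-≢0 {suc _} h = refl

  -- Code by code. The new weights are settled before the draws, so only the indicator of being
  -- unhit is averaged, and `wt-step` trades its decrease for the increase in weight.
  update-risk : ∀ {R} (v : Vec Bool R) Y Z W W′ (Z′ : Vec Bool (K * b) → Matrix) → sum² n Y ≤ M →
    (∀ i j → i < n → j < n → W′ i j ≡ W i j + Y i j) → (∀ u v → W′ u v < M + M) →
    (∀ w i j → Z i j ≢ 0 → Z′ w i j ≢ 0) →
    (∀ w i → i < K → ∀ a b′ → pick Y (cells n n) (drawn (ext (v ++ᵛ w)) R b K i) ≡ just (a , b′) → Z′ w a b′ ≢ 0) →
    sumV (K * b) (λ w → codeRisk (Z′ w) W′) ≤ 2 ^ (K * b) * codeRisk Z W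
  update-risk v Y Z W W′ Z′ small raised bounded grow hit = begin
    sumV (K * b) (λ w → codeRisk (Z′ w) W′)
      ≡⟨ sumV-sumL (K * b) (λ w x → isz (hits n (jump x) (Z′ w)) * wt (mass W′ x)) family ⟩
    sumL (λ x → sumV (K * b) (λ w → isz (hits n (jump x) (Z′ w)) * wt (mass W′ x))) family
      ≤⟨ sumL-mono family each ⟩
    sumL (λ x → 2 ^ (K * b) * (isz (hits n (jump x) Z) * wt (mass W x))) family
      ≡⟨ sumL-* (2 ^ (K * b)) _ family ⟩
    2 ^ (K * b) * codeRisk Z W ∎
    where
    open ≤-Reasoning
    open Batch v Y K ≤-refl small
    each : ∀ x → sumV (K * b) (λ w → isz (hits n (jump x) (Z′ w)) * wt (mass W′ x)) ≤ 2 ^ (K * b) * (isz (hits n (jump x) Z) * wt (mass W x))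
    each x = begin
      sumV (K * b) (λ w → isz (hits n A (Z′ w)) * wt (mass W′ x))
        ≤⟨ sumV-mono (K * b) (λ w → ≤-trans (*-monoˡ-≤ (wt (mass W′ x)) (still-missed A Z (Z′ w) w (λ i j z _ → grow w i j z) (λ i i<K _ a b′ p _ → hit w i i<K a b′ p)))
             (≤-reflexive (lem (isz (hits n A Z)) _ (wt (mass W′ x))))) ⟩
      sumV (K * b) (λ w → isz (hits n A Z) * wt (mass W′ x) * prod< K (λ i → early-avoids K A Y n i (draw w i)))
        ≡⟨ sumV-* (K * b) (isz (hits n A Z) * wt (mass W′ x)) _ ⟩
      isz (hits n A Z) * wt (mass W′ x) * sumV (K * b) (λ w → prod< K (λ i → early-avoids K A Y n i (draw w i)))
        ≤⟨ *-monoʳ-≤ (isz (hits n A Z) * wt (mass W′ x)) (≤-trans (batch A) (≤-reflexive (trans (cong (λ k → M ^ k * (M ∸ y) ^ K) (n∸n≡0 K)) (*-identityˡ _)))) ⟩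
      isz (hits n A Z) * wt (mass W′ x) * (M ∸ y) ^ K
        ≡⟨ trans (*-assoc (isz (hits n A Z)) _ _) (cong (isz (hits n A Z) *_) (*-comm (wt (mass W′ x)) _)) ⟩
      isz (hits n A Z) * ((M ∸ y) ^ K * wt (mass W′ x))
        ≡⟨ cong (λ z → isz (hits n A Z) * ((M ∸ y) ^ K * wt z)) mass≡ ⟩
      isz (hits n A Z) * ((M ∸ y) ^ K * wt (mass W x + y))
        ≤⟨ *-monoʳ-≤ (isz (hits n A Z)) (wt-step y (mass W x) (≤-trans (restrict-≤ n A Y) small) (≤-trans (≤-reflexive (sym mass≡)) (mass-small x bounded))) ⟩
      isz (hits n A Z) * (M ^ K * wt (mass W x))
        ≡⟨ cong (λ z → isz (hits n A Z) * (z * wt (mass W x))) (trans (cong (_^ K) (sym 2^b≡M)) (trans (^-*-assoc 2 b K) (cong (2 ^_) (*-comm b K)))) ⟩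
      isz (hits n A Z) * (2 ^ (K * b) * wt (mass W x))
        ≡⟨ *-exchange′ (isz (hits n A Z)) (2 ^ (K * b)) (wt (mass W x)) ⟩
      2 ^ (K * b) * (isz (hits n A Z) * wt (mass W x)) ∎
      where
      A = jump x
      y = sum² n (restrict A Y)
      lem : ∀ a p w → a * p * w ≡ a * w * p
      lem = solve-∀
      *-exchange′ : ∀ a p w → a * (p * w) ≡ p * (a * w)
      *-exchange′ = solve-∀
      mass≡ : mass W′ x ≡ mass W x + y
      mass≡ = restrict-+ n A (λ u v → suc (W u v)) Y (λ u v → suc (W′ u v)) λ i j i<n j<n → cong suc (raised i j i<n j<n)

  -- The β or more vertices local to a triple carry weight at least 2 q β of M, and the chance that
  -- Q draws miss them is small enough for all n³ triples by `few-misses`.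
  hub-risk : ∀ {R} (v : Vec Bool R) Y (Hub′ : Vec Bool (K * b) → Matrix) →
    (∀ i → i < n → Y i i ≡ 2 * 8 ^ l) → (∀ i j → i < n → j < n → i ≢ j → Y i j ≡ 0) →
    (∀ w i → i < K → i < Q → ∀ a b′ → pick Y (cells n n) (drawn (ext (v ++ᵛ w)) R b K i) ≡ just (a , b′) → Hub′ w a a ≢ 0) →
    sumV (K * b) (λ w → N₁ * hubRisk (Hub′ w)) ≤ 2 ^ (K * b)
  hub-risk v Y Hub′ diag off hit = begin
    sumV (K * b) (λ w → N₁ * hubRisk (Hub′ w))           ≡⟨ sumV-* (K * b) N₁ _ ⟩
    N₁ * sumV (K * b) (λ w → hubRisk (Hub′ w))           ≡⟨ cong (N₁ *_) (sumV-sum³ (K * b) n (λ w → missed (Hub′ w))) ⟩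
    N₁ * sum³ n (λ s t d → sumV (K * b) (λ w → missed (Hub′ w) s t d))
      ≤⟨ *-monoʳ-≤ N₁ (sum³-mono n λ s t d _ _ _ → each s t d) ⟩
    N₁ * sum³ n (λ _ _ _ → x)                            ≡⟨ cong (N₁ *_) (sum³-const n x) ⟩
    N₁ * (n * n * n * x)                                 ≡⟨ lem₁ N₁ (n * n * n) (M ^ (K ∸ Q)) _ ⟩
    M ^ (K ∸ Q) * (n * n * n * N₁ * (M ∸ y) ^ Q)         ≤⟨ *-monoʳ-≤ (M ^ (K ∸ Q)) few-misses ⟩
    M ^ (K ∸ Q) * M ^ Q                                  ≡⟨ sym (^-distribˡ-+-* M (K ∸ Q) Q) ⟩
    M ^ (K ∸ Q + Q)                                      ≡⟨ cong (M ^_) (m∸n+n≡m Q≤K) ⟩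
    M ^ K                                                ≡⟨ trans (cong (_^ K) (sym 2^b≡M)) (trans (^-*-assoc 2 b K) (cong (2 ^_) (*-comm b K))) ⟩
    2 ^ (K * b)                                          ∎
    where
    open ≤-Reasoning
    q = 8 ^ l
    y = 2 * q * β
    x = M ^ (K ∸ Q) * (M ∸ y) ^ Q
    lem₁ : ∀ N m a z → N * (m * (a * z)) ≡ a * (m * N * z)
    lem₁ = solve-∀
    Yδ : ∀ i j → i < n → j < n → Y i j ≡ δ j i * (2 * q)
    Yδ i j i<n j<n with j ≟ i
    ... | yes refl rewrite ≡ᵇ-refl j = trans (diag j j<n) (sym (+-identityʳ _))
    ... | no j≢i   rewrite ≢⇒≡ᵇ j≢i = off i j i<n j<n (j≢i ∘ sym)
    row : ∀ i → sum< n (λ j → δ j i * (2 * q)) ≤ 2 * q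
    row i = ≤-trans (≤-reflexive (trans (sum-cong n λ j _ → *-comm (δ j i) (2 * q)) (sum-* n (2 * q) (λ j → δ j i))))
      (≤-trans (*-monoʳ-≤ (2 * q) (sum-δ n i)) (≤-reflexive (*-identityʳ (2 * q))))
    small : sum² n Y ≤ M
    small = ≤-trans (≤-reflexive (sum²-cong n Yδ)) (≤-trans (sum-mono n λ i _ → row i)
      (≤-trans (≤-reflexive (sum-const n (2 * q))) (≤-trans (*-monoˡ-≤ (2 * q) n≤q)
        (≤-reflexive (trans (lem₂ q) (cong (2 *_) qq≡H))))))
      where
      lem₂ : ∀ q → q * (2 * q) ≡ 2 * (q * q)
      lem₂ = solve-∀
    open Batch v Y Q Q≤K small
    each : ∀ s t d → sumV (K * b) (λ w → missed (Hub′ w) s t d) ≤ x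
    each s t d with β ≤ᵇ near-size s t d in big
    ... | false = ≤-trans (≤-reflexive (trans (sumV-const (K * b) 0) (*-zeroʳ (2 ^ (K * b))))) z≤n
    ... | true = begin
      sumV (K * b) (λ w → 1 * isz (hits n A (Hub′ w)))
        ≤⟨ sumV-mono (K * b) (λ w → ≤-trans (≤-reflexive (*-identityˡ _)) (≤-trans
             -- For an upper bound it is enough to start from the empty set of hubs.
             (still-missed A (λ _ _ → 0) (Hub′ w) w (λ i j z → contradiction refl z) (λ i i<K i<Q a b′ p t → opened w i i<K i<Q a b′ p t))
             (≤-trans (*-monoˡ-≤ _ (isz≤1 (hits n A (λ _ _ → 0)))) (≤-reflexive (*-identityˡ _))))) ⟩
      sumV (K * b) (λ w → prod< K (λ i → early-avoids Q A Y n i (draw w i)))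
        ≤⟨ batch A ⟩
      M ^ (K ∸ Q) * (M ∸ sum² n (restrict A Y)) ^ Q
        ≤⟨ *-monoʳ-≤ (M ^ (K ∸ Q)) (^-monoˡ-≤ Q (∸-monoʳ-≤ M enough)) ⟩
      M ^ (K ∸ Q) * (M ∸ y) ^ Q ∎
      where
      A = onDiagonal (near s t d)
      opened : ∀ w i → i < K → i < Q → ∀ a b′ → pick Y (cells n n) (draw w i) ≡ just (a , b′) → A a b′ ≡ true → Hub′ w a b′ ≢ 0
      opened w i i<K i<Q a b′ p t with ≡ᵇ⇒≡ a b′ (≡⇒T (proj₁ (∧-split {a ≡ᵇ b′} t)))
      ... | refl = hit w i i<K i<Q a a p
      enough : y ≤ sum² n (restrict A Y)
      enough = begin
        2 * q * β                               ≤⟨ *-monoʳ-≤ (2 * q) (true-≤ᵇ big) ⟩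
        2 * q * near-size s t d                 ≡⟨ sym (sum-* n (2 * q) _) ⟩
        sum< n (λ u → 2 * q * bit (near s t d u)) ≤⟨ sum-mono n (λ u u<n → ≤-trans (≤-reflexive (diagonal u u<n)) (sum-term (restrict A Y u) u<n)) ⟩
        sum² n (restrict A Y)                   ∎
        where
        diagonal : ∀ u → u < n → 2 * q * bit (near s t d u) ≡ restrict A Y u u
        diagonal u u<n rewrite ≡ᵇ-refl u = trans (*-comm (2 * q) (bit (near s t d u))) (cong (bit (near s t d u) *_) (sym (diag u u<n)))

-- The risk is a supermartingale

module Supermartingale (κ : ℕ) {n : ℕ} (G : Digraph n) (1≤n : 1 ≤ n) where

  open Potential κ G 1≤n public

  risk-stuck : ∀ S → memory S stuckCell 0 0 ≢ 0 → risk S ≡ Θ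
  risk-stuck S h = select-≢0 h

  risk-early : ∀ S → memory S stuckCell 0 0 ≡ 0 → memory S phaseCell 0 0 ≡ 0 → risk S ≡ Φ₀
  risk-early S h φ = trans (select-≡0 h) (select-≡0 φ)

  lateRiskOf : State → ℕ
  lateRiskOf S = lateRisk (memory S solutionArray) (memory S weightArray) (memory S hubArray)

  risk-late : ∀ S → memory S stuckCell 0 0 ≡ 0 → memory S phaseCell 0 0 ≢ 0 → risk S ≡ lateRiskOf S
  risk-late S h φ = trans (select-≡0 h) (select-≢0 φ)

  -- When the algorithm gets stuck, the local vertices are either many, but
  -- without a hub, or they form a heavy code avoided by the solution.
  certificate : ∀ {ω r rs S T S₁ S′} → Admissible r → Inv rs S → Round ω r S T S₁ S′ →
    bound′ T < memory T distH (source′ T) (target′ T) → M ≤ sum² n (newWeights T) → Θ ≤ lateRiskOf S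
  certificate {ω} {r} {rs} {S} {T} {S₁} {S′} admissible I R far′ heavy = by-size (β ≤? near-size s t d)
    where
    open Inv I using (inE; serving)
    open OneRound R admissible inE
    Z₀ W₀ Hub₀ : Matrix
    Z₀ = memory S solutionArray
    W₀ = memory S weightArray
    Hub₀ = memory S hubArray
    far : d < DH s t
    far = subst (d <_) (endpoints DH) far′
    Z≡ : ∀ i j → Z i j ≡ Z₀ i j
    Z≡ = T-same solutionArray refl
    A = near s t d
    D≡ : ∀ i j → i < n → j < n → D₀ i j ≡ DG i j
    D≡ i j i<n j<n = ≤-antisym (isDist-unique isDist₀ isDistG i j i<n j<n) (isDist-unique isDistG isDist₀ i j i<n j<n)
    -- A local hub u would give a path from s through u to t in the solution with at most d edges,
    -- contrary to `far`.
    no-hub : hits n (onDiagonal A) Hub₀ ≡ 0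
    no-hub with hits n (onDiagonal A) Hub₀ ≟ 0
    ... | yes z = z
    ... | no ne with hits-elim {n} {onDiagonal A} {Hub₀} ne
    ...   | u , v , u<n , v<n , a , h with ∧-split {u ≡ᵇ v} a
    ...     | e , Au with ≡ᵇ⇒≡ u v (≡⇒T e)
    ...       | refl with serving u h | true-≤ᵇ {D₀ s u + D₀ u t} Au
    ...         | _ , from , to | short with
                    to s (D₀ s u) s<n (IsDist.sound isDist₀ s u s<n u<n (≤-trans (s≤s (≤-trans (m≤m+n _ _) short)) d<n))
                  | from t (D₀ u t) t<n (IsDist.sound isDist₀ u t u<n t<n (≤-trans (s≤s (≤-trans (m≤n+m _ _) short)) d<n))
    ...           | i , i≤ , p | j , j≤ , p′ = contradiction
                      (IsDist.complete isDistH s t (j + i) s<n t<n (≤-trans total (<⇒≤ d<n)) (path-map (λ a b x → x ∘ trans (sym (Z≡ a b))) (p ⧺ p′)))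
                      (<⇒≱ (≤-trans (s≤s total) far))
      where
      total : j + i ≤ d
      total = ≤-trans (+-mono-≤ j≤ i≤) (≤-trans (≤-reflexive (+-comm (D₀ u t) (D₀ s u))) short)
    by-size : Dec (β ≤ near-size s t d) → Θ ≤ lateRiskOf S
    by-size (yes big) = ≤-trans (≤-reflexive (*-comm N₁ (wt M)))
      (≤-trans (*-monoʳ-≤ (wt M) (≤-trans (≤-reflexive (sym (*-identityʳ N₁))) (*-monoʳ-≤ N₁ one≤))) (m≤n+m _ (N₁ * codeRisk Z₀ W₀)))
      where
      one≤ : 1 ≤ hubRisk Hub₀
      one≤ = ≤-trans (≤-reflexive (sym (cong₂ (λ x y → bit x * isz y) (≤ᵇ-true big) no-hub))) (sum³-term (missed Hub₀) s<n t<n d<n)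
    by-size (no small) with encode A (DH s) n β s s<n As (λ v v<n → IsDist.bounded isDistH s v s<n v<n) (<⇒≤ (≰⇒> small))
      where
      -- s is local to its own request because of the edge from s to t and 1 ≤ d, so it can serve as
      -- padding of the code.
      As : A s ≡ true
      As = ≤ᵇ-true (≤-trans (+-mono-≤ (IsDist.complete isDist₀ s s 0 s<n s<n z≤n here) (IsDist.complete isDist₀ s t 1 s<n t<n (<⇒≤ 1<n) (here ▹ proj₁ admissible))) 1≤d)
    ... | x , x∈ , spec = ≤-trans (*-monoʳ-≤ N₁ (≤-trans (wt-mono heavy′ (mass-small x (Inv.weights I)))
          (≤-trans (≤-reflexive (trans (sym (*-identityˡ _)) (cong (λ z → isz z * wt (mass W₀ x)) (sym unhit))))
                   (sumL-∈ (λ x → isz (hits n (jump x) Z₀) * wt (mass W₀ x)) family x∈))))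
        (m≤m+n (N₁ * codeRisk Z₀ W₀) _)
      where
      -- Labels are distances in the solution, which rise by at most 1 along a bought edge.
      unhit : hits n (jump x) Z₀ ≡ 0
      unhit with hits n (jump x) Z₀ ≟ 0
      ... | yes z = z
      ... | no ne with hits-elim {n} {jump x} {Z₀} ne
      ...   | u , v , u<n , v<n , a , z with ∧-split {A u} (trans (sym (spec u v u<n v<n)) a)
      ...     | _ , a′ with ∧-split {A v} a′
      ...       | _ , lt = contradiction (<ᵇ⇒< (suc (DH s u)) (DH s v) (≡⇒T lt))
                    (≤⇒≯ (IsDist.relaxed isDistH s u v s<n u<n v<n (z ∘ trans (sym (Z≡ u v)))))
      heavy′ : M ≤ mass W₀ x
      heavy′ = ≤-trans heavy (sum²-mono n each)
        where
        each : ∀ u v → u < n → v < n → newWeights T u v ≤ bit (jump x u v) * suc (W₀ u v)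
        each u v u<n v<n with jump-cases (memory T graphArray) DG DH W d (source′ T) (target′ T) u v
        ... | inj₁ z = ≤-trans (≤-reflexive z) z≤n
        ... | inj₂ h = ≤-reflexive (trans (jump-weight _ _ _ _ _ _ _ u v h)
              (trans (cong suc (T-same weightArray refl u v)) (sym (trans (cong (λ z → bit z * suc (W₀ u v)) jumps) (*-identityˡ _)))))
          where
          h′ : Jump (memory T graphArray) DG DH W d s t u v
          h′ = subst₂ (λ a b → Jump (memory T graphArray) DG DH W d a b u v) T-source T-target h
          local-near : ∀ z → z < n → DG s z + DG z t ≤ d → A z ≡ true
          local-near z z<n le = ≤ᵇ-true (≤-trans (≤-reflexive (cong₂ _+_ (D≡ s z s<n z<n) (D≡ z t z<n t<n))) le)
          jumps : jump x u v ≡ true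
          jumps = trans (spec u v u<n v<n) (cong₂ _∧_ (local-near u u<n (Jump.local₁ h′))
            (cong₂ _∧_ (local-near v v<n (Jump.local₂ h′)) (T⇒≡ (<⇒<ᵇ (Jump.rise h′)))))

  sumV-bound : ∀ R {f x} → (∀ v → f v ≤ x) → sumV R f ≤ 2 ^ R * x
  sumV-bound R {x = x} h = ≤-trans (sumV-mono R h) (≤-reflexive (sumV-const R x))

  -- Deciding tosses no coins. Given the earlier coins `v`, the response is therefore the same for
  -- all continuations `w`, and only the purchases have to be averaged.
  round-risk : ∀ {r rs S R} (v : Vec Bool R) → tossed S ≡ R → Admissible r → Inv rs S →
    sumV (K * b) (λ w → risk (afterRound (ext (v ++ᵛ w)) r S)) ≤ 2 ^ (K * b) * risk S
  round-risk {r} {rs} {S} {R} v tossed≡ admissible I = by-stuck (memory S stuckCell 0 0 ≟ 0)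
    where
    open Inv I using (order; graph; inE; weights; early)
    ω₀ = ext v
    ω : Vec Bool (K * b) → Coins
    ω w = ext (v ++ᵛ w)
    T₀ S₁ : State
    T₀ = run ω₀ (block prepare) (start′ ω₀ r S)
    S₁ = decided ω₀ r S
    after′ : Vec Bool (K * b) → State
    after′ w = afterRound (ω w) r S
    start≡ : ∀ w → start′ (ω w) r S ≡ start′ ω₀ r S
    start≡ w = run-cong R (ext-++ˡ v w) (block (parameters c)) (receive r S)
      (≤-reflexive (trans (coinless-tossed (ω w) (block (parameters c)) parameters-coinless (receive r S)) tossed≡))
    coinless-same : ∀ p → coinless p ≡ true → ∀ w → run (ω w) p (start′ (ω w) r S) ≡ run ω₀ p (start′ ω₀ r S)
    coinless-same p h w = trans
      (run-cong R (ext-++ˡ v w) p (start′ (ω w) r S) (≤-reflexive (trans (coinless-tossed (ω w) p h (start′ (ω w) r S))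
        (trans (coinless-tossed (ω w) (block (parameters c)) parameters-coinless (receive r S)) tossed≡))))
      (cong (run ω₀ p) (start≡ w))
    rounds : ∀ w → Round (ω w) r S T₀ S₁ (after′ w)
    rounds w = subst₂ (λ x y → Round (ω w) r S x y (after′ w)) (coinless-same (block prepare) refl w) (coinless-same (block decide) refl w)
      (round-spec (ω w) r S order graph inE)
    round₀ : Round ω₀ r S T₀ S₁ (afterRound ω₀ r S)
    round₀ = round-spec ω₀ r S order graph inE
    module O = OneRound round₀ admissible inE
    Z₀ W₀ Hub₀ : Matrix
    Z₀ = memory S solutionArray
    W₀ = memory S weightArray
    Hub₀ = memory S hubArray

    stuck′ : ∀ w → memory (after′ w) stuckCell 0 0 ≡ memory S₁ stuckCell 0 0
    stuck′ w = proj₂ (proj₂ (proj₂ (Round.after (rounds w)))) 0 0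
    phase′ : ∀ w → memory (after′ w) phaseCell 0 0 ≡ memory S₁ phaseCell 0 0
    phase′ w = proj₁ (proj₂ (Round.after (rounds w))) 0 0
    weight′ : ∀ w → Same weightArray S₁ (after′ w)
    weight′ w = proj₁ (Round.after (rounds w))
    T-stuck : memory T₀ stuckCell 0 0 ≡ memory S stuckCell 0 0
    T-stuck = Round.T-same round₀ stuckCell refl 0 0
    T-phase : memory T₀ phaseCell 0 0 ≡ memory S phaseCell 0 0
    T-phase = Round.T-same round₀ phaseCell refl 0 0
    T-weight : ∀ i j → memory T₀ weightArray i j ≡ W₀ i j
    T-weight = Round.T-same round₀ weightArray refl
    T-sol : ∀ i j → memory T₀ solutionArray i j ≡ Z₀ i j
    T-sol = Round.T-same round₀ solutionArray refl
    hub₁ : ∀ i j → memory S₁ hubArray i j ≡ Hub₀ i j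
    hub₁ i j = trans (Round.hub₁ round₀ i j) (Round.T-same round₀ hubArray refl i j)

    late-anti : ∀ {S′} → (∀ i j → Z₀ i j ≢ 0 → memory S′ solutionArray i j ≢ 0) → (∀ i j → memory S′ weightArray i j ≡ W₀ i j) →
      (∀ w → Hub₀ w w ≢ 0 → memory S′ hubArray w w ≢ 0) → lateRiskOf S′ ≤ lateRiskOf S
    late-anti z w h = +-mono-≤ (*-monoʳ-≤ N₁ (codeRisk-mono z w)) (*-monoʳ-≤ (wt M) (*-monoʳ-≤ N₁ (hubRisk-mono h)))

    by-response : memory S stuckCell 0 0 ≡ 0 → Response n T₀ S₁ → sumV (K * b) (λ w → risk (after′ w)) ≤ 2 ^ (K * b) * risk S
    by-response st0 (satisfied _ sol wt′ ph _ st lim) = sumV-bound (K * b) each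
      where
      st″ : ∀ w → memory (after′ w) stuckCell 0 0 ≡ 0
      st″ w = trans (stuck′ w) (trans (st 0 0) (trans T-stuck st0))
      ph″ : ∀ w → memory (after′ w) phaseCell 0 0 ≡ memory S phaseCell 0 0
      ph″ w = trans (phase′ w) (trans (ph 0 0) T-phase)
      each : ∀ w → risk (after′ w) ≤ risk S
      each w = by-phase w (memory S phaseCell 0 0 ≟ 0)
        where
        by-phase : ∀ w → Dec (memory S phaseCell 0 0 ≡ 0) → risk (after′ w) ≤ risk S
        by-phase w (yes φ0) = ≤-reflexive (trans (risk-early (after′ w) (st″ w) (trans (ph″ w) φ0)) (sym (risk-early S st0 φ0)))
        by-phase w (no φ1) = ≤-trans (≤-reflexive (risk-late (after′ w) (st″ w) (φ1 ∘ trans (sym (ph″ w)))))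
          (≤-trans (late-anti {after′ w}
              (λ i j h → h ∘ trans (sym (trans (proj₁ (Round.idle (rounds w) lim) i j) (trans (sol i j) (T-sol i j)))))
              (λ i j → trans (weight′ w i j) (trans (wt′ i j) (T-weight i j)))
              (λ u h → h ∘ trans (sym (trans (proj₂ (Round.idle (rounds w) lim) u u) (hub₁ u u)))))
            (≤-reflexive (sym (risk-late S st0 φ1))))
    by-response st0 (direct _ _ φ0 _ _ ph _ st _) = sumV-bound (K * b) λ w → ≤-reflexive (trans
      (risk-early (after′ w) (trans (stuck′ w) (trans (st 0 0) (trans T-stuck st0))) (trans (phase′ w) (trans (ph 0 0) φ0)))
      (sym (risk-early S st0 (trans (sym T-phase) φ0))))
    -- The risk becomes `Θ`, a value that by `certificate` it had reached already.
    by-response st0 (stuck far _ φ1 heavy _ _ st1 _) = sumV-bound (K * b) λ w → ≤-trans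
      (≤-reflexive (risk-stuck (after′ w) (λ z → contradiction (trans (sym st1) (trans (sym (stuck′ w)) z)) λ ())))
      (≤-trans (certificate admissible I round₀ far (≤-trans (≤-reflexive (sym (Round.T-par round₀ 5 refl))) heavy))
        (≤-reflexive (sym (risk-late S st0 (φ1 ∘ trans T-phase)))))
    -- Whatever is drawn, the code risk is bounded through n² ≤ H, all weights being 1; only the hub
    -- risk is averaged.
    by-response st0 (hubs far bought φ0 large wt′ φ1 st mode lim diag off) = begin
      sumV (K * b) (λ w → risk (after′ w))
        ≤⟨ sumV-mono (K * b) each ⟩
      sumV (K * b) (λ w → length family * N₁ * wt H + wt M * (N₁ * hubRisk (memory (after′ w) hubArray)))
        ≡⟨ trans (sumV-+ (K * b) _ _) (cong₂ _+_ (sumV-const (K * b) _) (sumV-* (K * b) (wt M) _)) ⟩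
      2 ^ (K * b) * (length family * N₁ * wt H) + wt M * sumV (K * b) (λ w → N₁ * hubRisk (memory (after′ w) hubArray))
        ≤⟨ +-monoʳ-≤ (2 ^ (K * b) * (length family * N₁ * wt H)) (*-monoʳ-≤ (wt M) (hub-risk v (memory S₁ candidates) (λ w → memory (after′ w) hubArray)
             (λ i i<n → trans (diag i i<n) (Round.T-par round₀ 7 refl)) off opened)) ⟩
      2 ^ (K * b) * (length family * N₁ * wt H) + wt M * 2 ^ (K * b)
        ≡⟨ trans (cong (2 ^ (K * b) * (length family * N₁ * wt H) +_) (*-comm (wt M) _)) (sym (*-distribˡ-+ (2 ^ (K * b)) _ (wt M))) ⟩
      2 ^ (K * b) * Φ₀
        ≡⟨ cong (2 ^ (K * b) *_) (sym (risk-early S st0 (trans (sym T-phase) φ0))) ⟩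
      2 ^ (K * b) * risk S ∎
      where
      open ≤-Reasoning
      W0 : ∀ i j → W₀ i j ≡ 0
      W0 = proj₁ (early (trans (sym T-phase) φ0))
      opened : ∀ w i → i < K → i < Q → ∀ a b′ → pick (memory S₁ candidates) (cells n n) (drawn (ext (v ++ᵛ w)) R b K i) ≡ just (a , b′) → memory (after′ w) hubArray a a ≢ 0
      opened w i i<K i<Q a b′ p = proj₂ (Round.active (rounds w) 1 mode (λ ())) i i<K
        (≤-trans i<Q (≤-reflexive (sym (trans lim (Round.T-par round₀ 4 refl))))) a b′
        (subst (λ o → pick (memory S₁ candidates) (cells n n) (drawn (ω w) o b K i) ≡ just (a , b′)) (sym tossed≡) p)
      code≤ : ∀ w → codeRisk (memory (after′ w) solutionArray) (memory (after′ w) weightArray) ≤ length family * wt H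
      code≤ w = sumL-bound (wt H) family λ x → ≤-trans (*-monoˡ-≤ _ (isz≤1 (hits n (jump x) (memory (after′ w) solutionArray))))
        (≤-trans (≤-reflexive (*-identityˡ _)) (wt-mono (light x) (≤-trans (m≤m+n H H) (≤-trans (≤-reflexive 2H≡M) M≤T∞))))
        where
        light : ∀ x → mass (memory (after′ w) weightArray) x ≤ H
        light x = ≤-trans (restrict-≤ n (jump x) (λ i j → suc (memory (after′ w) weightArray i j)))
          (≤-trans (≤-reflexive (sum²-cong n λ i j _ _ → cong suc (trans (weight′ w i j) (trans (wt′ i j) (trans (T-weight i j) (W0 i j))))))
            (≤-trans (≤-reflexive (trans (sum²-const n 1) (*-identityʳ (n * n)))) n*n≤H))
      each : ∀ w → risk (after′ w) ≤ length family * N₁ * wt H + wt M * (N₁ * hubRisk (memory (after′ w) hubArray))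
      each w = ≤-trans (≤-reflexive (risk-late (after′ w) (trans (stuck′ w) (trans (st 0 0) (trans T-stuck st0)))
            (λ z → contradiction (trans (sym φ1) (trans (sym (phase′ w)) z)) λ ())))
        (+-monoˡ-≤ _ (≤-trans (*-monoʳ-≤ N₁ (code≤ w)) (≤-reflexive (lem N₁ (length family) (wt H)))))
        where
        lem : ∀ a f h → a * (f * h) ≡ f * a * h
        lem = solve-∀
    -- Hubs do not disappear, so their term cannot grow; the code term is averaged.
    by-response st0 (update far bought φ1 small Y≡ raised out-same ph st mode lim) = begin
      sumV (K * b) (λ w → risk (after′ w))
        ≤⟨ sumV-mono (K * b) each ⟩
      sumV (K * b) (λ w → N₁ * codeRisk (memory (after′ w) solutionArray) W₁ + wt M * (N₁ * hubRisk Hub₀))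
        ≡⟨ trans (sumV-+ (K * b) _ _) (cong₂ _+_ (sumV-* (K * b) N₁ _) (sumV-const (K * b) _)) ⟩
      N₁ * sumV (K * b) (λ w → codeRisk (memory (after′ w) solutionArray) W₁) + 2 ^ (K * b) * (wt M * (N₁ * hubRisk Hub₀))
        ≤⟨ +-monoˡ-≤ _ (*-monoʳ-≤ N₁ (update-risk v Y Z₀ W₀ W₁ (λ w → memory (after′ w) solutionArray) small′ raised′ bounded′ grow hit)) ⟩
      N₁ * (2 ^ (K * b) * codeRisk Z₀ W₀) + 2 ^ (K * b) * (wt M * (N₁ * hubRisk Hub₀))
        ≡⟨ lem N₁ (2 ^ (K * b)) (codeRisk Z₀ W₀) _ ⟩
      2 ^ (K * b) * lateRiskOf S
        ≡⟨ cong (2 ^ (K * b) *_) (sym (risk-late S st0 φS)) ⟩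
      2 ^ (K * b) * risk S ∎
      where
      open ≤-Reasoning
      lem : ∀ a p x y → a * (p * x) + p * y ≡ p * (a * x + y)
      lem = solve-∀
      Y W₁ : Matrix
      Y = memory S₁ candidates
      W₁ = memory S₁ weightArray
      φS : memory S phaseCell 0 0 ≢ 0
      φS = φ1 ∘ trans T-phase
      small′ : sum² n Y ≤ M
      small′ = <⇒≤ (≤-trans small (≤-reflexive (Round.T-par round₀ 5 refl)))
      raised′ : ∀ i j → i < n → j < n → W₁ i j ≡ W₀ i j + Y i j
      raised′ i j i<n j<n = trans (raised i j i<n j<n) (cong (_+ Y i j) (T-weight i j))
      inv₀ : Inv (r ∷ rs) (afterRound ω₀ r S)
      inv₀ = step admissible I round₀
      bounded′ : ∀ i j → W₁ i j < M + M
      bounded′ i j = subst (_< M + M) (proj₁ (Round.after round₀) i j) (Inv.weights inv₀ i j)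
      allowed : 0 ≡ 0 → ∀ i j → i < n → j < n → Y i j ≢ 0 → E i j ≢ 0
      allowed _ i j i<n j<n y = by-jump (jump-cases (memory T₀ graphArray) (memory T₀ distG) (memory T₀ distH) (memory T₀ weightArray) (bound′ T₀) (source′ T₀) (target′ T₀) i j)
        where
        by-jump : newWeights T₀ i j ≡ 0 ⊎ Jump (memory T₀ graphArray) (memory T₀ distG) (memory T₀ distH) (memory T₀ weightArray) (bound′ T₀) (source′ T₀) (target′ T₀) i j → E i j ≢ 0
        by-jump (inj₁ z) = contradiction (trans (Y≡ i j i<n j<n) z) y
        by-jump (inj₂ h) = Jump.edge h ∘ trans (Round.T-graph round₀ i j)
      outcome : ∀ w → Outcome (ω w) n E (memory T₀ distG) Y 0 (memory S₁ limitCell 0 0 * 1) S₁ (after′ w)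
      outcome w = proj₁ (Round.active (rounds w) 0 mode allowed)
      grow : ∀ w i j → Z₀ i j ≢ 0 → memory (after′ w) solutionArray i j ≢ 0
      grow w i j h = outcome w .buys .grows i j (O.Far.grows₁ far bought i j (h ∘ trans (sym (T-sol i j))))
      hit : ∀ w i → i < K → ∀ a b′ → pick Y (cells n n) (drawn (ext (v ++ᵛ w)) R b K i) ≡ just (a , b′) → memory (after′ w) solutionArray a b′ ≢ 0
      hit w i i<K a b′ p = proj₂ (Round.active (rounds w) 0 mode allowed) i i<K
        (≤-trans i<K (≤-reflexive (sym (trans lim (Round.T-par round₀ 2 refl))))) a b′
        (subst (λ o → pick Y (cells n n) (drawn (ω w) o b K i) ≡ just (a , b′)) (sym tossed≡) p)
      each : ∀ w → risk (after′ w) ≤ N₁ * codeRisk (memory (after′ w) solutionArray) W₁ + wt M * (N₁ * hubRisk Hub₀)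
      each w = ≤-trans (≤-reflexive (risk-late (after′ w) (trans (stuck′ w) (trans (st 0 0) (trans T-stuck st0))) (λ z → φ1 (trans (sym (ph 0 0)) (trans (sym (phase′ w)) z)))))
        (+-mono-≤ (*-monoʳ-≤ N₁ (codeRisk-mono (λ _ _ h → h) (weight′ w)))
          (*-monoʳ-≤ (wt M) (*-monoʳ-≤ N₁ (hubRisk-mono λ u h → outcome w .hubGrow u (h ∘ trans (sym (hub₁ u u)))))))

    by-stuck : Dec (memory S stuckCell 0 0 ≡ 0) → sumV (K * b) (λ w → risk (after′ w)) ≤ 2 ^ (K * b) * risk S
    by-stuck (yes st0) = by-response st0 (Round.response round₀)
    by-stuck (no st1)  = sumV-bound (K * b) λ w → ≤-reflexive (trans
      (risk-stuck (after′ w) (stuck-stays (Round.response round₀) (st1 ∘ trans (sym T-stuck)) ∘ trans (sym (stuck′ w))))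
      (sym (risk-stuck S st1)))

-- Edge sets as matrices

mat : ∀ n → EdgeSet n → Matrix
mat n F i j with i <? n | j <? n
... | yes i<n | yes j<n = bit (lookup F (combine (fromℕ< i<n) (fromℕ< j<n)))
... | _       | _       = 0

adjacency≡mat : ∀ {n} (G : Digraph n) i j → adjacency G i j ≡ mat n (edges G) i j
adjacency≡mat {n} G i j with i <? n | j <? n
... | yes _ | yes _ = refl
... | yes _ | no _  = refl
... | no _  | _     = refl

mat-intro : ∀ {n} {F : EdgeSet n} {u v : Fin n} → u ⟶ v ∈ F → mat n F (toℕ u) (toℕ v) ≢ 0
mat-intro {n} {F} {u} {v} e with toℕ u <? n | toℕ v <? n
... | no ¬p | _     = contradiction (toℕ<n u) ¬p
... | yes _ | no ¬p = contradiction (toℕ<n v) ¬p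
... | yes p | yes q rewrite fromℕ<-toℕ u p | fromℕ<-toℕ v q | []=⇒lookup e = λ ()

mat-elim : ∀ {n} {F : EdgeSet n} i j → mat n F i j ≢ 0 → ∃[ u ] ∃[ v ] toℕ {n} u ≡ i × toℕ v ≡ j × u ⟶ v ∈ F
mat-elim {n} {F} i j h with i <? n | j <? n
... | no _  | _    = contradiction refl h
... | yes _ | no _ = contradiction refl h
... | yes p | yes q with lookup F (combine (fromℕ< p) (fromℕ< q)) in eq
...   | true  = fromℕ< p , fromℕ< q , toℕ-fromℕ< p , toℕ-fromℕ< q , lookup⇒[]= _ F eq
...   | false = contradiction refl h

mat-toℕ : ∀ {n} {F : EdgeSet n} (u v : Fin n) → mat n F (toℕ u) (toℕ v) ≢ 0 → u ⟶ v ∈ F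
mat-toℕ {n} {F} u v h with mat-elim {n} {F} (toℕ u) (toℕ v) h
... | u′ , v′ , e , e′ , x with toℕ-injective e | toℕ-injective e′
...   | refl | refl = x

-- The characteristic function continued by 0, so that a cardinality becomes a `sum<`, which can be
-- cut into n blocks of length n.
digit : ∀ {m} → Vec Bool m → ℕ → ℕ
digit Vec.[]      _       = 0
digit (x Vec.∷ v) zero    = bit x
digit (x Vec.∷ v) (suc i) = digit v i

digit-lookup : ∀ {m} (p : Vec Bool m) i → digit p (toℕ i) ≡ bit (lookup p i)
digit-lookup (x Vec.∷ p) Fin.zero    = refl
digit-lookup (x Vec.∷ p) (Fin.suc i) = digit-lookup p i

sum-front : ∀ m f → sum< (suc m) f ≡ f 0 + sum< m (f ∘ suc)
sum-front zero    f = refl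
sum-front (suc m) f = trans (cong (f (suc m) +_) (sum-front m f)) (lem (f (suc m)) (f 0) _)
  where
  lem : ∀ a b c → a + (b + c) ≡ b + (a + c)
  lem = solve-∀

card-digits : ∀ {m} (p : Subset m) → ∣ p ∣ ≡ sum< m (digit p)
card-digits Vec.[] = refl
card-digits {suc m} (true Vec.∷ p)  = trans (cong suc (card-digits p)) (sym (sum-front m (digit (true Vec.∷ p))))
card-digits {suc m} (false Vec.∷ p) = trans (card-digits p) (sym (sum-front m (digit (false Vec.∷ p))))

sum-blocks : ∀ k m f → sum< (k * m) f ≡ sum< k (λ i → sum< m (λ j → f (m * i + j)))
sum-blocks zero    m f = refl
sum-blocks (suc k) m f = trans (sum-split m (k * m) f)
  (cong₂ _+_ (sum-cong m λ j _ → cong (λ x → f (x + j)) (*-comm k m)) (sum-blocks k m f))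

card≡count : ∀ {n} (F : EdgeSet n) → ∣ F ∣ ≡ count n (mat n F)
card≡count {n} F = trans (card-digits F) (trans (sum-blocks n n (digit F)) (sum²-cong n entry))
  where
  nz-bit : ∀ x → bit x ≡ nz (bit x)
  nz-bit true  = refl
  nz-bit false = refl
  entry : ∀ i j → i < n → j < n → digit F (n * i + j) ≡ nz (mat n F i j)
  entry i j i<n j<n with i <? n | j <? n
  ... | no ¬p | _     = contradiction i<n ¬p
  ... | yes _ | no ¬p = contradiction j<n ¬p
  ... | yes p | yes q = trans (cong (digit F) (sym (trans (toℕ-combine (fromℕ< p) (fromℕ< q))
            (cong₂ (λ a b → n * a + b) (toℕ-fromℕ< p) (toℕ-fromℕ< q)))))
          (trans (digit-lookup F (combine (fromℕ< p) (fromℕ< q))) (nz-bit (lookup F _)))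

-- Walks and their lengths

module _ {n : ℕ} {F : EdgeSet n} where

  steps : ∀ {s t} → Walk {n} F s t → ℕ
  steps ε       = 0
  steps (_ ◅ p) = suc (steps p)

  steps-◅◅ : ∀ {s t u} (p : Walk {n} F s t) (q : Walk {n} F t u) → steps (p ◅◅ q) ≡ steps p + steps q
  steps-◅◅ ε       q = refl
  steps-◅◅ (_ ◅ p) q = cong suc (steps-◅◅ p q)

  walk⇒path : ∀ {s t} (p : Walk {n} F s t) → Path (mat n F) (steps p) (toℕ s) (toℕ t)
  walk⇒path ε       = here
  walk⇒path (e ◅ p) = cons (mat-intro {n} {F} e) (walk⇒path p)

  path⇒walk : ∀ {s k i j} → toℕ s ≡ i → Path (mat n F) k i j → ∃[ t ] toℕ t ≡ j × Σ (Walk {n} F s t) λ p → steps p ≡ k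
  path⇒walk {s} s≡ here = s , s≡ , ε , refl
  path⇒walk s≡ (_▹_ {v = v} {w = w} p e) with path⇒walk s≡ p | mat-elim {n} {F} v w e
  ... | t , t≡ , q , len | u , u′ , u≡ , u′≡ , x with toℕ-injective (trans t≡ (sym u≡))
  ...   | refl = u′ , u′≡ , q ◅◅ (x ◅ ε) , trans (steps-◅◅ q (x ◅ ε)) (trans (+-comm (steps q) 1) (cong suc len))

  -- Among unnormalised rationals addition computes without reducing fractions.
  walkLength≃ : ∀ {s t} (p : Walk {n} F s t) → toℚᵘ (walkLength uniform p) ℚᵘ.≃ ℚᵘ.mkℚᵘ (ℤ.+ steps p) 0
  walkLength≃ ε       = ℚᵘ.≃-refl
  walkLength≃ (_ ◅ p) = ℚᵘ.≃-trans (ℚ.toℚᵘ-homo-+ 1ℚ (walkLength uniform p))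
    (ℚᵘ.≃-trans (ℚᵘ.+-cong (ℚᵘ.≃-refl {toℚᵘ 1ℚ}) (walkLength≃ p))
      (ℚᵘ.*≡* (cong (ℤ._* ℤ.+ 1) (cong (λ z → ℤ.+ 1 ℤ.+ z) (ℤ.*-identityʳ (ℤ.+ steps p))))))

  -- A walk within the bound also shows that the bound is nonnegative, so the absolute value handed
  -- to the machine as its numerator loses nothing.
  short⇒steps : ∀ {s t} (p : Walk {n} F s t) (q : ℚ) → walkLength uniform p ℚ.≤ q →
    ∃[ m ] (↥ q ≡ ℤ.+ m) × steps p * ↧ₙ q ≤ m
  short⇒steps p q@(mkℚ (ℤ.+ m) d _) h with ℚᵘ.≤-respˡ-≃ (walkLength≃ p) (ℚ.toℚᵘ-mono-≤ h)
  ... | ℚᵘ.*≤* le = m , refl , ℤ.drop‿+≤+ (subst₂ ℤ._≤_ (sym (ℤ.pos-* (steps p) (suc d))) (ℤ.*-identityʳ (ℤ.+ m)) le)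
  short⇒steps p q@(mkℚ ℤ.-[1+ m ] d _) h with ℚᵘ.≤-respˡ-≃ (walkLength≃ p) (ℚ.toℚᵘ-mono-≤ h)
  ... | ℚᵘ.*≤* le with subst₂ ℤ._≤_ (sym (ℤ.pos-* (steps p) (suc d))) (ℤ.*-identityʳ ℤ.-[1+ m ]) le
  ...   | ()

  steps⇒short : ∀ {s t} (p : Walk {n} F s t) (q : ℚ) m → ↥ q ≡ ℤ.+ m → steps p * ↧ₙ q ≤ m → walkLength uniform p ℚ.≤ q
  steps⇒short p q@(mkℚ _ d _) m refl h = ℚ.toℚᵘ-cancel-≤ (ℚᵘ.≤-respˡ-≃ (ℚᵘ.≃-sym (walkLength≃ p))
    (ℚᵘ.*≤* (subst₂ ℤ._≤_ (ℤ.pos-* (steps p) (suc d)) (sym (ℤ.*-identityʳ (ℤ.+ m))) (ℤ.+≤+ h))))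

-- Executions of the algorithm

onlineProgram : ℕ → Prog
onlineProgram c = block (parameters c) ⟫ main

module Runs (c : ℕ) {n : ℕ} (G : Digraph n) where

  open Preservation c G public

  nonnegative : ∀ {r} → Legal G r → ∃[ m ] (↥ bound r) ≡ ℤ.+ m
  nonnegative {r} ((p , le) , _) with short⇒steps {n} {edges G} p (bound r) le
  ... | m , e , _ = m , e

  edge⇒E : ∀ {u v} → u ⟶ v ∈ edges G → E (toℕ u) (toℕ v) ≢ 0
  edge⇒E {u} {v} e = mat-intro {n} {edges G} e ∘ trans (sym (adjacency≡mat G (toℕ u) (toℕ v)))

  -- G has no loops, so the endpoints differ and any walk between them has an edge. A bound that
  -- some walk meets is hence at least 1.
  admissible : ∀ {r} → Legal G r → Admissible r
  admissible {r} ((p , le) , e) = edge⇒E e , distinct , den≤num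
    where
    distinct : toℕ (source r) ≢ toℕ (target r)
    distinct eq = loopless G (source r) (subst (λ t → source r ⟶ t ∈ edges G) (sym (toℕ-injective eq)) e)
    nontrivial : ∀ {s t} (p : Walk {n} (edges G) s t) → toℕ s ≢ toℕ t → 1 ≤ steps {n} {edges G} p
    nontrivial ε       ne = contradiction refl ne
    nontrivial (_ ◅ _) ne = s≤s z≤n
    den≤num : den r ≤ num r
    den≤num with short⇒steps {n} {edges G} p (bound r) le
    ... | m , eq , h = ≤-trans (≤-trans (≤-reflexive (sym (*-identityˡ (den r)))) (*-monoˡ-≤ (den r) (nontrivial p distinct)))
                         (≤-trans h (≤-reflexive (sym (cong abs eq))))

  all-admissible : ∀ {rs} → All (Legal G) rs → All Admissible rs
  all-admissible []       = []
  all-admissible (x ∷ xs) = admissible x ∷ all-admissible xs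

  competitor : ∀ {rs F} → F ⊆ edges G → Feasible uniform F rs → Competitor rs (mat n F)
  competitor {rs} {F} sub feasible = inside′ , satisfied′ feasible
    where
    inside′ : ∀ u v → mat n F u v ≢ 0 → E u v ≢ 0
    inside′ i j h with mat-elim {n} {F} i j h
    ... | u , v , refl , refl , e = edge⇒E (sub e)
    satisfied′ : ∀ {rs} → Feasible uniform F rs → All (NumSat (mat n F)) rs
    satisfied′ [] = []
    satisfied′ {r ∷ _} ((p , le) ∷ ps) with short⇒steps {n} {F} p (bound r) le
    ... | m , eq , h = (steps {n} {F} p , walk⇒path p , ≤-trans h (≤-reflexive (sym (cong abs eq)))) ∷ satisfied′ ps

  stateAfter : Coins → List (Request n) → State
  stateAfter ω []       = state (initialMemory G) 0
  stateAfter ω (r ∷ rs) = afterRound ω r (stateAfter ω rs)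

  coinsFor : List (Request n) → ℕ
  coinsFor []       = 0
  coinsFor (_ ∷ rs) = coinsFor rs + K * b

  initially : Inv [] (state (initialMemory G) 0)
  initially = record
    { order = refl ; graph = λ _ _ → refl ; inE = λ _ _ h → contradiction refl h
    ; weights = λ _ _ → ≤-trans (m^n>0 64 l) (≤-trans (m≤m+n (64 ^ l) _) (m≤m+n M M))
    ; serving = λ _ h → contradiction refl h
    ; solved = []
    ; early = λ _ → (λ _ _ → refl) , refl , trans (sum²-const n 0) (*-zeroʳ (n * n)) , z≤n , λ _ _ _ _ h → contradiction refl h
    ; late = λ h → contradiction refl h
    }

  invariant : ∀ ω {rs} → All Admissible rs → Inv rs (stateAfter ω rs)
  theRound : ∀ ω {r rs} → All Admissible (r ∷ rs) → let S = stateAfter ω rs in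
    Round ω r S (run ω (block prepare) (start′ ω r S)) (decided ω r S) (afterRound ω r S)

  invariant ω []       = initially
  invariant ω (a ∷ as) = step a (invariant ω as) (theRound ω (a ∷ as))
  theRound ω {r} {rs} (_ ∷ as) = round-spec ω r (stateAfter ω rs) (Inv.order I) (Inv.graph I) (Inv.inE I)
    where I = invariant ω as

  tossed-after : ∀ ω {rs} → All Admissible rs → tossed (stateAfter ω rs) ≡ coinsFor rs
  tossed-after ω []                 = refl
  tossed-after ω {r ∷ rs} (a ∷ as) = trans (Round.tossed′ (theRound ω (a ∷ as))) (cong (_+ K * b) (tossed-after ω as))

  stateAfter-cong : ∀ {ω ω′ rs} → All Admissible rs → (∀ k → k < coinsFor rs → ω k ≡ ω′ k) → stateAfter ω rs ≡ stateAfter ω′ rs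
  stateAfter-cong []                          h = refl
  stateAfter-cong {ω} {ω′} {r ∷ rs} (a ∷ as) h = trans
    (run-cong (coinsFor (r ∷ rs)) h (onlineProgram c) (receive r (stateAfter ω rs)) (≤-reflexive (tossed-after ω (a ∷ as))))
    (cong (λ S → afterRound ω′ r S) (stateAfter-cong as λ k k< → h k (≤-trans k< (m≤m+n _ _))))

  stuck-mono : ∀ ω {r rs} → All Admissible (r ∷ rs) → memory (stateAfter ω (r ∷ rs)) stuckCell 0 0 ≡ 0 → memory (stateAfter ω rs) stuckCell 0 0 ≡ 0
  stuck-mono ω {r} {rs} as z with memory (stateAfter ω rs) stuckCell 0 0 ≟ 0
  ... | yes e = e
  ... | no ne = contradiction (trans (sym (proj₂ (proj₂ (proj₂ (Round.after R))) 0 0)) z)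
                  (stuck-stays (Round.response R) (ne ∘ trans (sym (Round.T-same R stuckCell refl 0 0))))
    where R = theRound ω as

  grows-round : ∀ ω {r rs} → All Admissible (r ∷ rs) → ∀ i j →
    memory (stateAfter ω rs) solutionArray i j ≢ 0 → memory (stateAfter ω (r ∷ rs)) solutionArray i j ≢ 0
  grows-round ω {r} {rs} (a ∷ as) i j h = grows-in-round (theRound ω (a ∷ as)) a (invariant ω as) i j h

  module Execute where

    regular-parameters : regular orderArray 1 (block (parameters c)) ≡ true
    regular-parameters = cong₂ _∧_ (smallest-regular c) growing-regular
      where
      growing-regular : regular orderArray 1 (loop 20 orderArray 0 (growIfSmall c)) ≡ true
      growing-regular = refl

    -- Two bounds, since the loops that compute the parameters are governed by n, those of `main` by
    -- the parameters.
    one-round : ∀ ω (r : Request n) S → ∃[ t ] (ω ⊢⟨ ⟦ onlineProgram c ⟧ , receive r S ⟩⇓[ t ] afterRound ω r S) ×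
      (∀ B B′ → Bounded orderArray 1 B (receive r S) → Bounded parArray 4 B′ (start′ ω r S) →
         t ≤ size (block (parameters c)) B + size main B′)
    one-round ω r S = proj₁ first + proj₁ second , ⇓seq (proj₁ (proj₂ first)) (proj₁ (proj₂ second)) ,
      λ B B′ h h′ → +-mono-≤ (proj₂ (proj₂ first) B h) (proj₂ (proj₂ second) B′ h′)
      where
      first : Halts ω orderArray 1 ⟦ block (parameters c) ⟧ (receive r S) (start′ ω r S) (size (block (parameters c)))
      first = halts ω orderArray 1 (block (parameters c)) regular-parameters (receive r S)
      second : Halts ω parArray 4 ⟦ main ⟧ (start′ ω r S) (afterRound ω r S) (size main)
      second = halts ω parArray 4 main refl (start′ ω r S)

    Represents : EdgeSet n → State → Set
    Represents F S = ∀ (u v : Fin n) → (u ⟶ v ∈ F → memory S solutionArray (toℕ u) (toℕ v) ≢ 0) × (memory S solutionArray (toℕ u) (toℕ v) ≢ 0 → u ⟶ v ∈ F)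

    test-≢0 : ∀ x → not (x ≡ᵇ 0) ≡ true → x ≢ 0
    test-≢0 (suc x) _ = λ ()

    ≢0-test : ∀ x → x ≢ 0 → not (x ≡ᵇ 0) ≡ true
    ≢0-test zero    h = contradiction refl h
    ≢0-test (suc x) _ = refl

    marks : State → Fin (n * n) → Bool
    marks S e = not (memory S solutionArray (toℕ (proj₁ (remQuot {n} n e))) (toℕ (proj₂ (remQuot {n} n e))) ≡ᵇ 0)

    marks-combine : ∀ S u v → lookup (tabulate (marks S)) (combine u v) ≡ not (memory S solutionArray (toℕ u) (toℕ v) ≡ᵇ 0)
    marks-combine S u v = trans (lookup∘tabulate (marks S) (combine u v))
      (cong (λ p → not (memory S solutionArray (toℕ (proj₁ p)) (toℕ (proj₂ p)) ≡ᵇ 0)) (remQuot-combine u v))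

    represents-round : ∀ {ω r rs F} → All (Legal G) (r ∷ rs) → Represents F (stateAfter ω rs) →
      Represents (F ∪ marked G (stateAfter ω (r ∷ rs))) (stateAfter ω (r ∷ rs))
    represents-round {ω} {r} {rs} {F} legal rep u v = from , to
      where
      S′ = stateAfter ω (r ∷ rs)
      ads = all-admissible legal
      from : u ⟶ v ∈ (F ∪ marked G S′) → memory S′ solutionArray (toℕ u) (toℕ v) ≢ 0
      from e = by-cases (x∈p∪q⁻ F (marked G S′) e)
        where
        by-cases : u ⟶ v ∈ F ⊎ u ⟶ v ∈ marked G S′ → memory S′ solutionArray (toℕ u) (toℕ v) ≢ 0
        by-cases (inj₁ old) = grows-round ω ads (toℕ u) (toℕ v) (proj₁ (rep u v) old)
        by-cases (inj₂ new) = test-≢0 _ (trans (sym (marks-combine S′ u v)) ([]=⇒lookup (proj₂ (x∈p∩q⁻ (edges G) (tabulate (marks S′)) new))))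
      to : memory S′ solutionArray (toℕ u) (toℕ v) ≢ 0 → u ⟶ v ∈ (F ∪ marked G S′)
      to h = x∈p∪q⁺ {p = F} (inj₂ (x∈p∩q⁺ (edge , lookup⇒[]= (combine u v) (tabulate (marks S′)) (trans (marks-combine S′ u v) (≢0-test _ h)))))
        where
        edge : u ⟶ v ∈ edges G
        edge = mat-toℕ {n} {edges G} u v (Inv.inE (invariant ω ads) (toℕ u) (toℕ v) h ∘ trans (adjacency≡mat G (toℕ u) (toℕ v)))

    -- Determinism of the machine identifies any execution with the function `stateAfter`.
    executes : ∀ {ω rs S F} → All (Legal G) rs → Execution ⟦ onlineProgram c ⟧ G ω rs S F → S ≡ stateAfter ω rs × Represents F S
    executes legal start = refl , λ u v → (λ e → contradiction e ∉⊥) , λ h → contradiction refl h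
    executes {ω} (le ∷ legal) (round {rs} {S} {F} {r} {t} {S′} before d) = next (executes legal before)
      where
      next : S ≡ stateAfter ω rs × Represents F S → S′ ≡ stateAfter ω (r ∷ rs) × Represents (F ∪ marked G S′) S′
      next (S≡ , rep) = S′≡ , subst (λ X → Represents (F ∪ marked G X) X) (sym S′≡)
          (represents-round {ω} {F = F} (le ∷ legal) (subst (Represents F) S≡ rep))
        where
        S′≡ : S′ ≡ stateAfter ω (r ∷ rs)
        S′≡ = trans (deterministic d (proj₁ (proj₂ (one-round ω r S)))) (cong (λ X → afterRound ω r X) S≡)

-- The competitive ratio

module Ratio (c : ℕ) where

  open Parameters c using (level)

  -- One factor l + 1 comes from the number of draws in an update, the other from the number of
  -- doublings of an edge; 8 + 14 c collects the constants of `late-cost`.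
  ratio : ℕ → ℕ
  ratio n = 4 ^ level n * ((8 + 14 * c) * (suc (level n) * suc (level n)))

  module _ {n : ℕ} (G : Digraph n) where

    open Runs c G hiding (level)

    β≥1 : 1 ≤ β
    β≥1 = m^n>0 4 l

    ratio-≥ : ∀ x → β * x ≤ ratio n * x
    ratio-≥ x = *-monoˡ-≤ x (≤-trans (≤-reflexive (sym (*-identityʳ β))) (*-monoʳ-≤ β (s≤s z≤n)))

    potential-bound : ∀ X W → (∀ u v → W u v < M + M) → potential X W ≤ count n X * (2 + 6 * l)
    potential-bound X W h = ≤-trans (sum²-mono n {Y = λ u v → (2 + 6 * l) * nz (X u v)} λ u v _ _ →
        ≤-trans (*-monoʳ-≤ (nz (X u v)) (≤-trans (⌊log₂⌋-mono-≤ (h u v)) (≤-reflexive log-bound))) (≤-reflexive (*-comm (nz (X u v)) _)))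
      (≤-reflexive (trans (trans (sum-cong n λ u _ → sum-* n (2 + 6 * l) _) (sum-* n (2 + 6 * l) _)) (*-comm (2 + 6 * l) (count n X))))
      where
      log-bound : ⌊log₂ M + M ⌋ ≡ 2 + 6 * l
      log-bound = trans (cong ⌊log₂_⌋ (trans (cong (M +_) (sym (+-identityʳ M))) (cong (λ z → 2 * (2 * z)) (^-*-assoc 2 6 l))))
        (⌊log₂[2^n]⌋≡n (2 + 6 * l))

    -- β ≤ x turns the fixed costs into multiples of β x: the first phase costs β², and the hub
    -- trees cost a multiple of 2 ^ l * 8 ^ l, which is β² again.
    late-cost : ∀ x p → β ≤ x → p ≤ x * (2 + 6 * l) → base + suc K * p ≤ ratio n * x
    late-cost x p β≤x p≤ = begin
      T16 + suc (Q * (n * 2)) + suc K * p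
        ≤⟨ +-mono-≤ (+-mono-≤ squares (+-mono-≤ one hubCost)) (*-mono-≤ (+-monoˡ-≤ K β≥1) (≤-trans p≤ (*-monoʳ-≤ x (≤-trans (m≤m+n (2 + 6 * l) 4) (≤-reflexive (lem₀ l)))))) ⟩
      β * x + (β * x + 2 * (c * y) * (β * x)) + (β + K) * (x * (6 * y))
        ≡⟨ lem₁ β x c y ⟩
      β * (2 + 2 * (c * y) + (1 + 2 * (c * y)) * (6 * y)) * x
        ≤⟨ *-monoˡ-≤ x (*-monoʳ-≤ β (≤-trans (m≤m+n _ (8 * (l * l) + 10 * l + 2 * c * (y * l))) (≤-reflexive (lem₂ c l)))) ⟩
      β * ((8 + 14 * c) * (y * y)) * x ∎
      where
      open ≤-Reasoning
      y = suc l
      squares : T16 ≤ β * x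
      squares = ≤-trans (≤-reflexive T16≡) (*-monoʳ-≤ β β≤x)
      one : 1 ≤ β * x
      one = *-mono-≤ β≥1 (≤-trans β≥1 β≤x)
      16^l : 2 ^ l * 8 ^ l ≡ β * β
      16^l = trans (sym (power-product 2 8 l)) (power-product 4 4 l)
      hubCost : Q * (n * 2) ≤ 2 * (c * y) * (β * x)
      hubCost = begin
        c * y * 2 ^ l * (n * 2)           ≤⟨ *-monoʳ-≤ (c * y * 2 ^ l) (*-monoˡ-≤ 2 (n≤8^level n)) ⟩
        c * y * 2 ^ l * (8 ^ l * 2)       ≡⟨ lem₃ (c * y) (2 ^ l) (8 ^ l) ⟩
        2 * (c * y) * (2 ^ l * 8 ^ l)     ≡⟨ cong (2 * (c * y) *_) 16^l ⟩
        2 * (c * y) * (β * β)             ≤⟨ *-monoʳ-≤ (2 * (c * y)) (*-monoʳ-≤ β β≤x) ⟩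
        2 * (c * y) * (β * x)             ∎
        where
        lem₃ : ∀ a b d → a * b * (d * 2) ≡ 2 * a * (b * d)
        lem₃ = solve-∀
      lem₀ : ∀ l → 2 + 6 * l + 4 ≡ 6 * suc l
      lem₀ = solve-∀
      lem₁ : ∀ β x c y → β * x + (β * x + 2 * (c * y) * (β * x)) + (β + 2 * (c * y * β)) * (x * (6 * y)) ≡
        β * (2 + 2 * (c * y) + (1 + 2 * (c * y)) * (6 * y)) * x
      lem₁ = solve-∀
      lem₂ : ∀ c l → 2 + 2 * (c * suc l) + (1 + 2 * (c * suc l)) * (6 * suc l) + (8 * (l * l) + 10 * l + 2 * c * (suc l * l)) ≡
        (8 + 14 * c) * (suc l * suc l)
      lem₂ = solve-∀

    cost-bound : ∀ {rs S X} → Inv rs S → memory S stuckCell 0 0 ≡ 0 → Competitor rs X →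
      count n (memory S solutionArray) ≤ ratio n * count n X
    cost-bound {rs} {S} {X} I unstuck comp = by-phase (memory S phaseCell 0 0 ≟ 0)
      where
      Z = memory S solutionArray
      x = count n X
      by-phase : Dec (memory S phaseCell 0 0 ≡ 0) → count n Z ≤ ratio n * x
      by-phase (no φ1) = ≤-trans (proj₂ (Inv.late I φ1 X comp) unstuck)
        (late-cost x (potential X (memory S weightArray)) (proj₁ (Inv.late I φ1 X comp)) (potential-bound X (memory S weightArray) (Inv.weights I)))
      by-phase (yes φ0) = ≤-trans (by-size (≤-total β x)) (ratio-≥ x)
        where
        e = Inv.early I φ0
        -- The size is at most β² and at most x², and the smaller of these is at most β x.
        by-size : β ≤ x ⊎ x ≤ β → count n Z ≤ β * x
        by-size (inj₁ h) = ≤-trans (≤-reflexive (proj₁ (proj₂ (proj₂ e)))) (≤-trans (proj₁ (proj₂ (proj₂ (proj₂ e)))) (≤-trans (≤-reflexive T16≡) (*-monoʳ-≤ β h)))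
        by-size (inj₂ h) = ≤-trans (count-pairs n (λ i j z → adjacency-supported i j (proj₁ comp i j z)) (proj₂ (proj₂ (proj₂ (proj₂ e))) X comp)) (*-monoˡ-≤ x h)

    open Execute

    competitive : ∀ ω rs → All (Legal G) rs → memory (stateAfter ω rs) stuckCell 0 0 ≡ 0 →
      Competitive ⟦ onlineProgram c ⟧ G (ratio n) ω rs
    competitive ω rs legal unstuck {S} {F} ex = feasible legal (Inv.solved I) , cheap
      where
      I = invariant ω (all-admissible legal)
      Z = memory (stateAfter ω rs) solutionArray
      rep : Represents F (stateAfter ω rs)
      rep = subst (Represents F) (proj₁ (executes legal ex)) (proj₂ (executes legal ex))
      Z⇒F : ∀ i j → Z i j ≢ 0 → mat n F i j ≢ 0
      Z⇒F i j z = by-fin (adjacency-supported i j (Inv.inE I i j z))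
        where
        by-fin : i < n × j < n → mat n F i j ≢ 0
        by-fin (i<n , j<n) = subst₂ (λ a b → mat n F a b ≢ 0) (toℕ-fromℕ< i<n) (toℕ-fromℕ< j<n)
          (mat-intro {n} {F} (proj₂ (rep (fromℕ< i<n) (fromℕ< j<n)) (subst₂ (λ a b → Z a b ≢ 0) (sym (toℕ-fromℕ< i<n)) (sym (toℕ-fromℕ< j<n)) z)))
      F⇒Z : ∀ i j → mat n F i j ≢ 0 → Z i j ≢ 0
      F⇒Z i j h with mat-elim {n} {F} i j h
      ... | u , v , refl , refl , e = proj₁ (rep u v) e
      feasible : ∀ {rs} → All (Legal G) rs → All (NumSat Z) rs → Feasible uniform F rs
      feasible []              []                   = []
      feasible {r ∷ _} (le ∷ ls) ((k , p , h) ∷ ps) with path⇒walk {n} {F} refl (path-map Z⇒F p) | nonnegative {r} le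
      ... | t , t≡ , q , len | m , eq with toℕ-injective t≡
      ...   | refl = (q , steps⇒short {n} {F} q (bound r) m eq
                        (≤-trans (≤-reflexive (cong (_* den r) len)) (≤-trans h (≤-reflexive (cong abs eq))))) ∷ feasible ls ps
      cheap : ∀ opt → IsOPT uniform G rs opt → ∣ F ∣ ≤ ratio n * opt
      cheap opt isOPT with IsOPT.attained isOPT
      ... | F* , sub , feas , refl = begin
        ∣ F ∣                              ≡⟨ card≡count {n} F ⟩
        count n (mat n F)                  ≤⟨ count-mono n {mat n F} {Z} F⇒Z ⟩
        count n Z                          ≤⟨ cost-bound I unstuck (competitor sub feas) ⟩
        ratio n * count n (mat n F*)       ≡⟨ cong (ratio n *_) (sym (card≡count {n} F*)) ⟩
        ratio n * ∣ F* ∣                   ∎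
        where open ≤-Reasoning

-- Success with high probability

module Success (κ : ℕ) {n : ℕ} (G : Digraph n) (1≤n : 1 ≤ n) where

  open Supermartingale κ G 1≤n using (c; M; K; b; T∞; 1≤M; Φ₀; Θ; wt; gain-H; risk; risk-stuck; round-risk)
  open Runs c G using (afterRound; stateAfter; coinsFor; invariant; stateAfter-cong; tossed-after; stuck-mono; Admissible; all-admissible)
  open Ratio c

  -- The tower rule: the coins of the last round are summed over with the earlier ones held fixed.
  total-risk : ∀ {rs} → All Admissible rs → sumV (coinsFor rs) (λ v → risk (stateAfter (ext v) rs)) ≤ 2 ^ coinsFor rs * Φ₀
  total-risk []                 = ≤-reflexive (sym (+-identityʳ Φ₀))
  total-risk {r ∷ rs} (a ∷ as) = begin
    sumV (R + K * b) (λ v → risk (stateAfter (ext v) (r ∷ rs)))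
      ≡⟨ sumV-++ R (K * b) _ ⟩
    sumV R (λ v → sumV (K * b) (λ w → risk (stateAfter (ext (v ++ᵛ w)) (r ∷ rs))))
      ≡⟨ sumV-cong R (λ v → sumV-cong (K * b) λ w → cong (λ S → risk (afterRound (ext (v ++ᵛ w)) r S)) (stateAfter-cong as (ext-++ˡ v w))) ⟩
    sumV R (λ v → sumV (K * b) (λ w → risk (afterRound (ext (v ++ᵛ w)) r (stateAfter (ext v) rs))))
      ≤⟨ sumV-mono R (λ v → round-risk v (tossed-after (ext v) as) a (invariant (ext v) as)) ⟩
    sumV R (λ v → 2 ^ (K * b) * risk (stateAfter (ext v) rs))
      ≡⟨ sumV-* R (2 ^ (K * b)) _ ⟩
    2 ^ (K * b) * sumV R (λ v → risk (stateAfter (ext v) rs))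
      ≤⟨ *-monoʳ-≤ (2 ^ (K * b)) (total-risk as) ⟩
    2 ^ (K * b) * (2 ^ R * Φ₀)
      ≡⟨ trans (sym (*-assoc (2 ^ (K * b)) (2 ^ R) Φ₀)) (cong (_* Φ₀) (trans (*-comm (2 ^ (K * b)) (2 ^ R)) (sym (^-distribˡ-+-* 2 R (K * b))))) ⟩
    2 ^ (R + K * b) * Φ₀ ∎
    where
    open ≤-Reasoning
    R = coinsFor rs

  failed : List (Request n) → Coins → Bool
  failed rs ω = not (memory (stateAfter ω rs) stuckCell 0 0 ≡ᵇ 0)

  failed-false : ∀ x → not (x ≡ᵇ 0) ≡ false → x ≡ 0
  failed-false zero _ = refl

  failed-risk : ∀ S → bit (not (memory S stuckCell 0 0 ≡ᵇ 0)) * Θ ≤ risk S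
  failed-risk S = by-value (memory S stuckCell 0 0) refl
    where
    by-value : ∀ x → memory S stuckCell 0 0 ≡ x → bit (not (x ≡ᵇ 0)) * Θ ≤ risk S
    by-value zero    _  = z≤n
    by-value (suc _) eq = ≤-reflexive (trans (+-identityʳ Θ) (sym (risk-stuck S λ z → contradiction (trans (sym eq) z) λ ())))

  1≤wt : 1 ≤ wt M
  1≤wt = positive-power K (*-mono-≤ (positive-power M (s≤s z≤n)) (positive-power (T∞ ∸ M) 1≤M))
    where
    positive-power : ∀ {x} k → 1 ≤ x → 1 ≤ x ^ k
    positive-power zero    h = ≤-refl
    positive-power (suc k) h = *-mono-≤ h (positive-power k h)

  -- Markov's inequality: a failing outcome has risk 2 n ^ κ times `wt M`, whereas the average is at
  -- most `Φ₀`, that is, at most 2 times `wt M`.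
  rarely-fails : ∀ {rs} → All Admissible rs → length (select-outcomes (coinsFor rs) (failed rs ∘ ext)) * n ^ κ ≤ 2 ^ coinsFor rs
  rarely-fails {rs} as = *-cancelʳ-≤ (len * n ^ κ) (2 ^ R) (2 * wt M) {{>-nonZero (*-mono-≤ (s≤s (z≤n {1})) 1≤wt)}} (begin
    len * n ^ κ * (2 * wt M)                               ≡⟨ lem len (n ^ κ) (wt M) ⟩
    Θ * len                                                ≡⟨ cong (Θ *_) (length-select R (failed rs ∘ ext)) ⟩
    Θ * sumV R (λ v → bit (failed rs (ext v)))             ≡⟨ sym (sumV-* R Θ _) ⟩
    sumV R (λ v → Θ * bit (failed rs (ext v)))             ≤⟨ sumV-mono R (λ v → ≤-trans (≤-reflexive (*-comm Θ _)) (failed-risk (stateAfter (ext v) rs))) ⟩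
    sumV R (λ v → risk (stateAfter (ext v) rs))            ≤⟨ total-risk as ⟩
    2 ^ R * Φ₀                                             ≤⟨ *-monoʳ-≤ (2 ^ R) (+-monoˡ-≤ (wt M) gain-H) ⟩
    2 ^ R * (wt M + wt M)                                  ≡⟨ cong (2 ^ R *_) (cong (wt M +_) (sym (+-identityʳ (wt M)))) ⟩
    2 ^ R * (2 * wt M)                                     ∎)
    where
    open ≤-Reasoning
    R = coinsFor rs
    len = length (select-outcomes R (failed rs ∘ ext))
    lem : ∀ a p w → a * p * (2 * w) ≡ 2 * p * w * a
    lem = solve-∀

  -- A flag that is down at the end was down at every earlier time.
  all-tails : ∀ ω rs → All (Legal G) rs → memory (stateAfter ω rs) stuckCell 0 0 ≡ 0 →
    All (Competitive ⟦ onlineProgram c ⟧ G (ratio n) ω) (tails rs)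
  all-tails ω []       []          z = competitive G ω [] [] z ∷ []
  all-tails ω (r ∷ rs) (le ∷ legal) z = competitive G ω (r ∷ rs) (le ∷ legal) z ∷ all-tails ω rs legal (stuck-mono ω (all-admissible (le ∷ legal)) z)

  succeeds : ∀ rs → All (Legal G) rs → FailureProbability≤1/ (n ^ κ) λ ω → All (Competitive ⟦ onlineProgram c ⟧ G (ratio n) ω) (tails rs)
  succeeds rs legal = R , select-outcomes R (failed rs ∘ ext) , rarely-fails ads , good
    where
    R = coinsFor rs
    ads = all-admissible legal
    good : ∀ ω → tabulate (λ i → ω (toℕ i)) ∉ᴸ select-outcomes R (failed rs ∘ ext) →
      All (Competitive ⟦ onlineProgram c ⟧ G (ratio n) ω) (tails rs)
    good ω ∉bad = all-tails ω rs legal (failed-false _ (trans (cong (λ S → not (memory S stuckCell 0 0 ≡ᵇ 0)) (sym same)) (not-failed _ refl)))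
      where
      v = tabulate {n = R} (λ i → ω (toℕ i))
      same : stateAfter (ext v) rs ≡ stateAfter ω rs
      same = stateAfter-cong ads (ext-tabulate R ω)
      not-failed : ∀ x → failed rs (ext v) ≡ x → x ≡ false
      not-failed false _ = refl
      not-failed true  e = contradiction (select-∈ R (failed rs ∘ ext) v e) ∉bad

competitiveRatio : ∀ κ → CompetitiveRatio κ ⟦ onlineProgram (10 + 3 * κ) ⟧ (Ratio.ratio (10 + 3 * κ))
-- Without vertices no request can arrive, and the inequalities behind `Success` start at n ≥ 1.
competitiveRatio κ {zero}  G []      []    = 0 , [] , z≤n , λ _ _ → (λ { start → [] , λ _ _ → z≤n }) ∷ []
competitiveRatio κ {zero}  G (record { source = () } ∷ _) _
competitiveRatio κ {suc n} G rs      legal = Success.succeeds κ G (s≤s z≤n) rs legal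

-- Running time

module Time (c : ℕ) where

  open Parameters c
  open Ratio c using (ratio)

  8^level≤ : ∀ n → 8 ^ level n ≤ 8 * suc n
  8^level≤ n = by-cases (level n) (levelIn-small n n)
    where
    by-cases : ∀ l → l ≡ 0 ⊎ 8 ^ (l ∸ 1) < n → 8 ^ l ≤ 8 * suc n
    by-cases zero    _         = s≤s z≤n
    by-cases (suc l) (inj₂ lt) = *-monoʳ-≤ 8 (≤-trans (<⇒≤ lt) (n≤1+n n))

  k≤8^k : ∀ k → k ≤ 8 ^ k
  k≤8^k zero    = z≤n
  k≤8^k (suc k) = ≤-trans (+-mono-≤ (m^n>0 8 k) (k≤8^k k)) (+-monoʳ-≤ (8 ^ k) (m≤m+n (8 ^ k) _))

  -- Bounds the four cells that govern the loops of `main`: n, n - 1, the number of draws and the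
  -- number of coins per draw.
  limit : ℕ → ℕ
  limit n = n + (value n (level n) 2 + value n (level n) 3)

  poly-limit : Poly limit
  poly-limit = poly-+ poly-id (poly-+
    (poly-mono (λ n → *-monoʳ-≤ 2 (*-mono-≤ (*-monoʳ-≤ c (s≤s (≤-trans (k≤8^k (level n)) (8^level≤ n)))) (≤-trans (^-monoˡ-≤ (level n) (m≤m+n 4 4)) (8^level≤ n))))
      (poly-* (poly-const 2) (poly-* (poly-* (poly-const c) (poly-+ (poly-const 1) (poly-* (poly-const 8) (poly-+ (poly-const 1) poly-id)))) (poly-* (poly-const 8) (poly-+ (poly-const 1) poly-id)))))
    (poly-mono (λ n → s≤s (*-monoʳ-≤ 6 (≤-trans (k≤8^k (level n)) (8^level≤ n))))
      (poly-+ (poly-const 1) (poly-* (poly-const 6) (poly-* (poly-const 8) (poly-+ (poly-const 1) poly-id))))))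

  steps≤ : ℕ → ℕ
  steps≤ n = size (block (parameters c)) n + size main (limit n)

  poly-steps : Poly steps≤
  poly-steps = poly-+ (poly-size (block (parameters c))) (poly-∘ (poly-size main) poly-limit)

  polynomialTime : PolynomialTime ⟦ onlineProgram c ⟧
  polynomialTime = in-input poly-steps
    where
    in-input : Poly steps≤ → PolynomialTime ⟦ onlineProgram c ⟧
    in-input (C , e , p) = C * 2 ^ e , e , λ {n} G ω r rs {S} {F} legal ex → bounded-run {n} G ω r rs {S} {F} legal ex
      where
      bounded-run : ∀ {n} (G : Digraph n) (ω : Coins) (r : Request n) rs {S F} → All (Legal G) (r ∷ rs) → Execution ⟦ onlineProgram c ⟧ G ω rs S F →
        ∃[ t ] ∃[ S′ ] (ω ⊢⟨ ⟦ onlineProgram c ⟧ , receive r S ⟩⇓[ t ] S′) × t ≤ C * 2 ^ e * inputSize n (r ∷ rs) ^ e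
      bounded-run {n} G ω r rs {S} {F} (le ∷ legal) ex = proj₁ run′ , afterRound ω r S , proj₁ (proj₂ run′) ,
        ≤-trans (proj₂ (proj₂ run′) n (limit n) order-bounded par-bounded)
          (≤-trans (p n) (≤-trans (*-monoʳ-≤ C (^-monoˡ-≤ e n≤)) (≤-reflexive (trans (cong (C *_) (power-product 2 (inputSize n (r ∷ rs)) e)) (sym (*-assoc C (2 ^ e) _))))))
        where
        open Runs c G using (afterRound; start′; invariant; all-admissible; stateAfter; l; module Inv; module Execute)
        open Execute
        run′ = one-round ω r S
        I = invariant ω (all-admissible legal)
        S≡ : S ≡ stateAfter ω rs
        S≡ = proj₁ (executes legal ex)
        order : memory S orderArray 0 0 ≡ n
        order = trans (cong (λ X → memory X orderArray 0 0) S≡) (Inv.order I)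
        order-bounded : Bounded orderArray 1 n (receive r S)
        order-bounded zero    _        = ≤-reflexive order
        order-bounded (suc _) (s≤s ())
        given : HasParameters n l (start′ ω r S)
        given = block-spec ω (parameters c) (receive r S) (HasParameters n l) (parameters-spec ω n (receive r S) order)
        par-bounded : Bounded parArray 4 (limit n) (start′ ω r S)
        par-bounded 0 _ = ≤-trans (≤-reflexive (given 0 refl)) (m≤m+n n _)
        par-bounded 1 _ = ≤-trans (≤-reflexive (given 1 refl)) (≤-trans (m∸n≤m n 1) (m≤m+n n _))
        par-bounded 2 _ = ≤-trans (≤-reflexive (given 2 refl)) (≤-trans (m≤m+n _ _) (m≤n+m _ n))
        par-bounded 3 _ = ≤-trans (≤-reflexive (given 3 refl)) (≤-trans (m≤n+m _ (value n (level n) 2)) (m≤n+m _ n))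
        par-bounded (suc (suc (suc (suc _)))) (s≤s (s≤s (s≤s (s≤s ()))))
        1≤n : 1 ≤ n
        1≤n = ≤-trans (s≤s z≤n) (toℕ<n (source r))
        -- A request has a vertex as its source, so n ≥ 1 and n + 1 ≤ 2 n², where n² is the part of
        -- the input size due to the graph.
        n≤ : suc n ≤ 2 * inputSize n (r ∷ rs)
        n≤ = ≤-trans (+-mono-≤ (*-mono-≤ 1≤n 1≤n) (≤-trans (≤-reflexive (sym (*-identityʳ n))) (*-monoʳ-≤ n 1≤n)))
          (≤-trans (≤-reflexive (cong (n * n +_) (sym (+-identityʳ (n * n))))) (*-monoʳ-≤ 2 (m≤m+n (n * n) _)))

  level≤ : ∀ n → 1 ≤ n → level n ≤ suc ⌈log₂ n ⌉
  level≤ n 1≤n = by-cases (level n) (levelIn-small n n)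
    where
    by-cases : ∀ l → l ≡ 0 ⊎ 8 ^ (l ∸ 1) < n → l ≤ suc ⌈log₂ n ⌉
    by-cases zero    _         = z≤n
    by-cases (suc l) (inj₂ lt) = s≤s (≤-trans (≤-reflexive (sym (⌈log₂2^n⌉≡n l)))
      (⌈log₂⌉-mono-≤ (≤-trans (^-monoˡ-≤ l (s≤s (s≤s (z≤n {6})))) (<⇒≤ lt))))

  8^level≤8n : ∀ n → 1 ≤ n → 8 ^ level n ≤ 8 * n
  8^level≤8n n 1≤n = by-cases (level n) (levelIn-small n n)
    where
    by-cases : ∀ l → l ≡ 0 ⊎ 8 ^ (l ∸ 1) < n → 8 ^ l ≤ 8 * n
    by-cases zero    _         = *-mono-≤ (s≤s (z≤n {7})) 1≤n
    by-cases (suc l) (inj₂ lt) = *-monoʳ-≤ 8 (<⇒≤ lt)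

  -- The cube of 4 ^ l is the square of 8 ^ l, which is at most 8 n. From n = 2 on the logarithm is
  -- at least 1 and absorbs additive constants.
  ratio-Õ : ratio ∈Õ[n^ 2 / 3 ]
  ratio-Õ = 4 * (D * 9) , 2 , 2 , bound′′
    where
    D = 8 + 14 * c
    bound′′ : ∀ n → 2 ≤ n → ratio n ^ 3 ≤ (4 * (D * 9) * ⌈log₂ n ⌉ ^ 2) ^ 3 * n ^ 2
    bound′′ n 2≤n = begin
      (4 ^ l * (D * (suc l * suc l))) ^ 3       ≡⟨ power-product (4 ^ l) (D * (suc l * suc l)) 3 ⟩
      (4 ^ l) ^ 3 * (D * (suc l * suc l)) ^ 3   ≤⟨ *-mono-≤ cube (^-monoˡ-≤ 3 (*-monoʳ-≤ D (*-mono-≤ small small))) ⟩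
      4 ^ 3 * n ^ 2 * (D * (3 * g * (3 * g))) ^ 3
        ≡⟨ regroup 4 (n ^ 2) (D * (3 * g * (3 * g))) ⟩
      (4 * (D * (3 * g * (3 * g)))) ^ 3 * n ^ 2 ≡⟨ cong (λ z → z ^ 3 * n ^ 2) (lem D g) ⟩
      (4 * (D * 9) * g ^ 2) ^ 3 * n ^ 2         ∎
      where
      open ≤-Reasoning
      l = level n
      g = ⌈log₂ n ⌉
      1≤g : 1 ≤ g
      1≤g = ≤-trans (≤-reflexive (sym (⌈log₂2^n⌉≡n 1))) (⌈log₂⌉-mono-≤ 2≤n)
      small : suc l ≤ 3 * g
      small = ≤-trans (s≤s (level≤ n (<⇒≤ 2≤n))) (≤-trans (+-mono-≤ 1≤g (+-mono-≤ 1≤g ≤-refl)) (≤-reflexive (lem₀ g)))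
        where
        lem₀ : ∀ g → g + (g + g) ≡ 3 * g
        lem₀ = solve-∀
      regroup : ∀ a N m → a ^ 3 * N * m ^ 3 ≡ (a * m) ^ 3 * N
      regroup a N m = trans (*-assoc (a ^ 3) N (m ^ 3)) (trans (cong (a ^ 3 *_) (*-comm N (m ^ 3)))
        (trans (sym (*-assoc (a ^ 3) (m ^ 3) N)) (cong (_* N) (sym (power-product a m 3)))))
      cube : (4 ^ l) ^ 3 ≤ 4 ^ 3 * n ^ 2
      cube = begin
        (4 ^ l) ^ 3        ≡⟨ trans (^-*-assoc 4 l 3) (trans (cong (4 ^_) (*-comm l 3)) (sym (^-*-assoc 4 3 l))) ⟩
        64 ^ l             ≡⟨ power-product 8 8 l ⟩
        8 ^ l * 8 ^ l      ≤⟨ *-mono-≤ (8^level≤8n n (<⇒≤ 2≤n)) (8^level≤8n n (<⇒≤ 2≤n)) ⟩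
        8 * n * (8 * n)    ≡⟨ trans ([m*n]*[o*p]≡[m*o]*[n*p] 8 n 8 n) (cong (λ z → 64 * (n * z)) (sym (*-identityʳ n))) ⟩
        64 * n ^ 2         ∎
      lem : ∀ D g → 4 * (D * (3 * g * (3 * g))) ≡ 4 * (D * 9) * (g * (g * 1))
      lem = solve-∀

-- The exponent κ of the failure probability enters the program only through the constant that
-- scales the numbers of draws and of hubs.
theorem4 : (κ : ℕ) → ∃[ P ] ∃[ c ] PolynomialTime P × CompetitiveRatio κ P c × c ∈Õ[n^ 2 / 3 ]
theorem4 κ = ⟦ onlineProgram c ⟧ , Ratio.ratio c , Time.polynomialTime c , competitiveRatio κ , Time.ratio-Õ c
  where
  c = 10 + 3 * κ
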